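{- Let $\beta(n,d)=\dim_{\mathbb{Z}_3}\tilde H_d(\mathsf{M}_n;\mathbb{Z}_3)$. Then $\beta(3,0)=2$, $\beta(6,1)=16$, $\beta(9,2)=50$, $\beta(12,3)=56$, and \[\beta(3r+3,r)\le\frac{6r^3+9r^2+5r}{2}-73\quad\text{for all } r\ge 4.\]
   Context: $\mathsf{M}_n$ is the matching complex of the complete graph on $[n]=\{1,\dots,n\}$ (vertices: edges; faces: matchings). $\tilde H$ denotes reduced simplicial homology. -}

module Defs where

open import Data.Nat as ℕ using (ℕ; zero; suc)
open import Data.Nat.DivMod using (_mod_)
open import Data.Fin as Fin using (Fin; toℕ)
open import Data.Fin.Permutation.Components as PC using ()
open import Data.Product using (Σ; _×_; _,_)
open import Data.List using (List; foldr; map; allFin)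
open import Data.Vec using (Vec; lookup; tabulate; _∷_)
open import Relation.Nullary using (¬_)
open import Relation.Binary.PropositionalEquality using (_≡_; _≢_)

F3 : Set
F3 = Fin 3

0₃ : F3
0₃ = Fin.zero

_+₃_ : F3 → F3 → F3
a +₃ b = (toℕ a ℕ.+ toℕ b) mod 3

_*₃_ : F3 → F3 → F3
a *₃ b = (toℕ a ℕ.* toℕ b) mod 3

-₃_ : F3 → F3
-₃ a = (3 ℕ.∸ toℕ a) mod 3

sumFin : (k : ℕ) → (Fin k → F3) → F3
sumFin k f = foldr _+₃_ 0₃ (map f (allFin k))

-- The matching complex M_n of K_n
-- Vertices of M_n are edges {i,j} of K_n, encoded as pairs (i , j) with i < j.

Pair : ℕ → Set
Pair n = Fin n × Fin n

IsEdge : ∀ {n} → Pair n → Set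
IsEdge (i , j) = i Fin.< j

Disjoint : ∀ {n} → Pair n → Pair n → Set
Disjoint (a , b) (c , d) = (a ≢ c) × (a ≢ d) × (b ≢ c) × (b ≢ d)

IsMatching : ∀ {n m} → Vec (Pair n) m → Set
IsMatching {m = m} τ =
  (∀ (p : Fin m) → IsEdge (lookup τ p)) ×
  (∀ (p q : Fin m) → p ≢ q → Disjoint (lookup τ p) (lookup τ q))

swapAt : ∀ {A : Set} {m} → Vec A m → Fin m → Fin m → Vec A m
swapAt τ p q = tabulate (λ i → lookup τ (PC.transpose p q i))

-- Simplicial chains of M_n over Z_3.
-- A chain with m vertices per simplex (i.e. of dimension m - 1) is an
-- alternating function on ordered m-tuples of vertices, supported on faces.
-- (Over Z_3, char ≠ 2, these form exactly the oriented chain group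
-- C_{m-1}(M_n; Z_3); m = 0 gives the augmentation term C_{-1} = Z_3.)

Chain : ℕ → ℕ → Set
Chain n m = Vec (Pair n) m → F3

IsChain : ∀ {n m} → Chain n m → Set
IsChain {n} {m} c =
  (∀ (τ : Vec (Pair n) m) → ¬ IsMatching τ → c τ ≡ 0₃) ×
  (∀ (τ : Vec (Pair n) m) (p q : Fin m) → p ≢ q → c (swapAt τ p q) ≡ -₃ (c τ))

-- simplicial boundary (for m = 0 it is the augmentation map):
-- (∂ c)(w₀,…,w_{m-1}) = Σ_v c(v,w₀,…,w_{m-1})
∂ : ∀ {n m} → Chain n (suc m) → Chain n m
∂ {n} c τ = sumFin n (λ i → sumFin n (λ j → c ((i , j) ∷ τ)))

_≈_ : ∀ {n m} → Chain n m → Chain n m → Set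
c ≈ c' = ∀ τ → c τ ≡ c' τ

zeroC : ∀ {n m} → Chain n m
zeroC _ = 0₃

_+C_ : ∀ {n m} → Chain n m → Chain n m → Chain n m
(c +C c') τ = c τ +₃ c' τ

lincomb : ∀ {n m k} → (Fin k → F3) → (Fin k → Chain n m) → Chain n m
lincomb {k = k} a z τ = sumFin k (λ i → a i *₃ z i τ)

-- HasBetti n d k :  dim_{Z_3} H̃_d(M_n ; Z_3) = k,
-- i.e. there are k reduced d-cycles whose classes form a basis of
-- H̃_d = ker ∂_d / im ∂_{d+1}  (d-simplices have d+1 vertices).

HasBetti : ℕ → ℕ → ℕ → Set
HasBetti n d k =
  Σ (Fin k → Chain n (suc d)) λ z →
    (∀ i → IsChain (z i) × (∂ (z i) ≈ zeroC)) ×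
    (∀ (a : Fin k → F3) →
       Σ (Chain n (suc (suc d))) (λ b → IsChain b × (lincomb a z ≈ ∂ b)) →
       ∀ i → a i ≡ 0₃) ×
    (∀ (c : Chain n (suc d)) → IsChain c → ∂ c ≈ zeroC →
       Σ (Fin k → F3) λ a → Σ (Chain n (suc (suc d))) λ b →
         IsChain b × (c ≈ (lincomb a z +C ∂ b)))

{-# OPTIONS --safe #-}
module Submission where

-- A cycle of M_n can be pushed off a vertex v as soon as its links at the edges
-- va bound. For n ≥ 3m + 2 this kills H_{m-1}(M_n), and for n ≥ 3m it shows that
-- H_{m-1}(M_n) is generated by the stars (ua − uv) ∧ y with y a cycle on the
-- remaining vertices. For n = 3m + 1 all of these are multiples of one class.
--
-- For n = 3m write (ua − uv) ∧ y either as a triangle (uv + ua + va) ∧ y, where y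
-- lives on 3m − 2 vertices and so matters only up to a scalar, or move a to a
-- fixed vertex e. The obstruction to the latter is, for each a, the family of
-- links of y at the edges ec, each again a multiple of one class. Hence
--   β(3r+3, r) ≤ β(3r, r−1) + (3r+1) + 3r(3r−1),
-- which from β(12, 3) = 56 gives the cubic bound.
--
-- In the four exact cases a formal calculus of chains checks that the generators
-- reduce to the stated number (for n = 12 after relating the lifts over the
-- four-cycles a, b, c, d), and explicit cocycles, pulled back along relabellings
-- or along links of edges, separate the classes of the remaining ones.

import Data.Fin.Permutation.Components as PC
import Data.List.Membership.Propositional as Membership
import Data.List.Relation.Unary.Unique.Propositional.Properties as Uniqueₚ
import Data.Nat.Properties as ℕₚ
import Data.Vec.Properties as Vecₚ
import Defs
open import Data.Bool using (Bool; true; false; if_then_else_; not; T) renaming (_∧_ to _&&_)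
open import Data.Empty using (⊥; ⊥-elim)
open import Data.Fin as Fin using (Fin; toℕ)
open import Data.Fin.Properties as Finₚ using (all?)
open import Data.List as List using (List; []; _∷_; _++_; map; length; foldr; allFin; tabulate; filter)
open import Data.List.Membership.DecPropositional using () renaming (_∈?_ to mem?)
open import Data.List.Membership.Propositional using (_∈_; _∉_)
open import Data.List.Membership.Propositional.Properties as Listₘ
  using (∈-++⁻; ∈-++⁺ˡ; ∈-++⁺ʳ; ∈-map⁺; ∈-map⁻; ∈-lookup; ∈-allFin; ∈-filter⁺; ∈-filter⁻)
open import Data.List.Properties as Listₚ using (map-tabulate)
open import Data.List.Relation.Unary.All as All using (All; []; _∷_)
open import Data.List.Relation.Unary.All.Properties using (++⁺)
open import Data.List.Relation.Unary.AllPairs as AllPairs using (AllPairs; []; _∷_)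
open import Data.List.Relation.Unary.Any as Any using (here; there)
open import Data.List.Relation.Unary.Any.Properties using (lookup-index)
open import Data.List.Relation.Unary.Unique.Propositional using (Unique)
open import Data.Maybe using (Maybe; just; nothing)
open import Data.Nat as ℕ using (ℕ; zero; suc; _≤_; z≤n; s≤s; _<ᵇ_; _≡ᵇ_)
open import Data.Nat.DivMod using (_/_; _%_)
open import Data.Nat.Tactic.RingSolver using (solve-∀)
open import Data.Product using (Σ; ∃; _×_; _,_; proj₁; proj₂; map₂)
open import Data.Product.Properties using (≡-dec)
open import Data.Sum using (_⊎_; inj₁; inj₂; [_,_]′)
open import Data.Unit using (⊤; tt)
open import Data.Vec as Vec using (Vec; []; _∷_)
open import Defs using (F3; 0₃; Pair; Chain; _≈_; zeroC; IsEdge; IsMatching; Disjoint; IsChain; swapAt; _+₃_; _*₃_; -₃_; sumFin; lincomb; HasBetti)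
open import Function using (_∘_; id; _$_)
open import Relation.Binary.Definitions using (DecidableEquality)
open import Relation.Binary.PropositionalEquality hiding (resp)
open import Relation.Nullary using (¬_; Dec; yes; no; does)
open import Relation.Nullary.Decidable using (¬?; from-yes; dec-true; dec-false; _×-dec_; _→-dec_; map′)

-- Characteristic 3 enters in two ways. The triangle uv + ua + va is a reduced cycle because its
-- augmentation is 3, and 2uv = -uv turns a star at v into that triangle minus a star at u. The
-- obstacle is that 3m vertices are one too few for moving the apex of a star freely, so whatever
-- cannot be moved has to be counted. For n = 12 the number 56 arises as 10 + 17 + 29: ten
-- triangles; 17 of the 72 lifts, since the relations over four-cycles complete rectangles in a
-- bipartite graph on 9 + 9 vertices and leave a spanning tree; and 29 of the 50 classes on nine
-- vertices, because the basis there contains 21 triangle products, which die under a further star.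
-- The polynomial (6r³ + 9r² + 5r)/2 solves the recursion with value 0 at r = 0. Its value at r = 3
-- is 129, and 73 = 129 - 56 is what the exact value at n = 12 gains. For r ≥ 4 a Betti number has
-- to be exhibited, not only bounded, so a basis is extracted from the spanning family by a finite
-- search for linear dependencies.

pattern #0 = Fin.zero
pattern #1 = Fin.suc Fin.zero
pattern #2 = Fin.suc (Fin.suc Fin.zero)

-- Arithmetic of the field with three elements

infixl 6 _+_
infix 8 -_

-- Sealed, so that sums remain symbols during type checking instead of unfolding to computations
-- modulo 3. Everything that depends on their definition asks for it by an `unfolding` clause.
opaque
  _+_ : F3 → F3 → F3
  _+_ = _+₃_

  -_ : F3 → F3
  -_ = -₃_

  sum : (k : ℕ) → (Fin k → F3) → F3
  sum = sumFin

  sumP : (n : ℕ) → (Pair n → F3) → F3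
  sumP n f = sum n λ i → sum n λ j → f (i , j)

_≟₃_ : DecidableEquality F3
_≟₃_ = Finₚ._≟_

opaque
  unfolding _+_ -_

  +-comm : ∀ a b → a + b ≡ b + a
  +-comm = from-yes (all? λ a → all? λ b → (a + b) ≟₃ (b + a))

  +-assoc : ∀ a b c → (a + b) + c ≡ a + (b + c)
  +-assoc = from-yes (all? λ a → all? λ b → all? λ c → ((a + b) + c) ≟₃ (a + (b + c)))

  +-identityˡ : ∀ a → 0₃ + a ≡ a
  +-identityˡ = from-yes (all? λ a → (0₃ + a) ≟₃ a)

  neg-inverseʳ : ∀ a → a + (- a) ≡ 0₃
  neg-inverseʳ = from-yes (all? λ a → (a + (- a)) ≟₃ 0₃)

  neg-distrib : ∀ a b → - (a + b) ≡ (- a) + (- b)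
  neg-distrib = from-yes (all? λ a → all? λ b → (- (a + b)) ≟₃ ((- a) + (- b)))

  neg-involutive : ∀ a → - (- a) ≡ a
  neg-involutive = from-yes (all? λ a → (- (- a)) ≟₃ a)

  neg-0 : - 0₃ ≡ 0₃
  neg-0 = refl

  double : ∀ a → a + a ≡ - a
  double = from-yes (all? λ a → (a + a) ≟₃ (- a))

  a≡-a⇒0 : ∀ a → a ≡ - a → a ≡ 0₃
  a≡-a⇒0 #0 _ = refl
  a≡-a⇒0 #1 ()
  a≡-a⇒0 #2 ()

+-identityʳ : ∀ a → a + 0₃ ≡ a
+-identityʳ a = trans (+-comm a 0₃) (+-identityˡ a)

neg-inverseˡ : ∀ a → (- a) + a ≡ 0₃
neg-inverseˡ a = trans (+-comm (- a) a) (neg-inverseʳ a)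

+-interchange : ∀ a b c d → (a + b) + (c + d) ≡ (a + c) + (b + d)
+-interchange a b c d = begin
  (a + b) + (c + d) ≡⟨ +-assoc a b (c + d) ⟩
  a + (b + (c + d)) ≡⟨ cong (a +_) (+-assoc b c d) ⟨
  a + ((b + c) + d) ≡⟨ cong (λ x → a + (x + d)) (+-comm b c) ⟩
  a + ((c + b) + d) ≡⟨ cong (a +_) (+-assoc c b d) ⟩
  a + (c + (b + d)) ≡⟨ +-assoc a c (b + d) ⟨
  (a + c) + (b + d) ∎ where open ≡-Reasoning

-- A normaliser for linear identities over ℤ/3

data Expr (k : ℕ) : Set where
  var  : Fin k → Expr k
  :0   : Expr k
  _:+_ : Expr k → Expr k → Expr k
  :-_  : Expr k → Expr k

infixl 6 _:+_
infix 8 :-_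

-- A transparent counterpart of the sealed addition: the coefficients of normal forms and
-- certificates have to compute.
plus : F3 → F3 → F3
plus #0 b = b
plus a #0 = a
plus #1 #1 = #2
plus #1 #2 = #0
plus #2 #1 = #0
plus #2 #2 = #1

negate : F3 → F3
negate #0 = #0
negate #1 = #2
negate #2 = #1

infixr 7 _·_
_·_ : F3 → F3 → F3
#0 · x = 0₃
#1 · x = x
#2 · x = - x

·-plus : ∀ a b x → plus a b · x ≡ a · x + b · x
·-plus #0 b x = sym (+-identityˡ _)
·-plus #1 #0 x = sym (+-identityʳ _)
·-plus #1 #1 x = sym (double x)
·-plus #1 #2 x = sym (neg-inverseʳ x)
·-plus #2 #0 x = sym (+-identityʳ _)
·-plus #2 #1 x = sym (neg-inverseˡ x)
·-plus #2 #2 x = trans (sym (neg-involutive x)) (trans (cong -_ (sym (double x))) (neg-distrib x x))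

·-negate : ∀ a x → negate a · x ≡ - (a · x)
·-negate #0 x = sym neg-0
·-negate #1 x = refl
·-negate #2 x = sym (neg-involutive x)

eval : ∀ {k} → Expr k → Vec F3 k → F3
eval (var i) ρ = Vec.lookup ρ i
eval :0 ρ = 0₃
eval (e :+ f) ρ = eval e ρ + eval f ρ
eval (:- e) ρ = - eval e ρ

norm : ∀ {k} → Expr k → Vec F3 k
norm (var i) = Vec.tabulate λ j → if does (i Finₚ.≟ j) then #1 else #0
norm :0 = Vec.replicate _ #0
norm (e :+ f) = Vec.zipWith plus (norm e) (norm f)
norm (:- e) = Vec.map negate (norm e)

dot : ∀ {k} → Vec F3 k → Vec F3 k → F3
dot [] [] = 0₃
dot (#0 ∷ cs) (x ∷ ρ) = dot cs ρ
dot (c ∷ cs) (x ∷ ρ) = c · x + dot cs ρ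

dot-∷ : ∀ {k} c x (cs ρ : Vec F3 k) → dot (c ∷ cs) (x ∷ ρ) ≡ c · x + dot cs ρ
dot-∷ #0 x cs ρ = sym (+-identityˡ _)
dot-∷ #1 x cs ρ = refl
dot-∷ #2 x cs ρ = refl

dot-zero : ∀ {k} (ρ : Vec F3 k) → dot (Vec.replicate k #0) ρ ≡ 0₃
dot-zero [] = refl
dot-zero (x ∷ ρ) = dot-zero ρ

dot-const : ∀ {k} (f : Fin k → F3) (ρ : Vec F3 k) → (∀ j → f j ≡ #0) → dot (Vec.tabulate f) ρ ≡ 0₃
dot-const f [] h = refl
dot-const f (x ∷ ρ) h rewrite h #0 = dot-const (f ∘ Fin.suc) ρ (h ∘ Fin.suc)

dot-unit : ∀ {k} (i : Fin k) ρ → dot (norm (var i)) ρ ≡ Vec.lookup ρ i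
dot-unit #0 (x ∷ ρ) = trans (cong (x +_) (dot-const _ ρ λ j → refl)) (+-identityʳ x)
dot-unit (Fin.suc i) (x ∷ ρ) = dot-unit i ρ

dot-plus : ∀ {k} (cs ds ρ : Vec F3 k) → dot (Vec.zipWith plus cs ds) ρ ≡ dot cs ρ + dot ds ρ
dot-plus [] [] [] = sym (+-identityˡ _)
dot-plus (c ∷ cs) (d ∷ ds) (x ∷ ρ) = begin
  dot (plus c d ∷ Vec.zipWith plus cs ds) (x ∷ ρ) ≡⟨ dot-∷ (plus c d) x _ ρ ⟩
  plus c d · x + dot (Vec.zipWith plus cs ds) ρ ≡⟨ cong₂ _+_ (·-plus c d x) (dot-plus cs ds ρ) ⟩
  (c · x + d · x) + (dot cs ρ + dot ds ρ) ≡⟨ +-interchange (c · x) _ _ _ ⟩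
  (c · x + dot cs ρ) + (d · x + dot ds ρ) ≡⟨ cong₂ _+_ (dot-∷ c x cs ρ) (dot-∷ d x ds ρ) ⟨
  dot (c ∷ cs) (x ∷ ρ) + dot (d ∷ ds) (x ∷ ρ) ∎ where open ≡-Reasoning

dot-neg : ∀ {k} (cs ρ : Vec F3 k) → dot (Vec.map negate cs) ρ ≡ - dot cs ρ
dot-neg [] [] = sym neg-0
dot-neg (c ∷ cs) (x ∷ ρ) = begin
  dot (negate c ∷ Vec.map negate cs) (x ∷ ρ) ≡⟨ dot-∷ (negate c) x _ ρ ⟩
  negate c · x + dot (Vec.map negate cs) ρ ≡⟨ cong₂ _+_ (·-negate c x) (dot-neg cs ρ) ⟩
  - (c · x) + (- dot cs ρ) ≡⟨ neg-distrib _ _ ⟨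
  - (c · x + dot cs ρ) ≡⟨ cong -_ (dot-∷ c x cs ρ) ⟨
  - dot (c ∷ cs) (x ∷ ρ) ∎ where open ≡-Reasoning

norm-correct : ∀ {k} (e : Expr k) ρ → dot (norm e) ρ ≡ eval e ρ
norm-correct (var i) ρ = dot-unit i ρ
norm-correct :0 ρ = dot-zero ρ
norm-correct (e :+ f) ρ = trans (dot-plus (norm e) (norm f) ρ) (cong₂ _+_ (norm-correct e ρ) (norm-correct f ρ))
norm-correct (:- e) ρ = trans (dot-neg (norm e) ρ) (cong -_ (norm-correct e ρ))

open import Relation.Binary.Reflection (setoid F3) var eval (λ e → dot (norm e)) norm-correct
  using (solve) renaming (_⊜_ to infix 4 _:=_) public

+-cancel : ∀ a b → a + b ≡ a → b ≡ 0₃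
+-cancel a b h = trans (solve 2 (λ a b → b := (:- a) :+ (a :+ b)) refl a b)
  (trans (cong ((- a) +_) h) (neg-inverseˡ a))

a+b≡0⇒b≡-a : ∀ a b → a + b ≡ 0₃ → b ≡ - a
a+b≡0⇒b≡-a a b h = trans (solve 2 (λ a b → b := (:- a) :+ (a :+ b)) refl a b)
  (trans (cong ((- a) +_) h) (+-identityʳ _))

-- Finite sums

opaque
  unfolding sum _+_

  sum-zero : (f : Fin 0 → F3) → sum 0 f ≡ 0₃
  sum-zero f = refl

  sum-suc : ∀ k (f : Fin (suc k) → F3) → sum (suc k) f ≡ f Fin.zero + sum k (f ∘ Fin.suc)
  sum-suc k f = cong (f Fin.zero +_) (cong (foldr _+_ 0₃)
    (trans (map-tabulate Fin.suc f) (sym (map-tabulate id (f ∘ Fin.suc)))))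

sum-cong : ∀ k {f g : Fin k → F3} → (∀ i → f i ≡ g i) → sum k f ≡ sum k g
sum-cong zero h = trans (sum-zero _) (sym (sum-zero _))
sum-cong (suc k) {f} {g} h = begin
  sum (suc k) f ≡⟨ sum-suc k f ⟩
  f #0 + sum k (f ∘ Fin.suc) ≡⟨ cong₂ _+_ (h #0) (sum-cong k (h ∘ Fin.suc)) ⟩
  g #0 + sum k (g ∘ Fin.suc) ≡⟨ sum-suc k g ⟨
  sum (suc k) g ∎ where open ≡-Reasoning

sum-0 : ∀ k {f : Fin k → F3} → (∀ i → f i ≡ 0₃) → sum k f ≡ 0₃
sum-0 zero h = sum-zero _
sum-0 (suc k) {f} h = trans (sum-suc k f) (trans (cong₂ _+_ (h #0) (sum-0 k (h ∘ Fin.suc))) (+-identityˡ 0₃))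

sum-+ : ∀ k (f g : Fin k → F3) → sum k (λ i → f i + g i) ≡ sum k f + sum k g
sum-+ zero f g = trans (sum-zero _) (sym (trans (cong₂ _+_ (sum-zero f) (sum-zero g)) (+-identityˡ 0₃)))
sum-+ (suc k) f g = begin
  sum (suc k) (λ i → f i + g i) ≡⟨ sum-suc k _ ⟩
  (f #0 + g #0) + sum k (λ i → f (Fin.suc i) + g (Fin.suc i))
    ≡⟨ cong ((f #0 + g #0) +_) (sum-+ k (f ∘ Fin.suc) (g ∘ Fin.suc)) ⟩
  (f #0 + g #0) + (sum k (f ∘ Fin.suc) + sum k (g ∘ Fin.suc)) ≡⟨ +-interchange (f #0) _ _ _ ⟩
  (f #0 + sum k (f ∘ Fin.suc)) + (g #0 + sum k (g ∘ Fin.suc))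
    ≡⟨ cong₂ _+_ (sum-suc k f) (sum-suc k g) ⟨
  sum (suc k) f + sum (suc k) g ∎ where open ≡-Reasoning

sum-neg : ∀ k (f : Fin k → F3) → sum k (λ i → - f i) ≡ - sum k f
sum-neg zero f = trans (sum-zero _) (sym (trans (cong -_ (sum-zero f)) neg-0))
sum-neg (suc k) f = begin
  sum (suc k) (λ i → - f i) ≡⟨ sum-suc k _ ⟩
  - f #0 + sum k (λ i → - f (Fin.suc i)) ≡⟨ cong (- f #0 +_) (sum-neg k _) ⟩
  - f #0 + (- sum k (f ∘ Fin.suc)) ≡⟨ neg-distrib (f #0) _ ⟨
  - (f #0 + sum k (f ∘ Fin.suc)) ≡⟨ cong -_ (sum-suc k f) ⟨
  - sum (suc k) f ∎ where open ≡-Reasoning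

sum-swap : ∀ k l (f : Fin k → Fin l → F3) →
  sum k (λ i → sum l (f i)) ≡ sum l (λ j → sum k (λ i → f i j))
sum-swap zero l f = trans (sum-zero _) (sym (sum-0 l (λ _ → sum-zero _)))
sum-swap (suc k) l f = begin
  sum (suc k) (λ i → sum l (f i)) ≡⟨ sum-suc k _ ⟩
  sum l (f #0) + sum k (λ i → sum l (f (Fin.suc i)))
    ≡⟨ cong (sum l (f #0) +_) (sum-swap k l (f ∘ Fin.suc)) ⟩
  sum l (f #0) + sum l (λ j → sum k (λ i → f (Fin.suc i) j)) ≡⟨ sum-+ l _ _ ⟨
  sum l (λ j → f #0 j + sum k (λ i → f (Fin.suc i) j))
    ≡⟨ sum-cong l (λ j → sym (sum-suc k (λ i → f i j))) ⟩
  sum l (λ j → sum (suc k) (λ i → f i j)) ∎ where open ≡-Reasoning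

sum-single : ∀ k (i₀ : Fin k) {f : Fin k → F3} → (∀ i → i ≢ i₀ → f i ≡ 0₃) → sum k f ≡ f i₀
sum-single (suc k) #0 {f} h = begin
  sum (suc k) f ≡⟨ sum-suc k f ⟩
  f #0 + sum k (f ∘ Fin.suc) ≡⟨ cong (f #0 +_) (sum-0 k (λ i → h (Fin.suc i) λ ())) ⟩
  f #0 + 0₃ ≡⟨ +-identityʳ _ ⟩
  f #0 ∎ where open ≡-Reasoning
sum-single (suc k) (Fin.suc i₀) {f} h = begin
  sum (suc k) f ≡⟨ sum-suc k f ⟩
  f #0 + sum k (f ∘ Fin.suc) ≡⟨ cong₂ _+_ (h #0 λ ()) (sum-single k i₀ λ i ne → h (Fin.suc i) λ { refl → ne refl }) ⟩
  0₃ + f (Fin.suc i₀) ≡⟨ +-identityˡ _ ⟩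
  f (Fin.suc i₀) ∎ where open ≡-Reasoning

opaque
  unfolding sumP

  sumP-def : ∀ n f → sumP n f ≡ sum n λ i → sum n λ j → f (i , j)
  sumP-def n f = refl

  sumP-cong : ∀ n {f g : Pair n → F3} → (∀ w → f w ≡ g w) → sumP n f ≡ sumP n g
  sumP-cong n h = sum-cong n λ i → sum-cong n λ j → h (i , j)

  sumP-+ : ∀ n (f g : Pair n → F3) → sumP n (λ w → f w + g w) ≡ sumP n f + sumP n g
  sumP-+ n f g = trans (sum-cong n λ i → sum-+ n _ _) (sum-+ n _ _)

  sumP-neg : ∀ n (f : Pair n → F3) → sumP n (λ w → - f w) ≡ - sumP n f
  sumP-neg n f = trans (sum-cong n λ i → sum-neg n _) (sum-neg n _)

  sumP-sum : ∀ n k (f : Pair n → Fin k → F3) →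
    sumP n (λ w → sum k (f w)) ≡ sum k (λ l → sumP n (λ w → f w l))
  sumP-sum n k f = trans (sum-cong n λ i → sum-swap n k _) (sum-swap n k _)

  sumP-swap : ∀ n (f : Pair n → Pair n → F3) →
    sumP n (λ w → sumP n (f w)) ≡ sumP n (λ v → sumP n (λ w → f w v))
  sumP-swap n f = trans (sumP-sum n n _) (sum-cong n λ i → sumP-sum n n _)

  sumP-single : ∀ n (w₀ : Pair n) {f : Pair n → F3} → (∀ w → w ≢ w₀ → f w ≡ 0₃) → sumP n f ≡ f w₀
  sumP-single n (i₀ , j₀) {f} h = trans
    (sum-single n i₀ λ i ne → sum-0 n λ j → h (i , j) λ { refl → ne refl })
    (sum-single n j₀ λ j ne → h (i₀ , j) λ { refl → ne refl })

-- Chains and linear maps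

infixl 6 _+C_

_+C_ : ∀ {n m} → Chain n m → Chain n m → Chain n m
(c +C d) τ = c τ + d τ

infix 8 -C_
infixl 6 _-C_

-C_ : ∀ {n m} → Chain n m → Chain n m
(-C c) τ = - c τ

_-C_ : ∀ {n m} → Chain n m → Chain n m → Chain n m
(c -C d) τ = c τ + (- d τ)

ΣC : ∀ {n m} k → (Fin k → Chain n m) → Chain n m
ΣC k f τ = sum k λ i → f i τ

≈-refl : ∀ {n m} {c : Chain n m} → c ≈ c
≈-refl τ = refl

≈-sym : ∀ {n m} {c d : Chain n m} → c ≈ d → d ≈ c
≈-sym h τ = sym (h τ)

≈-trans : ∀ {n m} {c d e : Chain n m} → c ≈ d → d ≈ e → c ≈ e
≈-trans h g τ = trans (h τ) (g τ)

-- Every scalar of ℤ/3 is 0, 1 or -1, so additivity already gives linearity. Compatibility with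
-- pointwise equality is a separate field because chains are functions.
record Linear {n m n' m'} (f : Chain n m → Chain n' m') : Set where
  field
    resp : ∀ {c d} → c ≈ d → f c ≈ f d
    add  : ∀ c d → f (c +C d) ≈ (f c +C f d)

  zer : f zeroC ≈ zeroC
  zer τ = +-cancel (f zeroC τ) _ (trans (sym (add zeroC zeroC τ)) (resp (λ _ → +-identityˡ 0₃) τ))

  neg : ∀ c → f (-C c) ≈ (-C f c)
  neg c τ = a+b≡0⇒b≡-a (f c τ) _ (trans (sym (add c (-C c) τ))
    (trans (resp (λ σ → neg-inverseʳ (c σ)) τ) (zer τ)))

  sub : ∀ c d → f (c -C d) ≈ (f c -C f d)
  sub c d τ = trans (add c (-C d) τ) (cong (f c τ +_) (neg d τ))

  sums : ∀ k (g : Fin k → _) → f (ΣC k g) ≈ ΣC k (f ∘ g)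
  sums zero g τ = trans (resp (λ σ → sum-zero _) τ) (trans (zer τ) (sym (sum-zero _)))
  sums (suc k) g τ = trans (resp (λ σ → sum-suc k (λ i → g i σ)) τ)
    (trans (add (g #0) (ΣC k (g ∘ Fin.suc)) τ)
    (trans (cong (f (g #0) τ +_) (sums k (g ∘ Fin.suc) τ))
    (sym (sum-suc k (λ i → f (g i) τ)))))

  zero≈ : ∀ {c} → c ≈ zeroC → f c ≈ zeroC
  zero≈ h = ≈-trans (resp h) zer

open Linear public

∂ : ∀ {n m} → Chain n (suc m) → Chain n m
∂ {n} c τ = sumP n λ w → c (w ∷ τ)

ι : ∀ {n m} → Pair n → Chain n (suc m) → Chain n m
ι w c τ = c (w ∷ τ)

∂-linear : ∀ {n m} → Linear {n} {suc m} ∂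
∂-linear {n} .resp h τ = sumP-cong n λ w → h (w ∷ τ)
∂-linear {n} .add c d τ = sumP-+ n (λ w → c (w ∷ τ)) (λ w → d (w ∷ τ))

∘-linear : ∀ {n m n' m' n'' m''} {f : Chain n' m' → Chain n'' m''} {g : Chain n m → Chain n' m'} →
  Linear f → Linear g → Linear (f ∘ g)
∘-linear F G .resp h = resp F (resp G h)
∘-linear F G .add c d = ≈-trans (resp F (add G c d)) (add F _ _)

-linear : ∀ {n m n' m'} {f g : Chain n m → Chain n' m'} → Linear f → Linear g → Linear (λ c → f c -C g c)
-linear F G .resp h τ = cong₂ (λ a b → a + (- b)) (resp F h τ) (resp G h τ)
-linear {f = f} {g} F G .add c d τ = trans (cong₂ (λ a b → a + (- b)) (add F c d τ) (add G c d τ))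
  (lem (f c τ) (f d τ) (g c τ) (g d τ))
  where
  lem : ∀ a b c d → (a + b) + (- (c + d)) ≡ (a + (- c)) + (b + (- d))
  lem = solve 4 (λ a b c d → (a :+ b) :+ (:- (c :+ d)) := (a :+ (:- c)) :+ (b :+ (:- d))) refl

+linear : ∀ {n m n' m'} {f g : Chain n m → Chain n' m'} → Linear f → Linear g → Linear (λ c → f c +C g c)
+linear F G .resp h τ = cong₂ _+_ (resp F h τ) (resp G h τ)
+linear {f = f} {g} F G .add c d τ = trans (cong₂ _+_ (add F c d τ) (add G c d τ))
  (+-interchange (f c τ) _ _ _)

-- Exterior multiplication by an edge

_≟P_ : ∀ {n} → DecidableEquality (Pair n)
_≟P_ = ≡-dec Finₚ._≟_ Finₚ._≟_

sel : ∀ {P : Set} → Dec P → F3 → F3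
sel (yes _) a = a
sel (no _) a = 0₃

sel-yes : ∀ {P : Set} (d : Dec P) → P → ∀ a → sel d a ≡ a
sel-yes (yes _) _ a = refl
sel-yes (no ¬p) p a = ⊥-elim (¬p p)

sel-no : ∀ {P : Set} (d : Dec P) → ¬ P → ∀ a → sel d a ≡ 0₃
sel-no (yes p) ¬p a = ⊥-elim (¬p p)
sel-no (no _) _ a = refl

sel-+ : ∀ {P : Set} (d : Dec P) a b → sel d (a + b) ≡ sel d a + sel d b
sel-+ (yes _) a b = refl
sel-+ (no _) a b = sym (+-identityˡ 0₃)

sel-0 : ∀ {P : Set} (d : Dec P) → sel d 0₃ ≡ 0₃
sel-0 (yes _) = refl
sel-0 (no _) = refl

sel-comm : ∀ {P Q : Set} (d : Dec P) (e : Dec Q) a → sel d (sel e a) ≡ sel e (sel d a)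
sel-comm (yes _) e a = refl
sel-comm (no _) e a = sym (sel-0 e)

-- Exterior multiplication by a vertex of the simplex on all pairs, defined
-- so that contraction with w is an antiderivation.
infixr 9 _∧_

_∧_ : ∀ {n m} → Pair n → Chain n m → Chain n (suc m)
_∧_ {m = zero}  e c (w ∷ τ) = sel (e ≟P w) (c τ)
_∧_ {m = suc m} e c (w ∷ τ) = sel (e ≟P w) (c τ) + (- (e ∧ ι w c) τ)

∧-linear : ∀ {n m} (e : Pair n) → Linear {n} {m} (e ∧_)
∧-linear e .resp {c} {d} = go c d
  where
  go : ∀ {m} (c d : Chain _ m) → c ≈ d → (e ∧ c) ≈ (e ∧ d)
  go {zero} c d h (w ∷ τ) = cong (sel (e ≟P w)) (h τ)
  go {suc m} c d h (w ∷ τ) = cong₂ _+_ (cong (sel (e ≟P w)) (h τ))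
    (cong -_ (go (ι w c) (ι w d) (λ σ → h (w ∷ σ)) τ))
∧-linear e .add = go
  where
  go : ∀ {m} (c d : Chain _ m) → (e ∧ (c +C d)) ≈ ((e ∧ c) +C (e ∧ d))
  go {zero} c d (w ∷ τ) = sel-+ (e ≟P w) (c τ) (d τ)
  go {suc m} c d (w ∷ τ) = trans
    (cong₂ _+_ (sel-+ (e ≟P w) (c τ) (d τ))
      (trans (cong -_ (go (ι w c) (ι w d) τ)) (neg-distrib ((e ∧ ι w c) τ) _)))
    (+-interchange (sel (e ≟P w) (c τ)) _ _ _)

-- Both sides have the same contraction with each w: the antiderivation rule splits it into delta
-- terms, which match after the sign, and the same identity for `ι w c`.
∧-anticomm : ∀ {n m} (e f : Pair n) (c : Chain n m) → (e ∧ f ∧ c) ≈ (-C (f ∧ e ∧ c))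
∧-anticomm {m = zero} e f c (w ∷ v ∷ τ) = trans
  (cong₂ (λ x y → x + (- y)) (sel-comm (e ≟P w) (f ≟P v) (c τ)) (sel-comm (e ≟P v) (f ≟P w) (c τ)))
  (solve 2 (λ x y → x :+ (:- y) := :- (y :+ (:- x))) refl _ _)
∧-anticomm {m = suc m} e f c (w ∷ τ) = begin
  sel (e ≟P w) ((f ∧ c) τ) + (- (e ∧ ι w (f ∧ c)) τ)
    ≡⟨ cong (λ x → sel (e ≟P w) ((f ∧ c) τ) + (- x)) (expand e f) ⟩
  sel (e ≟P w) ((f ∧ c) τ) + (- (sel (f ≟P w) ((e ∧ c) τ) + (- (e ∧ f ∧ ι w c) τ)))
    ≡⟨ cong (λ x → sel (e ≟P w) ((f ∧ c) τ) + (- (sel (f ≟P w) ((e ∧ c) τ) + (- x)))) (∧-anticomm e f (ι w c) τ) ⟩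
  sel (e ≟P w) ((f ∧ c) τ) + (- (sel (f ≟P w) ((e ∧ c) τ) + (- (- (f ∧ e ∧ ι w c) τ))))
    ≡⟨ lem _ _ _ ⟩
  - (sel (f ≟P w) ((e ∧ c) τ) + (- (sel (e ≟P w) ((f ∧ c) τ) + (- (f ∧ e ∧ ι w c) τ))))
    ≡⟨ cong (λ x → - (sel (f ≟P w) ((e ∧ c) τ) + (- x))) (expand f e) ⟨
  - (sel (f ≟P w) ((e ∧ c) τ) + (- (f ∧ ι w (e ∧ c)) τ)) ∎
  where
  open ≡-Reasoning
  lem : ∀ x y z → x + (- (y + (- (- z)))) ≡ - (y + (- (x + (- z))))
  lem = solve 3 (λ x y z → x :+ (:- (y :+ (:- (:- z)))) := :- (y :+ (:- (x :+ (:- z))))) refl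
  selC : ∀ {P : Set} → Dec P → Chain _ (suc m) → Chain _ (suc m)
  selC d x σ = sel d (x σ)
  ∧-sel : ∀ {P : Set} (d : Dec P) (g : Pair _) x → (g ∧ selC d x) ≈ (λ σ → sel d ((g ∧ x) σ))
  ∧-sel (yes _) g x σ = refl
  ∧-sel (no _) g x σ = zer (∧-linear g) σ
  expand : ∀ e f → (e ∧ ι w (f ∧ c)) τ ≡ sel (f ≟P w) ((e ∧ c) τ) + (- (e ∧ f ∧ ι w c) τ)
  expand e f = trans (sub (∧-linear e) (selC (f ≟P w) c) (f ∧ ι w c) τ)
    (cong (_+ (- (e ∧ f ∧ ι w c) τ)) (∧-sel (f ≟P w) e c τ))

-- The antiderivation rule summed over all w; the delta term contributes c exactly once. This cone
-- formula is behind every filling constructed below.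
∂-∧ : ∀ {n m} (e : Pair n) (c : Chain n (suc m)) → ∂ (e ∧ c) ≈ (c -C (e ∧ ∂ c))
∂-∧ {n} e c τ = begin
  sumP n (λ w → sel (e ≟P w) (c τ) + (- (e ∧ ι w c) τ)) ≡⟨ sumP-+ n _ _ ⟩
  sumP n (λ w → sel (e ≟P w) (c τ)) + sumP n (λ w → - (e ∧ ι w c) τ)
    ≡⟨ cong₂ _+_ (trans (sumP-single n e λ w ne → sel-no (e ≟P w) (ne ∘ sym) _) (sel-yes (e ≟P e) refl _))
        (trans (sumP-neg n _) (cong -_ (sym wedge∂))) ⟩
  c τ + (- (e ∧ ∂ c) τ) ∎
  where
  open ≡-Reasoning
  wedge∂ : (e ∧ ∂ c) τ ≡ sumP n (λ w → (e ∧ ι w c) τ)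
  wedge∂ = trans (resp (∧-linear e) (λ σ → sumP-def n _) τ)
    (trans (sums (∧-linear e) n (λ i → (λ σ → sum n λ j → c ((i , j) ∷ σ))) τ)
    (trans (sum-cong n λ i → sums (∧-linear e) n (λ j → ι (i , j) c) τ) (sym (sumP-def n _))))

∂-∧₀ : ∀ {n} (e : Pair n) (c : Chain n 0) → ∂ (e ∧ c) ≈ c
∂-∧₀ {n} e c [] = trans (sumP-single n e λ w ne → sel-no (e ≟P w) (ne ∘ sym) _) (sel-yes (e ≟P e) refl _)

-- The augmented complex ends with the empty simplex, so in degree 0 everything is a cycle. With
-- this convention links of 0-dimensional chains need no separate treatment.
data Cycle {n} : ∀ {m} → Chain n m → Set where
  cyc₀ : {c : Chain n 0} → Cycle c
  cyc₊ : ∀ {m} {c : Chain n (suc m)} → ∂ c ≈ zeroC → Cycle c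

∂-∧-cycle : ∀ {n m} (e : Pair n) {c : Chain n m} → Cycle c → ∂ (e ∧ c) ≈ c
∂-∧-cycle {m = zero} e {c} h = ∂-∧₀ e c
∂-∧-cycle {m = suc m} e {c} (cyc₊ h) τ = trans (∂-∧ e c τ)
  (trans (cong (λ x → c τ + (- x)) (zero≈ (∧-linear e) h τ)) (solve 1 (λ x → x :+ (:- :0) := x) refl (c τ)))

open Linear

variable
  n m k : ℕ

-- Vertex sets are given by the list X of deleted vertices.

_∈?_ : (v : Fin n) (X : List (Fin n)) → Dec (v ∈ X)
_∈?_ = mem? Finₚ._≟_

length-remove : ∀ (x : Fin n) {l} → Unique l → x ∈ l → length l ≡ suc (length (filter (λ y → ¬? (y Finₚ.≟ x)) l))
length-remove x {y ∷ l} (y∉ ∷ u) (here refl) with y Finₚ.≟ y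
... | yes _ = cong suc (cong length (sym (Listₚ.filter-all (λ z → ¬? (z Finₚ.≟ y)) (All.map (λ ne eq → ne (sym eq)) y∉))))
... | no ne = ⊥-elim (ne refl)
length-remove x {y ∷ l} (y∉ ∷ u) (there x∈) with y Finₚ.≟ x
... | yes refl = ⊥-elim (All.lookup y∉ x∈ refl)
... | no _ = cong suc (length-remove x u x∈)

opaque
  -- Entries of X may repeat, so the length of X says nothing about how many vertices are left.
  -- Hence `size` counts this complement.
  comp : List (Fin n) → List (Fin n)
  comp [] = allFin _
  comp (x ∷ X) = filter (λ y → ¬? (y Finₚ.≟ x)) (comp X)

  size : List (Fin n) → ℕ
  size X = length (comp X)

  ∈-comp⁻ : ∀ (X : List (Fin n)) {v} → v ∈ comp X → v ∉ X
  ∈-comp⁻ (x ∷ X) v∈ (here refl) = proj₂ (∈-filter⁻ (λ y → ¬? (y Finₚ.≟ x)) {xs = comp X} v∈) refl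
  ∈-comp⁻ (x ∷ X) v∈ (there v∈X) = ∈-comp⁻ X (proj₁ (∈-filter⁻ (λ y → ¬? (y Finₚ.≟ x)) v∈)) v∈X

  ∈-comp⁺ : ∀ (X : List (Fin n)) {v} → v ∉ X → v ∈ comp X
  ∈-comp⁺ [] {v} _ = ∈-allFin v
  ∈-comp⁺ (x ∷ X) v∉ = ∈-filter⁺ (λ y → ¬? (y Finₚ.≟ x)) (∈-comp⁺ X (v∉ ∘ there)) (v∉ ∘ here)

  comp-unique : ∀ (X : List (Fin n)) → Unique (comp X)
  comp-unique [] = Uniqueₚ.allFin⁺ _
  comp-unique (x ∷ X) = Uniqueₚ.filter⁺ _ (comp-unique X)

  size-∷ : ∀ {X : List (Fin n)} {v} → v ∉ X → size X ≡ suc (size (v ∷ X))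
  size-∷ {X = X} v∉ = length-remove _ (comp-unique X) (∈-comp⁺ X v∉)

  fresh : ∀ (X : List (Fin n)) {t} → suc t ≤ size X → ∃ λ v → v ∉ X
  fresh X h with comp X | ∈-comp⁻ X
  fresh X () | [] | f
  fresh X h | v ∷ _ | f = v , f (here refl)

  size-0 : ∀ (X : List (Fin n)) → size X ≡ 0 → ∀ a → a ∈ X
  size-0 X e a with a ∈? X
  ... | yes h = h
  ... | no a∉ with comp X | ∈-comp⁺ X a∉
  size-0 X () a | no a∉ | _ ∷ _ | _

  size-[] : size {n} [] ≡ n
  size-[] {n} = Listₚ.length-tabulate {n = n} id

  length-comp : ∀ (X : List (Fin n)) → length (comp X) ≡ size X
  length-comp X = refl

≤-size-∷ : ∀ {X : List (Fin n)} {v t} → v ∉ X → suc t ≤ size X → t ≤ size (v ∷ X)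
≤-size-∷ v∉ h = ℕₚ.≤-pred (subst (_ ≤_) (size-∷ v∉) h)

≡-size-∷ : ∀ {X : List (Fin n)} {v t} → v ∉ X → size X ≡ suc t → size (v ∷ X) ≡ t
≡-size-∷ v∉ h = ℕₚ.suc-injective (trans (sym (size-∷ v∉)) h)

∉-∷ : ∀ {v x : Fin n} {X} → v ≢ x → v ∉ X → v ∉ x ∷ X
∉-∷ ne _ (here eq) = ne eq
∉-∷ _ v∉ (there h) = v∉ h

infix 4 _⊆_
_⊆_ : List (Fin n) → List (Fin n) → Set
X ⊆ Y = ∀ {v} → v ∈ X → v ∈ Y

∷⊆ : ∀ {x : Fin n} {X Y} → x ∈ Y → X ⊆ Y → x ∷ X ⊆ Y
∷⊆ h f (here refl) = h
∷⊆ h f (there i) = f i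

∷-mono : ∀ {x : Fin n} {X Y} → X ⊆ Y → x ∷ X ⊆ x ∷ Y
∷-mono f (here e) = here e
∷-mono f (there i) = there (f i)

opaque
  -- Writes the edge ab in increasing order. `mk a a` is a pair but not an edge, so chains vanish on
  -- it and sums over neighbours may run over all vertices.
  mk : Fin n → Fin n → Pair n
  mk a b with a Finₚ.<? b
  ... | yes _ = a , b
  ... | no _ = b , a

ends : Pair n → List (Fin n) → List (Fin n)
ends w X = proj₁ w ∷ proj₂ w ∷ X

opaque
  unfolding mk

  mk-edge : ∀ {a b : Fin n} → a ≢ b → IsEdge (mk a b)
  mk-edge {a = a} {b} ne with a Finₚ.<? b
  ... | yes lt = lt
  ... | no nlt = Finₚ.≤∧≢⇒< (ℕₚ.≮⇒≥ nlt) (ne ∘ sym)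

  mk-sym : ∀ (a b : Fin n) → mk a b ≡ mk b a
  mk-sym a b with a Finₚ.<? b | b Finₚ.<? a
  ... | yes p | yes q = ⊥-elim (ℕₚ.<-asym p q)
  ... | yes p | no q = refl
  ... | no p | yes q = refl
  ... | no p | no q with Finₚ.≤-antisym (ℕₚ.≮⇒≥ q) (ℕₚ.≮⇒≥ p)
  ...   | refl = refl

  ends-mk⁺ : ∀ (a b : Fin n) X → ends (mk a b) X ⊆ a ∷ b ∷ X
  ends-mk⁺ a b X with a Finₚ.<? b
  ... | yes _ = id
  ... | no _ = ∷⊆ (there (here refl)) (∷⊆ (here refl) (there ∘ there))

  ends-mk⁻ : ∀ (a b : Fin n) X → a ∷ b ∷ X ⊆ ends (mk a b) X
  ends-mk⁻ a b X with a Finₚ.<? b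
  ... | yes _ = id
  ... | no _ = ∷⊆ (there (here refl)) (∷⊆ (here refl) (there ∘ there))

  mk-< : ∀ {a b : Fin n} → a Fin.< b → mk a b ≡ (a , b)
  mk-< {a = a} {b} lt with a Finₚ.<? b
  ... | yes _ = refl
  ... | no nlt = ⊥-elim (nlt lt)

edge-at : ∀ {w : Pair n} {v} → IsEdge w → v ∈ ends w [] → ∃ λ a → a ≢ v × w ≡ mk v a
edge-at {w = a , b} lt (here refl) = b , (λ { refl → ℕₚ.<-irrefl refl lt }) , sym (mk-< lt)
edge-at {w = a , b} lt (there (here refl)) =
  a , (λ { refl → ℕₚ.<-irrefl refl lt }) , trans (sym (mk-< lt)) (mk-sym a b)

opaque
  unfolding mk

  mk-injʳ : ∀ {v a b : Fin n} → mk v a ≡ mk v b → a ≡ b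
  mk-injʳ {v = v} {a} {b} eq with v Finₚ.<? a | v Finₚ.<? b
  ... | yes _ | yes _ = cong proj₂ eq
  ... | yes p | no q with eq
  ...   | refl = refl
  mk-injʳ eq | no p | yes q with eq
  ... | refl = refl
  mk-injʳ eq | no p | no q = cong proj₁ eq

Good : List (Fin n) → Pair n → Set
Good X w = IsEdge w × proj₁ w ∉ X × proj₂ w ∉ X

good? : ∀ X (w : Pair n) → Dec (Good X w)
good? X (a , b) = (a Finₚ.<? b) ×-dec (¬? (a ∈? X) ×-dec ¬? (b ∈? X))

good-⊆ : ∀ {X Y} {w : Pair n} → X ⊆ Y → Good Y w → Good X w
good-⊆ f (e , p , q) = e , p ∘ f , q ∘ f

opaque
  unfolding mk

  good-mk : ∀ {X} {a b : Fin n} → a ≢ b → a ∉ X → b ∉ X → Good X (mk a b)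
  good-mk {a = a} {b} ne p q with a Finₚ.<? b | mk-edge ne
  ... | yes _ | e = e , p , q
  ... | no _ | e = e , q , p

  good-mk⁻ : ∀ {X} (a b : Fin n) → Good X (mk a b) → a ≢ b × a ∉ X × b ∉ X
  good-mk⁻ a b g with a Finₚ.<? b
  ... | yes _ = (λ { refl → ℕₚ.<-irrefl refl (proj₁ g) }) , proj₂ g
  ... | no _ = (λ { refl → ℕₚ.<-irrefl refl (proj₁ g) }) , proj₂ (proj₂ g) , proj₁ (proj₂ g)

bad-meets : ∀ {X} (w v : Pair n) {a} → a ∈ ends w [] → a ∈ ends v [] → ¬ Good (ends v X) w
bad-meets w v (here refl) (here refl) (_ , p , _) = p (here refl)
bad-meets w v (here refl) (there (here refl)) (_ , p , _) = p (there (here refl))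
bad-meets w v (there (here refl)) (here refl) (_ , _ , p) = p (here refl)
bad-meets w v (there (here refl)) (there (here refl)) (_ , _ , p) = p (there (here refl))

-- Alternating chains on matchings avoiding X

AltHead : Chain n (suc m) → Set
AltHead {m = zero} c = ⊤
AltHead {m = suc m} c = ∀ w v τ → c (w ∷ v ∷ τ) ≡ - c (v ∷ w ∷ τ)

-- A recursive form of the chain condition. Alternation is asked only for the first two entries,
-- because the later adjacent transpositions come from the contractions; enlarging X by the ends of
-- w encodes disjointness from w.
data Ok {n} (X : List (Fin n)) : ∀ {m} → Chain n m → Set where
  ok₀ : {c : Chain n 0} → Ok X c
  ok₊ : {c : Chain n (suc m)} → AltHead c → (∀ w → ¬ Good X w → ι w c ≈ zeroC) →
    (∀ w → Ok (ends w X) (ι w c)) → Ok X c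

ok-alt : ∀ {X} {c : Chain n (suc m)} → Ok X c → AltHead c
ok-alt (ok₊ a _ _) = a

ok-bad : ∀ {X} {c : Chain n (suc m)} → Ok X c → ∀ w → ¬ Good X w → ι w c ≈ zeroC
ok-bad (ok₊ _ b _) = b

ok-ι : ∀ {X} {c : Chain n (suc m)} → Ok X c → ∀ w → Ok (ends w X) (ι w c)
ok-ι (ok₊ _ _ o) = o

Ok-≈ : ∀ {X} {c d : Chain n m} → c ≈ d → Ok X c → Ok X d
Ok-≈ {m = zero} h o = ok₀
Ok-≈ {m = suc m} {c = c} {d} h (ok₊ a b o) =
  ok₊ (alt m c d h a) (λ w g τ → trans (sym (h (w ∷ τ))) (b w g τ)) λ w → Ok-≈ (λ τ → h (w ∷ τ)) (o w)
  where
  alt : ∀ m (c d : Chain _ (suc m)) → c ≈ d → AltHead c → AltHead d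
  alt zero c d h a = tt
  alt (suc m) c d h a w v τ = trans (sym (h _)) (trans (a w v τ) (cong -_ (h _)))

Ok-0 : ∀ {X} → Ok X (zeroC {n} {m})
Ok-0 {m = zero} = ok₀
Ok-0 {m = suc m} = ok₊ (alt m) (λ w g τ → refl) λ w → Ok-0
  where
  alt : ∀ m → AltHead (zeroC {_} {suc m})
  alt zero = tt
  alt (suc m) w v τ = sym neg-0

Ok-≈0 : ∀ {X} {c : Chain n m} → c ≈ zeroC → Ok X c
Ok-≈0 h = Ok-≈ (≈-sym h) Ok-0

Ok-+ : ∀ {X} {c d : Chain n m} → Ok X c → Ok X d → Ok X (c +C d)
Ok-+ {m = zero} _ _ = ok₀
Ok-+ {m = suc m} {c = c} {d} (ok₊ a b o) (ok₊ a' b' o') =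
  ok₊ (alt m c d a a') (λ w g τ → trans (cong₂ _+_ (b w g τ) (b' w g τ)) (+-identityˡ 0₃)) λ w → Ok-+ (o w) (o' w)
  where
  alt : ∀ m (c d : Chain _ (suc m)) → AltHead c → AltHead d → AltHead (c +C d)
  alt zero c d a a' = tt
  alt (suc m) c d a a' w v τ = trans (cong₂ _+_ (a w v τ) (a' w v τ)) (sym (neg-distrib _ _))

Ok-neg : ∀ {X} {c : Chain n m} → Ok X c → Ok X (-C c)
Ok-neg {m = zero} _ = ok₀
Ok-neg {m = suc m} {c = c} (ok₊ a b o) =
  ok₊ (alt m c a) (λ w g τ → trans (cong -_ (b w g τ)) neg-0) λ w → Ok-neg (o w)
  where
  alt : ∀ m (c : Chain _ (suc m)) → AltHead c → AltHead (-C c)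
  alt zero c a = tt
  alt (suc m) c a w v τ = cong -_ (a w v τ)

Ok-sub : ∀ {X} {c d : Chain n m} → Ok X c → Ok X d → Ok X (c -C d)
Ok-sub o o' = Ok-+ o (Ok-neg o')

ΣC-suc : ∀ (f : Fin (suc k) → Chain n m) → ΣC (suc k) f ≈ (f #0 +C ΣC k (f ∘ Fin.suc))
ΣC-suc f τ = sum-suc _ _

Ok-Σ : ∀ {X} k {f : Fin k → Chain n m} → (∀ i → Ok X (f i)) → Ok X (ΣC k f)
Ok-Σ zero h = Ok-≈0 (λ τ → sum-zero _)
Ok-Σ (suc k) {f} h = Ok-≈ (≈-sym (ΣC-suc f)) (Ok-+ (h #0) (Ok-Σ k (h ∘ Fin.suc)))

Ok-⊆ : ∀ {X Y} {c : Chain n m} → X ⊆ Y → Ok Y c → Ok X c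
Ok-⊆ {m = zero} f o = ok₀
Ok-⊆ {m = suc m} f (ok₊ a b o) = ok₊ a (λ w g → b w (g ∘ good-⊆ f)) λ w → Ok-⊆ (∷-mono (∷-mono f)) (o w)

Ok-ι : ∀ {X} (a b : Fin n) {c : Chain n (suc m)} → Ok X c → Ok (a ∷ b ∷ X) (ι (mk a b) c)
Ok-ι a b o = Ok-⊆ (ends-mk⁻ a b _) (ok-ι o (mk a b))

ι-bad : ∀ {X} {c : Chain n (suc m)} w → Ok X c → ¬ Good X w → ι w c ≈ zeroC
ι-bad w o = ok-bad o w

ι-ι : ∀ {X} {c : Chain n (suc (suc m))} w v → Ok X c → ι w (ι v c) ≈ (-C ι v (ι w c))
ι-ι w v o τ = ok-alt o v w τ

∂-ι : ∀ {X} {c : Chain n (suc (suc m))} w → Ok X c → ∂ (ι w c) ≈ (-C ι w (∂ c))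
∂-ι {n = n} w o τ = trans (sumP-cong n λ v → ι-ι v w o τ) (sumP-neg n _)

-- Exchanging the two summation edges shows that the double boundary equals its own negative, and 2
-- is invertible modulo 3.
∂∂ : ∀ {X} {c : Chain n (suc (suc m))} → Ok X c → ∂ (∂ c) ≈ zeroC
∂∂ {n = n} {c = c} (ok₊ a _ _) τ = a≡-a⇒0 _ (begin
  sumP n (λ w → sumP n λ v → c (v ∷ w ∷ τ)) ≡⟨ sumP-cong n (λ w → trans (sumP-cong n λ v → a v w τ) (sumP-neg n _)) ⟩
  sumP n (λ w → - sumP n λ v → c (w ∷ v ∷ τ)) ≡⟨ sumP-neg n _ ⟩
  - sumP n (λ w → sumP n λ v → c (w ∷ v ∷ τ)) ≡⟨ cong -_ (sumP-swap n _) ⟩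
  - sumP n (λ w → sumP n λ v → c (v ∷ w ∷ τ)) ∎)
  where open ≡-Reasoning

-- The simplices of c avoid e, so the correction term `e ∧ ι e c` of the antiderivation rule is
-- zero.
∧-self : ∀ {X} (e : Pair n) {c : Chain n (suc m)} → Ok (ends e X) c → ι e (e ∧ c) ≈ c
∧-self e {c} o τ = trans (cong₂ (λ x y → x + (- y)) (sel-yes (e ≟P e) refl _)
    (zero≈ (∧-linear e) (ι-bad e o λ g → proj₁ (proj₂ g) (here refl)) τ))
  (solve 1 (λ x → x :+ (:- :0) := x) refl (c τ))

ι-∧ : ∀ (e w : Pair n) (c : Chain n (suc m)) → e ≢ w → ι w (e ∧ c) ≈ (-C (e ∧ ι w c))
ι-∧ e w c ne τ = trans (cong (_+ (- (e ∧ ι w c) τ)) (sel-no (e ≟P w) ne _)) (+-identityˡ _)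

Ok-∧ : ∀ {X} {e : Pair n} {c : Chain n m} → Good X e → Ok (ends e X) c → Ok X (e ∧ c)
Ok-∧ {m = zero} {X} {e} {c} g o = ok₊ tt (λ w ng τ → sel-no (e ≟P w) (λ { refl → ng g }) _) λ w → ok₀
Ok-∧ {n = n} {m = suc m} {X} {e} {c} g o@(ok₊ a b os) = ok₊ (alt m c a) bad sub'
  where
  alt : ∀ m (c : Chain n (suc m)) → AltHead c → AltHead (e ∧ c)
  alt zero c a w v τ = solve 2 (λ x y → x :+ (:- y) := :- (y :+ (:- x))) refl (sel (e ≟P w) (c (v ∷ τ))) _
  alt (suc m) c a w v τ = trans
    (cong (λ y → sel (e ≟P w) (c (v ∷ τ)) + (- (sel (e ≟P v) (c (w ∷ τ)) + (- y))))
      (trans (resp (∧-linear e) {d = -C ι w (ι v c)} (λ σ → a w v σ) τ) (neg (∧-linear e) (ι w (ι v c)) τ)))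
    (solve 3 (λ x y z → x :+ (:- (y :+ (:- (:- z)))) := :- (y :+ (:- (x :+ (:- z))))) refl
      (sel (e ≟P w) (c (v ∷ τ))) (sel (e ≟P v) (c (w ∷ τ))) ((e ∧ ι w (ι v c)) τ))
  bad : ∀ w → ¬ Good X w → ι w (e ∧ c) ≈ zeroC
  bad w ng τ = trans (ι-∧ e w c (λ { refl → ng g }) τ)
    (trans (cong -_ (zero≈ (∧-linear e) (b w (ng ∘ good-⊆ (there ∘ there))) τ)) neg-0)
  sub' : ∀ w → Ok (ends w X) (ι w (e ∧ c))
  sub' w with e ≟P w
  ... | yes refl = Ok-≈ (≈-sym (λ τ → trans (cong (λ y → c τ + (- y)) (zero≈ (∧-linear e) (ι-bad e o λ g → proj₁ (proj₂ g) (here refl)) τ))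
        (solve 1 (λ x → x :+ (:- :0) := x) refl (c τ)))) o
  ... | no ne with good? (ends w X) e
  ...   | yes ge = Ok-≈ (≈-sym (λ τ → +-identityˡ _)) (Ok-neg (Ok-∧ ge
            (Ok-⊆ (∷⊆ (there (there (here refl))) (∷⊆ (there (there (there (here refl))))
              (∷⊆ (here refl) (∷⊆ (there (here refl)) (there ∘ there ∘ there ∘ there))))) (os w))))
  -- Here e differs from w but meets it. The simplices of c avoid both ends of e, so none of them
  -- contains w.
  ...   | no ng = Ok-≈0 (λ τ → trans (+-identityˡ _) (trans (cong -_ (zero≈ (∧-linear e)
            (b w (λ gw → ng (proj₁ g ,
              (λ { (here eq) → proj₁ (proj₂ gw) (here (sym eq)) ; (there (here eq)) → proj₂ (proj₂ gw) (here (sym eq))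
                 ; (there (there i)) → proj₁ (proj₂ g) i }) ,
              (λ { (here eq) → proj₁ (proj₂ gw) (there (here (sym eq))) ; (there (here eq)) → proj₂ (proj₂ gw) (there (here (sym eq)))
                 ; (there (there i)) → proj₂ (proj₂ g) i })))) τ)) neg-0))

Ok-mk∧ : ∀ {X} {a b : Fin n} {c : Chain n m} → a ≢ b → a ∉ X → b ∉ X → Ok (a ∷ b ∷ X) c → Ok X (mk a b ∧ c)
Ok-mk∧ ne p q o = Ok-∧ (good-mk ne p q) (Ok-⊆ (ends-mk⁺ _ _ _) o)

-- Splitting a chain at a vertex

link : Fin n → Chain n (suc m) → Chain n (suc m)
link {n} v z = ΣC n λ a → mk v a ∧ ι (mk v a) z

-- A matching has at most one edge at v, so `link v z` collects every simplex through v exactly once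
-- and this is the part of z that misses v.
avoid : Fin n → Chain n (suc m) → Chain n (suc m)
avoid v z = z -C link v z

Ok-link : ∀ {X} v {z : Chain n (suc m)} → Ok X z → ∀ a → Ok X (mk v a ∧ ι (mk v a) z)
Ok-link {X = X} v {z} o a with good? X (mk v a)
... | yes g = Ok-∧ g (ok-ι o (mk v a))
... | no ng = Ok-≈0 (zero≈ (∧-linear (mk v a)) (ι-bad (mk v a) o ng))

private
  head∈ : ∀ (v a : Fin n) → v ∈ ends (mk v a) []
  head∈ v a = ends-mk⁻ v a [] (here refl)

-- Two different edges at v meet, so in the sum defining the link only the term of a₀ survives
-- contraction with va₀, and it cancels z.
avoid-at : ∀ {X} v a₀ {z : Chain n (suc m)} → Ok X z → v ≢ a₀ → ι (mk v a₀) (avoid v z) ≈ zeroC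
avoid-at {n = n} {m = m} {X} v a₀ {z} o v≢a₀ τ = begin
  z (mk v a₀ ∷ τ) + (- sum n (λ a → (mk v a ∧ ι (mk v a) z) (mk v a₀ ∷ τ)))
    ≡⟨ cong (λ x → z (mk v a₀ ∷ τ) + (- x)) (trans (sum-cong n (λ a → term m z o a τ))
         (trans (sum-single n a₀ λ a ne → sel-no (mk v a ≟P mk v a₀) (ne ∘ mk-injʳ) _)
           (sel-yes (mk v a₀ ≟P mk v a₀) refl _))) ⟩
  z (mk v a₀ ∷ τ) + (- z (mk v a₀ ∷ τ)) ≡⟨ neg-inverseʳ _ ⟩
  0₃ ∎
  where
  open ≡-Reasoning
  term : ∀ m (z : Chain n (suc m)) → Ok X z → ∀ a τ →
    (mk v a ∧ ι (mk v a) z) (mk v a₀ ∷ τ) ≡ sel (mk v a ≟P mk v a₀) (z (mk v a ∷ τ))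
  term zero z o a τ = refl
  term (suc m) z o a τ = trans (cong (λ y → sel (mk v a ≟P mk v a₀) (z (mk v a ∷ τ)) + (- y))
      (zero≈ (∧-linear (mk v a)) (ι-bad (mk v a₀) (ok-ι o (mk v a))
        (bad-meets (mk v a₀) (mk v a) (head∈ v a₀) (head∈ v a))) τ))
    (solve 1 (λ x → x :+ (:- :0) := x) refl _)

-- Induction on the dimension: removing the part through v commutes with contraction at an edge that
-- misses v, the two signs from passing va cancelling.
Ok-avoid : ∀ {X} v {z : Chain n (suc m)} → v ∉ X → Ok X z → Ok (v ∷ X) (avoid v z)
Ok-avoid {n = n} {m = m} {X} v {z} v∉ o = ok₊ (ok-alt whole) bad (rest m z o bad)
  where
  whole : Ok X (avoid v z)
  whole = Ok-sub o (Ok-Σ n (Ok-link v o))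
  bad : ∀ w → ¬ Good (v ∷ X) w → ι w (avoid v z) ≈ zeroC
  bad w ng with good? X w
  ... | no ng' = ι-bad w whole ng'
  ... | yes (e , p , q) with v ∈? ends w []
  ...   | no v∉w = ⊥-elim (ng (e , ∉-∷ (v∉w ∘ here ∘ sym) p , ∉-∷ (v∉w ∘ there ∘ here ∘ sym) q))
  ...   | yes v∈w with edge-at e v∈w
  ...     | a , ne , eq = subst (λ w → ι w (avoid v z) ≈ zeroC) (sym eq) (avoid-at v a o (ne ∘ sym))
  rest : ∀ m (z : Chain n (suc m)) → Ok X z → (∀ w → ¬ Good (v ∷ X) w → ι w (avoid v z) ≈ zeroC) →
    ∀ w → Ok (ends w (v ∷ X)) (ι w (avoid v z))
  rest zero z o bad w = ok₀
  rest (suc m) z o bad w with good? (v ∷ X) w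
  ... | no ng = Ok-≈0 (bad w ng)
  ... | yes g@(e , p , q) = Ok-≈ (≈-sym comm) (Ok-⊆ (∷⊆ (there (here refl)) (∷⊆ (there (there (here refl)))
          (∷⊆ (here refl) (there ∘ there ∘ there))))
        (Ok-avoid v (∉-∷ (p ∘ here ∘ sym) (∉-∷ (q ∘ here ∘ sym) v∉)) (ok-ι o w)))
    where
    comm : ι w (avoid v z) ≈ avoid v (ι w z)
    comm τ = cong (λ x → z (w ∷ τ) + (- x)) (sum-cong n λ a → begin
      (mk v a ∧ ι (mk v a) z) (w ∷ τ) ≡⟨ ι-∧ (mk v a) w (ι (mk v a) z) (λ { refl → good-mk⁻ v a g .proj₂ .proj₁ (here refl) }) τ ⟩
      - (mk v a ∧ ι w (ι (mk v a) z)) τ ≡⟨ cong -_ (resp (∧-linear (mk v a)) {c = ι w (ι (mk v a) z)} {d = -C ι (mk v a) (ι w z)} (ι-ι w (mk v a) o) τ) ⟩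
      - (mk v a ∧ (-C ι (mk v a) (ι w z))) τ ≡⟨ cong -_ (neg (∧-linear (mk v a)) _ τ) ⟩
      - (- (mk v a ∧ ι (mk v a) (ι w z)) τ) ≡⟨ neg-involutive _ ⟩
      (mk v a ∧ ι (mk v a) (ι w z)) τ ∎)
      where open ≡-Reasoning

-- Cycles, boundaries and spans of homology classes

record Zc {n m} (X : List (Fin n)) (c : Chain n m) : Set where
  constructor zc
  field
    ok  : Ok X c
    cyc : Cycle c
open Zc public

data Bd {n m} (X : List (Fin n)) (c : Chain n m) : Set where
  bd : (b : Chain n (suc m)) → Ok X b → c ≈ ∂ b → Bd X c

-- The subgroup generated by G modulo boundaries. Over ℤ/3 sums and negatives give all linear
-- combinations, so no coefficients are stored; `multiple` and `coefficients` recover them later.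
data Sp {n m} (X : List (Fin n)) (G : Chain n m → Set) : Chain n m → Set where
  gen   : ∀ {c} → G c → Sp X G c
  bound : ∀ {c} → Bd X c → Sp X G c
  sp+   : ∀ {c d} → Sp X G c → Sp X G d → Sp X G (c +C d)
  sp-   : ∀ {c} → Sp X G c → Sp X G (-C c)
  sp≈   : ∀ {c d} → c ≈ d → Sp X G c → Sp X G d

Triv : List (Fin n) → ℕ → Set
Triv {n} X m = ∀ (c : Chain n m) → Zc X c → Bd X c

cycle-≈ : {c d : Chain n m} → c ≈ d → Cycle c → Cycle d
cycle-≈ h cyc₀ = cyc₀
cycle-≈ h (cyc₊ e) = cyc₊ (≈-trans (resp ∂-linear (≈-sym h)) e)

cycle-0 : Cycle (zeroC {n} {m})
cycle-0 {m = zero} = cyc₀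
cycle-0 {m = suc m} = cyc₊ (zer ∂-linear)

cycle-+ : {c d : Chain n m} → Cycle c → Cycle d → Cycle (c +C d)
cycle-+ cyc₀ cyc₀ = cyc₀
cycle-+ {c = c} {d} (cyc₊ e) (cyc₊ f) = cyc₊ λ τ → trans (add ∂-linear c d τ)
  (trans (cong₂ _+_ (e τ) (f τ)) (+-identityˡ 0₃))

cycle-neg : {c : Chain n m} → Cycle c → Cycle (-C c)
cycle-neg cyc₀ = cyc₀
cycle-neg {c = c} (cyc₊ e) = cyc₊ λ τ → trans (neg ∂-linear c τ) (trans (cong -_ (e τ)) neg-0)

cycle-∂ : ∀ {X} {c : Chain n (suc m)} → Ok X c → Cycle (∂ c)
cycle-∂ {m = zero} o = cyc₀
cycle-∂ {m = suc m} o = cyc₊ (∂∂ o)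

zc-≈ : ∀ {X} {c d : Chain n m} → c ≈ d → Zc X c → Zc X d
zc-≈ h (zc o c) = zc (Ok-≈ h o) (cycle-≈ h c)

zc-0 : ∀ {X} → Zc X (zeroC {n} {m})
zc-0 = zc Ok-0 cycle-0

zc-+ : ∀ {X} {c d : Chain n m} → Zc X c → Zc X d → Zc X (c +C d)
zc-+ (zc o c) (zc o' c') = zc (Ok-+ o o') (cycle-+ c c')

zc-neg : ∀ {X} {c : Chain n m} → Zc X c → Zc X (-C c)
zc-neg (zc o c) = zc (Ok-neg o) (cycle-neg c)

zc-sub : ∀ {X} {c d : Chain n m} → Zc X c → Zc X d → Zc X (c -C d)
zc-sub z z' = zc-+ z (zc-neg z')

zc-Σ : ∀ {X} k {f : Fin k → Chain n m} → (∀ i → Zc X (f i)) → Zc X (ΣC k f)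
zc-Σ zero h = zc-≈ (≈-sym (λ τ → sum-zero _)) zc-0
zc-Σ (suc k) {f} h = zc-≈ (≈-sym (ΣC-suc f)) (zc-+ (h #0) (zc-Σ k (h ∘ Fin.suc)))

zc-⊆ : ∀ {X Y} {c : Chain n m} → X ⊆ Y → Zc Y c → Zc X c
zc-⊆ f (zc o c) = zc (Ok-⊆ f o) c

zc-ι : ∀ {X} a b {c : Chain n (suc m)} → Zc X c → Zc (a ∷ b ∷ X) (ι (mk a b) c)
zc-ι {m = zero} a b (zc o _) = zc ok₀ cyc₀
zc-ι {m = suc m} a b {c} (zc o (cyc₊ e)) = zc (Ok-ι a b o)
  (cyc₊ λ τ → trans (∂-ι (mk a b) o τ) (trans (cong -_ (e (mk a b ∷ τ))) neg-0))

bd-≈ : ∀ {X} {c d : Chain n m} → c ≈ d → Bd X c → Bd X d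
bd-≈ h (bd b o e) = bd b o (≈-trans (≈-sym h) e)

bd-0 : ∀ {X} → Bd X (zeroC {n} {m})
bd-0 = bd zeroC Ok-0 (≈-sym (zer ∂-linear))

bd-+ : ∀ {X} {c d : Chain n m} → Bd X c → Bd X d → Bd X (c +C d)
bd-+ (bd b o e) (bd b' o' e') = bd (b +C b') (Ok-+ o o')
  λ τ → trans (cong₂ _+_ (e τ) (e' τ)) (sym (add ∂-linear b b' τ))

bd-neg : ∀ {X} {c : Chain n m} → Bd X c → Bd X (-C c)
bd-neg (bd b o e) = bd (-C b) (Ok-neg o) λ τ → trans (cong -_ (e τ)) (sym (neg ∂-linear b τ))

bd-⊆ : ∀ {X Y} {c : Chain n m} → X ⊆ Y → Bd Y c → Bd X c
bd-⊆ f (bd b o e) = bd b (Ok-⊆ f o) e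

infix 4 _~[_]_
record _~[_]_ {n m} (c : Chain n m) (X : List (Fin n)) (d : Chain n m) : Set where
  constructor hom
  field
    bdy : Bd X (c -C d)
open _~[_]_ public

~-⊆ : ∀ {X Y} {c d : Chain n m} → X ⊆ Y → c ~[ Y ] d → c ~[ X ] d
~-⊆ f (hom b) = hom (bd-⊆ f b)

≈⇒~ : ∀ {X} {c d : Chain n m} → c ≈ d → c ~[ X ] d
≈⇒~ {d = d} h = hom (bd-≈ (λ τ → sym (trans (cong (_+ (- d τ)) (h τ)) (neg-inverseʳ _))) bd-0)

~-trans : ∀ {X} {c d e : Chain n m} → c ~[ X ] d → d ~[ X ] e → c ~[ X ] e
~-trans {c = c} {d} {e} (hom h) (hom g) = hom (bd-≈
  (λ τ → solve 3 (λ c d e → (c :+ (:- d)) :+ (d :+ (:- e)) := c :+ (:- e)) refl (c τ) (d τ) (e τ)) (bd-+ h g))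

sp-~ : ∀ {X G} {c d : Chain n m} → c ~[ X ] d → Sp X G d → Sp X G c
sp-~ {c = c} {d} (hom h) s = sp≈ (λ τ → solve 2 (λ c d → (c :+ (:- d)) :+ d := c) refl (c τ) (d τ)) (sp+ (bound h) s)

sp-0 : ∀ {X G} {c : Chain n m} → c ≈ zeroC → Sp X G c
sp-0 h = bound (bd-≈ (≈-sym h) bd-0)

sp-sub : ∀ {X G} {c d : Chain n m} → Sp X G c → Sp X G d → Sp X G (c -C d)
sp-sub s t = sp+ s (sp- t)

sp-Σ : ∀ {X G} k {f : Fin k → Chain n m} → (∀ i → Sp X G (f i)) → Sp X G (ΣC k f)
sp-Σ zero h = sp-0 (λ τ → sum-zero _)
sp-Σ (suc k) {f} h = sp≈ (≈-sym (ΣC-suc f)) (sp+ (h #0) (sp-Σ k (h ∘ Fin.suc)))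

sp-map : ∀ {X Y G G'} {f : Chain n m → Chain n k} → Linear f → (∀ {c} → Bd X c → Bd Y (f c)) →
  (∀ {c} → G c → Sp Y G' (f c)) → ∀ {c} → Sp X G c → Sp Y G' (f c)
sp-map L B h (gen g) = h g
sp-map L B h (bound b) = bound (B b)
sp-map L B h (sp+ s t) = sp≈ (≈-sym (add L _ _)) (sp+ (sp-map L B h s) (sp-map L B h t))
sp-map L B h (sp- s) = sp≈ (≈-sym (neg L _)) (sp- (sp-map L B h s))
sp-map L B h (sp≈ e s) = sp≈ (resp L e) (sp-map L B h s)

sp-bind : ∀ {X Y G G'} → X ⊆ Y → (∀ {c : Chain n m} → G c → Sp X G' c) → ∀ {c} → Sp Y G c → Sp X G' c
sp-bind f h (gen g) = h g
sp-bind f h (bound b) = bound (bd-⊆ f b)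
sp-bind f h (sp+ s t) = sp+ (sp-bind f h s) (sp-bind f h t)
sp-bind f h (sp- s) = sp- (sp-bind f h s)
sp-bind f h (sp≈ e s) = sp≈ e (sp-bind f h s)

-- Stars: the difference of two edges at a vertex times a chain

star : Fin n → Fin n → Fin n → Chain n m → Chain n (suc m)
star v a b c = (mk v a ∧ c) -C (mk v b ∧ c)

star-linear : ∀ (v a b : Fin n) → Linear {n} {m} (star v a b)
star-linear v a b = -linear (∧-linear _) (∧-linear _)

∂-star : ∀ (v a b : Fin n) (c : Chain n (suc m)) → ∂ (star v a b c) ≈ (-C star v a b (∂ c))
∂-star v a b c τ = trans (sub ∂-linear (mk v a ∧ c) (mk v b ∧ c) τ)
  (trans (cong₂ (λ x y → x + (- y)) (∂-∧ (mk v a) c τ) (∂-∧ (mk v b) c τ))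
    (solve 3 (λ c x y → (c :+ (:- x)) :+ (:- (c :+ (:- y))) := :- (x :+ (:- y))) refl (c τ) _ _))

∂-star-cycle : ∀ (v a b : Fin n) {c : Chain n m} → Cycle c → ∂ (star v a b c) ≈ zeroC
∂-star-cycle v a b {c} h τ = trans (sub ∂-linear (mk v a ∧ c) (mk v b ∧ c) τ)
  (trans (cong₂ (λ x y → x + (- y)) (∂-∧-cycle (mk v a) h τ) (∂-∧-cycle (mk v b) h τ)) (neg-inverseʳ _))

record Distinct3 {n} (X : List (Fin n)) (v a b : Fin n) : Set where
  constructor d3
  field
    va : v ≢ a
    vb : v ≢ b
    ab : a ≢ b
    vX : v ∉ X
    aX : a ∉ X
    bX : b ∉ X

Ok-star : ∀ {X} {v a b : Fin n} {c : Chain n m} → Distinct3 X v a b → Ok (v ∷ a ∷ b ∷ X) c → Ok X (star v a b c)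
Ok-star (d3 va vb ab vX aX bX) o = Ok-sub
  (Ok-mk∧ va vX aX (Ok-⊆ (∷-mono (∷-mono there)) o))
  (Ok-mk∧ vb vX bX (Ok-⊆ (∷-mono there) o))

zc-star : ∀ {X} {v a b : Fin n} {c : Chain n m} → Distinct3 X v a b → Zc (v ∷ a ∷ b ∷ X) c → Zc X (star v a b c)
zc-star d (zc o c) = zc (Ok-star d o) (cyc₊ (∂-star-cycle _ _ _ c))

bd-star : ∀ {X} {v a b : Fin n} {c : Chain n m} → Distinct3 X v a b → Bd (v ∷ a ∷ b ∷ X) c → Bd X (star v a b c)
bd-star {v = v} {a} {b} d (bd x o e) = bd (-C star v a b x) (Ok-neg (Ok-star d o)) λ τ →
  trans (resp (star-linear v a b) e τ) (sym (trans (neg ∂-linear (star v a b x) τ)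
    (trans (cong -_ (∂-star v a b x τ)) (neg-involutive _))))

~-star : ∀ {X} {v a b : Fin n} {c d : Chain n m} → Distinct3 X v a b → c ~[ v ∷ a ∷ b ∷ X ] d →
  star v a b c ~[ X ] star v a b d
~-star {v = v} {a} {b} {c} {d} D (hom h) = hom (bd-≈ (sub (star-linear v a b) c d) (bd-star D h))

-- Pushing a cycle off a vertex

private
  -- Makes the choice of fillings total: where va is no edge outside X the link of z is zero already
  -- and the zero chain fills it.
  fill : ∀ {X} (v : Fin n) {z : Chain n (suc m)} → v ∉ X → Ok X z →
    (∀ a → a ≢ v → a ∉ X → Bd (v ∷ a ∷ X) (ι (mk v a) z)) →
    ∀ a → Σ (Chain n (suc m)) λ b → Ok (v ∷ X) b × Ok X (mk v a ∧ b) × ι (mk v a) z ≈ ∂ b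
  fill {X = X} v {z} v∉ o h a with good? X (mk v a)
  ... | no ng = zeroC , Ok-0 , Ok-≈0 (zer (∧-linear _)) , ≈-trans (ι-bad (mk v a) o ng) (≈-sym (zer ∂-linear))
  ... | yes g with good-mk⁻ v a g
  ...   | v≢a , _ , a∉ with h a (v≢a ∘ sym) a∉
  ...     | bd b ob e = b , Ok-⊆ (∷-mono there) ob , Ok-mk∧ v≢a v∉ a∉ ob , e

-- If b_a fills the link at va, adding the boundary of the sum of the va ∧ b_a replaces each cone of
-- va over the link by b_a, which misses v.
push : ∀ {X} (v : Fin n) (z : Chain n (suc m)) → v ∉ X → Zc X z →
  (∀ a → a ≢ v → a ∉ X → Bd (v ∷ a ∷ X) (ι (mk v a) z)) →
  Σ (Chain n (suc m)) λ z' → Zc (v ∷ X) z' × (z ~[ X ] z')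
push {n} {m} {X} v z v∉ (zc o c) h = z' , zc oz' (cycle-+ c (cycle-∂ oB)) ,
  hom (bd (-C B) (Ok-neg oB) λ τ → trans (solve 2 (λ z b → z :+ (:- (z :+ b)) := :- b) refl (z τ) (∂ B τ)) (sym (neg ∂-linear B τ)))
  where
  b : Fin n → Chain n (suc m)
  b a = proj₁ (fill v v∉ o h a)
  B = ΣC n λ a → mk v a ∧ b a
  oB : Ok X B
  oB = Ok-Σ n λ a → proj₁ (proj₂ (proj₂ (fill v v∉ o h a)))
  z' = z +C ∂ B
  e : z' ≈ (avoid v z +C ΣC n b)
  e τ = begin
    z τ + ∂ B τ ≡⟨ cong (z τ +_) (sums ∂-linear n (λ a → mk v a ∧ b a) τ) ⟩
    z τ + sum n (λ a → ∂ (mk v a ∧ b a) τ) ≡⟨ cong (z τ +_) (sum-cong n λ a → ∂-∧ (mk v a) (b a) τ) ⟩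
    z τ + sum n (λ a → b a τ + (- (mk v a ∧ ∂ (b a)) τ))
      ≡⟨ cong (z τ +_) (sum-cong n λ a → cong (λ x → b a τ + (- x))
           (resp (∧-linear (mk v a)) (≈-sym (proj₂ (proj₂ (proj₂ (fill v v∉ o h a))))) τ)) ⟩
    z τ + sum n (λ a → b a τ + (- (mk v a ∧ ι (mk v a) z) τ))
      ≡⟨ cong (z τ +_) (trans (sum-+ n _ _) (cong (sum n (λ a → b a τ) +_) (sum-neg n _))) ⟩
    z τ + (sum n (λ a → b a τ) + (- link v z τ))
      ≡⟨ solve 3 (λ z b l → z :+ (b :+ (:- l)) := (z :+ (:- l)) :+ b) refl (z τ) _ _ ⟩
    avoid v z τ + sum n (λ a → b a τ) ∎
    where open ≡-Reasoning
  oz' : Ok (v ∷ X) z'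
  oz' = Ok-≈ (≈-sym e) (Ok-+ (Ok-avoid v v∉ o) (Ok-Σ n λ a → proj₁ (proj₂ (fill v v∉ o h a))))

push-triv : ∀ {X} (v : Fin n) (z : Chain n m) → v ∉ X → Zc X z →
  (∀ {m'} → m ≡ suc m' → ∀ a → a ≢ v → a ∉ X → Triv (v ∷ a ∷ X) m') →
  Σ (Chain n m) λ z' → Zc (v ∷ X) z' × (z ~[ X ] z')
push-triv {m = zero} v z v∉ Z h = z , zc ok₀ cyc₀ , ≈⇒~ ≈-refl
push-triv {m = suc m} v z v∉ Z h = push v z v∉ Z λ a ne a∉ → h refl a ne a∉ _ (zc-ι v a Z)

cone : ∀ {X} {a b : Fin n} {z : Chain n m} → a ≢ b → a ∉ X → b ∉ X → Zc (a ∷ b ∷ X) z → Bd X z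
cone {a = a} {b} {z} ne a∉ b∉ (zc o c) = bd (mk a b ∧ z) (Ok-mk∧ ne a∉ b∉ o) (≈-sym (∂-∧-cycle (mk a b) c))

-- tri m = 3 m, in a form that unfolds to successors
tri : ℕ → ℕ
tri zero = 0
tri (suc m) = 3 ℕ.+ tri m

-- Two vertices v and u are pushed off; what remains is a cycle that the edge uv cones off. The
-- second push is the tight one: the links at ua of a cycle already missing v live on three vertices
-- fewer, and 5 + 3m - 3 is exactly the bound for the previous degree.
vanish : ∀ m (X : List (Fin n)) → 2 ℕ.+ tri m ≤ size X → Triv X m
vanish zero X h z Z = cone (u∉ ∘ here ∘ sym) v∉ (u∉ ∘ there) (zc ok₀ cyc₀)
  where
  v∉ = proj₂ (fresh X h)
  u∉ = proj₂ (fresh (proj₁ (fresh X h) ∷ X) (≤-size-∷ v∉ h))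
vanish {n} (suc m) X h z Z =
  let v , v∉ = fresh X h
      hᵥ = ≤-size-∷ v∉ h
      u , u∉ = fresh (v ∷ X) hᵥ
      z₁ , Z₁ , e₁ = push v z v∉ Z λ a ne a∉ →
        vanish m _ (ℕₚ.≤-trans (ℕₚ.n≤1+n _) (≤-size-∷ (∉-∷ (ne ∘ sym) v∉) (≤-size-∷ a∉ h))) _ (zc-ι v a Z)
      z₂ , Z₂ , e₂ = push u z₁ u∉ Z₁ λ a ne a∉ →
        vanish m _ (≤-size-∷ (∉-∷ (ne ∘ sym) u∉) (≤-size-∷ a∉ hᵥ)) _ (zc-ι u a Z₁)
  in bd-≈ (λ τ → solve 3 (λ x y z → (x :+ (:- y)) :+ ((y :+ (:- z)) :+ z) := x) refl (z τ) (z₁ τ) (z₂ τ))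
       (bd-+ (bdy e₁) (bd-+ (bd-⊆ there (bdy e₂)) (cone (u∉ ∘ here) (u∉ ∘ there) v∉ Z₂)))

-- Generation by stars

data Star {n m} (u v : Fin n) (X : List (Fin n)) : Chain n (suc m) → Set where
  star₁ : ∀ a y → a ∉ u ∷ v ∷ X → Zc (a ∷ u ∷ v ∷ X) y → Star u v X (star u a v y)
  star₂ : ∀ a y → a ∉ u ∷ v ∷ X → Zc (a ∷ u ∷ v ∷ X) y → Star u v X (star v a u y)

-- A cycle is first made free of simplices through u a and v b with a, b ∉ {u, v};
-- what is left over is a sum of stars plus the boundary of a cone over u v.
module _ {n m} {X : List (Fin n)} {u v : Fin n} (u∉ : u ∉ X) (v∉ : v ∉ X) (u≢v : u ≢ v)
  (z : Chain n (suc m)) (Z : Zc X z)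
  (y : Fin n → Chain n m) (b : Fin n → Chain n (suc m))
  (Y : ∀ a → (a ∉ u ∷ v ∷ X × Zc (a ∷ u ∷ v ∷ X) (y a)) ⊎ (y a ≈ zeroC))
  (ob : ∀ a → Ok (u ∷ X) (b a)) (oub : ∀ a → Ok X (mk u a ∧ b a))
  (eq : ∀ a → a ≢ v → ι (mk u a) z ≈ (y a +C ∂ (b a)))
  (y-v : y v ≈ zeroC) (b-v : b v ≈ zeroC) where

  private
    B : Chain n (suc (suc m))
    B = ΣC n λ a → mk u a ∧ b a
    u₀ w : Chain n m
    s R s' : Chain n (suc m)
    u₀ = ι (mk u v) z
    w = u₀ +C ΣC n y
    s = avoid u z +C ΣC n b
    sy : Chain n (suc m)
    sy = ΣC n λ a → star u a v (y a)
    R = (z +C ∂ B) -C sy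
    q : Fin n → Chain n m
    q b = ι (mk v b) s
    sq : Chain n (suc m)
    sq = ΣC n λ b → star v b u (q b)
    s' = avoid v s

    oB : Ok X B
    oB = Ok-Σ n oub

    Zy : ∀ a → Zc (u ∷ v ∷ X) (y a)
    Zy a with Y a
    ... | inj₁ (_ , za) = zc-⊆ there za
    ... | inj₂ e = zc-≈ (≈-sym e) zc-0

    Zw : Zc (u ∷ v ∷ X) w
    Zw = zc-+ (zc-ι u v Z) (zc-Σ n Zy)

    os : Ok (u ∷ X) s
    os = Ok-+ (Ok-avoid u u∉ (ok Z)) (Ok-Σ n ob)

    sy-star : ∀ a → Star u v X (star u a v (y a)) ⊎ (star u a v (y a) ≈ zeroC)
    sy-star a with Y a
    ... | inj₁ (a∉ , za) = inj₁ (star₁ a (y a) a∉ za)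
    ... | inj₂ e = inj₂ (zero≈ (star-linear u a v) e)

    link-eq : ∀ a τ → (mk u a ∧ ι (mk u a) z) τ ≡
      ((mk u a ∧ y a) τ + (mk u a ∧ ∂ (b a)) τ) + sel (a Finₚ.≟ v) ((mk u v ∧ u₀) τ)
    link-eq a τ with a Finₚ.≟ v
    ... | no ne = trans (resp (∧-linear (mk u a)) (eq a ne) τ)
          (trans (add (∧-linear (mk u a)) (y a) (∂ (b a)) τ) (sym (+-identityʳ _)))
    ... | yes refl = trans (sym (+-identityˡ _)) (cong (_+ (mk u v ∧ u₀) τ)
          (sym (trans (cong₂ _+_ (zero≈ (∧-linear (mk u v)) y-v τ)
                 (zero≈ (∧-linear (mk u v)) (zero≈ ∂-linear b-v) τ)) (+-identityˡ _))))

    -- Once the links at the ua are replaced by the fillings and the stars are subtracted, the edge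
    -- uv is the only edge at u that remains. Its coefficient w collects the original link at uv and
    -- the uv-parts of all subtracted stars.
    R-eq : R ≈ ((mk u v ∧ w) +C s)
    R-eq τ = begin
      (z τ + ∂ B τ) + (- sy τ)
        ≡⟨ cong₂ (λ x y → (z τ + x) + (- y)) ∂B-eq sy-eq ⟩
      (z τ + (Sb + (- Sd))) + (- (Sy + (- Sv)))
        ≡⟨ solve 6 (λ z b d y v u → (z :+ (b :+ (:- d))) :+ (:- (y :+ (:- v))) :=
             (u :+ v) :+ ((z :+ (:- ((y :+ d) :+ u))) :+ b)) refl (z τ) Sb Sd Sy Sv U ⟩
      (U + Sv) + ((z τ + (- ((Sy + Sd) + U))) + Sb)
        ≡⟨ cong₂ (λ x y → x + ((z τ + (- y)) + Sb)) (sym w-eq) (sym l-eq) ⟩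
      (mk u v ∧ w) τ + s τ ∎
      where
      open ≡-Reasoning
      Sb Sd Sy Sv U : F3
      Sb = sum n λ a → b a τ
      Sd = sum n λ a → (mk u a ∧ ∂ (b a)) τ
      Sy = sum n λ a → (mk u a ∧ y a) τ
      Sv = sum n λ a → (mk u v ∧ y a) τ
      U = (mk u v ∧ u₀) τ
      ∂B-eq : ∂ B τ ≡ Sb + (- Sd)
      ∂B-eq = trans (sums ∂-linear n (λ a → mk u a ∧ b a) τ) (trans (sum-cong n λ a → ∂-∧ (mk u a) (b a) τ)
        (trans (sum-+ n _ _) (cong (Sb +_) (sum-neg n _))))
      sy-eq : sy τ ≡ Sy + (- Sv)
      sy-eq = trans (sum-+ n _ _) (cong (Sy +_) (sum-neg n _))
      w-eq : (mk u v ∧ w) τ ≡ U + Sv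
      w-eq = trans (add (∧-linear (mk u v)) u₀ (ΣC n y) τ) (cong (U +_) (sums (∧-linear (mk u v)) n y τ))
      l-eq : link u z τ ≡ (Sy + Sd) + U
      l-eq = trans (sum-cong n λ a → link-eq a τ) (trans (sum-+ n _ _)
        (cong₂ _+_ (sum-+ n _ _) (trans (sum-single n v λ a ne → sel-no (a Finₚ.≟ v) ne _) (sel-yes (v Finₚ.≟ v) refl _))))

    R-cycle : ∂ R ≈ zeroC
    R-cycle τ = trans (sub ∂-linear (z +C ∂ B) sy τ) (trans (cong₂ (λ x y → x + (- y))
        (trans (add ∂-linear z (∂ B) τ) (cong₂ _+_ (z-cyc (cyc Z) τ) (∂∂ oB τ)))
        (trans (sums ∂-linear n (λ a → star u a v (y a)) τ) (sum-0 n λ a → ∂-star-cycle u a v (cyc (Zy a)) τ)))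
      (solve 0 ((:0 :+ :0) :+ (:- :0) := :0) refl))
      where
      z-cyc : Cycle z → ∂ z ≈ zeroC
      z-cyc (cyc₊ e) = e

    ∂s : ∂ s ≈ (-C w)
    ∂s τ = a+b≡0⇒b≡-a (w τ) _ (trans (cong (_+ ∂ s τ) (sym (∂-∧-cycle (mk u v) (cyc Zw) τ)))
      (trans (sym (add ∂-linear (mk u v ∧ w) s τ)) (trans (resp ∂-linear (≈-sym R-eq) τ) (R-cycle τ))))

    -- The link of s at vb is a cycle although s is not one: the boundary of s is -w, and w misses
    -- v.
    q-good : ∀ b → (b ∉ u ∷ v ∷ X × Zc (b ∷ u ∷ v ∷ X) (q b)) ⊎ (q b ≈ zeroC)
    q-good b with good? (u ∷ X) (mk v b)
    ... | no ng = inj₂ (ι-bad (mk v b) os ng)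
    ... | yes g with good-mk⁻ v b g
    ...   | v≢b , _ , b∉ = inj₁ (∉-∷ (b∉ ∘ here) (∉-∷ (v≢b ∘ sym) (b∉ ∘ there)) ,
            zc (Ok-⊆ perm (Ok-ι v b os)) (cy m s os Zw ∂s))
      where
      perm : b ∷ u ∷ v ∷ X ⊆ v ∷ b ∷ u ∷ X
      perm = ∷⊆ (there (here refl)) (∷⊆ (there (there (here refl))) (∷⊆ (here refl) (there ∘ there ∘ there)))
      cy : ∀ m {w : Chain n m} (s : Chain n (suc m)) → Ok (u ∷ X) s → Zc (u ∷ v ∷ X) w → ∂ s ≈ (-C w) → Cycle (ι (mk v b) s)
      cy zero s os zw e = cyc₀
      cy (suc m) {w} s os zw e = cyc₊ λ τ → trans (∂-ι (mk v b) os τ) (trans (cong -_ (trans (e (mk v b ∷ τ))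
        (cong -_ (ι-bad (mk v b) (ok zw) (λ g → good-mk⁻ v b g .proj₂ .proj₁ (there (here refl))) τ))))
        (neg-involutive 0₃))

    q-cycle : ∀ b → Cycle (q b)
    q-cycle b with q-good b
    ... | inj₁ (_ , zq) = cyc zq
    ... | inj₂ e = cycle-≈ (≈-sym e) cycle-0

    os' : Ok (u ∷ v ∷ X) s'
    os' = Ok-⊆ (∷⊆ (there (here refl)) (∷⊆ (here refl) (there ∘ there))) (Ok-avoid v (∉-∷ (u≢v ∘ sym) v∉) os)

    sq-star : ∀ b → Star u v X (star v b u (q b)) ⊎ (star v b u (q b) ≈ zeroC)
    sq-star b with q-good b
    ... | inj₁ (b∉ , zb) = inj₁ (star₂ b (q b) b∉ zb)
    ... | inj₂ e = inj₂ (zero≈ (star-linear v b u) e)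

    -- Subtracting the stars at v makes s miss v too. The coefficient of uv is then minus the
    -- boundary of `s'`, so the cone of uv over `s'` bounds the whole remainder.
    R-sq : (R -C sq) ≈ ∂ (mk u v ∧ s')
    R-sq τ = begin
      R τ + (- sq τ) ≡⟨ cong₂ (λ x y → x + (- y)) (R-eq τ) sq-eq ⟩
      ((mk u v ∧ w) τ + s τ) + (- (L + (- Q)))
        ≡⟨ solve 4 (λ w s l q → (w :+ s) :+ (:- (l :+ (:- q))) := (s :+ (:- l)) :+ (:- (:- (w :+ q)))) refl _ (s τ) L Q ⟩
      s' τ + (- (- ((mk u v ∧ w) τ + Q)))
        ≡⟨ cong (λ x → s' τ + (- (- x))) (trans (cong ((mk u v ∧ w) τ +_) (sym Q-eq)) (sym (add (∧-linear (mk u v)) w (ΣC n q) τ))) ⟩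
      s' τ + (- (- (mk u v ∧ (w +C ΣC n q)) τ)) ≡⟨ cong (λ x → s' τ + (- x)) (sym (neg (∧-linear (mk u v)) (w +C ΣC n q) τ)) ⟩
      s' τ + (- (mk u v ∧ (-C (w +C ΣC n q))) τ)
        ≡⟨ cong (λ x → s' τ + (- x)) (resp (∧-linear (mk u v)) (≈-sym ∂s') τ) ⟩
      s' τ + (- (mk u v ∧ ∂ s') τ) ≡⟨ ∂-∧ (mk u v) s' τ ⟨
      ∂ (mk u v ∧ s') τ ∎
      where
      open ≡-Reasoning
      L Q : F3
      L = sum n λ b → (mk v b ∧ q b) τ
      Q = sum n λ b → (mk v u ∧ q b) τ
      sq-eq : sq τ ≡ L + (- Q)
      sq-eq = trans (sum-+ n _ _) (cong (L +_) (sum-neg n _))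
      Q-eq : (mk u v ∧ ΣC n q) τ ≡ Q
      Q-eq = trans (sums (∧-linear (mk u v)) n q τ) (cong (λ e → sum n λ b → (e ∧ q b) τ) (mk-sym u v))
      ∂s' : ∂ s' ≈ (-C (w +C ΣC n q))
      ∂s' σ = trans (sub ∂-linear s (link v s) σ) (trans (cong₂ (λ x y → x + (- y)) (∂s σ)
          (trans (sums ∂-linear n (λ b → mk v b ∧ q b) σ) (sum-cong n λ b → ∂-∧-cycle (mk v b) (q-cycle b) σ)))
        (solve 2 (λ w q → (:- w) :+ (:- q) := :- (w :+ q)) refl (w σ) _))

  stars-span : Sp X (Star u v X) z
  stars-span = sp-~ (hom (bd ((mk u v ∧ s') -C B) (Ok-sub (Ok-mk∧ u≢v u∉ v∉ os') oB) λ τ →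
      trans (solve 4 (λ z b y q → z :+ (:- (y :+ q)) := (((z :+ b) :+ (:- y)) :+ (:- q)) :+ (:- b)) refl (z τ) (∂ B τ) (sy τ) (sq τ))
        (trans (cong (_+ (- ∂ B τ)) (R-sq τ)) (sym (sub ∂-linear (mk u v ∧ s') B τ)))))
    (sp+ (sp-Σ n λ a → [ gen , sp-0 ]′ (sy-star a)) (sp-Σ n λ b → [ gen , sp-0 ]′ (sq-star b)))

-- Case where the links along u have been pushed off v
star-generation : ∀ {X : List (Fin n)} {u v : Fin n} → u ∉ X → v ∉ X → u ≢ v →
  (z : Chain n (suc m)) → Zc X z →
  (∀ a → a ∉ u ∷ v ∷ X → Σ (Chain n m) λ y → Zc (a ∷ u ∷ v ∷ X) y × (ι (mk u a) z ~[ u ∷ a ∷ X ] y)) →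
  Sp X (Star u v X) z
star-generation {n = n} {m = m} {X} {u} {v} u∉ v∉ u≢v z Z h =
  stars-span u∉ v∉ u≢v z Z (λ a → proj₁ (F a)) (λ a → proj₁ (proj₂ (F a)))
    (λ a → proj₁ (proj₂ (proj₂ (F a)))) (λ a → proj₁ (proj₂ (proj₂ (proj₂ (F a)))))
    (λ a → proj₁ (proj₂ (proj₂ (proj₂ (proj₂ (F a)))))) (λ a → proj₁ (proj₂ (proj₂ (proj₂ (proj₂ (proj₂ (F a)))))))
    (proj₁ (proj₂ (proj₂ (proj₂ (proj₂ (proj₂ (proj₂ (F v))))))) refl)
    (proj₂ (proj₂ (proj₂ (proj₂ (proj₂ (proj₂ (proj₂ (F v))))))) refl)
  where
  P : Fin n → Set
  P a = Σ (Chain n m) λ y → Σ (Chain n (suc m)) λ b →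
    ((a ∉ u ∷ v ∷ X × Zc (a ∷ u ∷ v ∷ X) y) ⊎ (y ≈ zeroC)) × Ok (u ∷ X) b × Ok X (mk u a ∧ b) ×
    (a ≢ v → ι (mk u a) z ≈ (y +C ∂ b)) × (a ≡ v → y ≈ zeroC) × (a ≡ v → b ≈ zeroC)
  trivial : ∀ a → (a ≢ v → ι (mk u a) z ≈ zeroC) → P a
  trivial a e = zeroC , zeroC , inj₂ ≈-refl , Ok-0 , Ok-≈0 (zer (∧-linear _)) ,
    (λ ne → ≈-trans (e ne) λ τ → sym (trans (cong (0₃ +_) (zer ∂-linear τ)) (+-identityˡ 0₃))) ,
    (λ _ → ≈-refl) , (λ _ → ≈-refl)
  F : ∀ a → P a
  F a with a Finₚ.≟ v
  -- The edge uv is not replaced; its link stays in the coefficient of uv, so y and b are zero here.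
  ... | yes refl = trivial a (λ ne → ⊥-elim (ne refl))
  ... | no a≢v with good? X (mk u a)
  ...   | no ng = trivial a (λ _ → ι-bad (mk u a) (ok Z) ng)
  ...   | yes g with good-mk⁻ u a g
  ...     | u≢a , _ , a∉ with h a (∉-∷ (u≢a ∘ sym) (∉-∷ a≢v a∉))
  ...       | y , Zy , hom (bd b o e) = y , b , inj₁ (∉-∷ (u≢a ∘ sym) (∉-∷ a≢v a∉) , Zy) ,
              Ok-⊆ (∷-mono there) o , Ok-mk∧ u≢a u∉ a∉ o ,
              (λ _ τ → trans (solve 2 (λ x y → x := y :+ (x :+ (:- y))) refl (ι (mk u a) z τ) (y τ)) (cong (y τ +_) (e τ))) ,
              (λ eq → ⊥-elim (a≢v eq)) , (λ eq → ⊥-elim (a≢v eq))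

-- The links at ua are pushed off v. Their own links at vb miss four vertices, and 3(m + 1) - 4 = 2
-- + 3(m - 1) is precisely the range of `vanish`; with one vertex fewer the argument breaks down.
star-span : ∀ {X : List (Fin n)} {u v : Fin n} → u ∉ X → v ∉ X → u ≢ v → tri (suc m) ≤ size X →
  (z : Chain n (suc m)) → Zc X z → Sp X (Star u v X) z
star-span {m = m} {X} {u} {v} u∉ v∉ u≢v h z Z = star-generation u∉ v∉ u≢v z Z λ a a∉ →
  let z' , Z' , e = push-triv v (ι (mk u a) z)
        (∉-∷ (u≢v ∘ sym) (∉-∷ (a∉ ∘ there ∘ here ∘ sym) v∉)) (zc-ι u a Z)
        λ { refl b b≢v b∉ → vanish _ _ (≤-size-∷ (∉-∷ (b≢v ∘ sym) (∉-∷ (u≢v ∘ sym) (∉-∷ (a∉ ∘ there ∘ here ∘ sym) v∉)))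
              (≤-size-∷ b∉ (≤-size-∷ (∉-∷ (a∉ ∘ here ∘ sym) u∉) (≤-size-∷ (a∉ ∘ there ∘ there) h)))) }
  in z' , zc-⊆ (∷⊆ (there (there (here refl))) (∷⊆ (there (here refl)) (∷⊆ (here refl) (there ∘ there ∘ there)))) Z' , e

-- Formal chains: combinations of lists of edges between positions

FEdge : Set
FEdge = ℕ × ℕ

Mono : ℕ → Set
Mono k = Vec FEdge k

Poly : ℕ → Set
Poly k = List (F3 × Mono k)

-- The interpretation is an arbitrary function, required later to be alternating. One normal form
-- thus serves wedge products, values of a chain on simplices, and rows of linear equations.
evalP : (Mono k → F3) → Poly k → F3
evalP I [] = 0₃
evalP I ((c , w) ∷ p) = c · I w + evalP I p

AltM : (Mono k → F3) → Set
AltM {zero} I = ⊤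
AltM {suc zero} I = ⊤
AltM {suc (suc k)} I = (∀ e f w → I (e ∷ f ∷ w) ≡ - I (f ∷ e ∷ w)) × (∀ e → AltM (λ w → I (e ∷ w)))

times : F3 → F3 → F3
times #0 b = #0
times #1 b = b
times #2 b = negate b

times-· : ∀ a b x → times a b · x ≡ a · (b · x)
times-· #0 b x = refl
times-· #1 b x = refl
times-· #2 b x = ·-negate b x

·-+ : ∀ a x y → a · (x + y) ≡ a · x + a · y
·-+ #0 x y = sym (+-identityˡ 0₃)
·-+ #1 x y = refl
·-+ #2 x y = neg-distrib x y

·-0 : ∀ a → a · 0₃ ≡ 0₃
·-0 #0 = refl
·-0 #1 = refl
·-0 #2 = neg-0

neg-· : ∀ a x → - (a · x) ≡ a · (- x)
neg-· #0 x = neg-0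
neg-· #1 x = refl
neg-· #2 x = refl

scaleP : F3 → Poly k → Poly k
scaleP a = map λ t → times a (proj₁ t) , proj₂ t

eval-scale : ∀ (I : Mono k → F3) a p → evalP I (scaleP a p) ≡ a · evalP I p
eval-scale I a [] = sym (·-0 a)
eval-scale I a ((c , w) ∷ p) = trans (cong₂ _+_ (times-· a c (I w)) (eval-scale I a p)) (sym (·-+ a (c · I w) _))

eval-++ : ∀ (I : Mono k → F3) p q → evalP I (p ++ q) ≡ evalP I p + evalP I q
eval-++ I [] q = sym (+-identityˡ _)
eval-++ I ((c , w) ∷ p) q = trans (cong (c · I w +_) (eval-++ I p q)) (sym (+-assoc _ _ _))

data Cmp {A : Set} (a b : A) : Set where
  lt gt : Cmp a b
  eq    : a ≡ b → Cmp a b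

cmpℕ : (a b : ℕ) → Cmp a b
cmpℕ a b with a ℕ.≟ b
... | yes p = eq p
... | no _ = if a <ᵇ b then lt else gt

cmpE : (e f : FEdge) → Cmp e f
cmpE (a , b) (c , d) with cmpℕ a c
... | lt = lt
... | gt = gt
... | eq refl with cmpℕ b d
...   | lt = lt
...   | gt = gt
...   | eq refl = eq refl

cmpM : (v w : Mono k) → Cmp v w
cmpM [] [] = eq refl
cmpM (e ∷ v) (f ∷ w) with cmpE e f
... | lt = lt
... | gt = gt
... | eq refl with cmpM v w
...   | lt = lt
...   | gt = gt
...   | eq refl = eq refl

insert : FEdge → Mono k → F3 × Mono (suc k)
insert e [] = #1 , e ∷ []
insert e (f ∷ w) with cmpE e f
... | gt = negate (proj₁ (insert e w)) , f ∷ proj₂ (insert e w)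
... | _ = #1 , e ∷ f ∷ w

sortM : Mono k → F3 × Mono k
sortM [] = #1 , []
sortM (e ∷ w) with sortM w
... | s , w' with insert e w'
...   | t , w'' = times s t , w''

insert-sound : ∀ (I : Mono (suc k) → F3) → AltM I → ∀ e w → I (e ∷ w) ≡ proj₁ (insert e w) · I (proj₂ (insert e w))
insert-sound I a e [] = refl
insert-sound {suc k} I a e (f ∷ w) with cmpE e f
... | lt = refl
... | eq _ = refl
... | gt = trans (proj₁ a e f w) (trans (cong -_ (insert-sound (λ w → I (f ∷ w)) (proj₂ a f) e w))
      (sym (·-negate (proj₁ (insert e w)) _)))

AltM-tail : ∀ (I : Mono (suc k) → F3) → AltM I → ∀ e → AltM (λ w → I (e ∷ w))
AltM-tail {zero} I a e = tt
AltM-tail {suc k} I a e = proj₂ a e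

sort-sound : ∀ (I : Mono k → F3) → AltM I → ∀ w → I w ≡ proj₁ (sortM w) · I (proj₂ (sortM w))
sort-sound I a [] = refl
sort-sound I a (e ∷ w) with sortM w | sort-sound (λ w → I (e ∷ w)) (AltM-tail I a e) w
... | s , w' | h with insert e w' | insert-sound I a e w'
...   | t , w'' | g = trans h (trans (cong (s ·_) g) (sym (times-· s t _)))

cons : F3 → Mono k → Poly k → Poly k
cons #0 w p = p
cons c w p = (c , w) ∷ p

eval-cons : ∀ (I : Mono k → F3) c w p → evalP I (cons c w p) ≡ c · I w + evalP I p
eval-cons I #0 w p = sym (+-identityˡ _)
eval-cons I #1 w p = refl
eval-cons I #2 w p = refl

merge : Poly k → Poly k → Poly k
merge {k} [] q = q
merge {k} ((c , v) ∷ p) = go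
  where
  go : Poly k → Poly k
  go [] = (c , v) ∷ p
  go ((d , w) ∷ q) with cmpM v w
  ... | lt = (c , v) ∷ merge p ((d , w) ∷ q)
  ... | gt = (d , w) ∷ go q
  ... | eq _ = cons (plus c d) v (merge p q)

eval-merge : ∀ (I : Mono k → F3) p q → evalP I (merge p q) ≡ evalP I p + evalP I q
eval-merge I [] q = sym (+-identityˡ _)
eval-merge {k} I ((c , v) ∷ p) = go
  where
  go : ∀ q → evalP I (merge ((c , v) ∷ p) q) ≡ evalP I ((c , v) ∷ p) + evalP I q
  go [] = sym (+-identityʳ _)
  go ((d , w) ∷ q) with cmpM v w
  ... | lt = trans (cong (c · I v +_) (eval-merge I p ((d , w) ∷ q))) (sym (+-assoc _ _ _))
  ... | gt = trans (cong (d · I w +_) (go q))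
    (solve 4 (λ a b c d → c :+ ((a :+ b) :+ d) := (a :+ b) :+ (c :+ d)) refl (c · I v) (evalP I p) (d · I w) (evalP I q))
  ... | eq refl = trans (eval-cons I (plus c d) v (merge p q))
    (trans (cong₂ _+_ (·-plus c d (I v)) (eval-merge I p q)) (+-interchange (c · I v) _ _ _))

pairUp : List (Poly k) → List (Poly k)
pairUp (p ∷ q ∷ ps) = merge p q ∷ pairUp ps
pairUp ps = ps

evalL : (Mono k → F3) → List (Poly k) → F3
evalL I [] = 0₃
evalL I (p ∷ ps) = evalP I p + evalL I ps

eval-pairUp : ∀ (I : Mono k → F3) ps → evalL I (pairUp ps) ≡ evalL I ps
eval-pairUp I [] = refl
eval-pairUp I (p ∷ []) = refl
eval-pairUp I (p ∷ q ∷ ps) = trans (cong₂ _+_ (eval-merge I p q) (eval-pairUp I ps)) (+-assoc _ _ _)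

total : ℕ → List (Poly k) → Poly k
total zero ps = List.foldr merge [] ps
total (suc f) [] = []
total (suc f) (p ∷ []) = p
total (suc f) ps = total f (pairUp ps)

eval-total : ∀ (I : Mono k → F3) f ps → evalP I (total f ps) ≡ evalL I ps
eval-total I zero [] = refl
eval-total I zero (p ∷ ps) = trans (eval-merge I p _) (cong (evalP I p +_) (eval-total I zero ps))
eval-total I (suc f) [] = refl
eval-total I (suc f) (p ∷ []) = sym (+-identityʳ _)
eval-total I (suc f) (p ∷ q ∷ ps) = trans (eval-total I f (pairUp (p ∷ q ∷ ps))) (eval-pairUp I (p ∷ q ∷ ps))

single : F3 × Mono k → Poly k
single (c , w) with sortM w
... | s , w' = (times c s , w') ∷ []

-- Bottom-up merging of the signed, sorted monomials. Twenty rounds handle about a million terms,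
-- and when they run out `total` folds the rest, so correctness does not depend on the number.
nf : Poly k → Poly k
nf p = total 20 (map single p)

eval-nf : ∀ (I : Mono k → F3) → AltM I → ∀ p → evalP I (nf p) ≡ evalP I p
eval-nf I a p = trans (eval-total I 20 (map single p)) (go p)
  where
  go : ∀ p → evalL I (map single p) ≡ evalP I p
  go [] = refl
  go ((c , w) ∷ p) with sortM w | sort-sound I a w
  ... | s , w' | h = cong₂ _+_ (trans (+-identityʳ _) (trans (times-· c s (I w')) (cong (c ·_) (sym h)))) (go p)

isNil : ∀ {A : Set} → List A → Bool
isNil [] = true
isNil (_ ∷ _) = false

nf-zero : ∀ (I : Mono k → F3) → AltM I → ∀ p → isNil (nf p) ≡ true → evalP I p ≡ 0₃
nf-zero I a p h with nf p | eval-nf I a p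
... | [] | e = sym e

fedge : ℕ → ℕ → FEdge
fedge i j = if i <ᵇ j then (i , j) else (j , i)

mulE : FEdge → Poly k → Poly (suc k)
mulE e = map λ t → proj₁ t , e ∷ proj₂ t

starP : ℕ → ℕ → ℕ → Poly k → Poly (suc k)
starP v a b p = mulE (fedge v a) p ++ scaleP #2 (mulE (fedge v b) p)

oneP : Poly 0
oneP = (#1 , []) ∷ []

∂M : Mono (suc k) → Poly k
∂M (e ∷ []) = (#1 , []) ∷ []
∂M (e ∷ f ∷ w) = (#1 , f ∷ w) ∷ scaleP #2 (mulE e (∂M (f ∷ w)))

∂P : Poly (suc k) → Poly k
∂P [] = []
∂P ((c , w) ∷ p) = scaleP c (∂M w) ++ ∂P p

nth : {A : Set} → A → List A → ℕ → A
nth d [] i = d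
nth d (x ∷ xs) zero = x
nth d (x ∷ xs) (suc i) = nth d xs i

module Interp {n : ℕ} (ρ : ℕ → Fin n) where

  edge : FEdge → Pair n
  edge (i , j) = mk (ρ i) (ρ j)

  edge-fedge : ∀ i j → edge (fedge i j) ≡ mk (ρ i) (ρ j)
  edge-fedge i j with i <ᵇ j
  ... | true = refl
  ... | false = mk-sym (ρ j) (ρ i)

  -- The trailing chain h makes an identity checked on a few positions applicable on larger vertex
  -- sets, multiplied by any cycle on the other vertices.
  wedges : Mono k → Chain n m → Chain n (k ℕ.+ m)
  wedges [] h = h
  wedges (e ∷ w) h = edge e ∧ wedges w h

  wedges-alt : ∀ {l} (f : Chain n (k ℕ.+ m) → Chain n l) → Linear f → (h : Chain n m) → ∀ τ →
    AltM {k} (λ w → f (wedges w h) τ)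
  wedges-alt {zero} f L h τ = tt
  wedges-alt {suc zero} f L h τ = tt
  wedges-alt {suc (suc k)} f L h τ =
    (λ d e w → trans (resp L (∧-anticomm (edge d) (edge e) (wedges w h)) τ) (neg L _ τ)) ,
    λ e → wedges-alt {suc k} (f ∘ (edge e ∧_)) (∘-linear L (∧-linear (edge e))) h τ

  ⟦_⟧ : Poly k → Chain n m → Chain n (k ℕ.+ m)
  ⟦ p ⟧ h τ = evalP (λ w → wedges w h τ) p

  ⟦nf⟧ : (p : Poly k) (h : Chain n m) → isNil (nf p) ≡ true → ⟦ p ⟧ h ≈ zeroC
  ⟦nf⟧ p h e τ = nf-zero _ (wedges-alt id (∘-linear {f = id} {g = id} id-linear id-linear) h τ) p e
    where
    id-linear : ∀ {n m} → Linear {n} {m} id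
    id-linear .resp h = h
    id-linear .add c d τ = refl

  ⟦++⟧ : (p q : Poly k) (h : Chain n m) → ⟦ p ++ q ⟧ h ≈ (⟦ p ⟧ h +C ⟦ q ⟧ h)
  ⟦++⟧ p q h τ = eval-++ _ p q

  _·C_ : F3 → Chain n m → Chain n m
  (a ·C c) τ = a · c τ

  ⟦scale⟧ : ∀ a (p : Poly k) (h : Chain n m) → ⟦ scaleP a p ⟧ h ≈ (a ·C ⟦ p ⟧ h)
  ⟦scale⟧ a p h τ = eval-scale _ a p

  ·-lin : ∀ {l l'} {f : Chain n l → Chain n l'} → Linear f → ∀ a c → f (a ·C c) ≈ (a ·C f c)
  ·-lin L #0 c = zer L
  ·-lin L #1 c = ≈-refl
  ·-lin L #2 c = neg L c

  ⟦mulE⟧ : ∀ e (p : Poly k) (h : Chain n m) → ⟦ mulE e p ⟧ h ≈ (edge e ∧ ⟦ p ⟧ h)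
  ⟦mulE⟧ e [] h τ = sym (zer (∧-linear (edge e)) τ)
  ⟦mulE⟧ e ((c , w) ∷ p) h τ = sym (trans (add (∧-linear (edge e)) (c ·C wedges w h) (⟦ p ⟧ h) τ)
    (cong₂ _+_ (·-lin (∧-linear (edge e)) c (wedges w h) τ) (sym (⟦mulE⟧ e p h τ))))

  ⟦starP⟧ : ∀ v a b (p : Poly k) (h : Chain n m) → ⟦ starP v a b p ⟧ h ≈ star (ρ v) (ρ a) (ρ b) (⟦ p ⟧ h)
  ⟦starP⟧ v a b p h τ = trans (⟦++⟧ (mulE (fedge v a) p) _ h τ) (cong₂ _+_
    (trans (⟦mulE⟧ (fedge v a) p h τ) (cong (λ e → (e ∧ ⟦ p ⟧ h) τ) (edge-fedge v a)))
    (trans (⟦scale⟧ #2 (mulE (fedge v b) p) h τ)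
      (cong -_ (trans (⟦mulE⟧ (fedge v b) p h τ) (cong (λ e → (e ∧ ⟦ p ⟧ h) τ) (edge-fedge v b))))))

  ⟦oneP⟧ : (h : Chain n m) → ⟦ oneP ⟧ h ≈ h
  ⟦oneP⟧ h τ = +-identityʳ _

  ∂-wedges : ∀ (w : Mono (suc k)) {h : Chain n m} → Cycle h → ∂ (wedges w h) ≈ ⟦ ∂M w ⟧ h
  ∂-wedges (e ∷ []) {h} c τ = trans (∂-∧-cycle (edge e) c τ) (sym (+-identityʳ _))
  ∂-wedges (e ∷ f ∷ w) {h} c τ = trans (∂-∧ (edge e) (wedges (f ∷ w) h) τ) (cong (wedges (f ∷ w) h τ +_)
    (sym (trans (⟦scale⟧ #2 (mulE e (∂M (f ∷ w))) h τ) (cong -_ (trans (⟦mulE⟧ e (∂M (f ∷ w)) h τ)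
      (resp (∧-linear (edge e)) (≈-sym (∂-wedges (f ∷ w) c)) τ))))))

  ∂-⟦⟧ : ∀ (p : Poly (suc k)) {h : Chain n m} → Cycle h → ∂ (⟦ p ⟧ h) ≈ ⟦ ∂P p ⟧ h
  ∂-⟦⟧ [] c = zer ∂-linear
  ∂-⟦⟧ ((a , w) ∷ p) {h} c τ = trans (add ∂-linear (a ·C wedges w h) (⟦ p ⟧ h) τ)
    (sym (trans (⟦++⟧ (scaleP a (∂M w)) (∂P p) h τ) (cong₂ _+_
      (trans (⟦scale⟧ a (∂M w) h τ) (sym (trans (·-lin ∂-linear a (wedges w h) τ) (cong (a ·_) (∂-wedges w c τ)))))
      (sym (∂-⟦⟧ p c τ)))))

elemᵇ : ℕ → List ℕ → Bool
elemᵇ i [] = false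
elemᵇ i (j ∷ js) = if i ≡ᵇ j then true else elemᵇ i js

-- U lists the positions already occupied. When distinct positions stand for distinct vertices,
-- validity says that the monomial becomes a matching.
validM : ℕ → List ℕ → Mono k → Bool
validM K U [] = true
validM K U ((i , j) ∷ w) =
  (i <ᵇ K) && ((j <ᵇ K) && (not (i ≡ᵇ j) && (not (elemᵇ i U) && (not (elemᵇ j U) && validM K (i ∷ j ∷ U) w))))

validP : ℕ → Poly k → Bool
validP K [] = true
validP K ((_ , w) ∷ p) = validM K [] w && validP K p

&&-split : ∀ {a b} → a && b ≡ true → a ≡ true × b ≡ true
&&-split {true} {true} _ = refl , refl

not-true : ∀ {a} → not a ≡ true → a ≡ false
not-true {false} _ = refl

<ᵇ-true : ∀ {i K} → (i <ᵇ K) ≡ true → i ℕ.< K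
<ᵇ-true {i} {K} e = ℕₚ.<ᵇ⇒< i K (subst T (sym e) tt)

≡ᵇ-refl : ∀ i → (i ≡ᵇ i) ≡ true
≡ᵇ-refl zero = refl
≡ᵇ-refl (suc i) = ≡ᵇ-refl i

elem-false : ∀ {i U} → elemᵇ i U ≡ false → i ∉ U
elem-false {i} {j ∷ U} e (here refl) rewrite ≡ᵇ-refl i with e
... | ()
elem-false {i} {j ∷ U} e (there h) with i ≡ᵇ j
... | false = elem-false e h
elem-false {i} {j ∷ U} () (there h) | true

record Env {n} (X vs : List (Fin n)) : Set where
  constructor env
  field
    uniq : AllPairs _≢_ vs
    outside : All (_∉ X) vs

module _ {n} {X vs : List (Fin n)} (d : Fin n) (E : Env X vs) where
  open Env E
  open Interp (nth d vs)

  private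
    ρ = nth d vs

  nth-∈ : ∀ (ws : List (Fin n)) {i} → i ℕ.< length ws → nth d ws i ∈ ws
  nth-∈ (w ∷ ws) {zero} h = here refl
  nth-∈ (w ∷ ws) {suc i} (s≤s h) = there (nth-∈ ws h)

  nth-inj : ∀ {ws : List (Fin n)} → AllPairs _≢_ ws → ∀ {i j} → i ℕ.< length ws → j ℕ.< length ws →
    nth d ws i ≡ nth d ws j → i ≡ j
  nth-inj (a ∷ u) {zero} {zero} _ _ _ = refl
  nth-inj (a ∷ u) {zero} {suc j} p (s≤s q) e = ⊥-elim (All.lookup a (nth-∈ _ q) e)
  nth-inj (a ∷ u) {suc i} {zero} (s≤s p) q e = ⊥-elim (All.lookup a (nth-∈ _ p) (sym e))
  nth-inj (a ∷ u) {suc i} {suc j} (s≤s p) (s≤s q) e = cong suc (nth-inj u p q e)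

  Ok-wedges : ∀ (w : Mono k) U → All (ℕ._< length vs) U → validM (length vs) U w ≡ true →
    {h : Chain n m} → Ok (vs ++ X) h → Ok (map ρ U ++ X) (wedges w h)
  Ok-wedges [] U all v o = Ok-⊆ sub' o
    where
    sub' : map ρ U ++ X ⊆ vs ++ X
    sub' h with ∈-++⁻ (map ρ U) h
    ... | inj₂ x = ∈-++⁺ʳ vs x
    ... | inj₁ x with ∈-map⁻ ρ x
    ...   | i , i∈ , refl = ∈-++⁺ˡ (nth-∈ vs (All.lookup all i∈))
  Ok-wedges ((i , j) ∷ w) U all v o =
    let iK , v₁ = &&-split v
        jK , v₂ = &&-split v₁
        ij , v₃ = &&-split v₂
        iU , v₄ = &&-split v₃
        jU , v₅ = &&-split v₄
        i< = <ᵇ-true iK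
        j< = <ᵇ-true jK
    in Ok-mk∧ (λ e → false≢true (not-true ij) (trans (cong (_≡ᵇ j) (nth-inj uniq i< j< e)) (≡ᵇ-refl j)))
         (out i< (elem-false (not-true iU))) (out j< (elem-false (not-true jU)))
         (Ok-wedges w (i ∷ j ∷ U) (i< ∷ j< ∷ all) v₅ o)
    where
    false≢true : ∀ {a} → a ≡ false → a ≢ true
    false≢true refl ()
    out : ∀ {i} → i ℕ.< length vs → i ∉ U → ρ i ∉ map ρ U ++ X
    out i< i∉ h with ∈-++⁻ (map ρ U) h
    ... | inj₂ x = All.lookup outside (nth-∈ vs i<) x
    ... | inj₁ x with ∈-map⁻ ρ x
    ...   | j , j∈ , e = i∉ (subst (_∈ U) (sym (nth-inj uniq i< (All.lookup all j∈) e)) j∈)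

  Ok-⟦⟧ : ∀ (p : Poly k) → validP (length vs) p ≡ true → {h : Chain n m} → Ok (vs ++ X) h → Ok X (⟦ p ⟧ h)
  Ok-⟦⟧ [] v o = Ok-0
  Ok-⟦⟧ ((c , w) ∷ p) v o = Ok-+ (scale c (Ok-wedges w [] [] (proj₁ (&&-split v)) o)) (Ok-⟦⟧ p (proj₂ (&&-split v)) o)
    where
    scale : ∀ {l} c {x : Chain n l} → Ok X x → Ok X (c ·C x)
    scale #0 o = Ok-0
    scale #1 o = o
    scale #2 o = Ok-neg o

  -- The form of every certificate: q is a formal filling, and p - ∂q is checked by normalisation to
  -- have no terms left.
  formal-bd : ∀ (p : Poly (suc k)) (q : Poly (suc (suc k))) {h : Chain n m} →
    validP (length vs) q ≡ true → isNil (nf (p ++ scaleP #2 (∂P q))) ≡ true → Zc (vs ++ X) h → Bd X (⟦ p ⟧ h)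
  formal-bd p q {h} v e Z = bd (⟦ q ⟧ h) (Ok-⟦⟧ q v (ok Z)) λ τ →
    trans (solve 2 (λ x y → x := (x :+ (:- y)) :+ y) refl (⟦ p ⟧ h τ) (⟦ ∂P q ⟧ h τ))
      (trans (cong (_+ ⟦ ∂P q ⟧ h τ) (trans (cong (⟦ p ⟧ h τ +_) (sym (⟦scale⟧ #2 (∂P q) h τ)))
        (trans (sym (⟦++⟧ p (scaleP #2 (∂P q)) h τ)) (⟦nf⟧ (p ++ scaleP #2 (∂P q)) h e τ))))
      (trans (+-identityˡ _) (sym (∂-⟦⟧ q (cyc Z) τ))))

-- Iterated star generators

picks : {A : Set} → List A → List (A × List A)
picks [] = []
picks (x ∷ xs) = (x , xs) ∷ map (λ p → proj₁ p , x ∷ proj₂ p) (picks xs)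

starPairs : ℕ → ℕ → ℕ → List (Poly k) → List (Poly (suc k))
starPairs u v a [] = []
starPairs u v a (g ∷ gs) = starP u a v g ∷ starP v a u g ∷ starPairs u v a gs

-- The two families of `star-span` applied recursively, the first two remaining positions playing u
-- and v. This gives 2, 16 and 224 generators on 3, 6 and 9 positions in the critical degree, and 40
-- on 7 positions.
genP : ∀ m → List ℕ → List (Poly m)
genPicks : ∀ m → ℕ → ℕ → List (ℕ × List ℕ) → List (Poly (suc m))
genP zero _ = oneP ∷ []
genP (suc m) (u ∷ v ∷ N) = genPicks m u v (picks N)
genP (suc m) _ = []
genPicks m u v [] = []
genPicks m u v ((a , N) ∷ ps) = starPairs u v a (genP m N) ++ genPicks m u v ps

starPairs-∈ : ∀ {u v a} {g : Poly k} {gs} → g ∈ gs → starP u a v g ∈ starPairs u v a gs × starP v a u g ∈ starPairs u v a gs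
starPairs-∈ (here refl) = here refl , there (here refl)
starPairs-∈ (there h) = there (there (proj₁ (starPairs-∈ h))) , there (there (proj₂ (starPairs-∈ h)))

genPicks-∈ : ∀ {m u v a N ps} {g : Poly (suc m)} → (a , N) ∈ ps → g ∈ starPairs u v a (genP m N) → g ∈ genPicks m u v ps
genPicks-∈ (here refl) h = ∈-++⁺ˡ h
genPicks-∈ {m} {u} {v} {ps = (b , M) ∷ _} (there i) h = ∈-++⁺ʳ (starPairs u v b (genP m M)) (genPicks-∈ i h)

pick : ∀ {A : Set} {x : A} {xs} → x ∈ xs → ∃ λ ys → (x , ys) ∈ picks xs × (∀ {y} → y ∈ xs → y ≢ x → y ∈ ys) × (∀ {y} → y ∈ ys → y ∈ xs) ×
  (∀ {R : A → A → Set} → (∀ {a b} → R a b → R b a) → AllPairs R xs → All (R x) ys × AllPairs R ys)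
pick {xs = x ∷ xs} (here refl) = xs , here refl , (λ { (here e) ne → ⊥-elim (ne e) ; (there h) _ → h }) , there ,
  λ _ → λ { (a ∷ r) → a , r }
pick {x = x} {xs = y ∷ xs} (there i) with pick i
... | ys , p , f , g , h = y ∷ ys , there (∈-map⁺ _ p) ,
  (λ { (here e) ne → here e ; (there j) ne → there (f j ne) }) , (λ { (here e) → here e ; (there j) → there (g j) }) ,
  λ s → λ { (a ∷ r) → (s (All.lookup a i) ∷ proj₁ (h s r)) , (All.tabulate (λ j → All.lookup a (g j)) ∷ proj₂ (h s r)) }

unit : Chain n 0
unit _ = #1

module _ {n : ℕ} (ρ : ℕ → Fin n) where
  open Interp ρ

  Gen : ∀ m → List ℕ → Chain n (m ℕ.+ 0) → Set
  Gen m ps c = ∃ λ g → g ∈ genP m ps × c ≈ ⟦ g ⟧ unit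

  gens-span : ∀ m ps X → tri (m ℕ.+ 0) ≤ size X → AllPairs (λ i j → ρ i ≢ ρ j) ps → All (λ i → ρ i ∉ X) ps →
    (∀ a → a ∉ X → ∃ λ i → i ∈ ps × ρ i ≡ a) → ∀ z → Zc X z → Sp X (Gen m ps) z
  gens-span zero ps X h d o c z Z = scal (z []) refl
    where
    scal : ∀ x → z [] ≡ x → Sp X (Gen zero ps) z
    scal #0 e = sp-0 λ { [] → e }
    scal #1 e = gen (oneP , here refl , λ { [] → trans e (sym (+-identityʳ _)) })
    scal #2 e = sp≈ (λ { [] → trans (cong -_ (+-identityʳ #1)) (trans neg-1 (sym e)) }) (sp- (gen (oneP , here refl , ≈-refl)))
      where
      neg-1 : - #1 ≡ #2
      neg-1 = trans (sym (·-negate #1 #1)) (trans (cong (_· #1) {x = #2} refl) two)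
        where
        two : #2 · #1 ≡ #2
        two = trans (sym (double #1)) one+one
          where
          opaque
            unfolding _+_
            one+one : #1 + #1 ≡ #2
            one+one = refl
  gens-span (suc m) [] X h d o c z Z = ⊥-elim (no-vertex (fresh X h))
    where
    no-vertex : ∃ (_∉ X) → ⊥
    no-vertex (v , v∉) with c v v∉
    ... | _ , () , _
  gens-span (suc m) (u ∷ []) X h d (u∉ ∷ _) c z Z = ⊥-elim (no-vertex (fresh (ρ u ∷ X) (≤-size-∷ u∉ h)))
    where
    no-vertex : ∃ (_∉ ρ u ∷ X) → ⊥
    no-vertex (v , v∉) with c v (v∉ ∘ there)
    ... | _ , here refl , refl = v∉ (here refl)
  gens-span (suc m) (u ∷ v ∷ N) X h ((u≢v ∷ uN) ∷ (vN ∷ NN)) (u∉ ∷ v∉ ∷ N∉) c z Z =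
    sp-bind id step (star-span u∉ v∉ u≢v h z Z)
    where
    module At (a : Fin n) (y : Chain n (m ℕ.+ 0)) (a∉ : a ∉ ρ u ∷ ρ v ∷ X) (Zy : Zc (a ∷ ρ u ∷ ρ v ∷ X) y) where
      loc : ∃ λ i → i ∈ N × ρ i ≡ a
      loc with c a (a∉ ∘ there ∘ there)
      ... | i , here refl , refl = ⊥-elim (a∉ (here refl))
      ... | i , there (here refl) , refl = ⊥-elim (a∉ (there (here refl)))
      ... | i , there (there i∈) , e = i , i∈ , e
      i = proj₁ loc
      a≡ = proj₂ (proj₂ loc)
      pk = pick (proj₁ (proj₂ loc))
      M = proj₁ pk
      ap = proj₂ (proj₂ (proj₂ (proj₂ pk))) {R = λ i j → ρ i ≢ ρ j} (λ ne e → ne (sym e)) NN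
      sub-all : ∀ {P : ℕ → Set} → All P N → All P M
      sub-all q = All.tabulate λ j → All.lookup q (proj₁ (proj₂ (proj₂ (proj₂ pk))) j)
      out : All (λ j → ρ j ∉ a ∷ ρ u ∷ ρ v ∷ X) M
      out = All.tabulate λ {j} j∈ → ∉-∷ (λ e → All.lookup (proj₁ ap) j∈ (trans a≡ (sym e)))
        (∉-∷ (λ e → All.lookup (sub-all uN) j∈ (sym e)) (∉-∷ (λ e → All.lookup (sub-all vN) j∈ (sym e)) (All.lookup (sub-all N∉) j∈)))
      cov : ∀ b → b ∉ a ∷ ρ u ∷ ρ v ∷ X → ∃ λ j → j ∈ M × ρ j ≡ b
      cov b b∉ with c b (b∉ ∘ there ∘ there ∘ there)
      ... | j , here refl , refl = ⊥-elim (b∉ (there (here refl)))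
      ... | j , there (here refl) , refl = ⊥-elim (b∉ (there (there (here refl))))
      ... | j , there (there j∈) , e = j , proj₁ (proj₂ (proj₂ pk)) j∈ (λ { refl → b∉ (here (trans (sym e) a≡)) }) , e
      IH : Sp (a ∷ ρ u ∷ ρ v ∷ X) (Gen m M) y
      IH = gens-span m M (a ∷ ρ u ∷ ρ v ∷ X)
        (≤-size-∷ a∉ (≤-size-∷ (∉-∷ u≢v u∉) (≤-size-∷ v∉ h))) (proj₂ ap) out cov y Zy
      member : ∀ {g} → g ∈ starPairs u v i (genP m M) → g ∈ genP (suc m) (u ∷ v ∷ N)
      member = genPicks-∈ (proj₁ (proj₂ pk))
    step : ∀ {x} → Star (ρ u) (ρ v) X x → Sp X (Gen (suc m) (u ∷ v ∷ N)) x
    step (star₁ a y a∉ Zy) = sp-map (star-linear (ρ u) a (ρ v))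
        (λ b → bd-star (d3 (a∉ ∘ here ∘ sym) u≢v (a∉ ∘ there ∘ here) u∉ (a∉ ∘ there ∘ there) v∉)
          (bd-⊆ (∷⊆ (there (here refl)) (∷⊆ (here refl) (∷⊆ (there (there (here refl))) (there ∘ there ∘ there)))) b))
        (λ { (g , g∈ , e) → gen (starP u i v g , member (proj₁ (starPairs-∈ g∈)) ,
          ≈-trans (resp (star-linear (ρ u) a (ρ v)) e)
            (subst (λ a → star (ρ u) a (ρ v) (⟦ g ⟧ unit) ≈ ⟦ starP u i v g ⟧ unit) a≡ (≈-sym (⟦starP⟧ u i v g unit)))) })
        IH
      where open At a y a∉ Zy
    step (star₂ a y a∉ Zy) = sp-map (star-linear (ρ v) a (ρ u))
        (λ b → bd-star (d3 (a∉ ∘ there ∘ here ∘ sym) (u≢v ∘ sym) (a∉ ∘ here) v∉ (a∉ ∘ there ∘ there) u∉)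
          (bd-⊆ (∷⊆ (there (there (here refl))) (∷⊆ (here refl) (∷⊆ (there (here refl)) (there ∘ there ∘ there)))) b))
        (λ { (g , g∈ , e) → gen (starP v i u g , member (proj₂ (starPairs-∈ g∈)) ,
          ≈-trans (resp (star-linear (ρ v) a (ρ u)) e)
            (subst (λ a → star (ρ v) a (ρ u) (⟦ g ⟧ unit) ≈ ⟦ starP v i u g ⟧ unit) a≡ (≈-sym (⟦starP⟧ v i u g unit)))) })
        IH
      where open At a y a∉ Zy

-- Elimination of generators along certified relations

-- A combination of indexed generators, together with a formal chain having it as boundary.
Rel : ℕ → Set
Rel m = List (F3 × ℕ) × Poly (suc m)

-- A generator index is disguised as a monomial with one edge, so that `nf` also performs the
-- arithmetic of rows.
symbol : ℕ → Mono 1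
symbol i = (i , 0) ∷ []

vector : List (F3 × ℕ) → Poly 1
vector = map λ t → proj₁ t , symbol (proj₂ t)

expand : List (Poly m) → List (F3 × ℕ) → Poly m
expand syms [] = []
expand syms ((c , i) ∷ r) = scaleP c (nth [] syms i) ++ expand syms r

relOK : ℕ → List (Poly (suc m)) → Rel (suc m) → Bool
relOK K syms (r , q) = validP K q && isNil (nf (expand syms r ++ scaleP #2 (∂P q)))

relsOK : ℕ → List (Poly (suc m)) → List (Rel (suc m)) → Bool
relsOK K syms [] = true
relsOK K syms (r ∷ rs) = relOK K syms r && relsOK K syms rs

combine : List (Poly 1) → List (F3 × ℕ) → Poly 1
combine rels [] = []
combine rels ((c , i) ∷ L) = scaleP c (nth [] rels i) ++ combine rels L

unknown : List ℕ → Poly 1 → Poly 1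
unknown known [] = []
unknown known ((c , (i , z) ∷ []) ∷ r) = if elemᵇ i known then unknown known r else (c , (i , z) ∷ []) ∷ unknown known r

solved : Poly 1 → Maybe ℕ
solved ((#1 , (i , _) ∷ []) ∷ []) = just i
solved ((#2 , (i , _) ∷ []) ∷ []) = just i
solved _ = nothing

-- Each step names a combination of rows in which a single generator is not yet known; its
-- coefficient is ±1, hence invertible. A step that fails to isolate one is skipped, so a wrong list
-- can only make the final test fail.
eliminate : List (Poly 1) → List ℕ → List (List (F3 × ℕ)) → List ℕ
eliminate rels known [] = known
eliminate rels known (L ∷ Ls) with solved (unknown known (nf (combine rels L)))
... | just i = eliminate rels (i ∷ known) Ls
... | nothing = eliminate rels known Ls

allBelow : ℕ → List ℕ → Bool
allBelow zero known = true
allBelow (suc i) known = elemᵇ i known && allBelow i known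

elem-true : ∀ {i U} → elemᵇ i U ≡ true → i ∈ U
elem-true {i} {j ∷ U} e with i ℕ.≟ j
... | yes refl = here refl
... | no ne with i ≡ᵇ j in q
...   | false = there (elem-true e)
...   | true = ⊥-elim (ne (ℕₚ.≡ᵇ⇒≡ i j (subst T (sym q) tt)))

module Elim {n} {X vs : List (Fin n)} (d : Fin n) (E : Env X vs) {m l : ℕ} (h : Chain n l) (Z : Zc (vs ++ X) h)
  (G : Chain n (suc m ℕ.+ l) → Set) (syms : List (Poly (suc m))) where
  open Interp (nth d vs)

  sym⟦_⟧ : ℕ → Chain n (suc m ℕ.+ l)
  sym⟦ i ⟧ = ⟦ nth [] syms i ⟧ h

  val : Vec (Pair n) (suc m ℕ.+ l) → Mono 1 → F3
  val τ ((i , _) ∷ []) = sym⟦ i ⟧ τ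

  vec⟦_⟧ : Poly 1 → Chain n (suc m ℕ.+ l)
  vec⟦ r ⟧ τ = evalP (val τ) r

  vec-expand : ∀ r → vec⟦ vector r ⟧ ≈ ⟦ expand syms r ⟧ h
  vec-expand [] τ = refl
  vec-expand ((c , i) ∷ r) τ = sym (trans (⟦++⟧ (scaleP c (nth [] syms i)) _ h τ)
    (cong₂ _+_ (⟦scale⟧ c (nth [] syms i) h τ) (sym (vec-expand r τ))))

  bd-scale : ∀ c {x : Chain n (suc m ℕ.+ l)} → Bd X x → Bd X (c ·C x)
  bd-scale #0 b = bd-0
  bd-scale #1 b = b
  bd-scale #2 b = bd-neg b

  rels-bd : ∀ (rels : List (Rel (suc m))) → relsOK (length vs) syms rels ≡ true →
    ∀ i → Bd X vec⟦ nth [] (map (vector ∘ proj₁) rels) i ⟧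
  rels-bd [] e i = bd-0
  rels-bd ((r , q) ∷ rels) e zero =
    let e₁ , e₂ = &&-split (proj₁ (&&-split e))
    in bd-≈ (≈-sym (vec-expand r)) (formal-bd d E (expand syms r) q e₁ e₂ Z)
  rels-bd (_ ∷ rels) e (suc i) = rels-bd rels (proj₂ (&&-split e)) i

  module _ (rels : List (Poly 1)) (B : ∀ i → Bd X vec⟦ nth [] rels i ⟧) where

    combine-bd : ∀ L → Bd X vec⟦ combine rels L ⟧
    combine-bd [] = bd-0
    combine-bd ((c , i) ∷ L) = bd-≈
      (λ τ → sym (trans (eval-++ (val τ) (scaleP c (nth [] rels i)) (combine rels L))
        (cong (_+ vec⟦ combine rels L ⟧ τ) (eval-scale (val τ) c (nth [] rels i)))))
      (bd-+ (bd-scale c (B i)) (combine-bd L))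

    nf-bd : ∀ L → Bd X vec⟦ nf (combine rels L) ⟧
    nf-bd L = bd-≈ (λ τ → sym (eval-nf (val τ) tt (combine rels L))) (combine-bd L)

    Known : List ℕ → Set
    Known known = ∀ i → i ∈ known → Sp X G sym⟦ i ⟧

    sp-scale : ∀ c {x : Chain n (suc m ℕ.+ l)} → Sp X G x → Sp X G (c ·C x)
    sp-scale #0 s = sp-0 ≈-refl
    sp-scale #1 s = s
    sp-scale #2 s = sp- s

    unknown-sp : ∀ {known} → Known known → ∀ r → Sp X G (vec⟦ r ⟧ -C vec⟦ unknown known r ⟧)
    unknown-sp K [] = sp-0 (λ τ → neg-inverseʳ 0₃)
    unknown-sp {known} K ((c , (i , z) ∷ []) ∷ r) with elemᵇ i known in e
    ... | true = sp≈ (λ τ → sym (+-assoc (c · sym⟦ i ⟧ τ) _ _)) (sp+ (sp-scale c (K i (elem-true e))) (unknown-sp K r))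
    ... | false = sp≈ (λ τ → solve 3 (λ a x y → x :+ (:- y) := (a :+ x) :+ (:- (a :+ y))) refl (c · sym⟦ i ⟧ τ) _ _) (unknown-sp K r)

    solved-sp : ∀ r i → solved r ≡ just i → Sp X G vec⟦ r ⟧ → Sp X G sym⟦ i ⟧
    solved-sp ((#1 , (i , _) ∷ []) ∷ []) .i refl s = sp≈ (λ τ → +-identityʳ _) s
    solved-sp ((#2 , (i , _) ∷ []) ∷ []) .i refl s = sp≈ (λ τ → trans (cong -_ (+-identityʳ _)) (neg-involutive _)) (sp- s)

    eliminate-sp : ∀ Ls {known} → Known known → Known (eliminate rels known Ls)
    eliminate-sp [] K = K
    eliminate-sp (L ∷ Ls) {known} K with solved (unknown known (nf (combine rels L))) in e
    ... | nothing = eliminate-sp Ls K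
    ... | just i = eliminate-sp Ls λ { j (here refl) → new ; j (there j∈) → K j j∈ }
      where
      r = nf (combine rels L)
      new : Sp X G sym⟦ i ⟧
      new = solved-sp (unknown known r) i e (sp≈ (λ τ → solve 2 (λ x y → x :+ (:- (x :+ (:- y))) := y) refl (vec⟦ r ⟧ τ) _)
        (sp-sub (bound (nf-bd L)) (unknown-sp K r)))

  elimination : ∀ rels → relsOK (length vs) syms rels ≡ true → ∀ known → (∀ i → i ∈ known → Sp X G sym⟦ i ⟧) →
    ∀ Ls N → allBelow N (eliminate (map (vector ∘ proj₁) rels) known Ls) ≡ true → ∀ i → i ℕ.< N → Sp X G sym⟦ i ⟧
  elimination rels e known K Ls N all i i< =
    eliminate-sp (map (vector ∘ proj₁) rels) (rels-bd rels e) Ls K i (below N i all i<)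
    where
    below : ∀ N i {U} → allBelow N U ≡ true → i ℕ.< N → i ∈ U
    below (suc N) i a i< with i ℕ.≟ N
    ... | yes refl = elem-true (proj₁ (&&-split a))
    ... | no ne = below N i (proj₂ (&&-split a)) (ℕₚ.≤∧≢⇒< (ℕₚ.≤-pred i<) ne)

-- Certificates were found by Gaussian elimination over ℤ/3 and are stored as
-- decimal numbers, of which only the decoded value is checked.

coef : ℕ → F3
coef 1 = #1
coef 2 = #2
coef _ = #0

-- The two lowest digits are the first edge.
monoOf : ∀ k → ℕ → Mono k
monoOf zero N = []
monoOf (suc k) N = (N / 10 % 10 , N % 10) ∷ monoOf k (N / 100)

dropEdges : ℕ → ℕ → ℕ
dropEdges zero N = N
dropEdges (suc k) N = dropEdges k (N / 100)

-- Blocks of 2k + 1 digits, with the coefficient on top. It is 1 or 2, so the decimal notation loses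
-- no leading zero.
polyOf : ∀ k → (fuel : ℕ) → ℕ → Poly k
polyOf k zero N = []
polyOf k (suc f) zero = []
polyOf k (suc f) N@(suc _) = (coef (dropEdges k N % 10) , monoOf k N) ∷ polyOf k f (dropEdges k N / 10)

-- Blocks of four digits: the coefficient, then three digits of index.
vecOf : (fuel : ℕ) → ℕ → List (F3 × ℕ)
vecOf zero N = []
vecOf (suc f) zero = []
vecOf (suc f) N@(suc _) = (coef (N / 1000 % 10) , N % 1000) ∷ vecOf f (N / 10000)

relsOf : ∀ m → List (ℕ × ℕ) → List (Rel m)
relsOf m = map λ t → vecOf 400 (proj₁ t) , polyOf (suc m) 400 (proj₂ t)

-- Each vertex is compared with the tail and with X together, so that a suffix of the list can be
-- moved into the deleted set by reassociating the concatenation.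
data Fresh {n} (X : List (Fin n)) : List (Fin n) → Set where
  []  : Fresh X []
  _∷_ : ∀ {v vs} → v ∉ vs ++ X → Fresh X vs → Fresh X (v ∷ vs)

fresh-env : ∀ {X vs : List (Fin n)} → Fresh X vs → Env X vs
fresh-env [] = env [] []
fresh-env {vs = v ∷ vs} (v∉ ∷ f) with fresh-env f
... | env u o = env (All.tabulate (λ {w} w∈ e → v∉ (∈-++⁺ˡ (subst (_∈ vs) (sym e) w∈))) ∷ u) ((v∉ ∘ ∈-++⁺ʳ vs) ∷ o)

fresh-size : ∀ {X vs : List (Fin n)} → Fresh X vs → size X ≡ length vs ℕ.+ size (vs ++ X)
fresh-size [] = refl
fresh-size {vs = v ∷ vs} (v∉ ∷ f) = trans (fresh-size f)
  (trans (cong (length vs ℕ.+_) (size-∷ v∉)) (ℕₚ.+-suc (length vs) _))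

fresh-covers : ∀ {X vs : List (Fin n)} → Fresh X vs → size X ≡ length vs → ∀ a → a ∉ X → a ∈ vs
fresh-covers {X = X} {vs} f e a a∉ =
  [ id , (λ h → ⊥-elim (a∉ h)) ]′ (∈-++⁻ vs (size-0 (vs ++ X) (ℕₚ.+-cancelˡ-≡ (length vs) _ _
    (trans (sym (fresh-size f)) (trans e (sym (ℕₚ.+-identityʳ _))))) a))

-- Triangles, and relations between stars

tr : Fin n → Fin n → Fin n → Chain n m → Chain n (suc m)
tr p q r c = (mk p q ∧ c) +C ((mk p r ∧ c) +C (mk q r ∧ c))

tr-linear : ∀ (p q r : Fin n) → Linear {n} {m} (tr p q r)
tr-linear p q r = +linear (∧-linear _) (+linear (∧-linear _) (∧-linear _))

-- The cone formula produces three copies of c, and 3c = 0. This is what makes triangles specific to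
-- characteristic 3.
∂-tr : ∀ (p q r : Fin n) (c : Chain n (suc m)) → ∂ (tr p q r c) ≈ (-C tr p q r (∂ c))
∂-tr p q r c τ = trans (add ∂-linear (mk p q ∧ c) ((mk p r ∧ c) +C (mk q r ∧ c)) τ)
  (trans (cong₂ _+_ (∂-∧ (mk p q) c τ) (trans (add ∂-linear (mk p r ∧ c) (mk q r ∧ c) τ)
      (cong₂ _+_ (∂-∧ (mk p r) c τ) (∂-∧ (mk q r) c τ))))
    (solve 4 (λ c x y z → (c :+ (:- x)) :+ ((c :+ (:- y)) :+ (c :+ (:- z))) := :- (x :+ (y :+ z))) refl (c τ) _ _ _))

Ok-tr : ∀ {X} {p q r : Fin n} {c : Chain n m} → Distinct3 X p q r → Ok (p ∷ q ∷ r ∷ X) c → Ok X (tr p q r c)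
Ok-tr (d3 pq pr qr pX qX rX) o = Ok-+ (Ok-mk∧ pq pX qX (Ok-⊆ (∷-mono (∷-mono there)) o))
  (Ok-+ (Ok-mk∧ pr pX rX (Ok-⊆ (∷-mono there) o)) (Ok-mk∧ qr qX rX (Ok-⊆ there o)))

bd-tr : ∀ {X} {p q r : Fin n} {c : Chain n m} → Distinct3 X p q r → Bd (p ∷ q ∷ r ∷ X) c → Bd X (tr p q r c)
bd-tr {p = p} {q} {r} d (bd x o e) = bd (-C tr p q r x) (Ok-neg (Ok-tr d o)) λ τ →
  trans (resp (tr-linear p q r) e τ) (sym (trans (neg ∂-linear (tr p q r x) τ)
    (trans (cong -_ (∂-tr p q r x τ)) (neg-involutive _))))

triP : ℕ → ℕ → ℕ → Poly k → Poly (suc k)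
triP a b c p = mulE (fedge a b) p ++ mulE (fedge a c) p ++ mulE (fedge b c) p

⟦triP⟧ : ∀ (ρ : ℕ → Fin n) a b c (p : Poly k) (h : Chain n m) →
  Interp.⟦_⟧ ρ (triP a b c p) h ≈ tr (ρ a) (ρ b) (ρ c) (Interp.⟦_⟧ ρ p h)
⟦triP⟧ ρ a b c p h τ = trans (⟦++⟧ (mulE (fedge a b) p) _ h τ) (cong₂ _+_ (one a b)
    (trans (⟦++⟧ (mulE (fedge a c) p) _ h τ) (cong₂ _+_ (one a c) (one b c))))
  where
  open Interp ρ
  one : ∀ a b → ⟦ mulE (fedge a b) p ⟧ h τ ≡ (mk (ρ a) (ρ b) ∧ ⟦ p ⟧ h) τ
  one a b = trans (⟦mulE⟧ (fedge a b) p h τ) (cong (λ e → (e ∧ ⟦ p ⟧ h) τ) (edge-fedge a b))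

opaque
  tri-star-poly : Poly 2
  tri-star-poly = triP 0 1 2 (starP 4 5 6 oneP)

  -- A 2-chain on seven positions, found by linear algebra. Position 3 is the spare vertex of the
  -- four: it does not occur in the cycle, but the filling passes through it.
  tri-star-filling : Poly 3
  tri-star-filling = polyOf 3 20 146350122613051261405136120513614021452613245260114513022352614135260124635022461205235140214536021461305246130224536122361405

  tri-star-valid : validP 7 tri-star-filling ≡ true
  tri-star-valid = refl

  tri-star-filled : isNil (nf (tri-star-poly ++ scaleP #2 (∂P tri-star-filling))) ≡ true
  tri-star-filled = refl

  ⟦tri-star⟧ : ∀ (ρ : ℕ → Fin n) (h : Chain n m) →
    Interp.⟦_⟧ ρ tri-star-poly h ≈ tr (ρ 0) (ρ 1) (ρ 2) (star (ρ 4) (ρ 5) (ρ 6) h)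
  ⟦tri-star⟧ ρ h = ≈-trans (⟦triP⟧ ρ 0 1 2 (starP 4 5 6 oneP) h) (resp (tr-linear (ρ 0) (ρ 1) (ρ 2))
    (≈-trans (Interp.⟦starP⟧ ρ 4 5 6 oneP h) (resp (star-linear (ρ 4) (ρ 5) (ρ 6)) (Interp.⟦oneP⟧ ρ h))))

-- The sum of the three components of M₄ times a star bounds in M₇.
tri-star-bd : ∀ {X} {p q r s c d e : Fin n} {h : Chain n m} → Fresh X (p ∷ q ∷ r ∷ s ∷ c ∷ d ∷ e ∷ []) →
  Zc (p ∷ q ∷ r ∷ s ∷ c ∷ d ∷ e ∷ X) h → Bd X (tr p q r (star c d e h))
tri-star-bd {p = p} {q} {r} {s} {c} {d} {e} {h} f Z = bd-≈ (⟦tri-star⟧ _ h)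
  (formal-bd p (fresh-env f) tri-star-poly tri-star-filling tri-star-valid tri-star-filled Z)

-- The terms -uv ∧ x are common to both stars, and ua and vb are disjoint edges missed by x, so (ua
-- - vb) ∧ x bounds through ua ∧ vb ∧ x.
star-hop : ∀ {X} {u v a b : Fin n} {x : Chain n m} → Fresh X (b ∷ a ∷ u ∷ v ∷ []) → Zc (b ∷ a ∷ u ∷ v ∷ X) x →
  star u a v x ~[ X ] star v b u x
star-hop {u = u} {v} {a} {b} {x} (b∉ ∷ a∉ ∷ u∉ ∷ v∉ ∷ []) (zc o c) =
  hom $ bd (-C (mk u a ∧ mk v b ∧ x))
    (Ok-neg (Ok-mk∧ (a∉ ∘ here ∘ sym) (u∉ ∘ there) (a∉ ∘ there ∘ there)
      (Ok-mk∧ (b∉ ∘ there ∘ there ∘ here ∘ sym) (∉-∷ (u∉ ∘ here ∘ sym) (∉-∷ (a∉ ∘ there ∘ here ∘ sym) v∉))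
        (∉-∷ (b∉ ∘ there ∘ here) (∉-∷ (b∉ ∘ here) (b∉ ∘ there ∘ there ∘ there)))
        (Ok-⊆ (∷⊆ (there (there (there (here refl)))) (∷⊆ (here refl) (∷⊆ (there (there (here refl)))
          (∷⊆ (there (here refl)) (there ∘ there ∘ there ∘ there))))) o))))
    λ τ → begin
      ((mk u a ∧ x) τ + (- (mk u v ∧ x) τ)) + (- ((mk v b ∧ x) τ + (- (mk v u ∧ x) τ)))
        ≡⟨ cong (λ e → ((mk u a ∧ x) τ + (- (mk u v ∧ x) τ)) + (- ((mk v b ∧ x) τ + (- (e ∧ x) τ)))) (mk-sym v u) ⟩
      ((mk u a ∧ x) τ + (- (mk u v ∧ x) τ)) + (- ((mk v b ∧ x) τ + (- (mk u v ∧ x) τ)))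
        ≡⟨ solve 3 (λ a b c → (a :+ (:- c)) :+ (:- (b :+ (:- c))) := :- (b :+ (:- a))) refl _ _ _ ⟩
      - ((mk v b ∧ x) τ + (- (mk u a ∧ x) τ))
        ≡⟨ cong (λ y → - ((mk v b ∧ x) τ + (- y))) (resp (∧-linear (mk u a)) (≈-sym (∂-∧-cycle (mk v b) c)) τ) ⟩
      - ((mk v b ∧ x) τ + (- (mk u a ∧ ∂ (mk v b ∧ x)) τ)) ≡⟨ cong -_ (∂-∧ (mk u a) (mk v b ∧ x) τ) ⟨
      - ∂ (mk u a ∧ mk v b ∧ x) τ ≡⟨ neg ∂-linear (mk u a ∧ mk v b ∧ x) τ ⟨
      ∂ (-C (mk u a ∧ mk v b ∧ x)) τ ∎
  where open ≡-Reasoning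

-- Homology groups with one generator

record IsGen {n m} (X : List (Fin n)) (g : Chain n m) : Set where
  constructor isGen
  field
    gen-zc : Zc X g
    gen-sp : ∀ z → Zc X z → Sp X (_≡ g) z
open IsGen public

multiple : ∀ {X} {g z : Chain n m} → Sp X (_≡ g) z → ∃ λ c → z ~[ X ] (λ τ → c · g τ)
multiple (gen refl) = #1 , ≈⇒~ ≈-refl
multiple (bound b) = #0 , hom (bd-≈ (λ τ → solve 1 (λ x → x := x :+ (:- :0)) refl _) b)
multiple {g = g} (sp+ {c} {d} s t) with multiple s | multiple t
... | a , hom h | b , hom k = plus a b , hom (bd-≈ (λ τ → trans
    (solve 4 (λ c x d y → (c :+ (:- x)) :+ (d :+ (:- y)) := (c :+ d) :+ (:- (x :+ y))) refl (c τ) (a · g τ) (d τ) (b · g τ))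
    (cong (λ x → (c τ + d τ) + (- x)) (sym (·-plus a b (g τ))))) (bd-+ h k))
multiple {g = g} (sp- {c} s) with multiple s
... | a , hom h = negate a , hom (bd-≈ (λ τ → trans
    (solve 2 (λ c x → :- (c :+ (:- x)) := (:- c) :+ (:- (:- x))) refl (c τ) (a · g τ))
    (cong (λ x → (- c τ) + (- x)) (sym (·-negate a (g τ))))) (bd-neg h))
multiple {g = g} (sp≈ e s) with multiple s
... | a , hom h = a , hom (bd-≈ (λ τ → cong (_+ (- (a · g τ))) (e τ)) h)

-- With one vertex more than in `star-span`, y can first be pushed off any further vertex b, which
-- makes `star-hop` applicable. Hops alternate between stars at u and at v; at most three of them
-- bring any a to e, where y is a multiple of g.
gen-step : ∀ {X} {u v e : Fin n} {g : Chain n (suc m)} → Fresh X (e ∷ u ∷ v ∷ []) → 4 ℕ.+ tri (suc m) ≤ size X →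
  IsGen (e ∷ u ∷ v ∷ X) g → IsGen X (star u e v g)
gen-step {n} {m} {X} {u} {v} {e} {g} (e∉ ∷ u∉ ∷ v∉ ∷ []) h (isGen Zg Sg) = isGen
  (zc-star (d3 (e∉ ∘ here ∘ sym) (u∉ ∘ here) (e∉ ∘ there ∘ here) (u∉ ∘ there) (e∉ ∘ there ∘ there) v∉)
    (zc-⊆ (∷⊆ (there (here refl)) (∷⊆ (here refl) (∷⊆ (there (there (here refl))) (there ∘ there ∘ there)))) Zg))
  λ z Z → sp-bind id step (star-span (u∉ ∘ there) v∉ (u∉ ∘ here) (ℕₚ.≤-trans (ℕₚ.n≤1+n _) h) z Z)
  where
  Goal : Chain n (suc (suc m)) → Set
  Goal = Sp X (_≡ star u e v g)
  move : ∀ {a y} b → a ∉ u ∷ v ∷ X → b ∉ a ∷ u ∷ v ∷ X → Zc (a ∷ u ∷ v ∷ X) y →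
    Σ (Chain n (suc m)) λ y' → Zc (b ∷ a ∷ u ∷ v ∷ X) y' × (y ~[ a ∷ u ∷ v ∷ X ] y')
  move b a∉ b∉ Zy = push b _ b∉ Zy λ c ne c∉ → vanish m _
    (≤-size-∷ (∉-∷ (ne ∘ sym) b∉) (≤-size-∷ c∉ (≤-size-∷ a∉ (≤-size-∷ u∉ (≤-size-∷ v∉ h))))) _ (zc-ι b c Zy)
  atE : ∀ y → Zc (e ∷ u ∷ v ∷ X) y → Goal (star u e v y)
  atE y Zy = sp-map (star-linear u e v)
    (λ b → bd-star (d3 (e∉ ∘ here ∘ sym) (u∉ ∘ here) (e∉ ∘ there ∘ here) (u∉ ∘ there) (e∉ ∘ there ∘ there) v∉)
      (bd-⊆ (∷⊆ (there (here refl)) (∷⊆ (here refl) (∷⊆ (there (there (here refl))) (there ∘ there ∘ there)))) b))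
    (λ { refl → gen refl }) (Sg y Zy)
  v≢u : v ≢ u
  v≢u = u∉ ∘ here ∘ sym
  d₁ : ∀ {a} → a ∉ u ∷ v ∷ X → Distinct3 X u a v
  d₁ a∉ = d3 (a∉ ∘ here ∘ sym) (u∉ ∘ here) (a∉ ∘ there ∘ here) (u∉ ∘ there) (a∉ ∘ there ∘ there) v∉
  d₂ : ∀ {a} → a ∉ u ∷ v ∷ X → Distinct3 X v a u
  d₂ a∉ = d3 (a∉ ∘ there ∘ here ∘ sym) v≢u (a∉ ∘ here) v∉ (a∉ ∘ there ∘ there) (u∉ ∘ there)
  Pushed : Fin n → Fin n → Chain n (suc m) → Set
  Pushed a b y = Σ (Chain n (suc m)) λ y' → Zc (b ∷ a ∷ u ∷ v ∷ X) y' × (y ~[ a ∷ u ∷ v ∷ X ] y')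
  toE : ∀ a y → a ∉ u ∷ v ∷ X → e ≢ a → Pushed a e y → Goal (star v a u y)
  toE a y a∉ e≢a (y' , Zy' , y~) = sp-~ (~-trans
      (~-star (d₂ a∉) (~-⊆ (∷⊆ (there (there (here refl))) (∷⊆ (here refl) (∷⊆ (there (here refl)) (there ∘ there ∘ there)))) y~))
      (star-hop (∉-∷ e≢a (∉-∷ (e∉ ∘ there ∘ here) (∉-∷ (e∉ ∘ here) (e∉ ∘ there ∘ there))) ∷
        ∉-∷ (a∉ ∘ there ∘ here) (∉-∷ (a∉ ∘ here) (a∉ ∘ there ∘ there)) ∷ ∉-∷ v≢u v∉ ∷ (u∉ ∘ there) ∷ [])
        (zc-⊆ (∷-mono (∷-mono (∷⊆ (there (here refl)) (∷⊆ (here refl) (there ∘ there))))) Zy')))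
    (atE y' (zc-⊆ (∷-mono there) Zy'))
  second : ∀ a y → a ∉ u ∷ v ∷ X → e ≢ a → Zc (a ∷ u ∷ v ∷ X) y → Goal (star v a u y)
  second a y a∉ e≢a Zy = toE a y a∉ e≢a (move e a∉ (∉-∷ e≢a e∉) Zy)
  enough : ∀ {a} → a ∉ u ∷ v ∷ X → e ≢ a → 1 ≤ size (e ∷ a ∷ u ∷ v ∷ X)
  enough a∉ e≢a = ≤-size-∷ (∉-∷ e≢a e∉) (≤-size-∷ a∉ (≤-size-∷ u∉ (≤-size-∷ v∉ (ℕₚ.≤-trans (s≤s (s≤s (s≤s (s≤s (s≤s z≤n))))) h))))
  enough′ : ∀ {a} → a ∉ u ∷ v ∷ X → 1 ≤ size (a ∷ u ∷ v ∷ X)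
  enough′ a∉ = ≤-size-∷ a∉ (≤-size-∷ u∉ (≤-size-∷ v∉ (ℕₚ.≤-trans (s≤s (s≤s (s≤s (s≤s z≤n)))) h)))
  other : ∀ {a} → a ∉ u ∷ v ∷ X → ∃ λ b → b ∉ e ∷ a ∷ u ∷ v ∷ X
  other {a} a∉ with e Finₚ.≟ a
  ... | no e≢a = fresh (e ∷ a ∷ u ∷ v ∷ X) (enough a∉ e≢a)
  ... | yes refl = map₂ (λ b∉ → ∉-∷ (b∉ ∘ here) b∉) (fresh (a ∷ u ∷ v ∷ X) (enough′ a∉))
  viaSecond : ∀ a y b → a ∉ u ∷ v ∷ X → b ∉ a ∷ u ∷ v ∷ X → e ≢ b → Pushed a b y → Goal (star u a v y)
  viaSecond a y b a∉ b∉ e≢b (y' , Zy' , y~) = sp-~ (~-trans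
      (~-star (d₁ a∉) (~-⊆ (∷⊆ (there (here refl)) (∷⊆ (here refl) (∷⊆ (there (there (here refl))) (there ∘ there ∘ there)))) y~))
      (star-hop (b∉ ∷ a∉ ∷ u∉ ∷ v∉ ∷ []) Zy'))
    (second b y' (b∉ ∘ there) e≢b (zc-⊆ (∷-mono there) Zy'))
  first : ∀ a y → a ∉ u ∷ v ∷ X → Zc (a ∷ u ∷ v ∷ X) y → Goal (star u a v y)
  first a y a∉ Zy =
    let b , b∉ = other a∉
    in viaSecond a y b a∉ (b∉ ∘ there) (b∉ ∘ here ∘ sym) (move b a∉ (b∉ ∘ there) Zy)
  viaFirst : ∀ a y b → a ∉ u ∷ v ∷ X → b ∉ a ∷ u ∷ v ∷ X → Pushed a b y → Goal (star v a u y)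
  viaFirst a y b a∉ b∉ (y' , Zy' , y~) = sp-~ (~-trans
        (~-star (d₂ a∉) (~-⊆ (∷⊆ (there (there (here refl))) (∷⊆ (here refl) (∷⊆ (there (here refl)) (there ∘ there ∘ there)))) y~))
        (star-hop (∉-∷ (b∉ ∘ here) (∉-∷ (b∉ ∘ there ∘ there ∘ here) (∉-∷ (b∉ ∘ there ∘ here) (b∉ ∘ there ∘ there ∘ there))) ∷
          ∉-∷ (a∉ ∘ there ∘ here) (∉-∷ (a∉ ∘ here) (a∉ ∘ there ∘ there)) ∷ ∉-∷ v≢u v∉ ∷ (u∉ ∘ there) ∷ [])
          (zc-⊆ (∷-mono (∷-mono (∷⊆ (there (here refl)) (∷⊆ (here refl) (there ∘ there))))) Zy')))
      (first b y' (b∉ ∘ there) (zc-⊆ (∷-mono there) Zy'))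
  step : ∀ {x} → Star u v X x → Goal x
  step (star₁ a y a∉ Zy) = first a y a∉ Zy
  step (star₂ a y a∉ Zy) =
    let b , b∉ = fresh (a ∷ u ∷ v ∷ X) (enough′ a∉)
    in viaFirst a y b a∉ b∉ (move b a∉ b∉ Zy)

-- Pentagons

-- M₅ is the Petersen graph, and ua, vb, ac, uv, bc is one of its 5-cycles: consecutive edges are
-- disjoint.
pent : Fin n → Fin n → Fin n → Fin n → Fin n → Chain n m → Chain n (suc (suc m))
pent u v a b c y = (mk u a ∧ mk v b ∧ y) +C ((mk v b ∧ mk a c ∧ y) +C ((mk a c ∧ mk u v ∧ y) +C
  ((mk u v ∧ mk b c ∧ y) +C (mk b c ∧ mk u a ∧ y))))

pair-linear : ∀ (e f : Pair n) → Linear {n} {m} (λ y → e ∧ f ∧ y)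
pair-linear e f = ∘-linear (∧-linear e) (∧-linear f)

pent-linear : ∀ (u v a b c : Fin n) → Linear {n} {m} (pent u v a b c)
pent-linear u v a b c = +linear (pair-linear _ _) (+linear (pair-linear _ _) (+linear (pair-linear _ _)
  (+linear (pair-linear _ _) (pair-linear _ _))))

∂-pair : ∀ (e f : Pair n) (y : Chain n (suc m)) → ∂ (e ∧ f ∧ y) ≈ (((f ∧ y) -C (e ∧ y)) +C (e ∧ f ∧ ∂ y))
∂-pair e f y τ = trans (∂-∧ e (f ∧ y) τ) (trans (cong (λ x → (f ∧ y) τ + (- x))
    (trans (resp (∧-linear e) (∂-∧ f y) τ) (sub (∧-linear e) y (f ∧ ∂ y) τ)))
  (solve 3 (λ f e p → f :+ (:- (e :+ (:- p))) := (f :+ (:- e)) :+ p) refl ((f ∧ y) τ) ((e ∧ y) τ) ((e ∧ f ∧ ∂ y) τ)))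

-- The boundaries of the five sides telescope around the closed walk. Passing two edges costs no
-- sign.
∂-pent : ∀ (u v a b c : Fin n) (y : Chain n (suc m)) → ∂ (pent u v a b c y) ≈ pent u v a b c (∂ y)
∂-pent u v a b c y τ = begin
  ∂ (pent u v a b c y) τ
    ≡⟨ trans (add ∂-linear (P e₁ e₂) R₁ τ) (cong (∂ (P e₁ e₂) τ +_) (trans (add ∂-linear (P e₂ e₃) R₂ τ)
         (cong (∂ (P e₂ e₃) τ +_) (trans (add ∂-linear (P e₃ e₄) R₃ τ) (cong (∂ (P e₃ e₄) τ +_)
           (add ∂-linear (P e₄ e₅) (P e₅ e₁) τ)))))) ⟩
  ∂ (P e₁ e₂) τ + (∂ (P e₂ e₃) τ + (∂ (P e₃ e₄) τ + (∂ (P e₄ e₅) τ + ∂ (P e₅ e₁) τ)))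
    ≡⟨ cong₂ _+_ (∂-pair e₁ e₂ y τ) (cong₂ _+_ (∂-pair e₂ e₃ y τ) (cong₂ _+_ (∂-pair e₃ e₄ y τ)
         (cong₂ _+_ (∂-pair e₄ e₅ y τ) (∂-pair e₅ e₁ y τ)))) ⟩
  _ ≡⟨ solve 10 (λ a b c d e p q r s t →
         ((b :+ (:- a)) :+ p) :+ (((c :+ (:- b)) :+ q) :+ (((d :+ (:- c)) :+ r) :+ (((e :+ (:- d)) :+ s) :+ ((a :+ (:- e)) :+ t))))
         := p :+ (q :+ (r :+ (s :+ t)))) refl
         ((e₁ ∧ y) τ) ((e₂ ∧ y) τ) ((e₃ ∧ y) τ) ((e₄ ∧ y) τ) ((e₅ ∧ y) τ) _ _ _ _ _ ⟩
  pent u v a b c (∂ y) τ ∎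
  where
  open ≡-Reasoning
  e₁ e₂ e₃ e₄ e₅ : Pair _
  e₁ = mk u a
  e₂ = mk v b
  e₃ = mk a c
  e₄ = mk u v
  e₅ = mk b c
  P : Pair _ → Pair _ → Chain _ _
  P e f = e ∧ f ∧ y
  R₁ R₂ R₃ : Chain _ _
  R₃ = P e₄ e₅ +C P e₅ e₁
  R₂ = P e₃ e₄ +C R₃
  R₁ = P e₂ e₃ +C R₂

∂-pair-cycle : ∀ (e f : Pair n) {y : Chain n m} → Cycle y → ∂ (e ∧ f ∧ y) ≈ ((f ∧ y) -C (e ∧ y))
∂-pair-cycle e f {y} c τ = trans (∂-∧ e (f ∧ y) τ)
  (cong (λ x → (f ∧ y) τ + (- x)) (resp (∧-linear e) (∂-∧-cycle f c) τ))

∂-pent-cycle : ∀ (u v a b c : Fin n) {y : Chain n m} → Cycle y → ∂ (pent u v a b c y) ≈ zeroC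
∂-pent-cycle u v a b c {y} cy τ = begin
  ∂ (pent u v a b c y) τ
    ≡⟨ trans (add ∂-linear (P e₁ e₂) R₁ τ) (cong (∂ (P e₁ e₂) τ +_) (trans (add ∂-linear (P e₂ e₃) R₂ τ)
         (cong (∂ (P e₂ e₃) τ +_) (trans (add ∂-linear (P e₃ e₄) R₃ τ) (cong (∂ (P e₃ e₄) τ +_)
           (add ∂-linear (P e₄ e₅) (P e₅ e₁) τ)))))) ⟩
  ∂ (P e₁ e₂) τ + (∂ (P e₂ e₃) τ + (∂ (P e₃ e₄) τ + (∂ (P e₄ e₅) τ + ∂ (P e₅ e₁) τ)))
    ≡⟨ cong₂ _+_ (∂-pair-cycle e₁ e₂ cy τ) (cong₂ _+_ (∂-pair-cycle e₂ e₃ cy τ) (cong₂ _+_ (∂-pair-cycle e₃ e₄ cy τ)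
         (cong₂ _+_ (∂-pair-cycle e₄ e₅ cy τ) (∂-pair-cycle e₅ e₁ cy τ)))) ⟩
  _ ≡⟨ solve 5 (λ a b c d e →
         (b :+ (:- a)) :+ ((c :+ (:- b)) :+ ((d :+ (:- c)) :+ ((e :+ (:- d)) :+ (a :+ (:- e))))) := :0) refl
         ((e₁ ∧ y) τ) ((e₂ ∧ y) τ) ((e₃ ∧ y) τ) ((e₄ ∧ y) τ) ((e₅ ∧ y) τ) ⟩
  0₃ ∎
  where
  open ≡-Reasoning
  e₁ e₂ e₃ e₄ e₅ : Pair _
  e₁ = mk u a
  e₂ = mk v b
  e₃ = mk a c
  e₄ = mk u v
  e₅ = mk b c
  P : Pair _ → Pair _ → Chain _ _
  P e f = e ∧ f ∧ y
  R₁ R₂ R₃ : Chain _ _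
  R₃ = P e₄ e₅ +C P e₅ e₁
  R₂ = P e₃ e₄ +C R₃
  R₁ = P e₂ e₃ +C R₂

Ok-pair : ∀ {X} {a b c d : Fin n} {y : Chain n m} → Fresh X (a ∷ b ∷ c ∷ d ∷ []) → Ok (a ∷ b ∷ c ∷ d ∷ X) y →
  Ok X (mk a b ∧ mk c d ∧ y)
Ok-pair (a∉ ∷ b∉ ∷ c∉ ∷ d∉ ∷ []) o = Ok-mk∧ (a∉ ∘ here) (a∉ ∘ there ∘ there ∘ there) (b∉ ∘ there ∘ there)
  (Ok-mk∧ (c∉ ∘ here) (∉-∷ (a∉ ∘ there ∘ here ∘ sym) (∉-∷ (b∉ ∘ here ∘ sym) (c∉ ∘ there)))
    (∉-∷ (a∉ ∘ there ∘ there ∘ here ∘ sym) (∉-∷ (b∉ ∘ there ∘ here ∘ sym) d∉))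
    (Ok-⊆ (∷⊆ (there (there (here refl))) (∷⊆ (there (there (there (here refl)))) (∷⊆ (here refl)
      (∷⊆ (there (here refl)) (there ∘ there ∘ there ∘ there))))) o))

fresh-head : ∀ {X vs : List (Fin n)} {v} → Fresh X (v ∷ vs) → v ∉ vs ++ X
fresh-head (v∉ ∷ _) = v∉

fresh-tail : ∀ {X vs : List (Fin n)} {v} → Fresh X (v ∷ vs) → Fresh X vs
fresh-tail (_ ∷ f) = f

module PentFresh {n} {X : List (Fin n)} {u v a b c : Fin n} (F : Fresh X (c ∷ v ∷ b ∷ u ∷ a ∷ [])) where
  cv : c ≢ v
  cb : c ≢ b
  cu : c ≢ u
  ca : c ≢ a
  vb : v ≢ b
  vu : v ≢ u
  va : v ≢ a
  bu : b ≢ u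
  ba : b ≢ a
  ua : u ≢ a
  cX : c ∉ X
  vX : v ∉ X
  bX : b ∉ X
  uX : u ∉ X
  aX : a ∉ X
  cv = fresh-head F ∘ here
  cb = fresh-head F ∘ there ∘ here
  cu = fresh-head F ∘ there ∘ there ∘ here
  ca = fresh-head F ∘ there ∘ there ∘ there ∘ here
  cX = fresh-head F ∘ there ∘ there ∘ there ∘ there
  vb = fresh-head (fresh-tail F) ∘ here
  vu = fresh-head (fresh-tail F) ∘ there ∘ here
  va = fresh-head (fresh-tail F) ∘ there ∘ there ∘ here
  vX = fresh-head (fresh-tail F) ∘ there ∘ there ∘ there
  bu = fresh-head (fresh-tail (fresh-tail F)) ∘ here
  ba = fresh-head (fresh-tail (fresh-tail F)) ∘ there ∘ here
  bX = fresh-head (fresh-tail (fresh-tail F)) ∘ there ∘ there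
  ua = fresh-head (fresh-tail (fresh-tail (fresh-tail F))) ∘ here
  uX = fresh-head (fresh-tail (fresh-tail (fresh-tail F))) ∘ there
  aX = fresh-head (fresh-tail (fresh-tail (fresh-tail (fresh-tail F))))

  fr : ∀ {p q r s} → p ≢ q → p ≢ r → p ≢ s → q ≢ r → q ≢ s → r ≢ s → p ∉ X → q ∉ X → r ∉ X → s ∉ X → Fresh X (p ∷ q ∷ r ∷ s ∷ [])
  fr pq pr ps qr qs rs p q r s = ∉-∷ pq (∉-∷ pr (∉-∷ ps p)) ∷ ∉-∷ qr (∉-∷ qs q) ∷ ∉-∷ rs r ∷ s ∷ []

  private
    ic : c ∈ c ∷ v ∷ b ∷ u ∷ a ∷ X
    ic = here refl
    iv : v ∈ c ∷ v ∷ b ∷ u ∷ a ∷ X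
    iv = there (here refl)
    ib : b ∈ c ∷ v ∷ b ∷ u ∷ a ∷ X
    ib = there (there (here refl))
    iu : u ∈ c ∷ v ∷ b ∷ u ∷ a ∷ X
    iu = there (there (there (here refl)))
    ia : a ∈ c ∷ v ∷ b ∷ u ∷ a ∷ X
    ia = there (there (there (there (here refl))))
    iX : X ⊆ c ∷ v ∷ b ∷ u ∷ a ∷ X
    iX = there ∘ there ∘ there ∘ there ∘ there

  Ok-pent : ∀ {m} {y : Chain n m} → Ok (c ∷ v ∷ b ∷ u ∷ a ∷ X) y → Ok X (pent u v a b c y)
  Ok-pent o = Ok-+ (Ok-pair (fr ua (vu ∘ sym) (bu ∘ sym) (va ∘ sym) (ba ∘ sym) vb uX aX vX bX) (s iu ia iv ib))
    (Ok-+ (Ok-pair (fr vb va (cv ∘ sym) ba (cb ∘ sym) (ca ∘ sym) vX bX aX cX) (s iv ib ia ic))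
    (Ok-+ (Ok-pair (fr (ca ∘ sym) (ua ∘ sym) (va ∘ sym) cu cv (vu ∘ sym) aX cX uX vX) (s ia ic iu iv))
    (Ok-+ (Ok-pair (fr (vu ∘ sym) (bu ∘ sym) (cu ∘ sym) vb (cv ∘ sym) (cb ∘ sym) uX vX bX cX) (s iu iv ib ic))
    (Ok-pair (fr (cb ∘ sym) bu ba cu ca ua bX cX uX aX) (s ib ic iu ia)))))
    where
    s : ∀ {p q r t} → p ∈ c ∷ v ∷ b ∷ u ∷ a ∷ X → q ∈ c ∷ v ∷ b ∷ u ∷ a ∷ X → r ∈ c ∷ v ∷ b ∷ u ∷ a ∷ X → t ∈ c ∷ v ∷ b ∷ u ∷ a ∷ X →
      Ok (p ∷ q ∷ r ∷ t ∷ X) _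
    s p q r t = Ok-⊆ (∷⊆ p (∷⊆ q (∷⊆ r (∷⊆ t iX)))) o

  zc-pent : ∀ {m} {y : Chain n m} → Zc (c ∷ v ∷ b ∷ u ∷ a ∷ X) y → Zc X (pent u v a b c y)
  zc-pent (zc o e) = zc (Ok-pent o) (cyc₊ (∂-pent-cycle u v a b c e))

  bd-pent : ∀ {m} {y : Chain n (suc m)} → Bd (c ∷ v ∷ b ∷ u ∷ a ∷ X) y → Bd X (pent u v a b c y)
  bd-pent (bd x o e) = bd (pent u v a b c x) (Ok-pent o)
    (≈-trans (resp (pent-linear u v a b c) e) (≈-sym (∂-pent u v a b c x)))

pair-∧ : ∀ (e f g : Pair n) (y : Chain n m) → (e ∧ f ∧ g ∧ y) ≈ (g ∧ e ∧ f ∧ y)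
pair-∧ e f g y τ = trans (resp (∧-linear e) (∧-anticomm f g y) τ) (trans (neg (∧-linear e) (g ∧ f ∧ y) τ)
  (trans (cong -_ (∧-anticomm e g (f ∧ y) τ)) (neg-involutive _)))

pent-∧ : ∀ (u v a b c : Fin n) (g : Pair n) (y : Chain n m) → pent u v a b c (g ∧ y) ≈ (g ∧ pent u v a b c y)
pent-∧ u v a b c g y τ = trans (cong₂ _+_ (P (mk u a) (mk v b)) (cong₂ _+_ (P (mk v b) (mk a c))
    (cong₂ _+_ (P (mk a c) (mk u v)) (cong₂ _+_ (P (mk u v) (mk b c)) (P (mk b c) (mk u a))))))
  (sym (trans (add G Q₁ (Q₂ +C (Q₃ +C (Q₄ +C Q₅))) τ) (cong ((g ∧ Q₁) τ +_) (trans (add G Q₂ (Q₃ +C (Q₄ +C Q₅)) τ)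
    (cong ((g ∧ Q₂) τ +_) (trans (add G Q₃ (Q₄ +C Q₅) τ) (cong ((g ∧ Q₃) τ +_) (add G Q₄ Q₅ τ))))))))
  where
  P : ∀ e f → (e ∧ f ∧ g ∧ y) τ ≡ (g ∧ e ∧ f ∧ y) τ
  P e f = pair-∧ e f g y τ
  G = ∧-linear g
  Q₁ Q₂ Q₃ Q₄ Q₅ : Chain _ _
  Q₁ = mk u a ∧ mk v b ∧ y
  Q₂ = mk v b ∧ mk a c ∧ y
  Q₃ = mk a c ∧ mk u v ∧ y
  Q₄ = mk u v ∧ mk b c ∧ y
  Q₅ = mk b c ∧ mk u a ∧ y

pent-star : ∀ (u v a b c p q r : Fin n) (y : Chain n m) → pent u v a b c (star p q r y) ≈ star p q r (pent u v a b c y)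
pent-star u v a b c p q r y τ = trans (sub (pent-linear u v a b c) (mk p q ∧ y) (mk p r ∧ y) τ)
  (cong₂ (λ x y → x + (- y)) (pent-∧ u v a b c (mk p q) y τ) (pent-∧ u v a b c (mk p r) y τ))

mk-≢ : ∀ {u a x y : Fin n} → u ≢ x → u ≢ y → mk x y ≢ mk u a
mk-≢ {u = u} {a} {x} {y} ux uy e with ends-mk⁺ x y [] (subst (λ w → u ∈ ends w []) (sym e) (ends-mk⁻ u a [] (here refl)))
... | here h = ux h
... | there (here h) = uy h

link-∧ : ∀ (e w : Pair n) (c : Chain n (suc m)) → e ≢ w → ι w c ≈ zeroC → ι w (e ∧ c) ≈ zeroC
link-∧ e w c ne z τ = trans (ι-∧ e w c ne τ) (trans (cong -_ (zero≈ (∧-linear e) z τ)) neg-0)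

module PentLink {n l} {X : List (Fin n)} {u v a b c : Fin n} (F : Fresh X (c ∷ v ∷ b ∷ u ∷ a ∷ []))
  (y : Chain n (suc l)) (o : Ok (c ∷ v ∷ b ∷ u ∷ a ∷ X) y) where
  open PentFresh F

  private
    y₀ : ∀ {p} q → p ∈ c ∷ v ∷ b ∷ u ∷ a ∷ X → ι (mk p q) y ≈ zeroC
    y₀ {p} q p∈ = ι-bad (mk p q) o λ g → good-mk⁻ p q g .proj₂ .proj₁ p∈
    iu : u ∈ c ∷ v ∷ b ∷ u ∷ a ∷ X
    iu = there (there (there (here refl)))
    iv : v ∈ c ∷ v ∷ b ∷ u ∷ a ∷ X
    iv = there (here refl)
    five : ∀ {a' : Fin n} {t₁ t₂ t₃ t₄ t₅ s₁ s₅ : F3} → t₁ ≡ s₁ → t₂ ≡ 0₃ → t₃ ≡ 0₃ → t₄ ≡ 0₃ → t₅ ≡ s₅ →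
      t₁ + (t₂ + (t₃ + (t₄ + t₅))) ≡ s₁ + s₅
    five refl refl refl refl refl = solve 2 (λ x y → x :+ (:0 :+ (:0 :+ (:0 :+ y))) := x :+ y) refl _ _

    mids : ∀ a' → a' ≢ v →
      (ι (mk u a') (mk v b ∧ mk a c ∧ y) ≈ zeroC) × (ι (mk u a') (mk a c ∧ mk u v ∧ y) ≈ zeroC) × (ι (mk u a') (mk u v ∧ mk b c ∧ y) ≈ zeroC)
    mids a' a'v =
      link-∧ _ _ (mk a c ∧ y) (mk-≢ (vu ∘ sym) (bu ∘ sym)) (link-∧ _ _ y (mk-≢ ua (cu ∘ sym)) (y₀ a' iu)) ,
      link-∧ _ _ (mk u v ∧ y) (mk-≢ ua (cu ∘ sym)) (link-∧ _ _ y (λ e → a'v (sym (mk-injʳ e))) (y₀ a' iu)) ,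
      link-∧ _ _ (mk b c ∧ y) (λ e → a'v (sym (mk-injʳ e))) (link-∧ _ _ y (mk-≢ (bu ∘ sym) (cu ∘ sym)) (y₀ a' iu))

  -- Among the five edges only ua and uv contain u, and the two sides at ua enter with opposite
  -- orientation.
  link-at : ι (mk u a) (pent u v a b c y) ≈ ((mk v b ∧ y) -C (mk b c ∧ y))
  link-at τ = five {a}
    (∧-self {X = X} (mk u a) {mk v b ∧ y} (Ok-⊆ (ends-mk⁺ u a X) (Ok-mk∧ vb
      (∉-∷ vu (∉-∷ va vX)) (∉-∷ bu (∉-∷ ba bX))
      (Ok-⊆ (∷⊆ iv (∷⊆ (there (there (here refl))) (∷⊆ iu (∷⊆ (there (there (there (there (here refl)))))
        (there ∘ there ∘ there ∘ there ∘ there))))) o))) τ)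
    (proj₁ (mids a (va ∘ sym)) τ) (proj₁ (proj₂ (mids a (va ∘ sym))) τ) (proj₂ (proj₂ (mids a (va ∘ sym))) τ)
    (trans (ι-∧ (mk b c) (mk u a) (mk u a ∧ y) (mk-≢ (bu ∘ sym) (cu ∘ sym)) τ)
      (cong -_ (resp (∧-linear (mk b c)) (∧-self {X = X} (mk u a) {y}
        (Ok-⊆ (ends-mk⁺ u a X) (Ok-⊆ (∷⊆ iu (∷⊆ (there (there (there (there (here refl))))) (there ∘ there ∘ there ∘ there ∘ there))) o))) τ)))

  link-off : ∀ a' → a' ≢ v → a' ≢ a → ι (mk u a') (pent u v a b c y) ≈ zeroC
  link-off a' a'v a'a τ = trans (five {a}
      (link-∧ (mk u a) (mk u a') (mk v b ∧ y) (λ e → a'a (sym (mk-injʳ e)))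
        (link-∧ _ _ y (mk-≢ (vu ∘ sym) (bu ∘ sym)) (y₀ a' iu)) τ)
      (proj₁ (mids a' a'v) τ) (proj₁ (proj₂ (mids a' a'v)) τ) (proj₂ (proj₂ (mids a' a'v)) τ)
      (link-∧ (mk b c) (mk u a') (mk u a ∧ y) (mk-≢ (bu ∘ sym) (cu ∘ sym))
        (link-∧ _ _ y (λ e → a'a (sym (mk-injʳ e))) (y₀ a' iu)) τ))
    (+-identityˡ 0₃)

  -- Of the two terms in `link-at` only vb ∧ y has an edge at v. A pentagon therefore prescribes y
  -- as the double link at ua, vb and leaves the other double links alone, except at uv.
  link-link : ι (mk v b) (ι (mk u a) (pent u v a b c y)) ≈ y
  link-link τ = trans (link-at (mk v b ∷ τ)) (trans (cong₂ (λ x z → x + (- z))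
      (∧-self {X = X} (mk v b) {y} (Ok-⊆ (ends-mk⁺ v b X) (Ok-⊆ (∷⊆ iv (∷⊆ (there (there (here refl)))
        (there ∘ there ∘ there ∘ there ∘ there))) o)) τ)
      (link-∧ (mk b c) (mk v b) y (mk-≢ vb (cv ∘ sym)) (y₀ b iv) τ))
    (solve 1 (λ x → x :+ (:- :0) := x) refl (y τ)))

  link-link-off : ∀ b' → b' ≢ b → ι (mk v b') (ι (mk u a) (pent u v a b c y)) ≈ zeroC
  link-link-off b' b'b τ = trans (link-at (mk v b' ∷ τ)) (trans (cong₂ (λ x z → x + (- z))
      (link-∧ (mk v b) (mk v b') y (λ e → b'b (sym (mk-injʳ e))) (y₀ b' iv) τ)
      (link-∧ (mk b c) (mk v b') y (mk-≢ vb (cv ∘ sym)) (y₀ b' iv) τ))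
    (neg-inverseʳ 0₃))

data Pent {n m} (u v : Fin n) (X : List (Fin n)) : Chain n (suc (suc (suc m))) → Set where
  pent-of : ∀ a b c (y : Chain n (suc m)) → Fresh X (c ∷ v ∷ b ∷ u ∷ a ∷ []) → Zc (c ∷ v ∷ b ∷ u ∷ a ∷ X) y →
    Pent u v X (pent u v a b c y)

-- One vertex short of star-span, the obstructions to pushing lie in groups in
-- which every class avoids a vertex c, and pentagons realise them.
star-pent-span : ∀ {X : List (Fin n)} {u v : Fin n} → u ∉ X → v ∉ X → u ≢ v → 8 ℕ.+ tri m ≤ size X →
  (z : Chain n (suc (suc (suc m)))) → Zc X z → Sp X (λ x → Star u v X x ⊎ Pent u v X x) z
star-pent-span {n = n} {m = m} {X} {u} {v} u∉ v∉ u≢v h z Z =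
  sp≈ (λ τ → solve 2 (λ z w → (z :+ (:- w)) :+ w := z) refl (z τ) (W τ))
    (sp+ (sp-bind id (gen ∘ inj₁) (star-generation u∉ v∉ u≢v z' Z' push-z'))
         (sp-bind id (gen ∘ inj₂) (sp-Σ n λ a → sp-Σ n λ b → spK (D a b))))
  where
  GoodPair : Fin n → Fin n → Set
  GoodPair a b = a ∉ u ∷ v ∷ X × b ∉ v ∷ u ∷ a ∷ X
  record Corr (a b : Fin n) : Set where
    field
      K : Chain n (suc (suc (suc m)))
      y : Chain n (suc m)
      zcK : Zc X K
      spK : Sp X (Pent u v X) K
      at : GoodPair a b → ι (mk v b) (ι (mk u a) z) ~[ v ∷ b ∷ u ∷ a ∷ X ] y
      same : ι (mk v b) (ι (mk u a) K) ≈ y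
      offˡ : ∀ a' b' → a' ≢ v → a' ≢ a → ι (mk v b') (ι (mk u a') K) ≈ zeroC
      offʳ : ∀ b' → b' ≢ b → ι (mk v b') (ι (mk u a) K) ≈ zeroC
  open Corr
  mkCorr : ∀ a b → a ∉ u ∷ v ∷ X → b ∉ v ∷ u ∷ a ∷ X → Corr a b
  mkCorr a b a∉ b∉ = record
      { K = pent u v a b c y' ; y = y' ; zcK = zc-pent Zy' ; spK = gen (pent-of a b c y' F Zy') ; at = λ _ → y~
      ; same = link-link ; offˡ = λ a' b' a'v a'a τ → link-off a' a'v a'a (mk v b' ∷ τ) ; offʳ = link-link-off }
    where
    u∉' : u ∉ a ∷ X
    u∉' = ∉-∷ (a∉ ∘ here ∘ sym) u∉
    b∉' : b ∉ u ∷ a ∷ X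
    b∉' = b∉ ∘ there
    v∉' : v ∉ b ∷ u ∷ a ∷ X
    v∉' = ∉-∷ (b∉ ∘ here ∘ sym) (∉-∷ (u≢v ∘ sym) (∉-∷ (a∉ ∘ there ∘ here ∘ sym) v∉))
    h₄ : 4 ℕ.+ tri m ≤ size (v ∷ b ∷ u ∷ a ∷ X)
    h₄ = ≤-size-∷ v∉' (≤-size-∷ b∉' (≤-size-∷ u∉' (≤-size-∷ (a∉ ∘ there ∘ there) h)))
    fc = fresh (v ∷ b ∷ u ∷ a ∷ X) h₄
    c = proj₁ fc
    c∉ = proj₂ fc
    F : Fresh X (c ∷ v ∷ b ∷ u ∷ a ∷ [])
    F = c∉ ∷ v∉' ∷ b∉' ∷ u∉' ∷ (a∉ ∘ there ∘ there) ∷ []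
    -- The double link misses four vertices, and its links at cd miss two more; of the 8 + 3m
    -- vertices this leaves the 2 + 3m that `vanish` asks for.
    pushed : Σ (Chain n (suc m)) λ y' → Zc (c ∷ v ∷ b ∷ u ∷ a ∷ X) y' × (ι (mk v b) (ι (mk u a) z) ~[ v ∷ b ∷ u ∷ a ∷ X ] y')
    pushed = push c (ι (mk v b) (ι (mk u a) z)) c∉ (zc-ι v b (zc-ι u a Z)) λ d ne d∉ →
      vanish m _ (≤-size-∷ (∉-∷ (ne ∘ sym) c∉) (≤-size-∷ d∉ h₄)) _ (zc-ι c d (zc-ι v b (zc-ι u a Z)))
    y' = proj₁ pushed
    Zy' = proj₁ (proj₂ pushed)
    y~ = proj₂ (proj₂ pushed)
    open PentFresh F using (zc-pent)
    open PentLink F y' (ok Zy')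
  D : ∀ a b → Corr a b
  D a b with a ∈? (u ∷ v ∷ X) | b ∈? (v ∷ u ∷ a ∷ X)
  ... | no a∉ | no b∉ = mkCorr a b a∉ b∉
  ... | yes a∈ | _ = record { K = zeroC ; y = zeroC ; zcK = zc-0 ; spK = sp-0 ≈-refl ; at = λ g → ⊥-elim (proj₁ g a∈)
      ; same = ≈-refl ; offˡ = λ _ _ _ _ → ≈-refl ; offʳ = λ _ _ → ≈-refl }
  ... | no _ | yes b∈ = record { K = zeroC ; y = zeroC ; zcK = zc-0 ; spK = sp-0 ≈-refl ; at = λ g → ⊥-elim (proj₂ g b∈)
      ; same = ≈-refl ; offˡ = λ _ _ _ _ → ≈-refl ; offʳ = λ _ _ → ≈-refl }
  W z' : Chain n (suc (suc (suc m)))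
  W = ΣC n λ a → ΣC n λ b → K (D a b)
  z' = z -C W
  Z' : Zc X z'
  Z' = zc-sub Z (zc-Σ n λ a → zc-Σ n λ b → zcK (D a b))
  -- After W is subtracted every double link at ua, vb bounds, so the links at ua can be pushed off
  -- v as in `star-span`.
  W-link : ∀ a b → a ≢ v → ι (mk v b) (ι (mk u a) W) ≈ y (D a b)
  W-link a b a≢v τ = trans (sum-single n a λ a' ne → sum-0 n λ b' → offˡ (D a' b') a b a≢v (ne ∘ sym) τ)
    (trans (sum-single n b λ b' ne → offʳ (D a b') b (ne ∘ sym) τ) (same (D a b) τ))
  push-z' : ∀ a → a ∉ u ∷ v ∷ X → Σ (Chain n (suc (suc m))) λ x → Zc (a ∷ u ∷ v ∷ X) x × (ι (mk u a) z' ~[ u ∷ a ∷ X ] x)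
  push-z' a a∉ = proj₁ pushed , zc-⊆ (∷⊆ (there (there (here refl))) (∷⊆ (there (here refl)) (∷⊆ (here refl) (there ∘ there ∘ there))))
      (proj₁ (proj₂ pushed)) , proj₂ (proj₂ pushed)
    where
    pushed : Σ (Chain n (suc (suc m))) λ x → Zc (v ∷ u ∷ a ∷ X) x × (ι (mk u a) z' ~[ u ∷ a ∷ X ] x)
    pushed = push v (ι (mk u a) z') (∉-∷ (u≢v ∘ sym) (∉-∷ (a∉ ∘ there ∘ here ∘ sym) v∉)) (zc-ι u a Z') λ b ne b∉ →
      bd-≈ (λ τ → cong (λ x → z (mk u a ∷ mk v b ∷ τ) + (- x)) (sym (W-link a b (a∉ ∘ there ∘ here) τ)))
        (bdy (at (D a b) (a∉ , ∉-∷ ne b∉)))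

-- With no generators the span consists of the boundaries, so `sp-map` into it shows that a linear
-- map kills homology classes.
sp-⊥ : ∀ {X} {c : Chain n m} → Sp X (λ _ → ⊥) c → Bd X c
sp-⊥ (bound b) = b
sp-⊥ (sp+ s t) = bd-+ (sp-⊥ s) (sp-⊥ t)
sp-⊥ (sp- s) = bd-neg (sp-⊥ s)
sp-⊥ (sp≈ e s) = bd-≈ e (sp-⊥ s)

-- Triangles kill cycles that miss a fourth vertex

tr-star-bd : ∀ {X : List (Fin n)} {p q r s} (f : Fresh X (p ∷ q ∷ r ∷ s ∷ [])) {u v a} →
  Fresh (p ∷ q ∷ r ∷ s ∷ X) (u ∷ a ∷ v ∷ []) → ∀ {y : Chain n m} → Zc (u ∷ a ∷ v ∷ p ∷ q ∷ r ∷ s ∷ X) y →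
  Bd X (tr p q r (star u a v y))
tr-star-bd {X = X} {p} {q} {r} {s} (p∉ ∷ q∉ ∷ r∉ ∷ s∉ ∷ []) {u} {v} {a} (u∉ ∷ a∉ ∷ v∉ ∷ []) Z = tri-star-bd
  (add₃ (q ∷ r ∷ s ∷ []) p∉ here ∷ add₃ (r ∷ s ∷ []) q∉ (there ∘ here) ∷ add₃ (s ∷ []) r∉ (there ∘ there ∘ here) ∷
   add₃ [] s∉ (there ∘ there ∘ there ∘ here) ∷
   out u∉ ∷ out′ a∉ ∷ (v∉ ∘ there ∘ there ∘ there ∘ there) ∷ [])
  (zc-⊆ (∷⊆ (there (there (there (here refl)))) (∷⊆ (there (there (there (there (here refl)))))
    (∷⊆ (there (there (there (there (there (here refl)))))) (∷⊆ (there (there (there (there (there (there (here refl)))))))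
    (∷⊆ (here refl) (∷⊆ (there (here refl)) (∷⊆ (there (there (here refl))) (there ∘ there ∘ there ∘ there ∘ there ∘ there ∘ there)))))))) Z)
  where
  L = p ∷ q ∷ r ∷ s ∷ X
  add₃ : ∀ {x} Y → x ∉ Y ++ X → (∀ {w} → w ≡ x → w ∈ L) → x ∉ Y ++ u ∷ a ∷ v ∷ X
  add₃ {x} Y x∉ loc h with ∈-++⁻ Y h
  ... | inj₁ i = x∉ (∈-++⁺ˡ i)
  ... | inj₂ (here e) = u∉ (there (there (loc (sym e))))
  ... | inj₂ (there (here e)) = a∉ (there (loc (sym e)))
  ... | inj₂ (there (there (here e))) = v∉ (loc (sym e))
  ... | inj₂ (there (there (there i))) = x∉ (∈-++⁺ʳ Y i)
  out : u ∉ a ∷ v ∷ L → u ∉ a ∷ v ∷ X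
  out h = h ∘ ∷-mono (∷-mono (there ∘ there ∘ there ∘ there))
  out′ : a ∉ v ∷ L → a ∉ v ∷ X
  out′ h = h ∘ ∷-mono (there ∘ there ∘ there ∘ there)

-- By `star-pent-span` only stars and pentagons need to be killed. A star is killed by
-- `tri-star-bd`. In a pentagon the factor y is spanned by stars, a star factor commutes with the
-- pentagon, and so this case too ends in a triangle times a star.
tr-bd : ∀ {X : List (Fin n)} {p q r s} → Fresh X (p ∷ q ∷ r ∷ s ∷ []) → ∀ (x : Chain n (suc (suc (suc m)))) →
  8 ℕ.+ tri m ≤ size (p ∷ q ∷ r ∷ s ∷ X) → Zc (p ∷ q ∷ r ∷ s ∷ X) x → Bd X (tr p q r x)
tr-bd {n} {m} {X} {p} {q} {r} {s} f x h Z = sp-⊥ (sp-map (tr-linear p q r) bdtr each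
    (star-pent-span u∉ v∉ (v∉' ∘ here ∘ sym) h x Z))
  where
  Y = p ∷ q ∷ r ∷ s ∷ X
  D : Distinct3 (s ∷ X) p q r
  D = d3 (fresh-head f ∘ here) (fresh-head f ∘ there ∘ here) (fresh-head (fresh-tail f) ∘ here)
    (fresh-head f ∘ there ∘ there) (fresh-head (fresh-tail f) ∘ there) (fresh-head (fresh-tail (fresh-tail f)))
  bdtr : ∀ {k} {c : Chain n k} → Bd Y c → Bd X (tr p q r c)
  bdtr b = bd-⊆ there (bd-tr D b)
  fu = fresh Y h
  u = proj₁ fu
  u∉ = proj₂ fu
  fv = fresh (u ∷ Y) (≤-size-∷ u∉ h)
  v = proj₁ fv
  v∉' = proj₂ fv
  v∉ : v ∉ Y
  v∉ = v∉' ∘ there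
  stars : ∀ {k u v} {y : Chain n (suc k)} → u ∉ Y → v ∉ u ∷ Y → Star u v Y y → Bd X (tr p q r y)
  stars u∉ v∉ (star₁ a y a∉ Zy) = tr-star-bd f
    (∉-∷ (a∉ ∘ here ∘ sym) (∉-∷ (v∉ ∘ here ∘ sym) u∉) ∷ (a∉ ∘ there) ∷ (v∉ ∘ there) ∷ [])
    (zc-⊆ (∷⊆ (there (here refl)) (∷⊆ (here refl) (∷⊆ (there (there (here refl))) (there ∘ there ∘ there)))) Zy)
  stars u∉ v∉ (star₂ a y a∉ Zy) = tr-star-bd f
    (∉-∷ (a∉ ∘ there ∘ here ∘ sym) v∉ ∷ ∉-∷ (a∉ ∘ here) (a∉ ∘ there ∘ there) ∷ u∉ ∷ [])
    (zc-⊆ (∷⊆ (there (there (here refl))) (∷⊆ (here refl) (∷⊆ (there (here refl)) (there ∘ there ∘ there)))) Zy)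
  pents : ∀ {k} a b c (y : Chain n (suc k)) → 3 ℕ.+ tri k ≤ size (c ∷ v ∷ b ∷ u ∷ a ∷ Y) →
    Fresh Y (c ∷ v ∷ b ∷ u ∷ a ∷ []) → Zc (c ∷ v ∷ b ∷ u ∷ a ∷ Y) y → Bd X (tr p q r (pent u v a b c y))
  pents {k} a b c y h₃ F Zy = sp-⊥ (sp-map (∘-linear (tr-linear p q r) (pent-linear u v a b c)) (bdtr ∘ PentFresh.bd-pent F) one
      (star-span t∉ (w∉ ∘ there) (w∉ ∘ here ∘ sym) h₃ y Zy))
    where
    P = c ∷ v ∷ b ∷ u ∷ a ∷ Y
    ft = fresh P h₃
    t = proj₁ ft
    t∉ = proj₂ ft
    fw = fresh (t ∷ P) (≤-size-∷ t∉ h₃)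
    w = proj₁ fw
    w∉ = proj₂ fw
    out : ∀ {x} → x ∉ P → x ∉ Y
    out h = h ∘ there ∘ there ∘ there ∘ there ∘ there
    one' : ∀ {a' t w} {y' : Chain n _} → t ∉ P → w ∉ t ∷ P → a' ∉ t ∷ w ∷ P → Zc (a' ∷ t ∷ w ∷ P) y' →
      Bd X (tr p q r (pent u v a b c (star t a' w y')))
    one' {a'} {t} {w} {y'} t∉ w∉ a∉ Zy' = bd-≈ (resp (tr-linear p q r) (≈-sym (pent-star u v a b c t a' w y')))
      (tr-star-bd f (∉-∷ (a∉ ∘ here ∘ sym) (∉-∷ (w∉ ∘ here ∘ sym) (out t∉)) ∷
          (a∉ ∘ there ∘ ∷-mono (there ∘ there ∘ there ∘ there ∘ there)) ∷ out (w∉ ∘ there) ∷ [])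
        (zcp y' Zy'))
      where
      lift : Fresh (t ∷ a' ∷ w ∷ Y) (c ∷ v ∷ b ∷ u ∷ a ∷ [])
      lift = pushF F (λ e → t∉ e) (λ e → a∉ (there (there e))) (λ e → w∉ (there e))
        where
        pushF : ∀ {vs} → Fresh Y vs → t ∉ vs ++ Y → a' ∉ vs ++ Y → w ∉ vs ++ Y → Fresh (t ∷ a' ∷ w ∷ Y) vs
        pushF [] _ _ _ = []
        pushF {x ∷ vs} (x∉ ∷ f) t∉ a∉ w∉ = new ∷ pushF f (t∉ ∘ there) (a∉ ∘ there) (w∉ ∘ there)
          where
          new : x ∉ vs ++ t ∷ a' ∷ w ∷ Y
          new h with ∈-++⁻ vs h
          ... | inj₁ i = x∉ (∈-++⁺ˡ i)
          ... | inj₂ (here refl) = t∉ (here refl)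
          ... | inj₂ (there (here refl)) = a∉ (here refl)
          ... | inj₂ (there (there (here refl))) = w∉ (here refl)
          ... | inj₂ (there (there (there i))) = x∉ (∈-++⁺ʳ vs i)
      zcp : ∀ {k} (y' : Chain n k) → Zc (a' ∷ t ∷ w ∷ P) y' → Zc (t ∷ a' ∷ w ∷ Y) (pent u v a b c y')
      zcp y' Zy' = PentFresh.zc-pent lift (zc-⊆ perm Zy')
        where
        perm : c ∷ v ∷ b ∷ u ∷ a ∷ t ∷ a' ∷ w ∷ Y ⊆ a' ∷ t ∷ w ∷ P
        perm = ∷⊆ (there (there (there (here refl)))) (∷⊆ (there (there (there (there (here refl)))))
          (∷⊆ (there (there (there (there (there (here refl)))))) (∷⊆ (there (there (there (there (there (there (here refl)))))))
          (∷⊆ (there (there (there (there (there (there (there (here refl)))))))) (∷⊆ (there (here refl)) (∷⊆ (here refl)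
          (∷⊆ (there (there (here refl))) (there ∘ there ∘ there ∘ there ∘ there ∘ there ∘ there ∘ there))))))))
    one : ∀ {x} → Star t w P x → Sp X (λ _ → ⊥) (tr p q r (pent u v a b c x))
    one (star₁ a' y' a∉ Zy') = bound (one' t∉ w∉ a∉ Zy')
    one (star₂ a' y' a∉ Zy') = bound (one' (w∉ ∘ there) (∉-∷ (w∉ ∘ here ∘ sym) t∉)
      (∉-∷ (a∉ ∘ there ∘ here) (∉-∷ (a∉ ∘ here) (a∉ ∘ there ∘ there)))
      (zc-⊆ (∷-mono (∷⊆ (there (here refl)) (∷⊆ (here refl) (there ∘ there)))) Zy'))
  each : ∀ {x} → Star u v Y x ⊎ Pent u v Y x → Sp X (λ _ → ⊥) (tr p q r x)
  each (inj₁ st) = bound (stars u∉ v∉' st)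
  each (inj₂ (pent-of a b c y F Zy)) = bound (pents a b c y
    (sizes F) F Zy)
    where
    sizes : Fresh Y (c ∷ v ∷ b ∷ u ∷ a ∷ []) → 3 ℕ.+ tri m ≤ size (c ∷ v ∷ b ∷ u ∷ a ∷ Y)
    sizes (c∉ ∷ v∉ ∷ b∉ ∷ u∉ ∷ a∉ ∷ []) = ≤-size-∷ c∉ (≤-size-∷ v∉ (≤-size-∷ b∉ (≤-size-∷ u∉ (≤-size-∷ a∉ h))))

-- Spans certified by elimination

nth-++ : ∀ {A : Set} {d : A} {x xs ys} → x ∈ xs → ∃ λ i → i ℕ.< length xs × nth d (xs ++ ys) i ≡ x
nth-++ (here refl) = 0 , s≤s z≤n , refl
nth-++ (there h) with nth-++ h
... | i , i< , e = suc i , s≤s i< , e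

below-∈ : ∀ N i {U} → allBelow N U ≡ true → i ℕ.< N → i ∈ U
below-∈ (suc N) i a i< with i ℕ.≟ N
... | yes refl = elem-true (proj₁ (&&-split a))
... | no ne = below-∈ N i (proj₂ (&&-split a)) (ℕₚ.≤∧≢⇒< (ℕₚ.≤-pred i<) ne)

module Certified {n} {X : List (Fin n)} (d : Fin n) (vs : List (Fin n)) (f : Fresh X vs) (full : size X ≡ length vs)
  (m : ℕ) (h : tri (suc m ℕ.+ 0) ≤ size X)
  (pos : List ℕ) (pos-distinct : AllPairs _≢_ pos) (pos-bound : All (ℕ._< length vs) pos) (pos-all : allBelow (length vs) pos ≡ true)
  where
  open Interp (nth d vs)
  private
    E = fresh-env f

  gens-of : ∀ z → Zc X z → Sp X (Gen (nth d vs) (suc m) pos) z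
  gens-of = gens-span (nth d vs) (suc m) pos X h
    (distinct pos-distinct pos-bound)
    (All.map (λ i< → All.lookup (Env.outside E) (nth-∈ d E vs i<)) pos-bound)
    λ a a∉ → let i , i< , e = nth-++ {d = d} {ys = []} (fresh-covers f full a a∉)
      in i , below-∈ (length vs) i pos-all i< , trans (cong (λ l → nth d l i) (sym (Listₚ.++-identityʳ vs))) e
    where
    distinct : ∀ {ps} → AllPairs _≢_ ps → All (ℕ._< length vs) ps → AllPairs (λ i j → nth d vs i ≢ nth d vs j) ps
    distinct [] [] = []
    distinct (ne ∷ u) (i< ∷ b) = All.zipWith (λ { (i≢j , j<) e → i≢j (nth-inj d E (Env.uniq E) i< j< e) }) (ne , b) ∷ distinct u b

  -- The cycles in `extra` carry the symbols that follow the generators. Relations may thus express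
  -- iterated stars through cycles of another shape.
  certify : ∀ (G : Chain n (suc m ℕ.+ 0) → Set) (extra : List (Poly (suc m))) (rels : List (Rel (suc m))) known steps →
    relsOK (length vs) (genP (suc m) pos ++ extra) rels ≡ true →
    allBelow (length (genP (suc m) pos)) (eliminate (map (vector ∘ proj₁) rels) known steps) ≡ true →
    (∀ i → i ∈ known → Sp X G (⟦ nth [] (genP (suc m) pos ++ extra) i ⟧ unit)) →
    ∀ z → Zc X z → Sp X G z
  certify G extra rels known steps ok₁ ok₂ base z Z = sp-bind id each (gens-of z Z)
    where
    each : ∀ {c} → Gen (nth d vs) (suc m) pos c → Sp X G c
    each (g , g∈ , e) =
      let i , i< , at = nth-++ {d = []} {ys = extra} g∈
      in sp≈ (≈-sym e) (subst (λ p → Sp X G (⟦ p ⟧ unit)) at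
           (Elim.elimination d E unit (zc ok₀ cyc₀) G (genP (suc m) pos ++ extra) rels ok₁ known base steps _ ok₂ i i<))

-- One generator on seven vertices

rels₇ : List (ℕ × ℕ)
rels₇ =
  (1015201120061002 , 14613022451302) ∷
  (20151006 , 256240115624131563401256340215613022461302) ∷
  (20191000 , 256230115623141563401256340215614022351402) ∷
  (103120272004 , 13615022341502) ∷
  (20272006 , 2462301146231514615022341502) ∷
  (103920352000 , 13516022341602) ∷
  (20031010 , 256340115634121562401256240315612032451203) ∷
  (20211012 , 256230115623141562401256240315614032261403) ∷
  (20252014 , 2462301146231514615032241503) ∷
  (20091016 , 256240115624131562301256230415613042251304) ∷
  (20131020 , 256240115624131562301256230415613042261304) ∷
  (10312022 , 13615042231504) ∷
  (10372016 , 12516042231604) ∷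
  (10392018 , 13516042231604) ∷
  (100520301026 , 13612052341205) ∷
  (10071026 , 1462301246230514612052341205) ∷
  (10151024 , 1462301246230514613052241305) ∷
  (10212028 , 12614052231405) ∷
  (10232030 , 13614052231405) ∷
  (10332024 , 12416052231605) ∷
  (100120381034 , 13512062341206) ∷
  (10111032 , 1452301245230614513062241306) ∷
  (10172036 , 12514062231406) ∷
  (10192038 , 13514062231406) ∷
  (10252032 , 12415062231506) ∷
  (10272034 , 13415062231506) ∷
  (20061000 , 24635011463502) ∷
  (20141008 , 24625011462503) ∷
  (20121010 , 14526012452603) ∷
  (20301024 , 23624011362405) ∷
  (20281026 , 13426012342605) ∷
  (20381032 , 23524011352406) ∷
  (20361034 , 13425012342506) ∷
  (20151009 , 24625011462513) ∷
  (20131011 , 14526012452613) ∷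
  (20211019 , 13526012352614) ∷
  (20311025 , 23624011362415) ∷
  (20291027 , 13426012342615) ∷
  (20391033 , 23524011352416) ∷
  (20401000 , 0) ∷
  []

steps₇ : List ℕ
steps₇ =
  1039 ∷ 1002 ∷ 1023 ∷ 1026 ∷ 1031 ∷ 1035 ∷ 1001 ∷ 1004 ∷ 1007 ∷ 1016 ∷ 1017 ∷ 1019 ∷ 1021 ∷ 1024 ∷ 1025 ∷ 1028 ∷ 1029 ∷ 1030 ∷ 1032 ∷ 1033 ∷ 1034 ∷ 1036 ∷ 1037 ∷ 1038 ∷ 1000 ∷ 1003 ∷ 1005 ∷ 1006 ∷ 1008 ∷ 1009 ∷ 1010 ∷ 1011 ∷ 1012 ∷ 1013 ∷ 1014 ∷ 1015 ∷ 1018 ∷ 1020 ∷ 1022 ∷ 1027 ∷ []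

-- Symbol 40, placed behind the forty generators. It coincides with generator 0, since two stars
-- change sign; the last relation, with empty filling, records this.
σ₂ : Poly 2
σ₂ = starP 0 1 2 (starP 3 4 5 oneP)

pos₇ : List ℕ
pos₇ = 0 ∷ 1 ∷ 2 ∷ 3 ∷ 4 ∷ 5 ∷ 6 ∷ []

check-rels₇ : relsOK 7 (genP 2 pos₇ ++ σ₂ ∷ []) (relsOf 2 rels₇) ≡ true
check-rels₇ = refl

check-steps₇ : allBelow (length (genP 2 pos₇)) (eliminate (map (vector ∘ proj₁) (relsOf 2 rels₇)) (40 ∷ []) (map (vecOf 400) steps₇)) ≡ true
check-steps₇ = refl

pos₇-distinct : AllPairs _≢_ pos₇
pos₇-distinct = from-yes (AllPairs.allPairs? (λ i j → ¬? (i ℕ.≟ j)) pos₇)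

pos₇-bound : All (ℕ._< 7) pos₇
pos₇-bound = from-yes (All.all? (ℕ._<? 7) pos₇)

-- The forty star generators are all reduced to one. The vertex g does not occur in the class; it is
-- the seventh vertex, through which the relations pass.
one₇ : ∀ {X : List (Fin n)} {a b c d e f g} → Fresh X (a ∷ b ∷ c ∷ d ∷ e ∷ f ∷ g ∷ []) → size X ≡ 7 →
  IsGen X (star a b c (star d e f unit))
one₇ {n} {X} {a} {b} {c} {d} {e} {f} {g} F full = isGen
    (zc-star {X = X} (d3 (h₀ ∘ here) (h₀ ∘ there ∘ here) (h₁ ∘ here) (h₀ ∘ there ∘ there ∘ there ∘ there ∘ there ∘ there)
      (h₁ ∘ there ∘ there ∘ there ∘ there ∘ there) (h₂ ∘ there ∘ there ∘ there ∘ there))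
      (zc-star (d3 (h₃ ∘ here) (h₃ ∘ there ∘ here) (h₄ ∘ here)
        (abc h₃' (h₀ ∘ there ∘ there ∘ here ∘ sym) (h₁ ∘ there ∘ here ∘ sym) (h₂ ∘ here ∘ sym))
        (abc h₄' (h₀ ∘ there ∘ there ∘ there ∘ here ∘ sym) (h₁ ∘ there ∘ there ∘ here ∘ sym) (h₂ ∘ there ∘ here ∘ sym))
        (abc h₅' (h₀ ∘ there ∘ there ∘ there ∘ there ∘ here ∘ sym) (h₁ ∘ there ∘ there ∘ there ∘ here ∘ sym) (h₂ ∘ there ∘ there ∘ here ∘ sym)))
        (zc ok₀ cyc₀)))
    (certify (_≡ star a b c (star d e f unit)) (σ₂ ∷ []) (relsOf 2 rels₇) (40 ∷ []) (map (vecOf 400) steps₇)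
      check-rels₇ check-steps₇ base)
  where
  vs = a ∷ b ∷ c ∷ d ∷ e ∷ f ∷ g ∷ []
  h₀ = fresh-head F
  h₁ = fresh-head (fresh-tail F)
  h₂ = fresh-head (fresh-tail (fresh-tail F))
  h₃ = fresh-head (fresh-tail (fresh-tail (fresh-tail F)))
  h₄ = fresh-head (fresh-tail (fresh-tail (fresh-tail (fresh-tail F))))
  h₅ = fresh-head (fresh-tail (fresh-tail (fresh-tail (fresh-tail (fresh-tail F)))))
  h₃' : d ∉ X
  h₃' = h₃ ∘ there ∘ there ∘ there
  h₄' : e ∉ X
  h₄' = h₄ ∘ there ∘ there
  h₅' : f ∉ X
  h₅' = h₅ ∘ there
  abc : ∀ {x} → x ∉ X → x ≢ a → x ≢ b → x ≢ c → x ∉ a ∷ b ∷ c ∷ X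
  abc x xa xb xc = ∉-∷ xa (∉-∷ xb (∉-∷ xc x))
  open Certified a vs F full 1 (subst (6 ≤_) (sym full) (ℕₚ.n≤1+n 6)) pos₇ pos₇-distinct pos₇-bound refl
  open Interp (nth a vs)
  base : ∀ i → i ∈ 40 ∷ [] → Sp X (_≡ star a b c (star d e f unit)) (⟦ nth [] (genP 2 pos₇ ++ σ₂ ∷ []) i ⟧ unit)
  base .40 (here refl) = sp≈ (≈-sym (≈-trans (⟦starP⟧ 0 1 2 (starP 3 4 5 oneP) unit) (resp (star-linear a b c)
    (≈-trans (⟦starP⟧ 3 4 5 oneP unit) (resp (star-linear d e f) (⟦oneP⟧ unit)))))) (gen refl)

-- A generator on 3m + 1 vertices; splitting a boundary at a vertex

pick-fresh : ∀ (X : List (Fin n)) k → k ≤ size X → ∃ λ vs → length vs ≡ k × Fresh X vs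
pick-fresh X zero h = [] , refl , []
pick-fresh X (suc k) h =
  let vs , e , F = pick-fresh X k (ℕₚ.≤-trans (ℕₚ.n≤1+n k) h)
      v , v∉ = fresh (vs ++ X) {0} (ℕₚ.+-cancelˡ-≤ (length vs) _ _
        (subst₂ _≤_ (trans (cong suc (sym e)) (ℕₚ.+-comm 1 (length vs))) (fresh-size F) h))
  in v ∷ vs , cong suc e , v∉ ∷ F

-- Seven vertices start the induction, and every further factor ue - uv uses up three more.
one-exists : ∀ m (X : List (Fin n)) → size X ≡ 7 ℕ.+ tri m → Σ (Chain n (suc (suc m))) (IsGen X)
one-exists zero X full = from (pick-fresh X 7 (ℕₚ.≤-reflexive (sym full)))
  where
  from : (∃ λ vs → length vs ≡ 7 × Fresh X vs) → Σ (Chain _ 2) (IsGen X)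
  from (a ∷ b ∷ c ∷ d ∷ e ∷ f ∷ g ∷ [] , refl , F) = _ , one₇ F full
one-exists (suc m) X full = from (pick-fresh X 3 (subst (3 ≤_) (sym full) (s≤s (s≤s (s≤s z≤n)))))
  where
  from : (∃ λ vs → length vs ≡ 3 × Fresh X vs) → Σ (Chain _ (suc (suc (suc m)))) (IsGen X)
  from (e ∷ u ∷ v ∷ [] , refl , F@(e∉ ∷ u∉ ∷ v∉ ∷ [])) =
    let g , G = one-exists m (e ∷ u ∷ v ∷ X) (≡-size-∷ e∉ (≡-size-∷ u∉ (≡-size-∷ v∉ full)))
    in star u e v g , gen-step F (ℕₚ.≤-reflexive (sym full)) G

-- Removing from the filling its part through a changes the boundary by the links at the edges ax.
-- These are cycles because z misses a, and they miss both a and x. A class that dies once a is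
-- available is thus a sum of classes missing one more vertex.
split-bd : ∀ {Y : List (Fin n)} {a} (z : Chain n (suc m)) → a ∉ Y → Zc (a ∷ Y) z → Bd Y z →
  Sp (a ∷ Y) (λ c → ∃ λ x → x ∉ a ∷ Y × Zc (x ∷ a ∷ Y) c) z
split-bd {n = n} {m} {Y} {a} z a∉ Z (bd b o e) = sp≈ (≈-sym z-eq)
    (sp+ (bound (bd (avoid a b) (Ok-avoid a a∉ o) ≈-refl)) (sp-Σ n part))
  where
  bx : Fin n → Chain n (suc m)
  bx x = ι (mk a x) b
  bx-cycle : ∀ x → Cycle (bx x)
  bx-cycle x = cyc₊ λ τ → trans (∂-ι (mk a x) o τ) (trans (cong -_ (trans (sym (e (mk a x ∷ τ)))
    (ι-bad (mk a x) (ok Z) (λ g → good-mk⁻ a x g .proj₂ .proj₁ (here refl)) τ))) neg-0)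
  z-eq : z ≈ (∂ (avoid a b) +C ΣC n bx)
  z-eq τ = begin
    z τ ≡⟨ e τ ⟩
    ∂ b τ ≡⟨ solve 2 (λ x y → x := (x :+ (:- y)) :+ y) refl (∂ b τ) (∂ (link a b) τ) ⟩
    (∂ b τ + (- ∂ (link a b) τ)) + ∂ (link a b) τ
      ≡⟨ cong₂ _+_ (sym (sub ∂-linear b (link a b) τ)) (trans (sums ∂-linear n (λ x → mk a x ∧ bx x) τ)
           (sum-cong n λ x → ∂-∧-cycle (mk a x) (bx-cycle x) τ)) ⟩
    ∂ (avoid a b) τ + sum n (λ x → bx x τ) ∎
    where open ≡-Reasoning
  part : ∀ x → Sp (a ∷ Y) (λ c → ∃ λ x → x ∉ a ∷ Y × Zc (x ∷ a ∷ Y) c) (bx x)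
  part x = go (good? Y (mk a x))
    where
    go : Dec (Good Y (mk a x)) → Sp (a ∷ Y) (λ c → ∃ λ x → x ∉ a ∷ Y × Zc (x ∷ a ∷ Y) c) (bx x)
    go (no ng) = sp-0 (ι-bad (mk a x) o ng)
    go (yes g) = let a≢x , _ , x∉ = good-mk⁻ a x g in
      gen (x , ∉-∷ (a≢x ∘ sym) x∉ , zc (Ok-⊆ (∷⊆ (there (here refl)) (∷⊆ (here refl) (there ∘ there))) (Ok-ι a x o)) (bx-cycle x))

-- ve - uv = (uv + ue + ve) - (ue - uv), because 2uv = -uv.
star-tr : ∀ (u v e : Fin n) (y : Chain n m) → star v e u y ≈ (tr u v e y -C star u e v y)
star-tr u v e y τ = trans (cong (λ w → (mk v e ∧ y) τ + (- (w ∧ y) τ)) (mk-sym v u))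
  (solve 3 (λ uv ue ve → ve :+ (:- uv) := (uv :+ (ue :+ ve)) :+ (:- (ue :+ (:- uv)))) refl ((mk u v ∧ y) τ) ((mk u e ∧ y) τ) ((mk v e ∧ y) τ))

scale : F3 → Chain n m → Chain n m
scale a c τ = a · c τ

scale-lin : ∀ {n' m'} {f : Chain n m → Chain n' m'} → Linear f → ∀ a c → f (scale a c) ≈ scale a (f c)
scale-lin L #0 c = zer L
scale-lin L #1 c = ≈-refl
scale-lin L #2 c = neg L c

zc-scale : ∀ {X} a {c : Chain n m} → Zc X c → Zc X (scale a c)
zc-scale #0 z = zc-0
zc-scale #1 z = z
zc-scale #2 z = zc-neg z

sp-scale : ∀ {X G} a {c : Chain n m} → Sp X G c → Sp X G (scale a c)
sp-scale #0 s = sp-0 ≈-refl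
sp-scale #1 s = s
sp-scale #2 s = sp- s

-- The recursion for H(M_{3m})

-- `g a` is a generator on the vertices other than u and v, chosen to miss a, so that it can be
-- multiplied by the triangle uva. `Y a c` has a generating link at ec and zero links at all other
-- edges of e, so multiples of it correct the links of a cycle for one c at a time.
module Recursion {n k : ℕ} {X : List (Fin n)} {e u v : Fin n} (F : Fresh X (e ∷ u ∷ v ∷ []))
  (h : tri (4 ℕ.+ k) ≤ size X)
  (g : Fin n → Chain n (3 ℕ.+ k)) (Y : Fin n → Fin n → Chain n (3 ℕ.+ k))
  (Zg : ∀ a → a ∉ u ∷ v ∷ X → Zc (a ∷ u ∷ v ∷ X) (g a))
  (Sg : ∀ a → a ∉ u ∷ v ∷ X → ∀ z → Zc (u ∷ v ∷ X) z → Sp (u ∷ v ∷ X) (_≡ g a) z)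
  (ZY : ∀ a c → a ∉ u ∷ v ∷ X → e ≢ a → c ∉ e ∷ a ∷ u ∷ v ∷ X → Zc (a ∷ u ∷ v ∷ X) (Y a c))
  (SY : ∀ a c → a ∉ u ∷ v ∷ X → e ≢ a → c ∉ e ∷ a ∷ u ∷ v ∷ X → ∀ z → Zc (e ∷ c ∷ a ∷ u ∷ v ∷ X) z →
    Sp (e ∷ c ∷ a ∷ u ∷ v ∷ X) (_≡ ι (mk e c) (Y a c)) z)
  (OY : ∀ a c → a ∉ u ∷ v ∷ X → e ≢ a → c ∉ e ∷ a ∷ u ∷ v ∷ X → ∀ c' → c' ≢ c → ι (mk e c') (Y a c) ≈ zeroC)
  where

  private
    e∉ = fresh-head F
    u∉ = fresh-head (fresh-tail F)
    v∉ = fresh-head (fresh-tail (fresh-tail F))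

  -- With 3r + 3 vertices there are 3r + 1 choices of a for `triangles`, 3r(3r - 1) pairs for
  -- `lifts`, and for `base` the group on three vertices fewer.
  data TGen : Chain n (4 ℕ.+ k) → Set where
    triangles : ∀ a → a ∉ u ∷ v ∷ X → TGen (tr u v a (g a))
    lifts     : ∀ a c → a ∉ u ∷ v ∷ X → e ≢ a → c ∉ e ∷ a ∷ u ∷ v ∷ X → TGen (star u a v (Y a c))
    base      : ∀ x → Zc (e ∷ u ∷ v ∷ X) x → TGen (star u e v x)

  dist : ∀ {a} → a ∉ u ∷ v ∷ X → Distinct3 X u a v
  dist a∉ = d3 (a∉ ∘ here ∘ sym) (u∉ ∘ here) (a∉ ∘ there ∘ here) (u∉ ∘ there) (a∉ ∘ there ∘ there) v∉

  dist-tr : ∀ {a} → a ∉ u ∷ v ∷ X → Distinct3 X u v a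
  dist-tr a∉ = d3 (u∉ ∘ here) (a∉ ∘ here ∘ sym) (a∉ ∘ there ∘ here ∘ sym) (u∉ ∘ there) v∉ (a∉ ∘ there ∘ there)

  tr-kills : ∀ {a x} (y : Chain n (3 ℕ.+ k)) → a ∉ u ∷ v ∷ X → x ∉ a ∷ u ∷ v ∷ X → Zc (x ∷ a ∷ u ∷ v ∷ X) y → Bd X (tr u v a y)
  tr-kills {a} {x} y a∉ x∉ Z = tr-bd f y sz (zc-⊆ perm Z)
    where
    perm : u ∷ v ∷ a ∷ x ∷ X ⊆ x ∷ a ∷ u ∷ v ∷ X
    perm = ∷⊆ (there (there (here refl))) (∷⊆ (there (there (there (here refl)))) (∷⊆ (there (here refl)) (∷⊆ (here refl) (there ∘ there ∘ there ∘ there))))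
    x∉X : x ∉ X
    x∉X = x∉ ∘ there ∘ there ∘ there
    a∉x : a ∉ x ∷ X
    a∉x = ∉-∷ (x∉ ∘ here ∘ sym) (a∉ ∘ there ∘ there)
    v∉x : v ∉ a ∷ x ∷ X
    v∉x = ∉-∷ (a∉ ∘ there ∘ here ∘ sym) (∉-∷ (x∉ ∘ there ∘ there ∘ here ∘ sym) v∉)
    u∉x : u ∉ v ∷ a ∷ x ∷ X
    u∉x = ∉-∷ (u∉ ∘ here) (∉-∷ (a∉ ∘ here ∘ sym) (∉-∷ (x∉ ∘ there ∘ here ∘ sym) (u∉ ∘ there)))
    f : Fresh X (u ∷ v ∷ a ∷ x ∷ [])
    f = u∉x ∷ v∉x ∷ a∉x ∷ x∉X ∷ []
    sz : 8 ℕ.+ tri k ≤ size (u ∷ v ∷ a ∷ x ∷ X)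
    sz = ≤-size-∷ u∉x (≤-size-∷ v∉x (≤-size-∷ a∉x (≤-size-∷ x∉X h)))

  -- Outside u and v the class of q is a multiple of that of `g a`, but the difference bounds only
  -- when a may be used. `split-bd` turns the difference into cycles missing a further vertex, and
  -- those are killed by the triangle.
  tr-span : ∀ a → a ∉ u ∷ v ∷ X → ∀ q → Zc (a ∷ u ∷ v ∷ X) q → Sp X TGen (tr u v a q)
  tr-span a a∉ q Zq = use (multiple (Sg a a∉ q (zc-⊆ there Zq)))
    where
    use : (∃ λ c → q ~[ u ∷ v ∷ X ] (λ τ → c · g a τ)) → Sp X TGen (tr u v a q)
    use (c , hom b) = sp≈ (λ τ → trans (cong (_+ tr u v a (scale c (g a)) τ) (sub (tr-linear u v a) q (scale c (g a)) τ))
          (solve 2 (λ x y → (x :+ (:- y)) :+ y := x) refl (tr u v a q τ) _))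
        (sp+ (bound killed) (sp≈ (≈-sym (scale-lin (tr-linear u v a) c (g a))) (sp-scale c (gen (triangles a a∉)))))
      where
      d = q -C scale c (g a)
      killed : Bd X (tr u v a d)
      killed = sp-⊥ (sp-map (tr-linear u v a)
        (λ b → bd-tr (dist-tr a∉) (bd-⊆ (∷⊆ (there (here refl)) (∷⊆ (there (there (here refl))) (∷⊆ (here refl) (there ∘ there ∘ there)))) b))
        (λ { {y} (x , x∉ , Zx) → bound (tr-kills y a∉ x∉ Zx) })
        (split-bd d a∉ (zc-sub Zq (zc-scale c (Zg a a∉))) b))

  -- The hop ends at a star at v, which is a triangle minus a star at u. The triangle uvb is killed
  -- because y also misses a.
  moved : ∀ a b → a ∉ u ∷ v ∷ X → b ∉ u ∷ v ∷ X → b ≢ a → ∀ y → Zc (b ∷ a ∷ u ∷ v ∷ X) y → star u a v y ~[ X ] (-C star u b v y)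
  moved a b a∉ b∉ b≢a y Zy = ~-trans (star-hop (∉-∷ b≢a b∉ ∷ a∉ ∷ u∉ ∷ v∉ ∷ []) Zy)
    (hom (bd-≈ (λ τ → sym (trans (cong (λ x → x + (- (- star u b v y τ))) (star-tr u v b y τ))
      (solve 2 (λ t s → (t :+ (:- s)) :+ (:- (:- s)) := t) refl (tr u v b y τ) (star u b v y τ))))
      (tr-kills y b∉ (∉-∷ (b≢a ∘ sym) a∉) (zc-⊆ (∷⊆ (there (here refl)) (∷⊆ (here refl) (there ∘ there))) Zy))))

  star-e : ∀ a → a ∉ u ∷ v ∷ X → e ≢ a → ∀ y → Zc (e ∷ a ∷ u ∷ v ∷ X) y → Sp X TGen (star u a v y)
  star-e a a∉ e≢a y Zy = sp-~ (moved a e a∉ e∉ e≢a y Zy) (sp- (gen (base y (zc-⊆ (∷-mono there) Zy))))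

  -- The link of y at each ec lies in a group with one generator. After subtraction of the
  -- corresponding multiples of the `Y a c` the cycle can be pushed off e, and then a can be moved
  -- to e.
  module AtA (a : Fin n) (a∉ : a ∉ u ∷ v ∷ X) (e≢a : e ≢ a) (y : Chain n (3 ℕ.+ k)) (Zy : Zc (a ∷ u ∷ v ∷ X) y) where
    eA : e ∉ a ∷ u ∷ v ∷ X
    eA = ∉-∷ e≢a e∉
    Coef : Fin n → Set
    Coef c = Σ F3 λ x → (c ∉ e ∷ a ∷ u ∷ v ∷ X → ι (mk e c) y ~[ e ∷ c ∷ a ∷ u ∷ v ∷ X ] scale x (ι (mk e c) (Y a c))) ×
      (c ∈ e ∷ a ∷ u ∷ v ∷ X → x ≡ #0)
    coefs : ∀ c → Coef c
    coefs c = go (c ∈? (e ∷ a ∷ u ∷ v ∷ X))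
      where
      go : Dec (c ∈ e ∷ a ∷ u ∷ v ∷ X) → Coef c
      go (yes c∈) = #0 , (λ c∉ → ⊥-elim (c∉ c∈)) , λ _ → refl
      go (no c∉) = let x , r = multiple (SY a c a∉ e≢a c∉ (ι (mk e c) y) (zc-ι e c Zy)) in x , (λ _ → r) , λ c∈ → ⊥-elim (c∉ c∈)
    co : Fin n → F3
    co c = proj₁ (coefs c)
    W y' : Chain n (3 ℕ.+ k)
    W = ΣC n λ c → scale (co c) (Y a c)
    y' = y -C W
    term : ∀ c → (c ∉ e ∷ a ∷ u ∷ v ∷ X) ⊎ (co c ≡ #0)
    term c = go (c ∈? (e ∷ a ∷ u ∷ v ∷ X))
      where
      go : Dec (c ∈ e ∷ a ∷ u ∷ v ∷ X) → (c ∉ e ∷ a ∷ u ∷ v ∷ X) ⊎ (co c ≡ #0)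
      go (yes c∈) = inj₂ (proj₂ (proj₂ (coefs c)) c∈)
      go (no c∉) = inj₁ c∉
    Z' : Zc (a ∷ u ∷ v ∷ X) y'
    Z' = zc-sub Zy (zc-Σ n λ c → [ (λ c∉ → zc-scale (co c) (ZY a c a∉ e≢a c∉)) ,
      (λ z → zc-≈ (λ τ → cong (_· Y a c τ) (sym z)) zc-0) ]′ (term c))
    W-link : ∀ c → ι (mk e c) W ≈ scale (co c) (ι (mk e c) (Y a c))
    W-link c τ = sum-single n c λ c' ne → [ (λ c'∉ → trans (cong (co c' ·_) (OY a c' a∉ e≢a c'∉ c (ne ∘ sym) τ)) (·-0 (co c'))) ,
      (λ z → cong (_· Y a c' (mk e c ∷ τ)) z) ]′ (term c')
    pushed : Σ (Chain n (3 ℕ.+ k)) λ y'' → Zc (e ∷ a ∷ u ∷ v ∷ X) y'' × (y' ~[ a ∷ u ∷ v ∷ X ] y'')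
    pushed = push e y' eA Z' λ c ne c∉ → bd-≈
      (λ τ → cong (λ x → y (mk e c ∷ τ) + (- x)) (sym (W-link c τ)))
      (bdy (proj₁ (proj₂ (coefs c)) (∉-∷ ne c∉)))
    result : Sp X TGen (star u a v y)
    result = sp≈ (λ τ → trans (cong (_+ star u a v W τ) (sub (star-linear u a v) y W τ))
        (solve 2 (λ x w → (x :+ (:- w)) :+ w := x) refl (star u a v y τ) _))
      (sp+ (sp-~ (~-star (dist a∉) (~-⊆ (∷⊆ (there (here refl)) (∷⊆ (here refl) (∷⊆ (there (there (here refl))) (there ∘ there ∘ there)))) (proj₂ (proj₂ pushed))))
             (star-e a a∉ e≢a (proj₁ pushed) (proj₁ (proj₂ pushed))))
           (sp≈ (≈-sym (sums (star-linear u a v) n (λ c → scale (co c) (Y a c))))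
             (sp-Σ n λ c → sp≈ (≈-sym (scale-lin (star-linear u a v) (co c) (Y a c)))
               ([ (λ c∉ → sp-scale (co c) (gen (lifts a c a∉ e≢a c∉))) ,
                  (λ z → sp-0 (λ τ → cong (_· star u a v (Y a c) τ) z)) ]′ (term c)))))

  star-any : ∀ a y → a ∉ u ∷ v ∷ X → Zc (a ∷ u ∷ v ∷ X) y → Sp X TGen (star u a v y)
  star-any a y a∉ Zy = go (e Finₚ.≟ a)
    where
    go : Dec (e ≡ a) → Sp X TGen (star u a v y)
    go (yes refl) = gen (base y Zy)
    go (no ne) = AtA.result a a∉ ne y Zy

  recursion : ∀ z → Zc X z → Sp X TGen z
  recursion z Z = sp-bind id each (star-span (u∉ ∘ there) v∉ (u∉ ∘ here) h z Z)
    where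
    each : ∀ {x} → Star u v X x → Sp X TGen x
    each (star₁ a y a∉ Zy) = star-any a y a∉ Zy
    -- A star at v is a triangle minus a star at u, so only these two kinds have to be spanned.
    each (star₂ a y a∉ Zy) = sp≈ (≈-sym (star-tr u v a y)) (sp-sub (tr-span a a∉ y Zy) (star-any a y a∉ Zy))

-- Nine vertices

rels₉ : List (ℕ × ℕ)
rels₉ =
  (2151112912221192 , 258372401158372416156372401256372408157231608257241608137241608145371608245231608) ∷
  (12271027101510261014 , 278563412278563401278563402) ∷
  (1027101520582046 , 178563401278563412278562401178562403178461203278561203256481203157481203257461203) ∷
  (1023101520542046 , 168573401178563401268573412278563412268572401278562401168572403178562403178461203278561203256471203168471203268571203257461203) ∷
  (12282027102320261022 , 268573412268573401268573402) ∷
  (21511147113120261016 , 257482301157482316156483701256483702158341602258371602148371602157481602257341602) ∷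
  (103120231003206210542034 , 168451203268471203156471203256481203167481203267451203) ∷
  (1031100720622038 , 178563401278563412278562401178562403178451203278561203256481203167481203267451203) ∷
  (2059105510262022 , 168572401268572413268573401168573402168471302268571302257481302156481302256471302) ∷
  (1055104720222014 , 168572401178562401268572413278562413268573401278563401168573402178563402178461302278561302256471302168471302268571302257461302) ∷
  (201510111007104620422038 , 267583401167583412167582401267582403178451203278461203158461203167581203267451203) ∷
  (102720191011205810502042 , 158461203258471203156471203256481203157481203257461203) ∷
  (12371061205510602054 , 256472813256472801256472803) ∷
  (1224103120231003103020221002 , 0) ∷
  (12261031100710301006 , 278563412278563401278563402) ∷
  (12292031101920301018 , 167583412167583401167583402) ∷
  (1225102720191011102620181010 , 0) ∷
  (106320551035203010222002 , 168451302268471302156471302256481302167481302267451302) ∷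
  (205510511035102220182002 , 267582401167582413167583401267583402168451302268471302158471302167581302267451302) ∷
  (105510392035202220061002 , 178562401278562413278563401178563402178451302278561302256471302168471302268451302) ∷
  (1043103520102002 , 267582401168572401167582413268572413167583401268573401267583402168573402168451302268571302257461302158461302167581302267451302) ∷
  (202720131007200321782166 , 257483601178453601157483612278453612156482301268452301256482307168452307168341207268451207245361207148361207156481207256341207) ∷
  (20471037120421961192 , 278462501178462513157462301257462308167241308267251308146251308157461308257241308) ∷
  (12341061103710601036 , 278562413278562401278562403) ∷
  (20551033120422002196 , 268472501168472513156472301256472308167241308267251308147251308156471308256241308) ∷
  (111511032030101610142010 , 267482301178462301167482315278462315156483701258463701256483702158463702178341502278461502246371502148371502167481502267341502) ∷
  (11151111210720261016101420122010 , 178462301278462315156483701258463701257483601256483702158463702157483602178361502278461502246371502148371502248361502) ∷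
  (2063105910552051203321362128 , 267482501168472501167482513268472513157482301258472301257482306158472306158241306258471306247251306148251306157481306257241306) ∷
  (1093106920602036 , 178562301278562314278562401178562403178251403278561403256281403167281403267251403) ∷
  (12331029202310282022 , 256473812256473801256473802) ∷
  (2029200321902166 , 167453801267453812268452301168452307168341207268451207245381207156381207256341207) ∷
  (12322029101720281016 , 167583412167583401167583402) ∷
  (1191116710281002 , 168452301268452317267453801167453802168341702268451702245381702156381702256341702) ∷
  (117911671026101220061002 , 256482301168452301156482317268452317157483601278453601257483602178453602168341702268451702245361702148361702156481702256341702) ∷
  (2179116912102200 , 248362501148362517147362501247362508146231708246251708136251708145361708245231708) ∷
  (116911611062204610421036 , 256482301158462301156482317258462317167482501278462501267482503178462503158241703258461703246251703148251703156481703256241703) ∷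
  (2191216111581128 , 256382401156382417157382401257382406158231706258241706138241706145381706245231706) ∷
  (206310592037114021362132 , 267482501167482513157482301257482306178241306278251306148251306157481306257241306) ∷
  (206110512039215221321128 , 256472801167452801156472813267452813158472301278452301258472306178452306178241306278451306245281306147281306158471306258241306) ∷
  (12391167116521982196 , 256341708256231708256241708) ∷
  (2021100322222198 , 168453701268453712267452301167452308167341208267451208245371208156371208256341208) ∷
  (2173116712042198 , 168342501268342517267342501167342508156231708256341708234251708146251708246231708) ∷
  (201920131009100722102198 , 258473601178453601158473612278453612156472301267452301256472308167452308167341208267451208245361208147361208156471208256341208) ∷
  (1189116510601034 , 168452301268452317267452801167452803168241703268451703245281703156281703256241703) ∷
  (21731169116510621032 , 256482301156482317167482501267482503168241703268251703148251703156481703256241703) ∷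
  (2023102110192017201510131011200921182110 , 158463701158473601258463712258473612268472301278462301168472305178462305178361205278461205246371205168371205268471205247361205) ∷
  (1137112910622058205410501032 , 257482301158472301157482316258472316167482501268472501267482503168472503158241603258471603247251603148251603157481603257241603) ∷
  (2147113712181200 , 248372501148372516146372501246372508147231608247251608137251608145371608245231608) ∷
  (20171011222212182194 , 158463701258463712257462301157462308157341208257461208246371208156371208256341208) ∷
  (10212017201310111007200312182214 , 158463701268453701178453601258463712168453712278453612257462301157462308157361208257461208246371208145371208245361208) ∷
  (12401163116121942192 , 256341708256231708256241708) ∷
  (2183116112142192 , 258362401158362417157362401257362408156231708256241708136241708145361708245231708) ∷
  (207910692214121012042200 , 278362501178362514147362501247362508167231408267251408136251408157361408257231408) ∷
  (211111011214221011962192 , 278362401178362415157362401257362408167231508267241508136241508147361508247231508) ∷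
  (12412103210111341132 , 278341506278231506278241506) ∷
  (21831179116310261008 , 256482301156482317157483601257483602158341702258361702148361702156481702256341702) ∷
  (20291025200721582134 , 167453801267453812278452301178452306178341206278451206245381206157381206257341206) ∷
  (2111110320992022101810122008 , 268472301168472315158473601258473602178341502278361502147361502168471502268341502) ∷
  (21731169116721631140213621341130 , 168342501268342517278342501178342506158231706258341706234251706148251706248231706) ∷
  (102720212007100321462134 , 256483701168453701156483712268453712157482301278452301257482306178452306178341206278451206245371206148371206157481206257341206) ∷
  (21891173216921671156214011361134 , 156342801268342501256342817168342517257342801178342501157342806278342506148231706248251706134251706234281706145281706245231706) ∷
  (1121211521521146 , 146372801246372815245372801145372806148231506248371506237281506147281506247231506) ∷
  (10252019215811542130 , 156473801256473812258472301158472306158341206258471206247381206157381206257341206) ∷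
  (10272017115021462130 , 256483701156483712157482301257482306158341206258371206148371206157481206257341206) ∷
  (20611057203921562132 , 167452801267452813278452301178452306178241306278451306245281306157281306257241306) ∷
  (2025101920151013200921222110 , 256473801157463801158473601156473812257463812258473612278462301178462305178361205278461205246381205147381205247361205) ∷
  (212511152103115621461134 , 246372801167342801146372815267342815145372801257342801245372806157342806178231506278341506234281506137281506148371506248231506) ∷
  (2187216911541136 , 246382501146382517147382501247382506148231706248251706138251706145381706245231706) ∷
  (2121210721841178 , 147362801247362815245362801145362807148231507248361507236281507146281507246231507) ∷
  (11251101206010561046 , 178462301278462315257462801157462803178241503278461503246281503167281503267241503) ∷
  (11252121109720601054 , 168472301268472315256472801156472803168241503268471503247281503167281503267241503) ∷
  (2125112111072099118821781166 , 247362801167342801147362815267342815145362801256342801245362807156342807168231507268341507234281507136281507148361507248231507) ∷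
  (2061203521882164 , 167452801267452813268452301168452307168241307268451307245281307156281307256241307) ∷
  (11912187116310241010 , 158462301258462317257463801157463802158341702258461702246381702156381702256341702) ∷
  (11892185116110561042 , 158462301258462317257462801157462803158241703258461703246281703156281703256241703) ∷
  (20572043218811842160 , 157462801257462813258462301158462307158241307258461307246281307156281307256241307) ∷
  (21191097122222181196 , 268372401168372415156372401256372408167231508267241508137241508146371508246231508) ∷
  (2063105710472037118821842168 , 257462801267482501178462501157462813167482513278462513156482301256482307148251307156481307256281307146281307246251307) ∷
  (20611057104720372035103321842172 , 257462801167452801178462501157462813267452813278462513268452301168452307168251307268451307245281307146281307246251307) ∷
  (12312025102120241020 , 268573412268573401268573402) ∷
  (1091107920242012 , 178562301278562314278563401178563402178361402278561402256381402157381402257361402) ∷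
  (2159212911901160 , 257382401157382416156382401256382407158231607258241607138241607145381607245231607) ∷
  (11271103202810241014 , 178462301278462315257463801157463802178341502278461502246381502167381502267341502) ∷
  (21111107110120971182217811642160 , 278362401178362415158362401258362407168231507268241507136241507148361507248231507) ∷
  (112311032099102420221014 , 268472301178462301168472315278462315156473801257463801256473802157463802178341502278461502246381502147381502168471502268341502) ∷
  (2091108710242020 , 168572301268572314268573401168573402168371402268571402257381402156381402256371402) ∷
  (11591135102820241006 , 178452301278452316267453801167453802178341602278451602245381602157381602257341602) ∷
  (11592155113120241018 , 158472301258472316256473801156473802158341602258471602247381602157381602257341602) ∷
  (20272009118221782162 , 257483601157483612156482301256482307158341207258361207148361207156481207256341207) ∷
  (21272097119021861164 , 267382401167382415156382401256382407168231507268241507138241507146381507246231507) ∷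
  (209510912069215811541140 , 267382501167382514147382501247382506178231406278251406138251406157381406257231406) ∷
  (2095108310282016 , 267582301167582314167583401267583402158371402167581402267381402156381402256371402) ∷
  (1093208721241118 , 156372801256372814246372801146372805168231405268371405237281405167281405267231405) ∷
  (2157213111881162 , 157342801257342816256342801156342807158231607258341607234281607145281607245231607) ∷
  (20952065219011861172 , 267382501167382514146382501246382507168231407268251407138251407156381407256231407) ∷
  (209510911075102820242008 , 267582301167582314167583401267583402158361402167581402267381402157381402257361402) ∷
  (214111351204220021981194 , 178342501278342516267342501167342508157231608257341608234251608147251608247231608) ∷
  (209510891079206921901188118621781168 , 257362801267382501178362501157362814167382514278362514145362801146382501248362501245362807246382507148362507138251407156381407256281407136281407236251407) ∷
  (11571133106020561038 , 178452301278452316267452801167452803178241603278451603245281603157281603257241603) ∷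
  (11572153112920561050 , 158472301258472316256472801156472803158241603258471603247281603157281603257241603) ∷
  (10612057204721242100 , 157462801257462813278462301178462305178241305278461305246281305167281305267241305) ∷
  (21891185216711241098 , 156342801256342817267342801167342805168231705268341705234281705146281705246231705) ∷
  (109320892079212411201110 , 157362801257362814247362801147362805178231405278361405236281405167281405267231405) ∷
  (1153214721201114 , 145372801245372816246372801146372805148231605248371605237281605147281605247231605) ∷
  (1185217911201106 , 145362801245362817247362801147362805148231705248361705236281705146281705246231705) ∷
  (10292023212611222098 , 156473801256473812268472301168472305168341205268471205247381205167381205267341205) ∷
  (10612055212411202096 , 156472801256472813268472301168472305168241305268471305247281305167281305267241305) ∷
  (215711532135112421201102 , 157342801257342816267342801167342805178231605278341605234281605147281605247231605) ∷
  (2093108110602048 , 267582301167582314167582401267582403158271403167581403267281403156281403256271403) ∷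
  (1091208121581148 , 256382701156382714145382701245382706158231406258271406138271406157381406257231406) ∷
  (2081107522201214 , 158362701258362714245362701145362708157231408257361408236271408156271408256231408) ∷
  (10952081207910752126111211102106 , 256382701158362701156382714258362714146382701248362701246382705148362705178231405278361405236271405138271405167381405267231405) ∷
  (12362061104920601048 , 167582413167582401167582403) ∷
  (1155214521221112 , 245382701145382716146382701246382705148231605248271605138271605147381605247231605) ∷
  (2053103522202196 , 168452701268452713267452301167452308167241308267451308245271308156271308256241308) ∷
  (2149113112201194 , 158342701258342716256342701156342708157231608257341608234271608145271608245231608) ∷
  (111311012062104810462042 , 267482301178462301167482315278462315156482701258462701256482703158462703178241503278461503246271503148271503167481503267241503) ∷
  (11232117210310992154114811342130 , 246382701168342701146382715268342715145382701258342701245382706158342706178231506278341506234271506138271506147381506247231506) ∷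
  (12352057105320561052 , 268572413268572401268572403) ∷
  (1123211321541144 , 246382701146382715145382701245382706148231506248271506138271506147381506247231506) ∷
  (2113110722161210 , 148362701248362715245362701145362708147231508247361508236271508146271508246231508) ∷
  (10632053111621122096 , 256482701156482713167482301267482305168241305268271305148271305167481305267241305) ∷
  (109320851065206010522032 , 168251403268271403156271403256281403167281403267251403) ∷
  (108920811073205610482040 , 158261403258271403156271403256281403157281403257261403) ∷
  (2091207321901180 , 257382601157382614145382601245382607158231407258261407138261407156381407256231407) ∷
  (2083107322221212 , 258372601158372614145372601245372608157231408257261408137261408156371408256231408) ∷
  (1095209120871083207321261122111821141104 , 257382601158372601157382614258372614147382601248372601247382605148372605168231405268371405237261405138261405167381405267231405) ∷
  (1187217711221104 , 245382601145382617147382601247382605148231705248261705138261705146381705246231705) ∷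
  (2181116312122194 , 158342601258342617257342601157342608156231708256341708234261708145261708245231708) ∷
  (20451039221221961192 , 178452601278452613267452301167452308167241308267451308245261308157261308257241308) ∷
  (1105109720621058105420501040 , 267482301168472301167482315268472315157482601258472601257482603158472603168241503268471503247261503148261503167481503267241503) ∷
  (1063205920551051204121042096 , 257482601158472601157482613258472613167482301268472301267482305168472305168241305268471305247261305148261305167481305267241305) ∷
  (21232109110320992186118011662162 , 247382601178342601147382615278342615145382601258342601245382607158342607168231507268341507234261507138261507146381507246231507) ∷
  (2123210521861176 , 247382601147382615145382601245382607148231507248261507138261507146381507246231507) ∷
  (2115110522181208 , 248372601148372615145372601245372608147231508247261508137261508146371508246231508) ∷
  (210911051101206210581044 , 267482301167482315157482601257482603178241503278261503148261503167481503267241503) ∷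
  (106320592045110821042100 , 257482601157482613167482301267482305178241305278261305148261305167481305267241305) ∷
  (1089107720562044 , 178562301278562314278562401178562403178261403278561403256281403157281403257261403) ∷
  (109520871067202810202000 , 168351402268371402156371402256381402167381402267351402) ∷
  (20932067218811841174 , 167352801267352814246352801146352807168231407268351407235281407156281407256231407) ∷
  (20851067222012161206 , 168352701268352714246352701146352708167231408267351408235271408156271408256231408) ∷
  (2093108910852081206721561152114821441138 , 167352801268352701267352814168352714247352801148352701147352806248352706158231406258271406135271406235281406157281406257231406) ∷
  (2185217111521138 , 146352801246352817247352801147352806148231706248351706235281706145281706245231706) ∷
  (2175116512062196 , 268352401168352417167352401267352408156231708256241708135241708146351708246231708) ∷
  (20151005120621981194 , 278463501178463512157462301257462308167341208267351208146351208157461208257341208) ∷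
  (1139113110302026202210181000 , 257482301158472301157482316258472316167483501268473501267483502168473502158341602258471602247351602148351602157481602257341602) ∷
  (2031102710232019200121382130 , 267483501168473501167483512268473512157482301258472301257482306158472306158341206258471206247351206148351206157481206257341206) ∷
  (21532143113321291184117421641160 , 147352801278352401247352816178352416246352801168352401146352807268352407158231607258241607135241607235281607145281607245231607) ∷
  (12301029100510281004 , 278563412278563401278563402) ∷
  (12421171116922022200 , 246351708246231708246251708) ∷
  (2153213911841170 , 147352801247352816246352801146352807148231607248351607235281607145281607245231607) ∷
  (203110272005114221382134 , 267483501167483512157482301257482306178341206278351206148351206157481206257341206) ∷
  (1095107120282004 , 178562301278562314278563401178563402178351402278561402256381402167381402267351402) ∷
  (12441061105720922088 , 167281304157281304156281304) ∷
  (1057104520882076 , 178562401278562413278562301178562304178261304278561304256281304157281304257261304) ∷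
  (2057105310882084 , 168572401268572413268572301168572304168271304268571304257281304156281304256271304) ∷
  (1157215120881082 , 145372801245372816256372801156372804158231604258371604237281604157281604257231604) ∷
  (1189218310881074 , 145362801245362817257362801157362804158231704258361704236281704156281704256231704) ∷
  (12381093208710922086 , 256372814256372801256372804) ∷
  (102520171009209010822074 , 158361204258371204156371204256381204157381204257361204) ∷
  (106120531033209210842064 , 168251304268271304156271304256281304167281304267251304) ∷
  (2029101710942082 , 267583401167583412167582301267582304158371204167581204267381204156381204256371204) ∷
  (1061103720922068 , 178562401278562413278562301178562304178251304278561304256281304167281304267251304) ∷
  (2061104910922080 , 267582401167582413167582301267582304158271304167581304267281304156281304256271304) ∷
  (11892185217510921066 , 146352801246352817267352801167352804168231704268351704235281704156281704256231704) ∷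
  (101710132009208220781074 , 178563401278563412278562301178562304178361204278561204256371204158371204258361204) ∷
  (206110571041109220882072 , 267582401167582413167582301267582304158261304167581304267281304157281304257261304) ∷
  (115721532143109220881070 , 147352801247352816267352801167352804178231604278351604235281604157281604257231604) ∷
  (1223119910202002 , 167452301267452318268453701168453702167341802267451802245371802156371802256341802) ∷
  (1223221310822072 , 245372601145372618158372601258372604157231804257261804137261804156371804256231804) ∷
  (2223219311502128 , 256372401156372418158372401258372406157231806257241806137241806145371806245231806) ∷
  (22231211202010181012200820061002 , 256472301156472318168453701158473601278453601268453702258473602178453602147361802156471802256371802145371802245361802) ∷
  (1217221111122106 , 145362701245362718248362701148362705147231805247361805236271805146271805246231805) ∷
  (2213119511802162 , 157342601257342618258342601158342607156231807256341807234261807145261807245231807) ∷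
  (2215119311822160 , 257362401157362418158362401258362407156231807256241807136241807145361807245231807) ∷
  (2211120111782168 , 247362501147362518148362501248362507146231807246251807136251807145361807245231807) ∷
  (2205119911722166 , 167342501267342518268342501168342507156231807256341807234251807146251807246231807) ∷
  (22131209119310502040 , 256472301156472318158472601258472603157241803257261803147261803156471803256241803) ∷
  (12131197219310442038 , 167452301267452318278452601178452603167241803267451803245261803157261803257241803) ∷
  (1221221311931052204410382034 , 268452701178452601168452703278452603157241803257261803145261803245271803156271803256241803) ∷
  (1219220911142104 , 245372601145372618148372601248372605147231805247261805137261805146371805246231805) ∷
  (2217220311442138 , 146352701246352718248352701148352706147231806247351806235271806145271806245231806) ∷
  (2207119711742164 , 267352401167352418168352401268352407156231807256241807135241807146351807246231807) ∷
  (12431029102520942090 , 167381204157381204156381204) ∷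
  (2089108510562052 , 168572301268572314268572401168572403168271403268571403257281403156281403256271403) ∷
  (1029100520942070 , 178563401278563412278562301178562304178351204278561204256381204167381204267351204) ∷
  (2025102110902086 , 168573401268573412268572301168572304168371204268571204257381204156381204256371204) ∷
  (1125211920921086 , 146372801246372815256372801156372804168231504268371504237281504167281504267231504) ∷
  (1127211720941084 , 246382701146382715156382701256382704168231504268271504138271504167381504267231504) ∷
  (1159214920901080 , 245382701145382716156382701256382704158231604258271604138271604157381604257231604) ∷
  (1191218110901072 , 245382601145382617157382601257382604158231704258261704138261704156381704256231704) ∷
  (1221221510802074 , 145362701245362718258362701158362704157231804257361804236271804156271804256231804) ∷
  (1095208521261116 , 256382701156382714146382701246382705168231405268271405138271405167381405267231405) ∷
  (2145113912161202 , 148352701248352716246352701146352708147231608247351608235271608145271608245231608) ∷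
  (22071199219510142004 , 257462301157462318178463501278463502167341802267351802146351802157461802257341802) ∷
  []

steps₉ : List ℕ
steps₉ =
  1000 ∷
  1003 ∷
  1108 ∷
  10041001 ∷
  1029 ∷
  1023202220122009 ∷
  1028 ∷
  119411891188118711852184218211781173217021681167116321612159115821571155215311482147114421402139213511321130112411232120111921182117211521121109109810972093209010851084208210812080207910772076207220691063106220591058205620531051105020481043104220412039103510341033203020272026102520241022202120182015101410112008100620022001 ∷
  218821872186218521842183216721551147114421402139113821201119211811171114210920982097109320902089108810851084208320771076207510732071206920672066106410621061206020592058105720561055105420522051104820431042103920381037103620352033103110272025102420212020201810171015201420101009200820061001 ∷
  21922189118721842163115911581157215611552153113811212118111521141112111121102106110420972093109220902089208810832082208110802079207720761075107410731071107020692068206720622061205920582057205620552052205020481045104320421041104020391038203720332032103120301027202510241022202110201019101720161010200920071006 ∷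
  21932192118611841159215811572156215521532149114521421141112121201118211621141113111021092106110511021101109720952093109220901089208810871083108210811077207420732072107120701069206810672066206010592057205320511050204920482047104610452044204210391036203520321030202620251022201610151013101220112005 ∷
  113810951085 ∷
  219221902189118721842166216311581157115321311128212621251121211811151114111211111105110421031102110120992093209020881083208120761075207410722070106810621058205620531052205120471046204520441043104220402036103520342031203020272024102110202017101610152012100610052002 ∷
  21891187118621632159115611551153211921161115111411122095109310901088108420832081207610732072107120672062206120592058105710551054205120491048204710462044204220411040103910381035203320322031203020252021101920181016201520122011200720051001 ∷
  2187118521831167115921582157215611551153214721441140113911382122112011181116211410982094109320912089108820832082207920781076207220712069106820662064206110572056105510532050104920441043104110382036103420322031102620251024202220212018101520101006 ∷
  1125 ∷
  118921862183116321612159115821532138211521122110209510912090108120801079107520731071106810672066206410592057205620551054105320521051205020491047204610441042204110402039103710361035203420322031103010251022102020191017101520141013101110091008100710051001 ∷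
  11922186215911581156115321222121111821142111111011062104209410932092109120891088208320822078107520741072107110702069206820662064206120571054105220452044104310421041104010381035203310311026202510242022102110202018101710161015201420131012200710061001 ∷
  11191116109520902084107320671057205520531051103720361035103420331032102710241022101820172016201520141010100920081001 ∷
  2189118721862163215811571155111511141112109520902085208120802079207620752073207110702068106710611059105710562055205420532052205020482043203810371035103310322031203010251022202020191018101710161015201210091008200720061001 ∷
  1039 ∷
  1040 ∷
  1041 ∷
  215711551114211020951090108510801079107320671064106010562055105220512043203610331032101920162015201410121010100720061001 ∷
  1092 ∷
  115710851080107910571056205510541053105210502048104720461044204310362034103220312015201310111007200610052001 ∷
  11891187118611632155211521142112108110751071106810571056105510541053205120501036203310321030102010162014101320102001 ∷
  11871158 ∷
  11571155111421101095209110851079106610642059105710562054205320512043103520342033202510192016101510121010200720062001 ∷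
  119011831169116121281095209110851079105010362031 ∷
  1119111610952090208420731067106210581057205620552053105110361033203210161014201020072001 ∷
  2036203510341033203210142007 ∷
  1001 ∷
  1002 ∷
  215711151110205520511050104310331014201320071006 ∷
  11571085108010792057105620542053105220512043203620321015101310072006 ∷
  211921161085108410801079205710561053105210151007 ∷
  20951090 ∷
  11202119108410262025 ∷
  1115111010621058205720562054205310502037103620342033103220171015201420132008 ∷
  1022 ∷
  1023 ∷
  1112 ∷
  1009 ∷
  1024 ∷
  1008 ∷
  101810151013 ∷
  212011191089208410821072107110701030 ∷
  1155115411291114211020852080207920562052201920141013 ∷
  118621832161215921582155215321141110108510801079105610521042 ∷
  21862183216111582156115511531114211010981091209010801069205310521031 ∷
  117511712155211411101085108020792077107110682056105210212017201510141013 ∷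
  11051101209110902080107420691065105710561054205320522045103610322031201520131010 ∷
  11202119109120901084108010762071207010541053105210472046104420342033202120141013101120101005 ∷
  1072 ∷
  115511142110208520802079107820712068205620522021 ∷
  1176216810851080207910572056105410531052202120152013 ∷
  1191218911832174217011611156109310882081106320622059104220301021 ∷
  1179117811552118108510801079206910561053105210072006 ∷
  2194118211762173215521481144213911242115211420982093108020782069105310522030 ∷
  1143 ∷
  11851161115621441115111020982091109020802069105320522031 ∷
  2155114021221118211020941090208510802079106920562053105210302021 ∷
  20441034103310142007 ∷
  1013 ∷
  1015 ∷
  1017 ∷
  1027 ∷
  1032 ∷
  1036 ∷
  1057 ∷
  1082 ∷
  1084 ∷
  1119 ∷
  1120 ∷
  1145 ∷
  1054 ∷
  1069 ∷
  1098 ∷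
  1116 ∷
  1156 ∷
  1169 ∷
  1006 ∷
  1007 ∷
  1010 ∷
  1011 ∷
  1014 ∷
  1016 ∷
  1019 ∷
  1020 ∷
  1021 ∷
  1030 ∷
  1033 ∷
  1034 ∷
  1038 ∷
  1042 ∷
  1043 ∷
  1046 ∷
  1053 ∷
  1056 ∷
  1059 ∷
  1060 ∷
  1062 ∷
  1064 ∷
  1066 ∷
  1067 ∷
  1071 ∷
  1073 ∷
  1074 ∷
  1078 ∷
  1079 ∷
  1085 ∷
  1089 ∷
  1090 ∷
  1091 ∷
  1093 ∷
  1094 ∷
  1099 ∷
  1100 ∷
  1101 ∷
  1105 ∷
  1109 ∷
  1110 ∷
  1114 ∷
  1115 ∷
  1117 ∷
  1118 ∷
  1122 ∷
  1124 ∷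
  1128 ∷
  1129 ∷
  1132 ∷
  1139 ∷
  1144 ∷
  1148 ∷
  1150 ∷
  1152 ∷
  1153 ∷
  1157 ∷
  1158 ∷
  1160 ∷
  1162 ∷
  1163 ∷
  1164 ∷
  1166 ∷
  1167 ∷
  1168 ∷
  1171 ∷
  1173 ∷
  1175 ∷
  1182 ∷
  1184 ∷
  1185 ∷
  1186 ∷
  1189 ∷
  1191 ∷
  1192 ∷
  1005 ∷
  1031 ∷
  1045 ∷
  1047 ∷
  1052 ∷
  1063 ∷
  1075 ∷
  1083 ∷
  1086 ∷
  1087 ∷
  1096 ∷
  1102 ∷
  1103 ∷
  1104 ∷
  1106 ∷
  1107 ∷
  1111 ∷
  1113 ∷
  1123 ∷
  1126 ∷
  1127 ∷
  1130 ∷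
  1133 ∷
  1134 ∷
  1135 ∷
  1136 ∷
  1137 ∷
  1141 ∷
  1142 ∷
  1146 ∷
  1149 ∷
  1151 ∷
  1165 ∷
  1170 ∷
  1172 ∷
  1177 ∷
  1180 ∷
  1181 ∷
  []

-- 29 of the 224 iterated stars; with the 21 triangle products they number 50. As many triangle
-- products as possible are useful here, since those contribute nothing on twelve vertices.
basis₉ : List ℕ
basis₉ = 3 ∷ 14 ∷ 15 ∷ 19 ∷ 29 ∷ 30 ∷ 35 ∷ 38 ∷ 46 ∷ 54 ∷ 60 ∷ 67 ∷ 73 ∷ 81 ∷ 88 ∷ 93 ∷ 111 ∷ 118 ∷ 128 ∷ 129 ∷ 131 ∷ 167 ∷ 178 ∷ 192 ∷ 196 ∷ 204 ∷ 210 ∷ 222 ∷ 223 ∷ []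

-- Positions a, b, c of a triangle, a spare position, and a cycle of M₅ on the five positions left.
-- Keeping the fourth position free is what lets `tr-star-bd` kill the product after multiplication
-- by a star.
tris₉ : List (List ℕ × ℕ)
tris₉ =
  (0 ∷ 1 ∷ 2 ∷ 3 ∷ [] , 268451684725647156482674816745) ∷
  (0 ∷ 1 ∷ 2 ∷ 3 ∷ [] , 258461584725647156482574815746) ∷
  (0 ∷ 1 ∷ 2 ∷ 3 ∷ [] , 2784517856156482674816745) ∷
  (0 ∷ 1 ∷ 2 ∷ 3 ∷ [] , 2784617856156482574815746) ∷
  (0 ∷ 1 ∷ 2 ∷ 3 ∷ [] , 2684716857157482564815647) ∷
  (0 ∷ 1 ∷ 2 ∷ 3 ∷ [] , 2584726758167482564815647) ∷
  (0 ∷ 1 ∷ 2 ∷ 4 ∷ [] , 2783517856156382673816735) ∷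
  (0 ∷ 1 ∷ 2 ∷ 4 ∷ [] , 2683716857157382563815637) ∷
  (0 ∷ 1 ∷ 2 ∷ 4 ∷ [] , 2583726758167382563815637) ∷
  (0 ∷ 1 ∷ 2 ∷ 5 ∷ [] , 2683416847147382673816734) ∷
  (0 ∷ 1 ∷ 3 ∷ 4 ∷ [] , 2782517856156282672816725) ∷
  (0 ∷ 1 ∷ 3 ∷ 4 ∷ [] , 2682716857157282562815627) ∷
  (0 ∷ 1 ∷ 3 ∷ 4 ∷ [] , 2582726758167282562815627) ∷
  (0 ∷ 1 ∷ 3 ∷ 5 ∷ [] , 2682416847147282672816724) ∷
  (0 ∷ 1 ∷ 4 ∷ 5 ∷ [] , 2682316837137282672816723) ∷
  (2 ∷ 3 ∷ 4 ∷ 5 ∷ [] , 2680116817117082670816701) ∷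
  (2 ∷ 3 ∷ 4 ∷ 6 ∷ [] , 2580115817117082570815701) ∷
  (2 ∷ 3 ∷ 4 ∷ 8 ∷ [] , 2670116715115062570615701) ∷
  (2 ∷ 3 ∷ 5 ∷ 6 ∷ [] , 2480114817117082470814701) ∷
  (5 ∷ 6 ∷ 7 ∷ 8 ∷ [] , 2340113412112042230412301) ∷
  (5 ∷ 6 ∷ 7 ∷ 8 ∷ [] , 2240112413113042230412301) ∷
  []

pos₉ : List ℕ
pos₉ = 0 ∷ 1 ∷ 2 ∷ 3 ∷ 4 ∷ 5 ∷ 6 ∷ 7 ∷ 8 ∷ []

record Tri : Set where
  constructor mkTri
  field
    v₁ v₂ v₃ v₄ : ℕ
    rest : Poly 2

toTri : List ℕ × ℕ → Tri
toTri (a ∷ b ∷ c ∷ d ∷ _ , N) = mkTri a b c d (polyOf 2 20 N)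
toTri _ = mkTri 0 0 0 0 []

triPoly : Tri → Poly 3
triPoly (mkTri a b c _ p) = triP a b c p

extra₉ : List (Poly 3)
extra₉ = map (triPoly ∘ toTri) tris₉

known₉ : List ℕ
known₉ = basis₉ ++ map (224 ℕ.+_) (List.upTo 21)

check-rels₉ : relsOK 9 (genP 3 pos₉ ++ extra₉) (relsOf 3 rels₉) ≡ true
check-rels₉ = refl

check-steps₉ : allBelow (length (genP 3 pos₉)) (eliminate (map (vector ∘ proj₁) (relsOf 3 rels₉)) known₉ (map (vecOf 400) steps₉)) ≡ true
check-steps₉ = refl

pos₉-distinct : AllPairs _≢_ pos₉
pos₉-distinct = from-yes (AllPairs.allPairs? (λ i j → ¬? (i ℕ.≟ j)) pos₉)

pos₉-bound : All (ℕ._< 9) pos₉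
pos₉-bound = from-yes (All.all? (ℕ._<? 9) pos₉)

basisPolys₉ : List (Poly 3)
basisPolys₉ = map (nth [] (genP 3 pos₉)) basis₉

module Nine {n} {X : List (Fin n)} (d : Fin n) {vs : List (Fin n)} (F : Fresh X vs) (nine : length vs ≡ 9) (full : size X ≡ 9) where
  open Interp (nth d vs)

  span₉ : ∀ z → Zc X z → Sp X (λ c → ∃ λ p → p ∈ basisPolys₉ ++ extra₉ × c ≡ ⟦ p ⟧ unit) z
  span₉ = certify _ extra₉ (relsOf 3 rels₉) known₉ (map (vecOf 400) steps₉)
    (subst (λ l → relsOK l (genP 3 pos₉ ++ extra₉) (relsOf 3 rels₉) ≡ true) (sym nine) check-rels₉) check-steps₉
    λ i i∈ → gen (_ , known-poly i i∈ , refl)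
    where
    open Certified d vs F (trans full (sym nine)) 2 (ℕₚ.≤-reflexive (sym full)) pos₉ pos₉-distinct
      (subst (λ l → All (ℕ._< l) pos₉) (sym nine) pos₉-bound) (subst (λ l → allBelow l pos₉ ≡ true) (sym nine) refl)
    all-polys : map (nth [] (genP 3 pos₉ ++ extra₉)) known₉ ≡ basisPolys₉ ++ extra₉
    all-polys = refl
    known-poly : ∀ i → i ∈ known₉ → nth [] (genP 3 pos₉ ++ extra₉) i ∈ basisPolys₉ ++ extra₉
    known-poly i i∈ = subst (nth [] (genP 3 pos₉ ++ extra₉) i ∈_) all-polys (∈-map⁺ (nth [] (genP 3 pos₉ ++ extra₉)) i∈)

-- Cycles given by positions, and stars over triangle products

distinctᵇ : ℕ → List ℕ → Bool
distinctᵇ K [] = true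
distinctᵇ K (i ∷ is) = (i <ᵇ K) && (not (elemᵇ i is) && distinctᵇ K is)

validPU : ℕ → List ℕ → Poly k → Bool
validPU K U [] = true
validPU K U ((_ , w) ∷ p) = validM K U w && validPU K U p

module Positions {n} {X : List (Fin n)} (d : Fin n) {vs : List (Fin n)} (F : Fresh X vs) where
  private
    ρ = nth d vs
    E = fresh-env F

  bounded : ∀ is → distinctᵇ (length vs) is ≡ true → All (ℕ._< length vs) is
  bounded [] e = []
  bounded (i ∷ is) e = let e₁ , e₂ = &&-split e in <ᵇ-true e₁ ∷ bounded is (proj₂ (&&-split {a = not (elemᵇ i is)} e₂))

  posFresh : ∀ is → distinctᵇ (length vs) is ≡ true → Fresh X (map ρ is)
  posFresh [] e = []
  posFresh (i ∷ is) e = out ∷ posFresh is e₃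
    where
    e₁ = proj₁ (&&-split e)
    e₂ = proj₁ (&&-split {a = not (elemᵇ i is)} (proj₂ (&&-split {a = i <ᵇ length vs} e)))
    e₃ = proj₂ (&&-split {a = not (elemᵇ i is)} (proj₂ (&&-split {a = i <ᵇ length vs} e)))
    out : ρ i ∉ map ρ is ++ X
    out h with ∈-++⁻ (map ρ is) h
    ... | inj₂ x = All.lookup (Env.outside E) (nth-∈ d E vs (<ᵇ-true e₁)) x
    ... | inj₁ x with ∈-map⁻ ρ x
    ...   | j , j∈ , at = elem-false (not-true e₂) (subst (_∈ is)
            (sym (nth-inj d E (Env.uniq E) (<ᵇ-true e₁) (All.lookup (bounded is e₃) j∈) at)) j∈)

  open Interp ρ

  Ok-⟦⟧-off : ∀ (p : Poly k) U → All (ℕ._< length vs) U → validPU (length vs) U p ≡ true → Ok (map ρ U ++ X) (⟦ p ⟧ unit)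
  Ok-⟦⟧-off [] U b v = Ok-0
  Ok-⟦⟧-off ((c , w) ∷ p) U b v = Ok-+ (go c (Ok-wedges d E w U b (proj₁ (&&-split v)) ok₀)) (Ok-⟦⟧-off p U b (proj₂ (&&-split {a = validM (length vs) U w} v)))
    where
    go : ∀ c {x : Chain n _} → Ok (map ρ U ++ X) x → Ok (map ρ U ++ X) (c ·C x)
    go #0 o = Ok-0
    go #1 o = o
    go #2 o = Ok-neg o

  zc-⟦⟧-off : ∀ (p : Poly (suc k)) U → distinctᵇ (length vs) U ≡ true → validPU (length vs) U p ≡ true →
    isNil (nf (∂P p)) ≡ true → Zc (map ρ U ++ X) (⟦ p ⟧ unit)
  zc-⟦⟧-off p U b v e = zc (Ok-⟦⟧-off p U (bounded U b) v) (cyc₊ (≈-trans (∂-⟦⟧ p cyc₀) (⟦nf⟧ (∂P p) unit e)))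

tr-∧ : ∀ (g : Pair n) (p q r : Fin n) (y : Chain n m) → (g ∧ tr p q r y) ≈ (-C tr p q r (g ∧ y))
tr-∧ g p q r y τ = trans (add G (mk p q ∧ y) ((mk p r ∧ y) +C (mk q r ∧ y)) τ)
  (trans (cong₂ _+_ (∧-anticomm g (mk p q) y τ) (trans (add G (mk p r ∧ y) (mk q r ∧ y) τ)
    (cong₂ _+_ (∧-anticomm g (mk p r) y τ) (∧-anticomm g (mk q r) y τ))))
  (solve 3 (λ a b c → (:- a) :+ ((:- b) :+ (:- c)) := :- (a :+ (b :+ c))) refl
    ((mk p q ∧ g ∧ y) τ) ((mk p r ∧ g ∧ y) τ) ((mk q r ∧ g ∧ y) τ)))
  where G = ∧-linear g

star-of-tr : ∀ (u e v p q r : Fin n) (y : Chain n m) → star u e v (tr p q r y) ≈ (-C tr p q r (star u e v y))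
star-of-tr u e v p q r y τ = trans (cong₂ (λ a b → a + (- b)) (tr-∧ (mk u e) p q r y τ) (tr-∧ (mk u v) p q r y τ))
  (trans (solve 2 (λ a b → (:- a) :+ (:- (:- b)) := :- (a :+ (:- b))) refl (tr p q r (mk u e ∧ y) τ) (tr p q r (mk u v ∧ y) τ))
    (cong -_ (sym (sub (tr-linear p q r) (mk u e ∧ y) (mk u v ∧ y) τ))))

triOK : Tri → Bool
triOK (mkTri a b c s p) = distinctᵇ 9 (a ∷ b ∷ c ∷ s ∷ []) && (validPU 9 (a ∷ b ∷ c ∷ s ∷ []) p && isNil (nf (∂P p)))

allᵇ : ∀ {A : Set} → (A → Bool) → List A → Bool
allᵇ f [] = true
allᵇ f (x ∷ xs) = f x && allᵇ f xs

allᵇ-∈ : ∀ {A : Set} (f : A → Bool) {xs x} → allᵇ f xs ≡ true → x ∈ xs → f x ≡ true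
allᵇ-∈ f h (here refl) = proj₁ (&&-split h)
allᵇ-∈ f {y ∷ xs} h (there i) = allᵇ-∈ f (proj₂ (&&-split {a = f y} h)) i

check-tris₉ : allᵇ triOK (map toTri tris₉) ≡ true
check-tris₉ = refl

-- Stars of vertices outside kill the triangle part of the basis of H(M₉).
star-kills : ∀ {n} {X : List (Fin n)} (d : Fin n) {u e v} {vs : List (Fin n)} → Fresh X (e ∷ u ∷ v ∷ []) →
  Fresh (e ∷ u ∷ v ∷ X) vs → length vs ≡ 9 → ∀ t → triOK t ≡ true →
  Bd X (star u e v (Interp.⟦_⟧ (nth d vs) (triPoly t) unit))
star-kills {n} {X} d {u} {e} {v} {vs} (e∉ ∷ u∉ ∷ v∉ ∷ []) F nine (mkTri a b c s p) ok = bd-≈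
    (λ τ → sym (trans (resp (star-linear u e v) (⟦triP⟧ ρ a b c p unit) τ) (star-of-tr u e v (ρ a) (ρ b) (ρ c) (⟦ p ⟧ unit) τ)))
    (bd-neg (tr-star-bd quad (out u∉' ∷ out e∉' ∷ out v∉' ∷ []) (zc-⊆ perm Zp)))
  where
  ρ = nth d vs
  open Interp ρ
  open Positions d F
  e₁ = subst (λ l → distinctᵇ l (a ∷ b ∷ c ∷ s ∷ []) ≡ true) (sym nine) (proj₁ (&&-split ok))
  e₂ = subst (λ l → validPU l (a ∷ b ∷ c ∷ s ∷ []) p ≡ true) (sym nine)
    (proj₁ (&&-split (proj₂ (&&-split {a = distinctᵇ 9 (a ∷ b ∷ c ∷ s ∷ [])} ok))))
  e₃ = proj₂ (&&-split {a = validPU 9 (a ∷ b ∷ c ∷ s ∷ []) p} (proj₂ (&&-split {a = distinctᵇ 9 (a ∷ b ∷ c ∷ s ∷ [])} ok)))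
  Zp : Zc (ρ a ∷ ρ b ∷ ρ c ∷ ρ s ∷ e ∷ u ∷ v ∷ X) (⟦ p ⟧ unit)
  Zp = zc-⟦⟧-off p (a ∷ b ∷ c ∷ s ∷ []) e₁ e₂ e₃
  Q : Fresh (e ∷ u ∷ v ∷ X) (ρ a ∷ ρ b ∷ ρ c ∷ ρ s ∷ [])
  Q = posFresh (a ∷ b ∷ c ∷ s ∷ []) e₁
  drop₃ : ∀ {ws x} → x ∉ ws ++ e ∷ u ∷ v ∷ X → x ∉ ws ++ X
  drop₃ {ws} h i with ∈-++⁻ ws i
  ... | inj₁ j = h (∈-++⁺ˡ j)
  ... | inj₂ j = h (∈-++⁺ʳ ws (there (there (there j))))
  quad : Fresh X (ρ a ∷ ρ b ∷ ρ c ∷ ρ s ∷ [])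
  quad = drop₃ {ρ b ∷ ρ c ∷ ρ s ∷ []} (fresh-head Q) ∷ drop₃ {ρ c ∷ ρ s ∷ []} (fresh-head (fresh-tail Q)) ∷
    drop₃ {ρ s ∷ []} (fresh-head (fresh-tail (fresh-tail Q))) ∷ drop₃ {[]} (fresh-head (fresh-tail (fresh-tail (fresh-tail Q)))) ∷ []
  L = ρ a ∷ ρ b ∷ ρ c ∷ ρ s ∷ X
  not-q : ∀ {x} → x ∈ e ∷ u ∷ v ∷ X → x ∉ X → x ∉ L
  not-q x∈ x∉ (here refl) = fresh-head Q (there (there (there x∈)))
  not-q x∈ x∉ (there (here refl)) = fresh-head (fresh-tail Q) (there (there x∈))
  not-q x∈ x∉ (there (there (here refl))) = fresh-head (fresh-tail (fresh-tail Q)) (there x∈)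
  not-q x∈ x∉ (there (there (there (here refl)))) = fresh-head (fresh-tail (fresh-tail (fresh-tail Q))) x∈
  not-q x∈ x∉ (there (there (there (there h)))) = x∉ h
  u∉L = not-q (there (here refl)) (u∉ ∘ there)
  e∉L = not-q (here refl) (e∉ ∘ there ∘ there)
  v∉L = not-q (there (there (here refl))) v∉
  u∉' : u ∉ e ∷ v ∷ L
  u∉' = ∉-∷ (e∉ ∘ here ∘ sym) (∉-∷ (u∉ ∘ here) u∉L)
  e∉' : e ∉ v ∷ L
  e∉' = ∉-∷ (e∉ ∘ there ∘ here) e∉L
  v∉' : v ∉ L
  v∉' = v∉L
  out : ∀ {x Y} → x ∉ Y → x ∉ Y
  out h = h
  perm : u ∷ e ∷ v ∷ L ⊆ ρ a ∷ ρ b ∷ ρ c ∷ ρ s ∷ e ∷ u ∷ v ∷ X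
  perm = ∷⊆ (there (there (there (there (there (here refl)))))) (∷⊆ (there (there (there (there (here refl)))))
    (∷⊆ (there (there (there (there (there (there (here refl))))))) (∷⊆ (here refl) (∷⊆ (there (here refl))
    (∷⊆ (there (there (here refl))) (∷⊆ (there (there (there (here refl)))) (there ∘ there ∘ there ∘ there ∘ there ∘ there ∘ there)))))))

-- Relations between the lifts

-- The recursion alone leaves every lift as a generator. With the `base` stars already spanned by G,
-- relations are derived that deduce one lift from others.
module Refine {n k : ℕ} {X : List (Fin n)} {e u v : Fin n} (F : Fresh X (e ∷ u ∷ v ∷ []))
  (h : tri (4 ℕ.+ k) ≤ size X)
  (g : Fin n → Chain n (3 ℕ.+ k)) (Y : Fin n → Fin n → Chain n (3 ℕ.+ k))
  (Zg : ∀ a → a ∉ u ∷ v ∷ X → Zc (a ∷ u ∷ v ∷ X) (g a))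
  (Sg : ∀ a → a ∉ u ∷ v ∷ X → ∀ z → Zc (u ∷ v ∷ X) z → Sp (u ∷ v ∷ X) (_≡ g a) z)
  (ZY : ∀ a c → a ∉ u ∷ v ∷ X → e ≢ a → c ∉ e ∷ a ∷ u ∷ v ∷ X → Zc (a ∷ u ∷ v ∷ X) (Y a c))
  (SY : ∀ a c → a ∉ u ∷ v ∷ X → e ≢ a → c ∉ e ∷ a ∷ u ∷ v ∷ X → ∀ z → Zc (e ∷ c ∷ a ∷ u ∷ v ∷ X) z →
    Sp (e ∷ c ∷ a ∷ u ∷ v ∷ X) (_≡ ι (mk e c) (Y a c)) z)
  (OY : ∀ a c → a ∉ u ∷ v ∷ X → e ≢ a → c ∉ e ∷ a ∷ u ∷ v ∷ X → ∀ c' → c' ≢ c → ι (mk e c') (Y a c) ≈ zeroC)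
  (G : Chain n (4 ℕ.+ k) → Set) (B : ∀ x → Zc (e ∷ u ∷ v ∷ X) x → Sp X G (star u e v x))
  where

  open Recursion F h g Y Zg Sg ZY SY OY using (moved; dist)

  Lift : Fin n → Fin n → Set
  Lift a c = Sp X G (star u a v (Y a c))

  private
    e∉ : e ∉ u ∷ v ∷ X
    e∉ = fresh-head F

    star-split : ∀ a x w y → Sp X G (star u a v (y -C scale x w)) → Sp X G (star u a v w) → Sp X G (star u a v y)
    star-split a x w y s t = sp≈ (λ τ → trans (cong₂ _+_ (sub (star-linear u a v) y (scale x w) τ) (sym (scale-lin (star-linear u a v) x w τ)))
      (solve 2 (λ a b → (a :+ (:- b)) :+ b := a) refl (star u a v y τ) _)) (sp+ s (sp-scale x t))

  module _ (a : Fin n) (a∉ : a ∉ u ∷ v ∷ X) (e≢a : e ≢ a) where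

    Bounding : Chain n (3 ℕ.+ k) → Fin n → Set
    Bounding y c = Bd (e ∷ c ∷ a ∷ u ∷ v ∷ X) (ι (mk e c) y)

    bounding-sub : ∀ {y w c} x → Bounding y c → ι (mk e c) w ≈ zeroC → Bounding (y -C scale x w) c
    bounding-sub {y} {w} {c} x b z = bd-≈ (λ τ → sym (trans (cong (λ t → y (mk e c ∷ τ) + (- (x · t))) (z τ))
      (trans (cong (λ t → y (mk e c ∷ τ) + (- t)) (·-0 x)) (solve 1 (λ y → y :+ (:- :0) := y) refl _)))) b

    -- If all links at e bound, y can be pushed off e, and then its star moves from a to e, where G
    -- takes over.
    by-base : ∀ y → Zc (a ∷ u ∷ v ∷ X) y → (∀ c → c ∉ e ∷ a ∷ u ∷ v ∷ X → Bounding y c) → Sp X G (star u a v y)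
    by-base y Zy b = use (push e y (∉-∷ e≢a e∉) Zy λ c ne c∉ → b c (∉-∷ ne c∉))
      where
      use : (Σ (Chain n (3 ℕ.+ k)) λ y' → Zc (e ∷ a ∷ u ∷ v ∷ X) y' × (y ~[ a ∷ u ∷ v ∷ X ] y')) → Sp X G (star u a v y)
      use (y' , Zy' , y~) = sp-~ (~-trans (~-star (dist a∉)
          (~-⊆ (∷⊆ (there (here refl)) (∷⊆ (here refl) (∷⊆ (there (there (here refl))) (there ∘ there ∘ there)))) y~))
          (moved a e a∉ e∉ e≢a y' Zy'))
        (sp- (B y' (zc-⊆ (∷-mono there) Zy')))

    -- The one link that need not bound is a multiple of the link of `Y a c`, so subtracting that
    -- multiple leads back to `by-base`.
    by-one : ∀ y c → c ∉ e ∷ a ∷ u ∷ v ∷ X → Zc (a ∷ u ∷ v ∷ X) y →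
      (∀ c' → c' ∉ e ∷ a ∷ u ∷ v ∷ X → c' ≢ c → Bounding y c') → Lift a c → Sp X G (star u a v y)
    by-one y c c∉ Zy b L = use (multiple (SY a c a∉ e≢a c∉ (ι (mk e c) y) (zc-ι e c Zy)))
      where
      use : (∃ λ x → ι (mk e c) y ~[ e ∷ c ∷ a ∷ u ∷ v ∷ X ] (λ τ → x · ι (mk e c) (Y a c) τ)) → Sp X G (star u a v y)
      use (x , hom r) = star-split a x (Y a c) y
          (by-base (y -C scale x (Y a c)) (zc-sub Zy (zc-scale x (ZY a c a∉ e≢a c∉))) each) L
        where
        each : ∀ c' → c' ∉ e ∷ a ∷ u ∷ v ∷ X → Bounding (y -C scale x (Y a c)) c'
        each c' c'∉ = go (c' Finₚ.≟ c)
          where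
          go : Dec (c' ≡ c) → Bounding (y -C scale x (Y a c)) c'
          go (yes refl) = r
          go (no ne) = bounding-sub {y} {Y a c} x (b c' c'∉ ne) (OY a c a∉ e≢a c∉ c' ne)

    by-two : ∀ y c d → c ∉ e ∷ a ∷ u ∷ v ∷ X → d ∉ e ∷ a ∷ u ∷ v ∷ X → Zc (a ∷ u ∷ v ∷ X) y →
      (∀ c' → c' ∉ e ∷ a ∷ u ∷ v ∷ X → c' ≢ c → c' ≢ d → Bounding y c') → Lift a c → Lift a d → Sp X G (star u a v y)
    by-two y c d c∉ d∉ Zy b L M = use (multiple (SY a c a∉ e≢a c∉ (ι (mk e c) y) (zc-ι e c Zy)))
      where
      use : (∃ λ x → ι (mk e c) y ~[ e ∷ c ∷ a ∷ u ∷ v ∷ X ] (λ τ → x · ι (mk e c) (Y a c) τ)) → Sp X G (star u a v y)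
      use (x , hom r) = star-split a x (Y a c) y
          (by-one (y -C scale x (Y a c)) d d∉ (zc-sub Zy (zc-scale x (ZY a c a∉ e≢a c∉))) each M) L
        where
        each : ∀ c' → c' ∉ e ∷ a ∷ u ∷ v ∷ X → c' ≢ d → Bounding (y -C scale x (Y a c)) c'
        each c' c'∉ c'≢d = go (c' Finₚ.≟ c)
          where
          go : Dec (c' ≡ c) → Bounding (y -C scale x (Y a c)) c'
          go (yes refl) = r
          go (no ne) = bounding-sub {y} {Y a c} x (b c' c'∉ ne c'≢d) (OY a c a∉ e≢a c∉ c' ne)

  -- A cycle κ avoiding a and b whose only nonzero links at e are those to c and d
  four-cycle : ∀ a b c d (κ : Chain n (3 ℕ.+ k)) → a ∉ u ∷ v ∷ X → e ≢ a → b ∉ u ∷ v ∷ X → e ≢ b → b ≢ a →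
    c ∉ e ∷ a ∷ u ∷ v ∷ X → c ∉ e ∷ b ∷ u ∷ v ∷ X → d ∉ e ∷ a ∷ u ∷ v ∷ X → d ∉ e ∷ b ∷ u ∷ v ∷ X → c ≢ d →
    Zc (b ∷ a ∷ u ∷ v ∷ X) κ → (∀ c' → c' ≢ c → c' ≢ d → ι (mk e c') κ ≈ zeroC) →
    (∀ z → Zc (e ∷ c ∷ a ∷ u ∷ v ∷ X) z → Sp (e ∷ c ∷ a ∷ u ∷ v ∷ X) (_≡ ι (mk e c) κ) z) →
    Lift a d → Lift b c → Lift b d → Lift a c
  four-cycle a b c d κ a∉ e≢a b∉ e≢b b≢a ca cb da db c≢d Zκ off Sκ Lad Lbc Lbd =
    use (multiple (Sκ (ι (mk e c) (Y a c)) (zc-ι e c (ZY a c a∉ e≢a ca))))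
    where
    κa : Zc (a ∷ u ∷ v ∷ X) κ
    κa = zc-⊆ there Zκ
    κb : Zc (b ∷ u ∷ v ∷ X) κ
    κb = zc-⊆ (∷-mono there) Zκ
    -- κ misses a and b, so its star moves from a to b. There only the lifts to c and d enter, and
    -- these are known.
    star-κ : Sp X G (star u a v κ)
    star-κ = sp-~ (moved a b a∉ b∉ b≢a κ Zκ) (sp- (by-two b b∉ e≢b κ c d cb db κb
      (λ c' _ c'c c'd → bd-≈ (≈-sym (off c' c'c c'd)) bd-0) Lbc Lbd))
    use : (∃ λ x → ι (mk e c) (Y a c) ~[ e ∷ c ∷ a ∷ u ∷ v ∷ X ] (λ τ → x · ι (mk e c) κ τ)) → Lift a c
    use (x , hom r) = star-split a x κ (Y a c)
        (by-one a a∉ e≢a (Y a c -C scale x κ) d da (zc-sub (ZY a c a∉ e≢a ca) (zc-scale x κa)) each Lad) star-κ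
      where
      each : ∀ c' → c' ∉ e ∷ a ∷ u ∷ v ∷ X → c' ≢ d → Bounding a a∉ e≢a (Y a c -C scale x κ) c'
      each c' c'∉ c'≢d = go (c' Finₚ.≟ c)
        where
        go : Dec (c' ≡ c) → Bounding a a∉ e≢a (Y a c -C scale x κ) c'
        go (yes refl) = r
        go (no ne) = bounding-sub a a∉ e≢a {Y a c} {κ} x (bd-≈ (≈-sym (OY a c a∉ e≢a ca c' ne)) bd-0) (off c' ne c'≢d)

-- Twelve vertices

rem : ℕ → List ℕ → List ℕ
rem i [] = []
rem i (j ∷ js) = if i ≡ᵇ j then rem i js else j ∷ rem i js

prodP : ∀ k → List ℕ → Poly k
prodP zero _ = oneP
prodP (suc k) (a ∷ b ∷ c ∷ is) = starP a b c (prodP k is)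
prodP (suc k) _ = []

-- Positions 0, 1, 2 are reserved for u, v, e; hence `ten` contains e and `nine` does not.
nine ten : List ℕ
nine = 3 ∷ 4 ∷ 5 ∷ 6 ∷ 7 ∷ 8 ∷ 9 ∷ 10 ∷ 11 ∷ []
ten = 2 ∷ nine

gP : ℕ → Poly 3
gP i = prodP 3 (rem i ten)

-- The first factor is ce minus the edge from c to the first remaining position. The link at ec is
-- therefore the product of the two other stars, the generator on seven vertices.
YP : ℕ → ℕ → Poly 3
YP a c = prodP 3 (c ∷ 2 ∷ rem c (rem a nine))

-- Regard (a, c) as an edge of the bipartite graph on two copies of the nine positions. These 8 + 7
-- + 2 pairs form a spanning tree of its 18 vertices, and the remaining edges are obtained by
-- completing rectangles.
kept : List (ℕ × ℕ)
kept = map (_, 4) (rem 4 nine) ++ map (3 ,_) (rem 3 (rem 4 nine)) ++ (4 , 5) ∷ (5 , 3) ∷ []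

shiftP : Poly k → Poly k
shiftP = map λ t → proj₁ t , Vec.map (λ e → 3 ℕ.+ proj₁ e , 3 ℕ.+ proj₂ e) (proj₂ t)

triG : ℕ → Poly 4
triG i = triP 0 1 i (gP i)

liftL : ℕ × ℕ → Poly 4
liftL (a , c) = starP 0 a 1 (YP a c)

baseB : Poly 3 → Poly 4
baseB p = starP 0 2 1 (shiftP p)

-- 10 + 17 + 29 = 56 cycles; the triangle products of the nine-vertex basis are left out.
basis₁₂ : List (Poly 4)
basis₁₂ = map triG ten ++ map liftL kept ++ map baseB basisPolys₉

closedOK : ℕ → List ℕ → Poly (suc k) → Bool
closedOK K U p = validPU K U p && isNil (nf (∂P p))

index : List (Fin n) → Fin n → ℕ
index [] a = 0
index (x ∷ xs) a = if does (x Finₚ.≟ a) then 0 else suc (index xs a)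

index-∈ : ∀ {d : Fin n} {xs a} → a ∈ xs → index xs a ℕ.< length xs × nth d xs (index xs a) ≡ a
index-∈ {xs = x ∷ xs} {a} a∈ with x Finₚ.≟ a
... | yes e = s≤s z≤n , e
index-∈ (here e) | no ne = ⊥-elim (ne (sym e))
index-∈ (there h) | no ne = let i , e = index-∈ h in s≤s i , e

isGen-≈ : ∀ {X} {g g' : Chain n m} → g ≈ g' → IsGen X g → IsGen X g'
isGen-≈ e (isGen z s) = isGen (zc-≈ e z) λ x Z → sp-bind id (λ { refl → sp≈ (≈-sym e) (gen refl) }) (s x Z)

fresh-++ : ∀ {X : List (Fin n)} ws {vs} → Fresh X (ws ++ vs) → Fresh (vs ++ X) ws × Fresh X vs
fresh-++ [] f = [] , f
fresh-++ {X = X} (w ∷ ws) {vs} (w∉ ∷ f) = let a , b = fresh-++ ws f in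
  (λ h → w∉ (subst (w ∈_) (sym (Listₚ.++-assoc ws vs X)) h)) ∷ a , b

-- The order in which vertices are made fresh: the six positions of the generator on seven vertices
-- and its spare i, then the star factor, and u, v deleted first. Suffixes of the list are the
-- successive deleted sets.
orderG : ℕ → List ℕ → List ℕ
orderG i (x₀ ∷ x₁ ∷ x₂ ∷ x₃ ∷ x₄ ∷ x₅ ∷ x₆ ∷ x₇ ∷ x₈ ∷ []) = x₃ ∷ x₄ ∷ x₅ ∷ x₆ ∷ x₇ ∷ x₈ ∷ i ∷ x₁ ∷ x₀ ∷ x₂ ∷ 0 ∷ 1 ∷ []
orderG i _ = []

orderY : ℕ → ℕ → List ℕ → List ℕ
orderY a c (x₀ ∷ x₁ ∷ x₂ ∷ x₃ ∷ x₄ ∷ x₅ ∷ x₆ ∷ []) = x₁ ∷ x₂ ∷ x₃ ∷ x₄ ∷ x₅ ∷ x₆ ∷ x₀ ∷ 2 ∷ c ∷ a ∷ 0 ∷ 1 ∷ []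
orderY a c _ = []

rem-∈ : ∀ {i j is} → j ∈ is → i ≢ j → j ∈ rem i is
rem-∈ {i} {j} {k ∷ is} j∈ ne with i ℕ.≟ k
rem-∈ {i} {j} {k ∷ is} (here refl) ne | yes e = ⊥-elim (ne e)
rem-∈ {i} {j} {k ∷ is} (there h) ne | yes refl rewrite ≡ᵇ-refl k = rem-∈ h ne
rem-∈ {i} {j} {k ∷ is} j∈ ne | no i≢k with i ≡ᵇ k in q
... | true = ⊥-elim (i≢k (ℕₚ.≡ᵇ⇒≡ i k (subst T (sym q) tt)))
rem-∈ {i} {j} {k ∷ is} (here refl) ne | no i≢k | false = here refl
rem-∈ {i} {j} {k ∷ is} (there h) ne | no i≢k | false = there (rem-∈ h ne)

G-distinct : ∀ {i} → i ∈ ten → distinctᵇ 12 (i ∷ 0 ∷ 1 ∷ []) ≡ true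
G-distinct = allᵇ-∈ (λ i → distinctᵇ 12 (i ∷ 0 ∷ 1 ∷ [])) {ten} refl

G-closed : ∀ {i} → i ∈ ten → closedOK 12 (i ∷ 0 ∷ 1 ∷ []) (gP i) ≡ true
G-closed = allᵇ-∈ (λ i → closedOK 12 (i ∷ 0 ∷ 1 ∷ []) (gP i)) {ten} refl

G-length : ∀ {i} → i ∈ ten → length (rem i ten) ≡ 9
G-length {i} i∈ = ℕₚ.≡ᵇ⇒≡ _ 9 (subst T (sym (allᵇ-∈ (λ i → length (rem i ten) ≡ᵇ 9) {ten} refl i∈)) tt)

G-order : ∀ {i} → i ∈ ten → distinctᵇ 12 (orderG i (rem i ten)) ≡ true
G-order = allᵇ-∈ (λ i → distinctᵇ 12 (orderG i (rem i ten))) {ten} refl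

all-pairs : (t : ℕ → ℕ → Bool) → allᵇ (λ a → allᵇ (t a) (rem a nine)) nine ≡ true → ∀ {a c} → a ∈ nine → c ∈ rem a nine → t a c ≡ true
all-pairs t h {a} a∈ = allᵇ-∈ (t a) (allᵇ-∈ (λ a → allᵇ (t a) (rem a nine)) h a∈)

Y-distinct : ∀ {i} → i ∈ nine → distinctᵇ 12 (i ∷ 0 ∷ 1 ∷ []) ≡ true
Y-distinct = allᵇ-∈ (λ i → distinctᵇ 12 (i ∷ 0 ∷ 1 ∷ [])) {nine} refl

Y-closed : ∀ {a c} → a ∈ nine → c ∈ rem a nine → closedOK 12 (a ∷ 0 ∷ 1 ∷ []) (YP a c) ≡ true
Y-closed = all-pairs (λ a c → closedOK 12 (a ∷ 0 ∷ 1 ∷ []) (YP a c)) refl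

Y-length : ∀ {a c} → a ∈ nine → c ∈ rem a nine → length (rem c (rem a nine)) ≡ 7
Y-length a∈ c∈ = ℕₚ.≡ᵇ⇒≡ _ 7 (subst T (sym (all-pairs (λ a c → length (rem c (rem a nine)) ≡ᵇ 7) refl a∈ c∈)) tt)

Y-order : ∀ {a c} → a ∈ nine → c ∈ rem a nine → distinctᵇ 12 (orderY a c (rem c (rem a nine))) ≡ true
Y-order = all-pairs (λ a c → distinctᵇ 12 (orderY a c (rem c (rem a nine)))) refl

-- Steps (a, b, c, d): the lift (a, c) follows from (a, d), (b, c) and (b, d).
Quad : Set
Quad = (ℕ × ℕ) × (ℕ × ℕ)

-- 42 pairs avoid row and column 3 and 4 and come from the kept pairs directly. Then follow six
-- pairs (4, c) by way of 5, six pairs (a, 3) by way of (5, 3) and (5, 4), and last (4, 3); together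
-- 55 = 72 - 17.
quads : List Quad
quads =
  List.concatMap (λ a → map (λ c → (a , 3) , (c , 4)) (rem a others)) others ++
  map (λ c → (4 , 3) , (c , 5)) (rem 5 others) ++
  map (λ a → (a , 5) , (3 , 4)) (rem 5 others) ++
  ((4 , 6) , (3 , 5)) ∷ []
  where
  others = rem 3 (rem 4 nine)

leftover : Quad → List ℕ
leftover ((a , b) , (c , d)) = rem d (rem c (rem b (rem a nine)))

quadTests : Quad → List ℕ → List Bool
quadTests ((a , b) , (c , d)) (f ∷ g ∷ h₁ ∷ h₂ ∷ h₃ ∷ []) =
  distinctᵇ 12 (h₁ ∷ h₂ ∷ h₃ ∷ g ∷ d ∷ f ∷ 2 ∷ c ∷ b ∷ a ∷ 0 ∷ 1 ∷ []) ∷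
  distinctᵇ 12 (f ∷ d ∷ g ∷ h₁ ∷ h₂ ∷ h₃ ∷ b ∷ 2 ∷ c ∷ a ∷ 0 ∷ 1 ∷ []) ∷
  distinctᵇ 12 (c ∷ 2 ∷ a ∷ 0 ∷ 1 ∷ []) ∷ distinctᵇ 12 (c ∷ 2 ∷ b ∷ 0 ∷ 1 ∷ []) ∷
  distinctᵇ 12 (d ∷ 2 ∷ a ∷ 0 ∷ 1 ∷ []) ∷ distinctᵇ 12 (d ∷ 2 ∷ b ∷ 0 ∷ 1 ∷ []) ∷
  elemᵇ a nine ∷ elemᵇ b nine ∷ elemᵇ c nine ∷ elemᵇ d nine ∷ []
quadTests _ _ = false ∷ []

conj : List Bool → Bool
conj [] = true
conj (b ∷ bs) = b && conj bs

conj-all : ∀ bs → conj bs ≡ true → All (_≡ true) bs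
conj-all [] h = []
conj-all (true ∷ bs) h = refl ∷ conj-all bs h

memᵇ : ℕ → ℕ → List (ℕ × ℕ) → Bool
memᵇ a c [] = false
memᵇ a c ((b , d) ∷ ps) = if (a ≡ᵇ b) && (c ≡ᵇ d) then true else memᵇ a c ps

memᵇ-∈ : ∀ {a c ps} → memᵇ a c ps ≡ true → (a , c) ∈ ps
memᵇ-∈ {a} {c} {(b , d) ∷ ps} h with (a ≡ᵇ b) && (c ≡ᵇ d) in q
... | false = there (memᵇ-∈ h)
... | true with ℕₚ.≡ᵇ⇒≡ a b (subst T (sym (proj₁ (&&-split q))) tt) | ℕₚ.≡ᵇ⇒≡ c d (subst T (sym (proj₂ (&&-split {a = a ≡ᵇ b} q))) tt)
...   | refl | refl = here refl

stepTests : Quad → List (ℕ × ℕ) → List Bool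
stepTests q@((a , b) , (c , d)) known = conj (quadTests q (leftover q)) ∷ memᵇ a d known ∷ memᵇ b c known ∷ memᵇ b d known ∷ []

-- A step whose tests fail changes nothing, so every list of steps is sound. That this list reaches
-- all 72 pairs is the content of `saturated-pairs`.
close : List (ℕ × ℕ) → List Quad → List (ℕ × ℕ)
close known [] = known
close known (q@((a , b) , (c , d)) ∷ qs) = close (if conj (stepTests q known) then (a , c) ∷ known else known) qs

opaque
  saturated : List (ℕ × ℕ)
  saturated = close kept quads

  saturated-pairs : ∀ {a c} → a ∈ nine → c ∈ rem a nine → memᵇ a c saturated ≡ true
  saturated-pairs = all-pairs (λ a c → memᵇ a c saturated) refl

module Twelve {n} {X : List (Fin n)} (d : Fin n) {u v e : Fin n} {vs : List (Fin n)} (F : Fresh X (u ∷ v ∷ e ∷ vs))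
  (len : length vs ≡ 9) (full : size X ≡ 12) where

  ws : List (Fin n)
  ws = u ∷ v ∷ e ∷ vs

  len₁₂ : length ws ≡ 12
  len₁₂ = cong (3 ℕ.+_) len

  ρ : ℕ → Fin n
  ρ = nth d ws

  open Interp ρ
  open Positions d F

  fr : ∀ is → distinctᵇ 12 is ≡ true → Fresh X (map ρ is)
  fr is h = posFresh is (subst (λ l → distinctᵇ l is ≡ true) (sym len₁₂) h)

  closed : ∀ (p : Poly (suc k)) U → distinctᵇ 12 U ≡ true → closedOK 12 U p ≡ true → Zc (map ρ U ++ X) (⟦ p ⟧ unit)
  closed p U h₁ h₂ = zc-⟦⟧-off p U (subst (λ l → distinctᵇ l U ≡ true) (sym len₁₂) h₁)
    (subst (λ l → validPU l U p ≡ true) (sym len₁₂) (proj₁ (&&-split h₂))) (proj₂ (&&-split {a = validPU 12 U p} h₂))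

  drop-size : ∀ {Y : List (Fin n)} {vs t} → Fresh Y vs → size Y ≡ length vs ℕ.+ t → size (vs ++ Y) ≡ t
  drop-size {vs = vs} f h = ℕₚ.+-cancelˡ-≡ (length vs) _ _ (trans (sym (fresh-size f)) h)

  Fe : Fresh X (e ∷ u ∷ v ∷ [])
  Fe = fr (2 ∷ 0 ∷ 1 ∷ []) refl

  F₉ : Fresh (e ∷ u ∷ v ∷ X) vs
  F₉ = reorder (proj₁ (fresh-++ vs (swap F)))
    where
    swap : Fresh X ((u ∷ v ∷ e ∷ []) ++ vs) → Fresh X (vs ++ (u ∷ v ∷ e ∷ []))
    swap f = rotate (u ∷ v ∷ e ∷ []) vs f
      where
      ins : ∀ x {as} → Fresh X as → x ∉ as ++ X → Fresh X (as ++ x ∷ [])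
      ins x {[]} f x∉ = x∉ ∷ []
      ins x {a ∷ as} (a∉ ∷ f) x∉ = (λ h → new (∈-++⁻ (as ++ x ∷ []) h)) ∷ ins x f (x∉ ∘ there)
        where
        new : (a ∈ as ++ x ∷ []) ⊎ (a ∈ X) → ⊥
        new (inj₂ h) = a∉ (∈-++⁺ʳ as h)
        new (inj₁ h) with ∈-++⁻ as h
        ... | inj₁ i = a∉ (∈-++⁺ˡ i)
        ... | inj₂ (here refl) = x∉ (here refl)
      rotate : ∀ as bs → Fresh X (as ++ bs) → Fresh X (bs ++ as)
      rotate [] bs f = subst (Fresh X) (sym (Listₚ.++-identityʳ bs)) f
      rotate (a ∷ as) bs (a∉ ∷ f) = subst (Fresh X) (Listₚ.++-assoc bs (a ∷ []) as)
        (rotate as (bs ++ a ∷ []) (subst (Fresh X) (Listₚ.++-assoc as bs (a ∷ [])) (ins a f a∉)))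
    reorder : ∀ {as} → Fresh (u ∷ v ∷ e ∷ X) as → Fresh (e ∷ u ∷ v ∷ X) as
    reorder [] = []
    reorder {a ∷ as} (a∉ ∷ f) = (λ h → a∉ (perm h)) ∷ reorder f
      where
      perm : as ++ e ∷ u ∷ v ∷ X ⊆ as ++ u ∷ v ∷ e ∷ X
      perm h with ∈-++⁻ as h
      ... | inj₁ i = ∈-++⁺ˡ i
      ... | inj₂ (here q) = ∈-++⁺ʳ as (there (there (here q)))
      ... | inj₂ (there (here q)) = ∈-++⁺ʳ as (here q)
      ... | inj₂ (there (there (here q))) = ∈-++⁺ʳ as (there (here q))
      ... | inj₂ (there (there (there i))) = ∈-++⁺ʳ as (there (there (there i)))

  sizeUV : size (u ∷ v ∷ X) ≡ 10
  sizeUV = drop-size (fr (0 ∷ 1 ∷ []) refl) full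

  ⟦prod⟧₂ : ∀ a b c x y z → ⟦ prodP 2 (a ∷ b ∷ c ∷ x ∷ y ∷ z ∷ []) ⟧ unit ≈ star (ρ a) (ρ b) (ρ c) (star (ρ x) (ρ y) (ρ z) unit)
  ⟦prod⟧₂ a b c x y z = ≈-trans (⟦starP⟧ a b c (prodP 1 (x ∷ y ∷ z ∷ [])) unit) (resp (star-linear (ρ a) (ρ b) (ρ c))
    (≈-trans (⟦starP⟧ x y z oneP unit) (resp (star-linear (ρ x) (ρ y) (ρ z)) (⟦oneP⟧ unit))))

  triangle-gen : ∀ i is → length is ≡ 9 → distinctᵇ 12 (orderG i is) ≡ true → IsGen (u ∷ v ∷ X) (⟦ prodP 3 is ⟧ unit)
  triangle-gen i (x₀ ∷ x₁ ∷ x₂ ∷ x₃ ∷ x₄ ∷ x₅ ∷ x₆ ∷ x₇ ∷ x₈ ∷ []) refl chk = isGen-≈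
      (≈-sym (≈-trans (⟦starP⟧ x₀ x₁ x₂ (prodP 2 (x₃ ∷ x₄ ∷ x₅ ∷ x₆ ∷ x₇ ∷ x₈ ∷ [])) unit)
        (resp (star-linear (ρ x₀) (ρ x₁) (ρ x₂)) (⟦prod⟧₂ x₃ x₄ x₅ x₆ x₇ x₈))))
      (gen-step f₃ (ℕₚ.≤-reflexive (sym sizeUV)) (one₇ f₇ (drop-size f₃ sizeUV)))
    where
    all = fr (x₃ ∷ x₄ ∷ x₅ ∷ x₆ ∷ x₇ ∷ x₈ ∷ i ∷ x₁ ∷ x₀ ∷ x₂ ∷ 0 ∷ 1 ∷ []) chk
    f₁₀ = proj₁ (fresh-++ (ρ x₃ ∷ ρ x₄ ∷ ρ x₅ ∷ ρ x₆ ∷ ρ x₇ ∷ ρ x₈ ∷ ρ i ∷ ρ x₁ ∷ ρ x₀ ∷ ρ x₂ ∷ []) {ρ 0 ∷ ρ 1 ∷ []} all)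
    f₃ : Fresh (u ∷ v ∷ X) (ρ x₁ ∷ ρ x₀ ∷ ρ x₂ ∷ [])
    f₃ = proj₂ (fresh-++ (ρ x₃ ∷ ρ x₄ ∷ ρ x₅ ∷ ρ x₆ ∷ ρ x₇ ∷ ρ x₈ ∷ ρ i ∷ []) {ρ x₁ ∷ ρ x₀ ∷ ρ x₂ ∷ []} f₁₀)
    f₇ : Fresh (ρ x₁ ∷ ρ x₀ ∷ ρ x₂ ∷ u ∷ v ∷ X) (ρ x₃ ∷ ρ x₄ ∷ ρ x₅ ∷ ρ x₆ ∷ ρ x₇ ∷ ρ x₈ ∷ ρ i ∷ [])
    f₇ = proj₁ (fresh-++ (ρ x₃ ∷ ρ x₄ ∷ ρ x₅ ∷ ρ x₆ ∷ ρ x₇ ∷ ρ x₈ ∷ ρ i ∷ []) {ρ x₁ ∷ ρ x₀ ∷ ρ x₂ ∷ []} f₁₀)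

  seven : ∀ a c x₀ x₁ x₂ x₃ x₄ x₅ x₆ → distinctᵇ 12 (x₀ ∷ x₁ ∷ x₂ ∷ x₃ ∷ x₄ ∷ x₅ ∷ x₆ ∷ 2 ∷ c ∷ a ∷ 0 ∷ 1 ∷ []) ≡ true →
    IsGen (e ∷ ρ c ∷ ρ a ∷ u ∷ v ∷ X) (star (ρ x₀) (ρ x₁) (ρ x₂) (star (ρ x₃) (ρ x₄) (ρ x₅) unit))
  seven a c x₀ x₁ x₂ x₃ x₄ x₅ x₆ chk = one₇ (proj₁ parts) (drop-size (proj₂ parts) full)
    where
    parts = fresh-++ (ρ x₀ ∷ ρ x₁ ∷ ρ x₂ ∷ ρ x₃ ∷ ρ x₄ ∷ ρ x₅ ∷ ρ x₆ ∷ []) {ρ 2 ∷ ρ c ∷ ρ a ∷ ρ 0 ∷ ρ 1 ∷ []}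
      (fr (x₀ ∷ x₁ ∷ x₂ ∷ x₃ ∷ x₄ ∷ x₅ ∷ x₆ ∷ 2 ∷ c ∷ a ∷ 0 ∷ 1 ∷ []) chk)

  lift-gen : ∀ a c is → length is ≡ 7 → distinctᵇ 12 (orderY a c is) ≡ true →
    IsGen (e ∷ ρ c ∷ ρ a ∷ u ∷ v ∷ X) (ι (mk e (ρ c)) (⟦ prodP 3 (c ∷ 2 ∷ is) ⟧ unit)) ×
    (∀ c' → c' ≢ ρ c → ι (mk e c') (⟦ prodP 3 (c ∷ 2 ∷ is) ⟧ unit) ≈ zeroC)
  lift-gen a c (x₀ ∷ x₁ ∷ x₂ ∷ x₃ ∷ x₄ ∷ x₅ ∷ x₆ ∷ []) refl chk = isGen-≈ (≈-sym at) S , off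
    where
    y = star (ρ x₁) (ρ x₂) (ρ x₃) (star (ρ x₄) (ρ x₅) (ρ x₆) unit)
    S = seven a c x₁ x₂ x₃ x₄ x₅ x₆ x₀ chk
    Y' = ⟦ prodP 3 (c ∷ 2 ∷ x₀ ∷ x₁ ∷ x₂ ∷ x₃ ∷ x₄ ∷ x₅ ∷ x₆ ∷ []) ⟧ unit
    shape : Y' ≈ star (ρ c) e (ρ x₀) y
    shape = ≈-trans (⟦starP⟧ c 2 x₀ (prodP 2 (x₁ ∷ x₂ ∷ x₃ ∷ x₄ ∷ x₅ ∷ x₆ ∷ [])) unit)
      (resp (star-linear (ρ c) e (ρ x₀)) (⟦prod⟧₂ x₁ x₂ x₃ x₄ x₅ x₆))
    f : Fresh X (ρ x₀ ∷ e ∷ ρ c ∷ ρ a ∷ u ∷ v ∷ [])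
    f = proj₂ (fresh-++ (ρ x₁ ∷ ρ x₂ ∷ ρ x₃ ∷ ρ x₄ ∷ ρ x₅ ∷ ρ x₆ ∷ []) {ρ x₀ ∷ e ∷ ρ c ∷ ρ a ∷ u ∷ v ∷ []}
      (fr (x₁ ∷ x₂ ∷ x₃ ∷ x₄ ∷ x₅ ∷ x₆ ∷ x₀ ∷ 2 ∷ c ∷ a ∷ 0 ∷ 1 ∷ []) chk))
    e≢c : e ≢ ρ c
    e≢c = fresh-head (fresh-tail f) ∘ here
    e≢x : e ≢ ρ x₀
    e≢x = fresh-head f ∘ here ∘ sym
    y₀ : ∀ c' → ι (mk e c') y ≈ zeroC
    y₀ c' = ι-bad (mk e c') (ok (gen-zc S)) λ g → good-mk⁻ e c' g .proj₂ .proj₁ (here refl)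
    at : ι (mk e (ρ c)) Y' ≈ y
    at τ = trans (shape (mk e (ρ c) ∷ τ)) (trans (cong₂ (λ p q → p + (- q))
        (subst (λ w → ι (mk e (ρ c)) (w ∧ y) τ ≡ y τ) (mk-sym e (ρ c))
          (∧-self {X = []} (mk e (ρ c)) {y} (Ok-⊆ (ends-mk⁺ e (ρ c) []) (Ok-⊆ (∷-mono (∷-mono λ ())) (ok (gen-zc S)))) τ))
        (link-∧ (mk (ρ c) (ρ x₀)) (mk e (ρ c)) y (mk-≢ e≢c e≢x) (y₀ (ρ c)) τ))
      (solve 1 (λ x → x :+ (:- :0) := x) refl (y τ)))
    off : ∀ c' → c' ≢ ρ c → ι (mk e c') Y' ≈ zeroC
    off c' ne τ = trans (shape (mk e c' ∷ τ)) (trans (cong₂ (λ p q → p + (- q))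
        (link-∧ (mk (ρ c) e) (mk e c') y (λ q → ne (sym (mk-injʳ (trans (mk-sym e (ρ c)) q)))) (y₀ c') τ)
        (link-∧ (mk (ρ c) (ρ x₀)) (mk e c') y (mk-≢ e≢c e≢x) (y₀ c') τ)) (neg-inverseʳ 0₃))

  opaque
    ix : Fin n → ℕ
    ix = index ws

    located : ∀ a → a ∉ u ∷ v ∷ X → ix a ∈ ten × ρ (ix a) ≡ a
    located a a∉ = split (below-∈ 12 (ix a) {0 ∷ 1 ∷ ten} refl (subst (ix a ℕ.<_) len₁₂ (proj₁ at))) , proj₂ at
      where
      at : ix a ℕ.< length ws × ρ (ix a) ≡ a
      at = index-∈ (fresh-covers F (trans full (sym len₁₂)) a (a∉ ∘ there ∘ there))
      split : ix a ∈ 0 ∷ 1 ∷ ten → ix a ∈ ten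
      split (here q) = ⊥-elim (a∉ (here (trans (sym (proj₂ at)) (cong ρ q))))
      split (there (here q)) = ⊥-elim (a∉ (there (here (trans (sym (proj₂ at)) (cong ρ q)))))
      split (there (there h)) = h

  located₉ : ∀ a → a ∉ u ∷ v ∷ X → e ≢ a → ix a ∈ nine × ρ (ix a) ≡ a
  located₉ a a∉ e≢a = split (proj₁ (located a a∉)) , proj₂ (located a a∉)
    where
    split : ix a ∈ ten → ix a ∈ nine
    split (here q) = ⊥-elim (e≢a (trans (cong ρ (sym q)) (proj₂ (located a a∉))))
    split (there h) = h

  g : Fin n → Chain n 3
  g a = ⟦ gP (ix a) ⟧ unit

  Y : Fin n → Fin n → Chain n 3
  Y a c = ⟦ YP (ix a) (ix c) ⟧ unit

  Zg : ∀ a → a ∉ u ∷ v ∷ X → Zc (a ∷ u ∷ v ∷ X) (g a)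
  Zg a a∉ = let i∈ , q = located a a∉ in
    subst (λ b → Zc (b ∷ u ∷ v ∷ X) (g a)) q (closed (gP (ix a)) (ix a ∷ 0 ∷ 1 ∷ []) (G-distinct i∈) (G-closed i∈))

  Sg : ∀ a → a ∉ u ∷ v ∷ X → ∀ z → Zc (u ∷ v ∷ X) z → Sp (u ∷ v ∷ X) (_≡ g a) z
  Sg a a∉ = let i∈ , q = located a a∉ in gen-sp (triangle-gen (ix a) (rem (ix a) ten) (G-length i∈) (G-order i∈))

  pairs : ∀ a c → a ∉ u ∷ v ∷ X → e ≢ a → c ∉ e ∷ a ∷ u ∷ v ∷ X →
    (ix a ∈ nine × ρ (ix a) ≡ a) × (ix c ∈ nine × ρ (ix c) ≡ c) × ix c ∈ rem (ix a) nine
  pairs a c a∉ e≢a c∉ = A , C , rem-∈ {ix a} {ix c} {nine} (proj₁ C) λ q → c∉ (there (here (trans (sym (proj₂ C)) (trans (cong ρ (sym q)) (proj₂ A)))))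
    where
    A = located₉ a a∉ e≢a
    C = located₉ c (c∉ ∘ there ∘ there) (c∉ ∘ here ∘ sym)

  ZY : ∀ a c → a ∉ u ∷ v ∷ X → e ≢ a → c ∉ e ∷ a ∷ u ∷ v ∷ X → Zc (a ∷ u ∷ v ∷ X) (Y a c)
  ZY a c a∉ e≢a c∉ = let (i∈ , q) , _ , c∈ = pairs a c a∉ e≢a c∉ in
    subst (λ b → Zc (b ∷ u ∷ v ∷ X) (Y a c)) q
      (closed (YP (ix a) (ix c)) (ix a ∷ 0 ∷ 1 ∷ []) (Y-distinct i∈) (Y-closed i∈ c∈))

  lifts-ok : ∀ a c → a ∉ u ∷ v ∷ X → e ≢ a → c ∉ e ∷ a ∷ u ∷ v ∷ X →
    IsGen (e ∷ c ∷ a ∷ u ∷ v ∷ X) (ι (mk e c) (Y a c)) × (∀ c' → c' ≢ c → ι (mk e c') (Y a c) ≈ zeroC)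
  lifts-ok a c a∉ e≢a c∉ = let (i∈ , q) , (_ , q') , c∈ = pairs a c a∉ e≢a c∉ in
    subst₂ (λ a' c' → IsGen (e ∷ c' ∷ a' ∷ u ∷ v ∷ X) (ι (mk e c') (Y a c)) × (∀ c'' → c'' ≢ c' → ι (mk e c'') (Y a c) ≈ zeroC)) q q'
      (lift-gen (ix a) (ix c) (rem (ix c) (rem (ix a) nine)) (Y-length i∈ c∈) (Y-order i∈ c∈))

  SY : ∀ a c → a ∉ u ∷ v ∷ X → e ≢ a → c ∉ e ∷ a ∷ u ∷ v ∷ X → ∀ z → Zc (e ∷ c ∷ a ∷ u ∷ v ∷ X) z →
    Sp (e ∷ c ∷ a ∷ u ∷ v ∷ X) (_≡ ι (mk e c) (Y a c)) z
  SY a c a∉ e≢a c∉ = gen-sp (proj₁ (lifts-ok a c a∉ e≢a c∉))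

  OY : ∀ a c → a ∉ u ∷ v ∷ X → e ≢ a → c ∉ e ∷ a ∷ u ∷ v ∷ X → ∀ c' → c' ≢ c → ι (mk e c') (Y a c) ≈ zeroC
  OY a c a∉ e≢a c∉ = proj₂ (lifts-ok a c a∉ e≢a c∉)

  Basis : Chain n 4 → Set
  Basis c = ∃ λ p → p ∈ basis₁₂ × c ≡ ⟦ p ⟧ unit

  basis-sp : ∀ {p} → p ∈ basis₁₂ → Sp X Basis (⟦ p ⟧ unit)
  basis-sp p∈ = gen (_ , p∈ , refl)

  ⟦shift⟧ : ∀ (p : Poly k) → ⟦ shiftP p ⟧ unit ≈ Interp.⟦_⟧ (nth d vs) p unit
  ⟦shift⟧ [] τ = refl
  ⟦shift⟧ ((c , w) ∷ p) τ = cong₂ _+_ (cong (c ·_) (mono w τ)) (⟦shift⟧ p τ)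
    where
    mono : ∀ {k} (w : Mono k) → wedges (Vec.map (λ e → 3 ℕ.+ proj₁ e , 3 ℕ.+ proj₂ e) w) unit ≈ Interp.wedges (nth d vs) w unit
    mono [] τ = refl
    mono ((i , j) ∷ w) τ = resp (∧-linear (mk (nth d vs i) (nth d vs j))) (mono w) τ

  base-span : ∀ x → Zc (e ∷ u ∷ v ∷ X) x → Sp X Basis (star u e v x)
  base-span x Zx = sp-map (star-linear u e v)
      (λ b → bd-star (d3 (e∉ ∘ here ∘ sym) (u∉ ∘ here) (e∉ ∘ there ∘ here) (u∉ ∘ there) (e∉ ∘ there ∘ there) v∉)
        (bd-⊆ (∷⊆ (there (here refl)) (∷⊆ (here refl) (∷⊆ (there (there (here refl))) (there ∘ there ∘ there)))) b))
      (λ { (p , p∈ , refl) → each p (∈-++⁻ basisPolys₉ p∈) })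
      (Nine.span₉ d F₉ len (drop-size Fe full) x Zx)
    where
    e∉ = fresh-head Fe
    u∉ = fresh-head (fresh-tail Fe)
    v∉ = fresh-head (fresh-tail (fresh-tail Fe))
    each : ∀ p → (p ∈ basisPolys₉) ⊎ (p ∈ extra₉) → Sp X Basis (star u e v (Interp.⟦_⟧ (nth d vs) p unit))
    each p (inj₁ p∈) = sp≈ (≈-trans (⟦starP⟧ 0 2 1 (shiftP p) unit) (resp (star-linear u e v) (⟦shift⟧ p)))
      (basis-sp (∈-++⁺ʳ (map triG ten) (∈-++⁺ʳ (map liftL kept) (∈-map⁺ baseB p∈))))
    -- The 21 triangle products vanish here, which is why only 29 classes of M₉ survive.
    each p (inj₂ p∈) = from (∈-map⁻ (triPoly ∘ toTri) p∈)
      where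
      from : (∃ λ t → t ∈ tris₉ × p ≡ triPoly (toTri t)) → Sp X Basis (star u e v (Interp.⟦_⟧ (nth d vs) p unit))
      from (t , t∈ , refl) = bound (star-kills d Fe F₉ len (toTri t) (allᵇ-∈ triOK check-tris₉ (∈-map⁺ toTri t∈)))

  h₁₂ : tri 4 ≤ size X
  h₁₂ = ℕₚ.≤-reflexive (sym full)

  open Recursion Fe h₁₂ g Y Zg Sg ZY SY OY
  open Refine Fe h₁₂ g Y Zg Sg ZY SY OY Basis base-span using (Lift; four-cycle)

  ix-ρ : ∀ {i} → i ∈ ten → ix (ρ i) ≡ i
  ix-ρ {i} i∈ = nth-inj d (fresh-env F) (Env.uniq (fresh-env F)) (subst (ix (ρ i) ℕ.<_) (sym len₁₂) (bound₁₂ (proj₁ loc)))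
      (subst (i ℕ.<_) (sym len₁₂) (bound₁₂ i∈)) (proj₂ loc)
    where
    bound₁₂ : ∀ {j} → j ∈ ten → j ℕ.< 12
    bound₁₂ = All.lookup (from-yes (All.all? (ℕ._<? 12) ten))
    f : Fresh X (ρ i ∷ u ∷ v ∷ [])
    f = fr (i ∷ 0 ∷ 1 ∷ []) (G-distinct i∈)
    loc = located (ρ i) (fresh-head f)

  lift-eq : ∀ {a c} → a ∈ nine → c ∈ nine → star u (ρ a) v (Y (ρ a) (ρ c)) ≈ ⟦ liftL (a , c) ⟧ unit
  lift-eq {a} {c} a∈ c∈ = ≈-trans
    (resp (star-linear u (ρ a) v) (λ τ → cong₂ (λ i j → ⟦ YP i j ⟧ unit τ) (ix-ρ (there a∈)) (ix-ρ (there c∈))))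
    (≈-sym (⟦starP⟧ 0 a 1 (YP a c) unit))

  Lifted : ℕ × ℕ → Set
  Lifted p = Sp X Basis (⟦ liftL p ⟧ unit)

  -- κ is the pentagon ec, df, cg, ed, fg times a star on the h's, so c and d are its only
  -- neighbours of e. Its link at ec is (df - fg) times that star, which is the generator on f, d,
  -- g, the h's and b.
  module QuadStep (a b c d' f g' h₁ h₂ h₃ : ℕ)
    (o₁ : distinctᵇ 12 (h₁ ∷ h₂ ∷ h₃ ∷ g' ∷ d' ∷ f ∷ 2 ∷ c ∷ b ∷ a ∷ 0 ∷ 1 ∷ []) ≡ true)
    (o₂ : distinctᵇ 12 (f ∷ d' ∷ g' ∷ h₁ ∷ h₂ ∷ h₃ ∷ b ∷ 2 ∷ c ∷ a ∷ 0 ∷ 1 ∷ []) ≡ true)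
    (ca : distinctᵇ 12 (c ∷ 2 ∷ a ∷ 0 ∷ 1 ∷ []) ≡ true) (cb : distinctᵇ 12 (c ∷ 2 ∷ b ∷ 0 ∷ 1 ∷ []) ≡ true)
    (da : distinctᵇ 12 (d' ∷ 2 ∷ a ∷ 0 ∷ 1 ∷ []) ≡ true) (db : distinctᵇ 12 (d' ∷ 2 ∷ b ∷ 0 ∷ 1 ∷ []) ≡ true)
    (a∈ : a ∈ nine) (b∈ : b ∈ nine) (c∈ : c ∈ nine) (d∈ : d' ∈ nine) where

    Fca : Fresh X (ρ c ∷ e ∷ ρ a ∷ u ∷ v ∷ [])
    Fca = fr (c ∷ 2 ∷ a ∷ 0 ∷ 1 ∷ []) ca
    Fcb : Fresh X (ρ c ∷ e ∷ ρ b ∷ u ∷ v ∷ [])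
    Fcb = fr (c ∷ 2 ∷ b ∷ 0 ∷ 1 ∷ []) cb
    Fda : Fresh X (ρ d' ∷ e ∷ ρ a ∷ u ∷ v ∷ [])
    Fda = fr (d' ∷ 2 ∷ a ∷ 0 ∷ 1 ∷ []) da
    Fdb : Fresh X (ρ d' ∷ e ∷ ρ b ∷ u ∷ v ∷ [])
    Fdb = fr (d' ∷ 2 ∷ b ∷ 0 ∷ 1 ∷ []) db
    parts = fresh-++ (ρ h₁ ∷ ρ h₂ ∷ ρ h₃ ∷ []) {ρ g' ∷ ρ d' ∷ ρ f ∷ e ∷ ρ c ∷ ρ b ∷ ρ a ∷ u ∷ v ∷ []}
      (fr (h₁ ∷ h₂ ∷ h₃ ∷ g' ∷ d' ∷ f ∷ 2 ∷ c ∷ b ∷ a ∷ 0 ∷ 1 ∷ []) o₁)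
    parts' = fresh-++ (ρ g' ∷ ρ d' ∷ ρ f ∷ e ∷ ρ c ∷ []) {ρ b ∷ ρ a ∷ u ∷ v ∷ []} (proj₂ parts)
    Fp : Fresh (ρ b ∷ ρ a ∷ u ∷ v ∷ X) (ρ g' ∷ ρ d' ∷ ρ f ∷ e ∷ ρ c ∷ [])
    Fp = proj₁ parts'
    Fh : Fresh (ρ g' ∷ ρ d' ∷ ρ f ∷ e ∷ ρ c ∷ ρ b ∷ ρ a ∷ u ∷ v ∷ X) (ρ h₁ ∷ ρ h₂ ∷ ρ h₃ ∷ [])
    Fh = proj₁ parts
    y : Chain n 1
    y = star (ρ h₁) (ρ h₂) (ρ h₃) unit
    Zy : Zc (ρ g' ∷ ρ d' ∷ ρ f ∷ e ∷ ρ c ∷ ρ b ∷ ρ a ∷ u ∷ v ∷ X) y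
    Zy = zc-star (d3 (fresh-head Fh ∘ here) (fresh-head Fh ∘ there ∘ here) (fresh-head (fresh-tail Fh) ∘ here)
      (fresh-head Fh ∘ there ∘ there) (fresh-head (fresh-tail Fh) ∘ there) (fresh-head (fresh-tail (fresh-tail Fh)))) (zc ok₀ cyc₀)
    κ : Chain n 3
    κ = pent e (ρ d') (ρ c) (ρ f) (ρ g') y
    Zκ : Zc (ρ b ∷ ρ a ∷ u ∷ v ∷ X) κ
    Zκ = PentFresh.zc-pent Fp Zy
    open PentLink Fp y (ok Zy)
    S : IsGen (e ∷ ρ c ∷ ρ a ∷ u ∷ v ∷ X) (ι (mk e (ρ c)) κ)
    S = isGen-≈ (λ τ → trans (cong (λ w → (w ∧ y) τ + (- (mk (ρ f) (ρ g') ∧ y) τ)) (mk-sym (ρ f) (ρ d'))) (sym (link-at τ)))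
      (seven a c f d' g' h₁ h₂ h₃ b o₂)
    result : Lifted (a , d') → Lifted (b , c) → Lifted (b , d') → Lifted (a , c)
    result Lad Lbc Lbd = sp≈ (lift-eq a∈ c∈) (four-cycle (ρ a) (ρ b) (ρ c) (ρ d') κ
      (fresh-head (fresh-tail (fresh-tail Fca))) (fresh-head (fresh-tail Fca) ∘ here)
      (fresh-head (fresh-tail (fresh-tail Fcb))) (fresh-head (fresh-tail Fcb) ∘ here)
      (fresh-head (proj₂ parts') ∘ here)
      (fresh-head Fca) (fresh-head Fcb) (fresh-head Fda) (fresh-head Fdb)
      (fresh-head (fresh-tail Fp) ∘ there ∘ there ∘ here ∘ sym)
      Zκ (λ c' c'c c'd → link-off c' c'd c'c) (gen-sp S)
      (sp≈ (≈-sym (lift-eq a∈ d∈)) Lad) (sp≈ (≈-sym (lift-eq b∈ c∈)) Lbc) (sp≈ (≈-sym (lift-eq b∈ d∈)) Lbd))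

  quad-step : ∀ a b c d is → All (_≡ true) (quadTests ((a , b) , (c , d)) is) →
    Lifted (a , d) → Lifted (b , c) → Lifted (b , d) → Lifted (a , c)
  quad-step a b c d' (f ∷ g' ∷ h₁ ∷ h₂ ∷ h₃ ∷ []) (o₁ ∷ o₂ ∷ ca ∷ cb ∷ da ∷ db ∷ a∈ ∷ b∈ ∷ c∈ ∷ d∈ ∷ []) =
    QuadStep.result a b c d' f g' h₁ h₂ h₃ o₁ o₂ ca cb da db (elem-true a∈) (elem-true b∈) (elem-true c∈) (elem-true d∈)
  quad-step a b c d' [] (() ∷ _)
  quad-step a b c d' (_ ∷ []) (() ∷ _)
  quad-step a b c d' (_ ∷ _ ∷ []) (() ∷ _)
  quad-step a b c d' (_ ∷ _ ∷ _ ∷ []) (() ∷ _)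
  quad-step a b c d' (_ ∷ _ ∷ _ ∷ _ ∷ []) (() ∷ _)
  quad-step a b c d' (_ ∷ _ ∷ _ ∷ _ ∷ _ ∷ _ ∷ _) (() ∷ _)

  one-step : ∀ a b c d is {known} → (∀ p → p ∈ known → Lifted p) →
    All (_≡ true) (conj (quadTests ((a , b) , (c , d)) is) ∷ memᵇ a d known ∷ memᵇ b c known ∷ memᵇ b d known ∷ []) → Lifted (a , c)
  one-step a b c d' is K (ok ∷ m₁ ∷ m₂ ∷ m₃ ∷ []) = quad-step a b c d' is (conj-all (quadTests ((a , b) , (c , d')) is) ok)
    (K _ (memᵇ-∈ m₁)) (K _ (memᵇ-∈ m₂)) (K _ (memᵇ-∈ m₃))

  close-lifted : ∀ qs {known} → (∀ p → p ∈ known → Lifted p) → ∀ p → p ∈ close known qs → Lifted p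
  close-lifted [] K = K
  close-lifted (((a , b) , (c , d')) ∷ qs) {known} K = close-lifted qs (extend (conj (stepTests q known)) refl)
    where
    q : Quad
    q = (a , b) , (c , d')
    extend : ∀ t → conj (stepTests q known) ≡ t → ∀ p → p ∈ (if t then (a , c) ∷ known else known) → Lifted p
    extend false _ = K
    extend true h p (there p∈) = K p p∈
    extend true h .(a , c) (here refl) = one-step a b c d' (leftover q) K (conj-all (stepTests q known) h)

  kept-lifted : ∀ p → p ∈ kept → Lifted p
  kept-lifted p p∈ = basis-sp (∈-++⁺ʳ (map triG ten) (∈-++⁺ˡ (∈-map⁺ liftL p∈)))

  opaque
    unfolding saturated

    saturated-lifted : ∀ p → p ∈ saturated → Lifted p
    saturated-lifted = close-lifted quads {kept} kept-lifted

  all-lifted : ∀ a c → a ∈ nine → c ∈ rem a nine → Lifted (a , c)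
  all-lifted a c a∈ c∈ = saturated-lifted (a , c) (memᵇ-∈ {a} {c} {saturated} (saturated-pairs a∈ c∈))

  triangle-in : ∀ {i} → i ∈ ten → Sp X Basis (⟦ triG i ⟧ unit)
  triangle-in i∈ = basis-sp (∈-++⁺ˡ (∈-map⁺ triG i∈))

  triangle-eq : ∀ i → ⟦ triG i ⟧ unit ≈ tr u v (ρ i) (⟦ gP i ⟧ unit)
  triangle-eq i = ⟦triP⟧ ρ 0 1 i (gP i) unit

  triangle-span : ∀ a → a ∉ u ∷ v ∷ X → Sp X Basis (tr u v a (g a))
  triangle-span a a∉ = subst (λ b → Sp X Basis (tr u v b (g a))) (proj₂ (located a a∉))
    (sp≈ (triangle-eq (ix a)) (triangle-in (proj₁ (located a a∉))))

  lift-span : ∀ a c → a ∉ u ∷ v ∷ X → e ≢ a → c ∉ e ∷ a ∷ u ∷ v ∷ X → Sp X Basis (star u a v (Y a c))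
  lift-span a c a∉ e≢a c∉ = from (pairs a c a∉ e≢a c∉)
    where
    shape : ∀ i j → ⟦ liftL (i , j) ⟧ unit ≈ star u (ρ i) v (⟦ YP i j ⟧ unit)
    shape i j = ⟦starP⟧ 0 i 1 (YP i j) unit
    from : (ix a ∈ nine × ρ (ix a) ≡ a) × (ix c ∈ nine × ρ (ix c) ≡ c) × ix c ∈ rem (ix a) nine → Sp X Basis (star u a v (Y a c))
    from ((a∈ , q) , _ , c∈) = subst (λ b → Sp X Basis (star u b v (Y a c))) q
      (sp≈ (shape (ix a) (ix c)) (all-lifted (ix a) (ix c) a∈ c∈))

  span₁₂ : ∀ z → Zc X z → Sp X Basis z
  span₁₂ z Z = sp-bind id each (recursion z Z)
    where
    each : ∀ {c} → TGen c → Sp X Basis c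
    each (base x Zx) = base-span x Zx
    each (triangles a a∉) = triangle-span a a∉
    each (lifts a c a∉ e≢a c∉) = lift-span a c a∉ e≢a c∉

-- Functionals on chains

-- A cochain stored by its simplices, with terms grouped by common leading edges; the edges along a
-- branch are contracted one after another.
data Trie : ℕ → Set where
  leaf : F3 → Trie 0
  node : List (FEdge × Trie k) → Trie (suc k)

evalT : Trie k → (Mono k → F3) → F3
evalTs : List (FEdge × Trie k) → (Mono (suc k) → F3) → F3
evalT (leaf c) I = c · I []
evalT (node ts) I = evalTs ts I
evalTs [] I = 0₃
evalTs ((f , t) ∷ ts) I = evalT t (λ w → I (f ∷ w)) + evalTs ts I

flatten : Trie k → Poly k
flattens : List (FEdge × Trie k) → Poly (suc k)
flatten (leaf c) = (c , []) ∷ []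
flatten (node ts) = flattens ts
flattens [] = []
flattens ((f , t) ∷ ts) = mulE f (flatten t) ++ flattens ts

eval-mulE : ∀ (I : Mono (suc k) → F3) f p → evalP I (mulE f p) ≡ evalP (λ w → I (f ∷ w)) p
eval-mulE I f [] = refl
eval-mulE I f ((c , w) ∷ p) = cong (c · I (f ∷ w) +_) (eval-mulE I f p)

eval-flatten : ∀ (t : Trie k) I → evalP I (flatten t) ≡ evalT t I
eval-flattens : ∀ (ts : List (FEdge × Trie k)) I → evalP I (flattens ts) ≡ evalTs ts I
eval-flatten (leaf c) I = +-identityʳ _
eval-flatten (node ts) I = eval-flattens ts I
eval-flattens [] I = refl
eval-flattens ((f , t) ∷ ts) I = trans (eval-++ I (mulE f (flatten t)) (flattens ts))
  (cong₂ _+_ (trans (eval-mulE I f (flatten t)) (eval-flatten t _)) (eval-flattens ts I))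

evalT-cong : ∀ (t : Trie k) {I J} → (∀ w → I w ≡ J w) → evalT t I ≡ evalT t J
evalTs-cong : ∀ (ts : List (FEdge × Trie k)) {I J} → (∀ w → I w ≡ J w) → evalTs ts I ≡ evalTs ts J
evalT-cong (leaf c) h = cong (c ·_) (h [])
evalT-cong (node ts) h = evalTs-cong ts h
evalTs-cong [] h = refl
evalTs-cong ((f , t) ∷ ts) h = cong₂ _+_ (evalT-cong t (λ w → h (f ∷ w))) (evalTs-cong ts h)

evalT-+ : ∀ (t : Trie k) I J → evalT t (λ w → I w + J w) ≡ evalT t I + evalT t J
evalTs-+ : ∀ (ts : List (FEdge × Trie k)) I J → evalTs ts (λ w → I w + J w) ≡ evalTs ts I + evalTs ts J
evalT-+ (leaf c) I J = ·-+ c _ _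
evalT-+ (node ts) I J = evalTs-+ ts I J
evalTs-+ [] I J = sym (+-identityˡ 0₃)
evalTs-+ ((f , t) ∷ ts) I J = trans (cong₂ _+_ (evalT-+ t _ _) (evalTs-+ ts I J)) (+-interchange (evalT t _) _ _ _)

evalT-neg : ∀ (t : Trie k) I → evalT t (λ w → - I w) ≡ - evalT t I
evalTs-neg : ∀ (ts : List (FEdge × Trie k)) I → evalTs ts (λ w → - I w) ≡ - evalTs ts I
evalT-neg (leaf c) I = sym (neg-· c _)
evalT-neg (node ts) I = evalTs-neg ts I
evalTs-neg [] I = sym neg-0
evalTs-neg ((f , t) ∷ ts) I = trans (cong₂ _+_ (evalT-neg t _) (evalTs-neg ts I)) (sym (neg-distrib _ _))

evalT-0 : ∀ (t : Trie k) → evalT t (λ w → 0₃) ≡ 0₃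
evalTs-0 : ∀ (ts : List (FEdge × Trie k)) → evalTs ts (λ w → 0₃) ≡ 0₃
evalT-0 (leaf c) = ·-0 c
evalT-0 (node ts) = evalTs-0 ts
evalTs-0 [] = refl
evalTs-0 ((f , t) ∷ ts) = trans (cong₂ _+_ (evalT-0 t) (evalTs-0 ts)) (+-identityˡ 0₃)

evalT-scale : ∀ (t : Trie k) c I → evalT t (λ w → c · I w) ≡ c · evalT t I
evalT-scale t #0 I = evalT-0 t
evalT-scale t #1 I = refl
evalT-scale t #2 I = evalT-neg t I

sameE : FEdge → FEdge → Bool
sameE (a , b) (c , d) = (a ≡ᵇ c) && (b ≡ᵇ d)

group : Poly (suc k) → List (FEdge × Poly k)
group [] = []
group ((c , f ∷ w) ∷ p) = add-term (group p)
  where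
  add-term : List (FEdge × Poly _) → List (FEdge × Poly _)
  add-term [] = (f , (c , w) ∷ []) ∷ []
  add-term ((g , q) ∷ gs) = if sameE f g then (g , (c , w) ∷ q) ∷ gs else (f , (c , w) ∷ []) ∷ (g , q) ∷ gs

build : ∀ k → Poly k → Trie k
build zero [] = leaf #0
build zero ((c , _) ∷ _) = leaf c
build (suc k) p = node (map (λ t → proj₁ t , build k (proj₂ t)) (group p))

relabel : List ℕ → Trie k → Trie k
relabels : List ℕ → List (FEdge × Trie k) → List (FEdge × Trie k)
relabel ps (leaf c) = leaf c
relabel ps (node ts) = node (relabels ps ts)
relabels ps [] = []
relabels ps (((i , j) , t) ∷ ts) = (fedge (nth 0 ps i) (nth 0 ps j) , relabel ps t) ∷ relabels ps ts

edgesOn : List ℕ → List FEdge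
edgesOn [] = []
edgesOn (i ∷ is) = map (i ,_) is ++ edgesOn is

meetsᵇ : FEdge → Mono k → Bool
meetsᵇ e [] = false
meetsᵇ e@(i , j) ((p , q) ∷ w) = if (i ≡ᵇ p) then true else if (i ≡ᵇ q) then true else if (j ≡ᵇ p) then true else
  if (j ≡ᵇ q) then true else meetsᵇ e w

cofacesM : F3 → Mono k → List FEdge → Poly (suc k)
cofacesM c w [] = []
cofacesM c w (f ∷ fs) = if meetsᵇ f w then cofacesM c w fs else (c , f ∷ w) ∷ cofacesM c w fs

cofaces : List FEdge → Poly k → Poly (suc k)
cofaces fs [] = []
cofaces fs ((c , w) ∷ p) = cofacesM c w fs ++ cofaces fs p

-- The formal coboundary over all edges of the complete graph, compared with zero in normal form.
-- Cofaces that are not matchings are dropped, since chains vanish on them.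
isCocycle : ℕ → Trie k → Bool
isCocycle K t = isNil (nf (cofaces (edgesOn (List.upTo K)) (flatten t)))

sumL : {A : Set} → (A → F3) → List A → F3
sumL f [] = 0₃
sumL f (x ∷ xs) = f x + sumL f xs

sumL-++ : ∀ {A : Set} (f : A → F3) xs ys → sumL f (xs ++ ys) ≡ sumL f xs + sumL f ys
sumL-++ f [] ys = sym (+-identityˡ _)
sumL-++ f (x ∷ xs) ys = trans (cong (f x +_) (sumL-++ f xs ys)) (sym (+-assoc _ _ _))

sumL-map : ∀ {A B : Set} (f : B → F3) (g : A → B) xs → sumL f (map g xs) ≡ sumL (f ∘ g) xs
sumL-map f g [] = refl
sumL-map f g (x ∷ xs) = cong (f (g x) +_) (sumL-map f g xs)

sumL-cong : ∀ {A : Set} {f g : A → F3} xs → (∀ x → x ∈ xs → f x ≡ g x) → sumL f xs ≡ sumL g xs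
sumL-cong [] h = refl
sumL-cong (x ∷ xs) h = cong₂ _+_ (h x (here refl)) (sumL-cong xs (λ y y∈ → h y (there y∈)))

sumL-+ : ∀ {A : Set} (f g : A → F3) xs → sumL (λ x → f x + g x) xs ≡ sumL f xs + sumL g xs
sumL-+ f g [] = sym (+-identityˡ 0₃)
sumL-+ f g (x ∷ xs) = trans (cong ((f x + g x) +_) (sumL-+ f g xs)) (+-interchange (f x) _ _ _)

sum-fresh : ∀ {X vs : List (Fin n)} → Fresh X vs → size X ≡ length vs → (f : Fin n → F3) → (∀ x → x ∈ X → f x ≡ 0₃) →
  sum n f ≡ sumL f vs
sum-fresh {n} {X} {vs} F full f h = peel vs F f (λ x x∉ → h x (out x x∉))
  where
  out : ∀ x → x ∉ vs → x ∈ X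
  out x x∉ = [ (λ i → ⊥-elim (x∉ i)) , id ]′ (∈-++⁻ vs (size-0 (vs ++ X)
    (ℕₚ.+-cancelˡ-≡ (length vs) _ _ (trans (sym (fresh-size F)) (trans full (sym (ℕₚ.+-identityʳ _))))) x))
  peel : ∀ ws → Fresh X ws → (f : Fin n → F3) → (∀ x → x ∉ ws → f x ≡ 0₃) → sum n f ≡ sumL f ws
  peel [] _ f z = sum-0 n (λ x → z x λ ())
  peel (w ∷ ws) (w∉ ∷ F) f z = begin
    sum n f ≡⟨ sum-cong n (λ x → split x (x Finₚ.≟ w)) ⟩
    sum n (λ x → sel (x Finₚ.≟ w) (f w) + f' x (x Finₚ.≟ w)) ≡⟨ sum-+ n _ _ ⟩
    sum n (λ x → sel (x Finₚ.≟ w) (f w)) + sum n (λ x → f' x (x Finₚ.≟ w))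
      ≡⟨ cong₂ _+_ (trans (sum-single n w λ x ne → sel-no (x Finₚ.≟ w) ne _) (sel-yes (w Finₚ.≟ w) refl _))
           (trans (peel ws F (λ x → f' x (x Finₚ.≟ w)) (λ x x∉ → zero' x x∉ (x Finₚ.≟ w)))
             (sumL-cong ws λ x x∈ → same x x∈ (x Finₚ.≟ w))) ⟩
    f w + sumL f ws ∎
    where
    open ≡-Reasoning
    f' : ∀ x → Dec (x ≡ w) → F3
    f' x (yes _) = 0₃
    f' x (no _) = f x
    split : ∀ x (q : Dec (x ≡ w)) → f x ≡ sel q (f w) + f' x q
    split x (yes refl) = sym (+-identityʳ _)
    split x (no _) = sym (+-identityˡ _)
    zero' : ∀ x → x ∉ ws → (q : Dec (x ≡ w)) → f' x q ≡ 0₃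
    zero' x x∉ (yes _) = refl
    zero' x x∉ (no ne) = z x (∉-∷ ne x∉)
    same : ∀ x → x ∈ ws → (q : Dec (x ≡ w)) → f' x q ≡ f x
    same x x∈ (yes refl) = ⊥-elim (w∉ (∈-++⁺ˡ x∈))
    same x x∈ (no _) = refl

map-nth : ∀ {A : Set} (d : A) xs → map (nth d xs) (List.upTo (length xs)) ≡ xs
map-nth d [] = refl
map-nth d (x ∷ xs) = cong (x ∷_) (trans (Listₚ.map-applyUpTo suc (nth d (x ∷ xs)) (length xs))
  (trans (sym (Listₚ.map-applyUpTo id (nth d xs) (length xs))) (map-nth d xs)))

opaque
  unfolding mk

  mk-sum : ∀ {X} {c : Chain n (suc m)} → Ok X c → ∀ x y → x ≢ y → ∀ τ → c ((x , y) ∷ τ) + c ((y , x) ∷ τ) ≡ c (mk x y ∷ τ)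
  mk-sum {c = c} o x y x≢y τ with x Finₚ.<? y
  ... | yes x<y = trans (cong (c ((x , y) ∷ τ) +_) (ok-bad o (y , x) (λ g → ℕₚ.<-asym x<y (proj₁ g)) τ)) (+-identityʳ _)
  ... | no nlt = trans (cong (_+ c ((y , x) ∷ τ)) (ok-bad o (x , y) (nlt ∘ proj₁) τ)) (+-identityˡ _)

pairSum : (Fin n → Fin n → F3) → List (Fin n) → F3
pairSum f [] = 0₃
pairSum f (x ∷ xs) = sumL (f x) xs + pairSum f xs

-- The diagonal vanishes and the two orders of each pair are added together; applied to a chain, at
-- most one of the two orders is an edge.
square : ∀ (F G : Fin n → Fin n → F3) {xs} → AllPairs _≢_ xs → (∀ x → F x x ≡ 0₃) → (∀ x y → x ≢ y → F x y + F y x ≡ G x y) →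
  sumL (λ x → sumL (F x) xs) xs ≡ pairSum G xs
square F G [] d h = refl
square F G {x ∷ xs} (x∉ ∷ u) d h = begin
  (F x x + sumL (F x) xs) + sumL (λ y → F y x + sumL (F y) xs) xs
    ≡⟨ cong₂ _+_ (trans (cong (_+ sumL (F x) xs) (d x)) (+-identityˡ _)) (sumL-+ (λ y → F y x) (λ y → sumL (F y) xs) xs) ⟩
  sumL (F x) xs + (sumL (λ y → F y x) xs + sumL (λ y → sumL (F y) xs) xs)
    ≡⟨ sym (+-assoc _ _ _) ⟩
  (sumL (F x) xs + sumL (λ y → F y x) xs) + sumL (λ y → sumL (F y) xs) xs
    ≡⟨ cong₂ _+_ (trans (sym (sumL-+ (F x) (λ y → F y x) xs)) (sumL-cong xs λ y y∈ → h x y (All.lookup x∉ y∈))) (square F G u d h) ⟩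
  sumL (G x) xs + pairSum G xs ∎
  where open ≡-Reasoning

opaque
  unfolding _+_ -_

  plus-+ : ∀ a b → plus a b ≡ a + b
  plus-+ #0 b = sym (+-identityˡ b)
  plus-+ #1 #0 = refl
  plus-+ #1 #1 = refl
  plus-+ #1 #2 = refl
  plus-+ #2 #0 = refl
  plus-+ #2 #1 = refl
  plus-+ #2 #2 = refl

  times-≡ : ∀ a b → times a b ≡ a · b
  times-≡ #0 b = refl
  times-≡ #1 b = refl
  times-≡ #2 #0 = refl
  times-≡ #2 #1 = refl
  times-≡ #2 #2 = refl

  ·-one : ∀ a → a · #1 ≡ a
  ·-one #0 = refl
  ·-one #1 = refl
  ·-one #2 = refl

  ·-comm : ∀ a b → a · b ≡ b · a
  ·-comm #0 #0 = refl
  ·-comm #0 #1 = refl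
  ·-comm #0 #2 = refl
  ·-comm #1 #0 = refl
  ·-comm #1 #1 = refl
  ·-comm #1 #2 = refl
  ·-comm #2 #0 = refl
  ·-comm #2 #1 = refl
  ·-comm #2 #2 = refl

contractM : FEdge → Mono (suc k) → Poly k
contractM f (e ∷ []) = if sameE e f then oneP else []
contractM f (e ∷ e' ∷ w) = (if sameE e f then (#1 , e' ∷ w) ∷ [] else []) ++ scaleP #2 (mulE e (contractM f (e' ∷ w)))

contract : FEdge → Poly (suc k) → Poly k
contract f [] = []
contract f ((c , w) ∷ p) = scaleP c (contractM f w) ++ contract f p

coefSum : Poly 0 → F3
coefSum [] = #0
coefSum ((c , _) ∷ p) = plus c (coefSum p)

-- Contracts the polynomial along the branches, so a common prefix is contracted only once. `pairNE`
-- abandons a branch as soon as nothing is left to contract.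
pairT : Trie k → Poly k → F3
pairTs : List (FEdge × Trie k) → Poly (suc k) → F3
pairNE : Trie k → Poly k → F3
pairT (leaf c) p = times c (coefSum p)
pairT (node ts) p = pairTs ts p
pairTs [] p = #0
pairTs ((f , t) ∷ ts) p = plus (pairNE t (contract f p)) (pairTs ts p)
pairNE t [] = #0
pairNE t p@(_ ∷ _) = pairT t p

normE : ℕ → FEdge → Bool
normE K (i , j) = (i <ᵇ j) && (j <ᵇ K)

normM : ℕ → Mono k → Bool
normM K [] = true
normM K (e ∷ w) = normE K e && normM K w

normP : ℕ → Poly k → Bool
normP K [] = true
normP K ((_ , w) ∷ p) = normM K w && normP K p

normT : ℕ → Trie k → Bool
normTs : ℕ → List (FEdge × Trie k) → Bool
normT K (leaf c) = true
normT K (node ts) = normTs K ts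
normTs K [] = true
normTs K ((f , t) ∷ ts) = normE K f && (normT K t && normTs K ts)

NormP : ℕ → Poly k → Set
NormP K p = All (λ t → normM K (proj₂ t) ≡ true) p

normP-all : ∀ {K} (p : Poly k) → normP K p ≡ true → NormP K p
normP-all [] h = []
normP-all {K = K} ((c , w) ∷ p) h = proj₁ (&&-split h) ∷ normP-all p (proj₂ (&&-split {a = normM K w} h))

scaleP-all : ∀ {K} a {p : Poly k} → NormP K p → NormP K (scaleP a p)
scaleP-all a [] = []
scaleP-all a (h ∷ hs) = h ∷ scaleP-all a hs

mulE-all : ∀ {K e} {p : Poly k} → normE K e ≡ true → NormP K p → NormP K (mulE e p)
mulE-all h [] = []
mulE-all {K = K} {e} h (x ∷ hs) = cong₂ _&&_ h x ∷ mulE-all h hs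

contractM-norm : ∀ {K} f (w : Mono (suc k)) → normM K w ≡ true → NormP K (contractM f w)
contractM-norm f (e ∷ []) h with sameE e f
... | true = refl ∷ []
... | false = []
contractM-norm {K = K} f (e ∷ e' ∷ w) h = ++⁺ (first (sameE e f))
    (scaleP-all #2 (mulE-all (proj₁ (&&-split h)) (contractM-norm f (e' ∷ w) (proj₂ (&&-split {a = normE K e} h)))))
  where
  first : ∀ b → NormP K (if b then (#1 , e' ∷ w) ∷ [] else [])
  first true = proj₂ (&&-split {a = normE K e} h) ∷ []
  first false = []

contract-norm : ∀ {K} f (p : Poly (suc k)) → NormP K p → NormP K (contract f p)
contract-norm f [] [] = []
contract-norm f ((c , w) ∷ p) (h ∷ hs) = ++⁺ (scaleP-all c (contractM-norm f w h)) (contract-norm f p hs)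

sameE-true : ∀ e f → sameE e f ≡ true → e ≡ f
sameE-true (a , b) (c , d) h = cong₂ _,_ (ℕₚ.≡ᵇ⇒≡ a c (subst T (sym (proj₁ (&&-split h))) tt))
  (ℕₚ.≡ᵇ⇒≡ b d (subst T (sym (proj₂ (&&-split {a = a ≡ᵇ c} h))) tt))

sameE-refl : ∀ e → sameE e e ≡ true
sameE-refl (a , b) = cong₂ _&&_ (≡ᵇ-refl a) (≡ᵇ-refl b)

module Functionals {n} {X : List (Fin n)} (d : Fin n) {vs : List (Fin n)} (F : Fresh X vs) where
  private
    E = fresh-env F
    ρ = nth d vs
  open Interp ρ

  Φ : Trie k → Chain n k → F3
  Φ t c = evalT t (λ w → c (Vec.map edge w))

  alt : ∀ {X} {c : Chain n k} → Ok X c → AltM (λ w → c (Vec.map edge w))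
  alt {zero} o = tt
  alt {suc zero} o = tt
  alt {suc (suc k)} o = (λ e f w → ok-alt o (edge e) (edge f) (Vec.map edge w)) , λ e → alt (ok-ι o (edge e))

  meets-zero : ∀ {Y i j} {c : Chain n k} → Ok Y c → ρ i ∈ Y → ρ j ∈ Y → ∀ w → meetsᵇ (i , j) w ≡ true → c (Vec.map edge w) ≡ 0₃
  meets-zero {suc k} {Y} {i} {j} {c} o i∈ j∈ ((p , q) ∷ w) h = go _ refl _ refl _ refl _ refl h
    where
    bad : ρ p ∈ Y ⊎ ρ q ∈ Y → c (edge (p , q) ∷ Vec.map edge w) ≡ 0₃
    bad (inj₁ m) = ok-bad o (edge (p , q)) (λ g → good-mk⁻ (ρ p) (ρ q) g .proj₂ .proj₁ m) (Vec.map edge w)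
    bad (inj₂ m) = ok-bad o (edge (p , q)) (λ g → good-mk⁻ (ρ p) (ρ q) g .proj₂ .proj₂ m) (Vec.map edge w)
    eqℕ : ∀ {a b} → (a ≡ᵇ b) ≡ true → a ≡ b
    eqℕ {a} {b} e = ℕₚ.≡ᵇ⇒≡ a b (subst T (sym e) tt)
    go : ∀ b₁ → (i ≡ᵇ p) ≡ b₁ → ∀ b₂ → (i ≡ᵇ q) ≡ b₂ → ∀ b₃ → (j ≡ᵇ p) ≡ b₃ → ∀ b₄ → (j ≡ᵇ q) ≡ b₄ →
      (if b₁ then true else if b₂ then true else if b₃ then true else if b₄ then true else meetsᵇ (i , j) w) ≡ true →
      c (edge (p , q) ∷ Vec.map edge w) ≡ 0₃
    go true e _ _ _ _ _ _ _ = bad (inj₁ (subst (λ x → ρ x ∈ Y) (eqℕ e) i∈))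
    go false _ true e _ _ _ _ _ = bad (inj₂ (subst (λ x → ρ x ∈ Y) (eqℕ e) i∈))
    go false _ false _ true e _ _ _ = bad (inj₁ (subst (λ x → ρ x ∈ Y) (eqℕ e) j∈))
    go false _ false _ false _ true e _ = bad (inj₂ (subst (λ x → ρ x ∈ Y) (eqℕ e) j∈))
    go false _ false _ false _ false _ h = meets-zero (ok-ι o (edge (p , q))) (there (there i∈)) (there (there j∈)) w h

  module _ (full : size X ≡ length vs) where

    -- Only edges between listed vertices contribute, because the list exhausts the complement of X.
    -- This matches the boundary over all pairs in `Fin n` with the finite coboundary computation.
    ∂-formal : ∀ {b : Chain n (suc k)} → Ok X b → ∀ τ → ∂ b τ ≡ sumL (λ f → b (edge f ∷ τ)) (edgesOn (List.upTo (length vs)))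
    ∂-formal {b = b} o τ = begin
      sumP n (λ w → b (w ∷ τ)) ≡⟨ sumP-def n _ ⟩
      sum n (λ i → sum n λ j → b ((i , j) ∷ τ))
        ≡⟨ sum-fresh F full _ (λ i i∈ → sum-0 n λ j → ok-bad o (i , j) (λ g → g .proj₂ .proj₁ i∈) τ) ⟩
      sumL (λ i → sum n λ j → b ((i , j) ∷ τ)) vs
        ≡⟨ sumL-cong vs (λ i _ → sum-fresh F full _ λ j j∈ → ok-bad o (i , j) (λ g → g .proj₂ .proj₂ j∈) τ) ⟩
      sumL (λ i → sumL (λ j → b ((i , j) ∷ τ)) vs) vs
        ≡⟨ square (λ i j → b ((i , j) ∷ τ)) (λ i j → b (mk i j ∷ τ)) (Env.uniq E)
             (λ x → ok-bad o (x , x) (λ g → ℕₚ.<-irrefl refl (proj₁ g)) τ) (λ x y ne → mk-sum o x y ne τ) ⟩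
      pairSum (λ i j → b (mk i j ∷ τ)) vs ≡⟨ cong (pairSum _) (sym (map-nth d vs)) ⟩
      pairSum (λ i j → b (mk i j ∷ τ)) (map ρ (List.upTo (length vs))) ≡⟨ pairs-formal (List.upTo (length vs)) ⟩
      sumL (λ f → b (edge f ∷ τ)) (edgesOn (List.upTo (length vs))) ∎
      where
      open ≡-Reasoning
      pairs-formal : ∀ is → pairSum (λ i j → b (mk i j ∷ τ)) (map ρ is) ≡ sumL (λ f → b (edge f ∷ τ)) (edgesOn is)
      pairs-formal [] = refl
      pairs-formal (i ∷ is) = sym (trans (sumL-++ _ (map (i ,_) is) (edgesOn is)) (cong₂ _+_
        (trans (sumL-map _ (i ,_) is) (sym (sumL-map _ ρ is))) (sym (pairs-formal is))))

    -- Transposition: evaluating t on ∂b is evaluating its coboundary on b. Since b is alternating,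
    -- the formal cancellation in the coboundary applies to its values.
    cocycle-∂ : ∀ (t : Trie k) → isCocycle (length vs) t ≡ true → ∀ {b : Chain n (suc k)} → Ok X b → Φ t (∂ b) ≡ 0₃
    cocycle-∂ t h {b} o = trans (sym (eval-flatten t _)) (trans (go (flatten t)) (nf-zero (λ w → b (Vec.map edge w)) (alt o) (cofaces (edgesOn (List.upTo (length vs))) (flatten t)) h))
      where
      fs = edgesOn (List.upTo (length vs))
      one : ∀ c (w : Mono _) fs → evalP (λ w → b (Vec.map edge w)) (cofacesM c w fs) ≡ c · sumL (λ f → b (edge f ∷ Vec.map edge w)) fs
      one c w [] = sym (·-0 c)
      one c w (f@(i , j) ∷ fs) = trans (step (meetsᵇ f w) refl) (sym (·-+ c _ _))
        where
        step : ∀ t → meetsᵇ f w ≡ t → evalP (λ w → b (Vec.map edge w)) (if t then cofacesM c w fs else (c , f ∷ w) ∷ cofacesM c w fs) ≡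
          c · b (edge f ∷ Vec.map edge w) + c · sumL (λ f → b (edge f ∷ Vec.map edge w)) fs
        step false _ = cong (c · b (edge f ∷ Vec.map edge w) +_) (one c w fs)
        step true e = trans (one c w fs) (sym (trans (cong (_+ c · sumL (λ f → b (edge f ∷ Vec.map edge w)) fs)
          (trans (cong (c ·_) (meets-zero (ok-ι o (edge f)) (ends-mk⁻ (ρ i) (ρ j) X (here refl)) (ends-mk⁻ (ρ i) (ρ j) X (there (here refl))) w e)) (·-0 c)))
          (+-identityˡ _)))
      go : ∀ p → evalP (λ w → ∂ b (Vec.map edge w)) p ≡ evalP (λ w → b (Vec.map edge w)) (cofaces fs p)
      go [] = refl
      go ((c , w) ∷ p) = sym (trans (eval-++ _ (cofacesM c w fs) (cofaces fs p))
        (cong₂ _+_ (trans (one c w fs) (cong (c ·_) (sym (∂-formal o (Vec.map edge w))))) (sym (go p))))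

  wedges₀ : Mono k → Chain n k
  wedges₀ [] = unit
  wedges₀ (e ∷ w) = edge e ∧ wedges₀ w

  ⟦_⟧₀ : Poly k → Chain n k
  ⟦ p ⟧₀ τ = evalP (λ w → wedges₀ w τ) p

  ⟦mulE⟧₀ : ∀ e (p : Poly k) → ⟦ mulE e p ⟧₀ ≈ (edge e ∧ ⟦ p ⟧₀)
  ⟦mulE⟧₀ e [] τ = sym (zer (∧-linear (edge e)) τ)
  ⟦mulE⟧₀ e ((c , w) ∷ p) τ = sym (trans (add (∧-linear (edge e)) (c ·C wedges₀ w) ⟦ p ⟧₀ τ)
    (cong₂ _+_ (·-lin (∧-linear (edge e)) c (wedges₀ w) τ) (sym (⟦mulE⟧₀ e p τ))))

  -- Equal edges have the same ends, and positions are determined by their vertices; increasing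
  -- order then excludes the crossed identification.
  edge-inj : ∀ {e f} → normE (length vs) e ≡ true → normE (length vs) f ≡ true → edge e ≡ edge f → e ≡ f
  edge-inj {i , j} {k , l} he hf eq′ = conclude (inside i j k l i< j< k< l< eq′) (inside k l i j k< l< i< j< (sym eq′))
    where
    j< = <ᵇ-true {j} (proj₂ (&&-split {a = i <ᵇ j} he))
    ij = <ᵇ-true {i} (proj₁ (&&-split he))
    i< = ℕₚ.<-trans ij j<
    l< = <ᵇ-true {l} (proj₂ (&&-split {a = k <ᵇ l} hf))
    kl = <ᵇ-true {k} (proj₁ (&&-split hf))
    k< = ℕₚ.<-trans kl l<
    inside : ∀ i j k l → i ℕ.< length vs → j ℕ.< length vs → k ℕ.< length vs → l ℕ.< length vs → edge (i , j) ≡ edge (k , l) →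
      (i ≡ k ⊎ i ≡ l) × (j ≡ k ⊎ j ≡ l)
    inside i j k l i< j< k< l< q = find i< (subst (λ w → ρ i ∈ ends w []) q (ends-mk⁻ (ρ i) (ρ j) [] (here refl))) ,
      find j< (subst (λ w → ρ j ∈ ends w []) q (ends-mk⁻ (ρ i) (ρ j) [] (there (here refl))))
      where
      find : ∀ {x} → x ℕ.< length vs → ρ x ∈ ends (edge (k , l)) [] → x ≡ k ⊎ x ≡ l
      find x< m with ends-mk⁺ (ρ k) (ρ l) [] m
      ... | here q = inj₁ (nth-inj d E (Env.uniq E) x< k< q)
      ... | there (here q) = inj₂ (nth-inj d E (Env.uniq E) x< l< q)
    conclude : (i ≡ k ⊎ i ≡ l) × (j ≡ k ⊎ j ≡ l) → (k ≡ i ⊎ k ≡ j) × (l ≡ i ⊎ l ≡ j) → (i , j) ≡ (k , l)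
    conclude (inj₁ refl , inj₂ refl) _ = refl
    conclude (inj₁ refl , inj₁ refl) _ = ⊥-elim (ℕₚ.<-irrefl refl ij)
    conclude (inj₂ refl , inj₂ refl) _ = ⊥-elim (ℕₚ.<-irrefl refl ij)
    conclude (inj₂ refl , inj₁ refl) _ = ⊥-elim (ℕₚ.<-asym ij kl)

  sel-same : ∀ e f → normE (length vs) e ≡ true → normE (length vs) f ≡ true → ∀ x → sel (edge e ≟P edge f) x ≡ (if sameE e f then x else 0₃)
  sel-same e f he hf x = go (sameE e f) refl
    where
    go : ∀ b → sameE e f ≡ b → sel (edge e ≟P edge f) x ≡ (if b then x else 0₃)
    go true q = sel-yes (edge e ≟P edge f) (cong edge (sameE-true e f q)) x
    go false q = sel-no (edge e ≟P edge f) (λ h → contra (edge-inj {e} {f} he hf h)) x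
      where
      contra : e ≡ f → ⊥
      contra refl with trans (sym q) (sameE-refl e)
      ... | ()

  ⟦contractM⟧ : ∀ f (w : Mono (suc k)) → normE (length vs) f ≡ true → normM (length vs) w ≡ true → ι (edge f) (wedges₀ w) ≈ ⟦ contractM f w ⟧₀
  ⟦contractM⟧ f (e ∷ []) hf hw [] = trans (sel-same e f (proj₁ (&&-split hw)) hf #1) (go (sameE e f))
    where
    go : ∀ b → (if b then #1 else 0₃) ≡ ⟦ if b then oneP else [] ⟧₀ []
    go true = sym (+-identityʳ _)
    go false = refl
  ⟦contractM⟧ f (e ∷ e' ∷ w) hf hw τ = trans (cong₂ (λ x y → x + (- y)) (sel-same e f (proj₁ (&&-split hw)) hf _)
      (resp (∧-linear (edge e)) (⟦contractM⟧ f (e' ∷ w) hf (proj₂ (&&-split {a = normE (length vs) e} hw))) τ))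
    (sym (trans (eval-++ _ (if sameE e f then (#1 , e' ∷ w) ∷ [] else []) (scaleP #2 (mulE e (contractM f (e' ∷ w)))))
      (cong₂ _+_ (go (sameE e f)) (trans (eval-scale _ #2 (mulE e (contractM f (e' ∷ w)))) (cong -_ (⟦mulE⟧₀ e (contractM f (e' ∷ w)) τ))))))
    where
    go : ∀ b → ⟦ if b then (#1 , e' ∷ w) ∷ [] else [] ⟧₀ τ ≡ (if b then wedges₀ (e' ∷ w) τ else 0₃)
    go true = +-identityʳ _
    go false = refl

  ⟦contract⟧ : ∀ f (p : Poly (suc k)) → normE (length vs) f ≡ true → NormP (length vs) p → ι (edge f) ⟦ p ⟧₀ ≈ ⟦ contract f p ⟧₀
  ⟦contract⟧ f [] hf hp τ = refl
  ⟦contract⟧ f ((c , w) ∷ p) hf (hw ∷ hp) τ = sym (trans (eval-++ _ (scaleP c (contractM f w)) (contract f p))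
    (cong₂ _+_ (trans (eval-scale _ c (contractM f w)) (cong (c ·_) (sym (⟦contractM⟧ f w hf hw τ)))) (sym (⟦contract⟧ f p hf hp τ))))

  pairT-sound : ∀ (t : Trie k) (p : Poly k) → normT (length vs) t ≡ true → NormP (length vs) p → Φ t ⟦ p ⟧₀ ≡ pairT t p
  pairTs-sound : ∀ (ts : List (FEdge × Trie k)) (p : Poly (suc k)) → normTs (length vs) ts ≡ true → NormP (length vs) p →
    evalTs ts (λ w → ⟦ p ⟧₀ (Vec.map edge w)) ≡ pairTs ts p
  pairNE-sound : ∀ (t : Trie k) (p : Poly k) → normT (length vs) t ≡ true → NormP (length vs) p → Φ t ⟦ p ⟧₀ ≡ pairNE t p
  pairT-sound (leaf c) p ht hp = trans (cong (c ·_) (coefs p)) (sym (times-≡ c (coefSum p)))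
    where
    coefs : ∀ (p : Poly 0) → ⟦ p ⟧₀ [] ≡ coefSum p
    coefs [] = refl
    coefs ((a , []) ∷ p) = trans (cong₂ _+_ (·-one a) (coefs p)) (sym (plus-+ a (coefSum p)))
  pairT-sound (node ts) p ht hp = pairTs-sound ts p ht hp
  pairTs-sound [] p ht hp = refl
  pairTs-sound ((f , t) ∷ ts) p ht hp =
    let hf = proj₁ (&&-split ht)
        h₁ = proj₁ (&&-split (proj₂ (&&-split {a = normE (length vs) f} ht)))
        h₂ = proj₂ (&&-split {a = normT (length vs) t} (proj₂ (&&-split {a = normE (length vs) f} ht)))
    in trans (cong₂ _+_ (trans (evalT-cong t λ w → ⟦contract⟧ f p hf hp (Vec.map edge w))
         (pairNE-sound t (contract f p) h₁ (contract-norm f p hp))) (pairTs-sound ts p h₂ hp)) (sym (plus-+ _ _))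
  pairNE-sound t [] ht hp = evalT-0 t
  pairNE-sound t p@(_ ∷ _) ht hp = pairT-sound t p ht hp

-- Cocycles pulled back along relabellings and links

nth-map : ∀ {A B : Set} (f : A → B) d is i → nth (f d) (map f is) i ≡ f (nth d is i)
nth-map f d [] i = refl
nth-map f d (x ∷ is) zero = refl
nth-map f d (x ∷ is) (suc i) = nth-map f d is i

-- Permuting the positions in a cochain is the same as keeping it and listing the vertices in
-- another order, so the check for the original cochain carries over.
eval-relabel : ∀ (ρ : ℕ → Fin n) ps (t : Trie k) (I : Vec (Pair n) k → F3) →
  evalT (relabel ps t) (λ w → I (Vec.map (Interp.edge ρ) w)) ≡ evalT t (λ w → I (Vec.map (Interp.edge (nth (ρ 0) (map ρ ps))) w))
eval-relabels : ∀ (ρ : ℕ → Fin n) ps (ts : List (FEdge × Trie k)) (I : Vec (Pair n) (suc k) → F3) →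
  evalTs (relabels ps ts) (λ w → I (Vec.map (Interp.edge ρ) w)) ≡ evalTs ts (λ w → I (Vec.map (Interp.edge (nth (ρ 0) (map ρ ps))) w))
eval-relabel ρ ps (leaf c) I = refl
eval-relabel ρ ps (node ts) I = eval-relabels ρ ps ts I
eval-relabels ρ ps [] I = refl
eval-relabels ρ ps (((i , j) , t) ∷ ts) I = cong₂ _+_
  (trans (evalT-cong (relabel ps t) λ w → cong (λ e → I (e ∷ Vec.map (Interp.edge ρ) w))
      (trans (Interp.edge-fedge ρ (nth 0 ps i) (nth 0 ps j)) (sym (cong₂ mk (nth-map ρ 0 ps i) (nth-map ρ 0 ps j)))))
    (eval-relabel ρ ps t (λ τ → I (Interp.edge (nth (ρ 0) (map ρ ps)) (i , j) ∷ τ))))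
  (eval-relabels ρ ps ts I)

-- The functional sending c to the value of t on the link of c at ab, with t transported to the
-- remaining positions in increasing order.
linkT : ℕ → Trie k → ℕ × ℕ → Trie (suc k)
linkT N t (a , b) = node (((a , b) , relabel (rem b (rem a (List.upTo N))) t) ∷ [])

linkOK : ℕ → ℕ → ℕ × ℕ → Bool
linkOK N K (a , b) = distinctᵇ N (rem b (rem a (List.upTo N)) ++ a ∷ b ∷ []) &&
  ((length (rem b (rem a (List.upTo N))) ≡ᵇ K) && (N ≡ᵇ 2 ℕ.+ K))

permOK : ℕ → List ℕ → Bool
permOK N ps = distinctᵇ N ps && (length ps ≡ᵇ N)

length-≡ᵇ : ∀ {A : Set} (xs : List A) {K} → (length xs ≡ᵇ K) ≡ true → length xs ≡ K
length-≡ᵇ xs {K} h = ℕₚ.≡ᵇ⇒≡ (length xs) K (subst T (sym h) tt)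

row : ℕ → Trie k → List (Poly k) → Poly 1
row i t [] = []
row i t (z ∷ zs) = cons (pairT t z) (symbol i) (row (suc i) t zs)

-- Functionals inherit the cocycle property from a few verified cochains. On twelve vertices this
-- reduces the verification to a single cocycle of M₁₀.
data DualOf (N : ℕ) : Trie k → Set where
  permuted : ∀ (t : Trie k) ps → isCocycle N t ≡ true → permOK N ps ≡ true → DualOf N (relabel ps t)
  linked   : ∀ {K} (t : Trie (suc k)) ab → isCocycle K t ≡ true → linkOK N K ab ≡ true → DualOf N (linkT N t ab)

record Duals (N k : ℕ) : Set where
  constructor duals
  field
    list  : List (Trie k)
    valid : All (λ t → normT N t ≡ true × DualOf N t) list
open Duals

linkDuals : ∀ {j K} N (t : Trie (suc j)) → isCocycle K t ≡ true → ∀ abs →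
  allᵇ (λ ab → linkOK N K ab && normT N (linkT N t ab)) abs ≡ true → Duals N (suc (suc j))
linkDuals {K = K} N t h abs chk = duals (map (linkT N t) abs) (go abs chk)
  where
  go : ∀ abs → allᵇ (λ ab → linkOK N K ab && normT N (linkT N t ab)) abs ≡ true →
    All (λ t → normT N t ≡ true × DualOf N t) (map (linkT N t) abs)
  go [] chk = []
  go (ab ∷ abs) chk = (proj₂ (&&-split {a = linkOK N K ab} (proj₁ (&&-split chk))) , linked t ab h (proj₁ (&&-split (proj₁ (&&-split chk))))) ∷
    go abs (proj₂ (&&-split {a = linkOK N K ab && normT N (linkT N t ab)} chk))

permDuals : ∀ N (t : Trie k) → isCocycle N t ≡ true → ∀ (digits : ℕ → List ℕ) ps →
  allᵇ (λ p → permOK N (digits p) && normT N (relabel (digits p) t)) ps ≡ true → Duals N k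
permDuals N t h digits ps chk = duals (map (λ p → relabel (digits p) t) ps) (go ps chk)
  where
  go : ∀ ps → allᵇ (λ p → permOK N (digits p) && normT N (relabel (digits p) t)) ps ≡ true →
    All (λ t → normT N t ≡ true × DualOf N t) (map (λ p → relabel (digits p) t) ps)
  go [] chk = []
  go (p ∷ ps) chk = (proj₂ (&&-split {a = permOK N (digits p)} (proj₁ (&&-split chk))) ,
      permuted t (digits p) h (proj₁ (&&-split (proj₁ (&&-split chk))))) ∷
    go ps (proj₂ (&&-split {a = permOK N (digits p) && normT N (relabel (digits p) t)} chk))

_∪_ : ∀ {N} → Duals N k → Duals N k → Duals N k
duals fs v ∪ duals gs w = duals (fs ++ gs) (++⁺ v w)

-- A rank certificate for the pairing matrix. It reuses the elimination of relations, starting with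
-- nothing known; an index being solved now means that its coefficient must vanish.
record Separated (zs : List (Poly k)) (fs : List (Trie k)) : Set where
  constructor separated
  field
    steps : List (List (F3 × ℕ))
    check : allBelow (length zs) (eliminate (map (λ t → row 0 t zs) fs) [] steps) ≡ true

module Dual {n} {X : List (Fin n)} (d : Fin n) {vs : List (Fin n)} (F : Fresh X vs) (full : size X ≡ length vs) where
  open Positions d F
  open Functionals d F
  private
    ρ = nth d vs

  Vanishing : Trie k → Set
  Vanishing {k} t = ∀ {b : Chain n (suc k)} → Ok X b → Φ t (∂ b) ≡ 0₃

  perm-vanishing : ∀ (t : Trie k) ps → isCocycle (length vs) t ≡ true → permOK (length vs) ps ≡ true → Vanishing (relabel ps t)
  perm-vanishing {k} t ps h ok {b} o = trans (eval-relabel ρ ps t (∂ b))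
    (Functionals.cocycle-∂ (ρ 0) F' (trans full (sym len)) t (subst (λ l → isCocycle l t ≡ true) (sym len) h) o)
    where
    F' = posFresh ps (proj₁ (&&-split ok))
    len : length (map ρ ps) ≡ length vs
    len = trans (Listₚ.length-map ρ ps) (length-≡ᵇ ps (proj₂ (&&-split {a = distinctᵇ (length vs) ps} ok)))

  -- Contraction at ab anticommutes with ∂, so the link of a boundary is a boundary on two vertices
  -- fewer, where t vanishes.
  link-vanishing : ∀ {K} (t : Trie (suc k)) ab → isCocycle K t ≡ true → linkOK (length vs) K ab ≡ true → Vanishing (linkT (length vs) t ab)
  link-vanishing {k} {K} t (a , b) h ok {c} o = trans (+-identityʳ _) (trans (eval-relabel ρ ps t (λ τ → ∂ c (mk (ρ a) (ρ b) ∷ τ)))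
      (trans (evalT-cong t λ w → trans (sym (neg-involutive _)) (cong -_ (sym (∂-ι (mk (ρ a) (ρ b)) o (Vec.map (Interp.edge (nth (ρ 0) (map ρ ps))) w)))))
      (trans (evalT-neg t _) (trans (cong -_ (Functionals.cocycle-∂ (ρ 0) (proj₁ parts)
        (trans sz (sym (Listₚ.length-map ρ ps)))
        t (subst (λ l → isCocycle l t ≡ true) (sym (trans (Listₚ.length-map ρ ps) len)) h) (Ok-ι (ρ a) (ρ b) o))) neg-0))))
    where
    ps = rem b (rem a (List.upTo (length vs)))
    o₁ = proj₁ (&&-split ok)
    len : length ps ≡ K
    o₂ = proj₂ (&&-split {a = distinctᵇ (length vs) (ps ++ a ∷ b ∷ [])} ok)
    len = length-≡ᵇ ps (proj₁ (&&-split o₂))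
    whole : Fresh X (map ρ ps ++ ρ a ∷ ρ b ∷ [])
    whole = subst (Fresh X) (Listₚ.map-++ ρ ps (a ∷ b ∷ [])) (posFresh (ps ++ a ∷ b ∷ []) o₁)
    parts = fresh-++ (map ρ ps) {ρ a ∷ ρ b ∷ []} whole
    sz : size (ρ a ∷ ρ b ∷ X) ≡ length ps
    sz = ℕₚ.+-cancelˡ-≡ 2 _ _ (trans (sym (fresh-size (proj₂ parts))) (trans full (total-length)))
      where
      total-length : length vs ≡ 2 ℕ.+ length ps
      total-length = trans (ℕₚ.≡ᵇ⇒≡ (length vs) (2 ℕ.+ K) (subst T (sym (proj₂ (&&-split {a = length ps ≡ᵇ K} o₂))) tt)) (cong (2 ℕ.+_) (sym len))

  linear : (ℕ → F3) → ℕ → List (Poly k) → Chain n k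
  linear a i [] = zeroC
  linear a i (z ∷ zs) τ = a i · ⟦ z ⟧₀ τ + linear a (suc i) zs τ

  valN : (ℕ → F3) → Mono 1 → F3
  valN a ((i , _) ∷ []) = a i

  row-sound : ∀ a i (t : Trie k) zs → normT (length vs) t ≡ true → All (NormP (length vs)) zs →
    Φ t (linear a i zs) ≡ evalP (valN a) (row i t zs)
  row-sound a i t [] ht [] = evalT-0 t
  row-sound a i t (z ∷ zs) ht (hz ∷ hzs) = trans (evalT-+ t _ _) (trans (cong₂ _+_
      (trans (evalT-scale t (a i) _) (trans (cong (a i ·_) (pairT-sound t z ht hz)) (·-comm (a i) (pairT t z))))
      (row-sound a (suc i) t zs ht hzs))
    (sym (eval-cons (valN a) (pairT t z) (symbol i) (row (suc i) t zs))))

  module Independence (a : ℕ → F3) (rows : List (Poly 1)) (R : ∀ i → evalP (valN a) (nth [] rows i) ≡ 0₃) where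

    combine-0 : ∀ L → evalP (valN a) (combine rows L) ≡ 0₃
    combine-0 [] = refl
    combine-0 ((c , i) ∷ L) = trans (eval-++ (valN a) (scaleP c (nth [] rows i)) (combine rows L))
      (trans (cong₂ _+_ (trans (eval-scale (valN a) c (nth [] rows i)) (trans (cong (c ·_) (R i)) (·-0 c))) (combine-0 L)) (+-identityˡ 0₃))

    unknown-0 : ∀ {known} → (∀ i → i ∈ known → a i ≡ 0₃) → ∀ r → evalP (valN a) r ≡ evalP (valN a) (unknown known r)
    unknown-0 K [] = refl
    unknown-0 {known} K ((c , (i , z) ∷ []) ∷ r) = go (elemᵇ i known) refl
      where
      go : ∀ b → elemᵇ i known ≡ b → c · a i + evalP (valN a) r ≡
        evalP (valN a) (if b then unknown known r else (c , (i , z) ∷ []) ∷ unknown known r)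
      go true e = trans (cong₂ _+_ (trans (cong (c ·_) (K i (elem-true e))) (·-0 c)) (unknown-0 K r)) (+-identityˡ _)
      go false e = cong (c · a i +_) (unknown-0 K r)

    solved-0 : ∀ r i → solved r ≡ just i → evalP (valN a) r ≡ 0₃ → a i ≡ 0₃
    solved-0 ((#1 , (i , _) ∷ []) ∷ []) .i refl s = trans (sym (+-identityʳ _)) s
    solved-0 ((#2 , (i , _) ∷ []) ∷ []) .i refl s = trans (sym (neg-involutive _)) (trans (cong -_ (trans (sym (+-identityʳ _)) s)) neg-0)

    eliminate-0 : ∀ Ls {known} → (∀ i → i ∈ known → a i ≡ 0₃) → ∀ i → i ∈ eliminate rows known Ls → a i ≡ 0₃
    eliminate-0 [] K = K
    eliminate-0 (L ∷ Ls) {known} K with solved (unknown known (nf (combine rows L))) in e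
    ... | nothing = eliminate-0 Ls K
    ... | just i = eliminate-0 Ls λ { j (here refl) → new ; j (there j∈) → K j j∈ }
      where
      new : a i ≡ 0₃
      new = solved-0 (unknown known (nf (combine rows L))) i e
        (trans (sym (unknown-0 K (nf (combine rows L)))) (trans (eval-nf (valN a) tt (combine rows L)) (combine-0 L)))

  vanishing : ∀ {t : Trie k} → DualOf (length vs) t → Vanishing t
  vanishing (permuted t ps h chk) = perm-vanishing t ps h chk
  vanishing (linked t ab h chk) = link-vanishing t ab h chk

  -- Every dual turns a relation modulo boundaries into a linear equation for the coefficients, and
  -- the certificate solves this system to zero.
  independent : ∀ (zs : List (Poly k)) (D : Duals (length vs) k) → All (NormP (length vs)) zs → Separated zs (list D) →
    ∀ a {b} → Ok X b → linear a 0 zs ≈ ∂ b → ∀ i → i ℕ.< length zs → a i ≡ 0₃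
  independent zs (duals fs valid) hz (separated steps check) a {b} o e i i< =
    Independence.eliminate-0 a (map (λ t → row 0 t zs) fs) (rows-0 fs valid) steps (λ _ ()) i (below-∈ (length zs) i check i<)
    where
    rows-0 : ∀ fs → All (λ t → normT (length vs) t ≡ true × DualOf (length vs) t) fs →
      ∀ i → evalP (valN a) (nth [] (map (λ t → row 0 t zs) fs) i) ≡ 0₃
    rows-0 [] [] i = refl
    rows-0 (t ∷ fs) ((ht , v) ∷ h) zero = trans (sym (row-sound a 0 t zs ht hz)) (trans (evalT-cong t λ w → e _) (vanishing v o))
    rows-0 (t ∷ fs) (_ ∷ h) (suc i) = rows-0 fs h i

-- Explicit cocycles and rank certificates

φ₇-digits φ₉-digits φ₁₀-digits : ℕ
φ₇-digits = 134261342515624156231351622516124161461522615123151351412614223141461312513224131451213612145062250612306214061130613605226051240511405213051360412504223042160411504145031260322403116032150314602135021560113401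
φ₉-digits = 256473816748352564728267352814635271473526278462514638252473625267342527846232584623267452326745182473618267351814635182673418247261826724182462517246231724623152673514256471324625132564712267351224736081463508247260816725081672308146170824715082231508167140824713082251308247120823512082462507246230724618072462305167180514718051231805267350425647032462503167180314718031251803256470226735021671802147180213518021674801158470127846012473801247360114635012472801235280124726011672501138250116723011582301
φ₁₀-digits = 2685749278564926957482795648168594716958471785946179584617845391684539267453917945381694538267453818967351894735189463518967341895734189563417845291684529267452916837291783629267352924835292673429258342917945281694528267452816937281793628267352824935282673428259342826839272693827146352715634272783926279382614735261573426189672518947251894625167392514839251673825149382524637252473625189672418957241895624167392415839241673824159382425637242573624257492325649232574823256482315947231584723159462315846232894523267452315748191564819258471925846191673819156381914738192483719146371925836191573619178351914635191683419157341916728191572819146281925827191562719234271924826191472619235261916825191472519137251917824191562419136241916723191582319148231915749181564918259471825946181673918157391814639182593718156371824936181473618169351814735181793418156341816729181562918147291824927181462718235271825926181572618234261817925181462518136251816924181572418137241816723181592318149231818956171564917156481718946172594617258461716945171684517258391715639172493817146381725936172483617268351724935172693417258341724829171462917135291725928171562817134281725826172492617269251724825172382517268241725924172392417256231724623172452317189571615749161574816189471625947162584716179451617845162483916147391625938161573816258371624937162793516248351627834162593416258291615729161342916249281614728161352816259271624827162782516249251623925162792416258241623824162572316247231624523161683915147391517938151463815269371524837152783615249361527934152683415167341517829151462915137291513429151692815147281513628151342815268271524927152382715279261524826152392615278241526924151672415239241523824151783914156391416938141573814268371425937142793614258361427835142693514167351416829141572914136291413529141792814156281413728141352814269271425827142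3927142782614259261423826142792514268251416725142392514238251416859131795813168571317956131784913157491316948131564813169471325847131784613259461317829131682913156291314729132452913179281316928131572813146281324528132592713248271325826132492613289251317825131692513289241317924131682413178591216958121695712178561216849121564912179481215748121684712259471217946122584612178391216839121573912146391224539121793812169381215638121473812245381225837122493712259361224836122893512179351216835122893412178341216934121574809156480925847092584609167380915738091463809258370915637092483609147360916835091473509178340915634091672809156280914728092482709146270923527092582609157260923426091782509146250913625091682409157240913724091672309158230914823092681709234170922517092231709278160923516092241609223160916715091481509236150923415092271509224150916714091581409237140923514092261409225140915713091461309228130915612091471209238120915749081564908259470825946081673908156390814739082493708146370825936081573608179350814635081693408157340816729081572908146290825927081562708234270824926081472608235260816925081472508137250817924081562408136240816723081592308149230826917082351708224170822317082791608234160822516082231608167150814915082371508234150822615082241508167140815914082361408235140822714082251408156130814713082291308157120814612082391208189560715649071564807189460725946072584607169450716845072483907146390725938071563807258360724936072693507248350726834072593407258290715629071342907249280714628071352807259260724826072682507249250723925072692407258240723824072562307246230724523071681907135190712419071231907169180713418071251807123180724615071391507128150725614071381407129140718913072691307268130725813072491307145130712613071891207269120726812072591207248120714512071361207189570615749061574806189470625947062584706179450617845062583906157390624938061473806259370624837062783506249350627934062583406248290614729061352906259280615728061342806258270624927062792506248250623825062782406259240623924062572306247230624523061781906134190612519061231906179180613518061241806123180624715061381506129150625714061391406128140618913062791306278130625913062481306145130612713061891206279120627812062581206249120614512061371206178390514639051693805147380526837052493705279360524836052783405269340516734051682905147290513629051342905179280514628051372805134280526927052482705239270527826052492605238260527924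05268240516724052392405238240526719052481905137190513419051261905124190526718052491805136180513418051271805124180514617052381705229170514716052391605228160527813052691305224130527912052681205234120516839041573904179380415638042693704258370427836042593604279350426835041673504178290415629041372904135290416928041572804136280413528042682704259270423827042792604258260423926042782504269250416725042392504238250426719042581904136190413519041271904125190426718042591804137180413518041261804125180415617042391704228170415716042381604229160427913042681304225130427812042691204235120417859031695803169570317856031684903156490317948031574803168470325947031794603258460317829031682903157290314629032452903179280316928031562803147280324528032582703249270325926032482603289250317925031682503289240317824031692403256190324719031281903257180324618031291803289170316917031681703159170314817032451703226170328916031791603178160315816031491603245160322716031791503168150312415031781403169140312514031685902179580216857021795602178490215749021694802156480216947022584702178460225946021783902168390215639021473902245390217938021693802157380214638022453802259370224837022583602249360228935021783502169350228934021793402168340225719022461902138190225618022471802139180228917021691702168170215817021491702245170223617022891602179160217816021591602148160224516022371602178150216915021341502179140216814021351402189670126957012685701279560127856012694701268470127946012784601267450127839012683901279380126938011473501146350115734011563401278290126829012352901234290127928012692801235280123428011472501146250113925011382501157240115624011392401138240118923011572301156230114723011462301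

perms₃ : List ℕ
perms₃ = 1012 ∷ 1021 ∷ []

dual-steps₃ : List ℕ
dual-steps₃ = 1001 ∷ 1000 ∷ []

perms₆ : List ℕ
perms₆ = 1012345 ∷ 1012435 ∷ 1021345 ∷ 1021435 ∷ 1031245 ∷ 1031425 ∷ 1041235 ∷ 1041325 ∷ 1051234 ∷ 1051324 ∷ 1120345 ∷ 1120435 ∷ 1130245 ∷ 1130425 ∷ 1140235 ∷ 1140325 ∷ []

dual-steps₆ : List ℕ
dual-steps₆ = 1002 ∷ 1003 ∷ 1004 ∷ 1005 ∷ 1006 ∷ 1007 ∷ 1008 ∷ 1009 ∷ 1010 ∷ 1011 ∷ 1012 ∷ 1013 ∷ 1014 ∷ 1015 ∷ 1001 ∷ 1000 ∷ []

-- 29 of the 36 edges, read along φ₇. The 21 relabelled copies of φ₉ complete them to a square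
-- system for 50 classes.
links₉ : List (ℕ × ℕ)
links₉ = (0 , 1) ∷ (0 , 2) ∷ (0 , 3) ∷ (0 , 4) ∷ (0 , 5) ∷ (0 , 6) ∷ (0 , 7) ∷ (0 , 8) ∷ (1 , 2) ∷ (1 , 3) ∷ (1 , 4) ∷ (1 , 5) ∷ (1 , 6) ∷ (1 , 7) ∷ (2 , 3) ∷ (2 , 4) ∷ (2 , 5) ∷ (2 , 6) ∷ (2 , 7) ∷ (3 , 4) ∷ (3 , 5) ∷ (3 , 6) ∷ (3 , 7) ∷ (4 , 5) ∷ (4 , 6) ∷ (4 , 7) ∷ (5 , 6) ∷ (5 , 7) ∷ (6 , 7) ∷ []

perms₉ : List ℕ
perms₉ = 1012345678 ∷ 1231087654 ∷ 1564137820 ∷ 1467281503 ∷ 1680354712 ∷ 1723456180 ∷ 1204765183 ∷ 1348027165 ∷ 1631472850 ∷ 1864015372 ∷ 1328641507 ∷ 1301862457 ∷ 1728163045 ∷ 1361047852 ∷ 1275836410 ∷ 1862013574 ∷ 1032481657 ∷ 1654087321 ∷ 1085361472 ∷ 1680153247 ∷ 1371682054 ∷ []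

dual-steps₉ : List ℕ
dual-steps₉ = 1003 ∷ 1004 ∷ 1005 ∷ 1006 ∷ 1009 ∷ 1011 ∷ 1013 ∷ 1016 ∷ 1017 ∷ 1018 ∷ 1020 ∷ 1021 ∷ 1010 ∷ 102710241012 ∷ 101210081007200210011000 ∷ 1022 ∷ 1007 ∷ 10141012 ∷ 1012 ∷ 10152002 ∷ 201920081001 ∷ 20251024202310081002 ∷ 1001 ∷ 10281023 ∷ 1023 ∷ 1026102420081002 ∷ 1008 ∷ 1024 ∷ 1025 ∷ 1049204810412040203810342033103210311029 ∷ 10482047104620431042104120392036203310301029 ∷ 20491047204210412040203720342032 ∷ 1049204720441042104110381036103410331030 ∷ 204910481044204110371036103420331032 ∷ 204920471045203920351034203310322031 ∷ 2049104810471045204220361035 ∷ 20492045204310411037103620352034 ∷ 1048104310422039 ∷ 1034 ∷ 10481040203710361032 ∷ 1032 ∷ 1039 ∷ 20441033 ∷ 1035 ∷ 1038 ∷ 1041 ∷ 1044 ∷ 1048 ∷ 1049 ∷ 1029 ∷ []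

-- 56 of the 66 edges, read along φ₁₀: exactly one functional for each class in the basis.
links₁₂ : List (ℕ × ℕ)
links₁₂ = (0 , 1) ∷ (0 , 2) ∷ (0 , 3) ∷ (0 , 4) ∷ (0 , 5) ∷ (0 , 6) ∷ (0 , 7) ∷ (0 , 8) ∷ (0 , 9) ∷ (0 , 10) ∷ (0 , 11) ∷ (1 , 2) ∷ (1 , 3) ∷ (1 , 4) ∷ (1 , 5) ∷ (1 , 6) ∷ (1 , 7) ∷ (1 , 8) ∷ (1 , 9) ∷ (1 , 10) ∷ (2 , 3) ∷ (2 , 4) ∷ (2 , 5) ∷ (2 , 6) ∷ (2 , 7) ∷ (2 , 8) ∷ (2 , 9) ∷ (2 , 10) ∷ (3 , 4) ∷ (3 , 5) ∷ (3 , 6) ∷ (3 , 7) ∷ (3 , 8) ∷ (3 , 9) ∷ (3 , 10) ∷ (4 , 5) ∷ (4 , 6) ∷ (4 , 7) ∷ (4 , 8) ∷ (4 , 9) ∷ (4 , 10) ∷ (5 , 6) ∷ (5 , 7) ∷ (5 , 8) ∷ (5 , 9) ∷ (5 , 10) ∷ (6 , 7) ∷ (6 , 8) ∷ (6 , 9) ∷ (6 , 10) ∷ (7 , 8) ∷ (7 , 9) ∷ (7 , 10) ∷ (8 , 9) ∷ (8 , 10) ∷ (9 , 10) ∷ []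

dual-steps₁₂ : List ℕ
dual-steps₁₂ = 1011 ∷ 1012 ∷ 1013 ∷ 1014 ∷ 1015 ∷ 1016 ∷ 1017 ∷ 1018 ∷ 1019 ∷ 1020 ∷ 1023 ∷ 1024 ∷ 1025 ∷ 1026 ∷ 1027 ∷ 1031 ∷ 1032 ∷ 1033 ∷ 1034 ∷ 1036 ∷ 1038 ∷ 1040 ∷ 1044 ∷ 1045 ∷ 1048 ∷ 1003 ∷ 1004 ∷ 1005 ∷ 1006 ∷ 1007 ∷ 1008 ∷ 1009 ∷ 1022 ∷ 1043 ∷ 2010200210011000 ∷ 1010 ∷ 1021 ∷ 1047 ∷ 1002 ∷ 1037 ∷ 105410511039 ∷ 1039103520281000 ∷ 1049 ∷ 2046104110302000 ∷ 104610352029 ∷ 1039 ∷ 1041 ∷ 10422030 ∷ 20521051205010351030 ∷ 1029 ∷ 10551050 ∷ 1050 ∷ 1053105120351030 ∷ 1035 ∷ 1051 ∷ 1052 ∷ []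

-- Only the lowest digits are read. The leading 1 of each stored permutation protects a possible
-- zero in its first place.
digitsOf : ℕ → ℕ → List ℕ
digitsOf zero N = []
digitsOf (suc f) N = digitsOf f (N / 10) ++ N % 10 ∷ []

φ₃ : Trie (suc 0)
φ₃ = build 1 ((#1 , (0 , 1) ∷ []) ∷ [])

-- The perfect matching 01, 23, 45 is the only coface of either term, and its two contributions have
-- opposite signs.
φ₆ : Trie (suc 1)
φ₆ = build 2 ((#1 , (0 , 1) ∷ (2 , 3) ∷ []) ∷ (#1 , (0 , 1) ∷ (4 , 5) ∷ []) ∷ [])

φ₇ : Trie (suc 1)
φ₇ = build 2 (polyOf 2 2000 φ₇-digits)

φ₉ : Trie (suc 2)
φ₉ = build 3 (polyOf 3 2000 φ₉-digits)

-- Found by linear algebra. As with φ₇, the homology group concerned has one generator, so up to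
-- scalars and coboundaries there is only one cocycle to choose.
φ₁₀ : Trie (suc 2)
φ₁₀ = build 3 (polyOf 3 2000 φ₁₀-digits)

cocycle₃ : isCocycle 3 φ₃ ≡ true
cocycle₃ = refl

cocycle₆ : isCocycle 6 φ₆ ≡ true
cocycle₆ = refl

cocycle₇ : isCocycle 7 φ₇ ≡ true
cocycle₇ = refl

cocycle₉ : isCocycle 9 φ₉ ≡ true
cocycle₉ = refl

cocycle₁₀ : isCocycle 10 φ₁₀ ≡ true
cocycle₁₀ = refl

basis₃ : List (Poly 1)
basis₃ = genP 1 (0 ∷ 1 ∷ 2 ∷ [])

basis₆ : List (Poly 2)
basis₆ = genP 2 (0 ∷ 1 ∷ 2 ∷ 3 ∷ 4 ∷ 5 ∷ [])

allBasis₉ : List (Poly 3)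
allBasis₉ = basisPolys₉ ++ extra₉

duals₃ : Duals 3 1
duals₃ = permDuals 3 φ₃ cocycle₃ (digitsOf 3) perms₃ refl

duals₆ : Duals 6 2
duals₆ = permDuals 6 φ₆ cocycle₆ (digitsOf 6) perms₆ refl

duals₉ : Duals 9 3
duals₉ = linkDuals {K = 7} 9 φ₇ cocycle₇ links₉ refl ∪ permDuals 9 φ₉ cocycle₉ (digitsOf 9) perms₉ refl

duals₁₂ : Duals 12 4
duals₁₂ = linkDuals {K = 10} 12 φ₁₀ cocycle₁₀ links₁₂ refl

dual-check₃ : Separated basis₃ (Duals.list duals₃)
dual-check₃ = separated (map (vecOf 400) dual-steps₃) refl

dual-check₆ : Separated basis₆ (Duals.list duals₆)
dual-check₆ = separated (map (vecOf 400) dual-steps₆) refl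

dual-check₉ : Separated allBasis₉ (Duals.list duals₉)
dual-check₉ = separated (map (vecOf 400) dual-steps₉) refl

dual-check₁₂ : Separated basis₁₂ (Duals.list duals₁₂)
dual-check₁₂ = separated (map (vecOf 400) dual-steps₁₂) refl

-- Chains in the sense of the definitions are the chains used here

data Matching {n} (X : List (Fin n)) : ∀ {m} → Vec (Pair n) m → Set where
  []  : Matching X []
  _∷_ : ∀ {m w} {τ : Vec (Pair n) m} → Good X w → Matching (ends w X) τ → Matching X (w ∷ τ)

matching⁺ : ∀ {X} (τ : Vec (Pair n) m) → IsMatching τ →
  (∀ p → proj₁ (Vec.lookup τ p) ∉ X × proj₂ (Vec.lookup τ p) ∉ X) → Matching X τ
matching⁺ [] _ _ = []
matching⁺ (w ∷ τ) (e , d) a = (e #0 , a #0) ∷ matching⁺ τ (e ∘ Fin.suc , λ p q ne → d (Fin.suc p) (Fin.suc q) λ { refl → ne refl })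
  λ p → let x₁ , x₂ , x₃ , x₄ = d #0 (Fin.suc p) λ () in
    ∉-∷ (x₁ ∘ sym) (∉-∷ (x₃ ∘ sym) (proj₁ (a (Fin.suc p)))) , ∉-∷ (x₂ ∘ sym) (∉-∷ (x₄ ∘ sym) (proj₂ (a (Fin.suc p))))

matching-avoids : ∀ {X} {τ : Vec (Pair n) m} → Matching X τ → ∀ p → proj₁ (Vec.lookup τ p) ∉ X × proj₂ (Vec.lookup τ p) ∉ X
matching-avoids ((_ , a) ∷ h) #0 = a
matching-avoids (_ ∷ h) (Fin.suc p) = let a , b = matching-avoids h p in a ∘ there ∘ there , b ∘ there ∘ there

matching⁻ : ∀ {X} {τ : Vec (Pair n) m} → Matching X τ → IsMatching τ
matching⁻ [] = (λ ()) , λ ()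
matching⁻ {n = n} {τ = w ∷ τ} ((e , _) ∷ h) = edges , disjoint
  where
  edges : ∀ p → IsEdge (Vec.lookup (w ∷ τ) p)
  edges #0 = e
  edges (Fin.suc p) = proj₁ (matching⁻ h) p
  disjoint : ∀ p q → p ≢ q → Disjoint (Vec.lookup (w ∷ τ) p) (Vec.lookup (w ∷ τ) q)
  disjoint #0 #0 ne = ⊥-elim (ne refl)
  disjoint #0 (Fin.suc q) ne = let a , b = matching-avoids h q in
    a ∘ here ∘ sym , b ∘ here ∘ sym , a ∘ there ∘ here ∘ sym , b ∘ there ∘ here ∘ sym
  disjoint (Fin.suc p) #0 ne = let a , b = matching-avoids h p in
    a ∘ here , a ∘ there ∘ here , b ∘ here , b ∘ there ∘ here
  disjoint (Fin.suc p) (Fin.suc q) ne = proj₂ (matching⁻ h) p q (λ { refl → ne refl })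

transpose-suc : ∀ (p q i : Fin m) → PC.transpose (Fin.suc p) (Fin.suc q) (Fin.suc i) ≡ Fin.suc (PC.transpose p q i)
transpose-suc p q i with does (i Finₚ.≟ p)
... | true = refl
... | false with does (i Finₚ.≟ q)
...   | true = refl
...   | false = refl

transpose-first : ∀ (p q i : Fin m) → does (i Finₚ.≟ p) ≡ true → PC.transpose p q i ≡ q
transpose-first p q i e rewrite e = refl

transpose-second : ∀ (p q i : Fin m) → does (i Finₚ.≟ p) ≡ false → does (i Finₚ.≟ q) ≡ true → PC.transpose p q i ≡ p
transpose-second p q i e f rewrite e | f = refl

transpose-other : ∀ (p q i : Fin m) → does (i Finₚ.≟ p) ≡ false → does (i Finₚ.≟ q) ≡ false → PC.transpose p q i ≡ i
transpose-other p q i e f rewrite e | f = refl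

transpose-comm : ∀ (p q i : Fin m) → PC.transpose p q i ≡ PC.transpose q p i
transpose-comm p q i = go (i Finₚ.≟ p) (i Finₚ.≟ q)
  where
  go : Dec (i ≡ p) → Dec (i ≡ q) → PC.transpose p q i ≡ PC.transpose q p i
  go (yes refl) (yes refl) = refl
  go (yes a) (no b) = trans (transpose-first p q i (dec-true (i Finₚ.≟ p) a))
    (sym (transpose-second q p i (dec-false (i Finₚ.≟ q) b) (dec-true (i Finₚ.≟ p) a)))
  go (no a) (yes b) = trans (transpose-second p q i (dec-false (i Finₚ.≟ p) a) (dec-true (i Finₚ.≟ q) b))
    (sym (transpose-first q p i (dec-true (i Finₚ.≟ q) b)))
  go (no a) (no b) = trans (transpose-other p q i (dec-false (i Finₚ.≟ p) a) (dec-false (i Finₚ.≟ q) b))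
    (sym (transpose-other q p i (dec-false (i Finₚ.≟ q) b) (dec-false (i Finₚ.≟ p) a)))

swapAt-suc : ∀ (w : Pair n) (τ : Vec (Pair n) m) p q → swapAt (w ∷ τ) (Fin.suc p) (Fin.suc q) ≡ w ∷ swapAt τ p q
swapAt-suc w τ p q = cong (w ∷_) (Vecₚ.tabulate-cong λ i → cong (Vec.lookup (w ∷ τ)) (transpose-suc p q i))

replaceAt : Pair n → Vec (Pair n) m → Fin m → Vec (Pair n) m
replaceAt w τ q = Vec.tabulate λ i → if does (i Finₚ.≟ q) then w else Vec.lookup τ i

swapAt-head : ∀ (w : Pair n) (τ : Vec (Pair n) m) q → swapAt (w ∷ τ) #0 (Fin.suc q) ≡ Vec.lookup τ q ∷ replaceAt w τ q
swapAt-head w τ q = cong (Vec.lookup τ q ∷_) (Vecₚ.tabulate-cong at)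
  where
  at : ∀ i → Vec.lookup (w ∷ τ) (PC.transpose #0 (Fin.suc q) (Fin.suc i)) ≡ (if does (i Finₚ.≟ q) then w else Vec.lookup τ i)
  at i with does (i Finₚ.≟ q)
  ... | true = refl
  ... | false = refl

-- Exchanging the head with a later entry is an adjacent transposition, an exchange one place
-- closer, and an adjacent transposition again: three signs.
alt-head : ∀ {X} {c : Chain n (suc m)} → Ok X c → ∀ w τ q → c (Vec.lookup τ q ∷ replaceAt w τ q) ≡ - c (w ∷ τ)
alt-head {m = suc m} {c = c} o w (v ∷ τ) #0 = trans (cong (λ σ → c (v ∷ w ∷ σ)) (Vecₚ.tabulate∘lookup τ)) (ok-alt o v w τ)
alt-head {m = suc m} {c = c} o w (v ∷ τ) (Fin.suc q) = begin
  c (Vec.lookup τ q ∷ v ∷ replaceAt w τ q) ≡⟨ ok-alt o _ v _ ⟩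
  - c (v ∷ Vec.lookup τ q ∷ replaceAt w τ q) ≡⟨ cong -_ (alt-head (ok-ι o v) w τ q) ⟩
  - (- c (v ∷ w ∷ τ)) ≡⟨ cong -_ (sym (ok-alt o w v τ)) ⟩
  - c (w ∷ v ∷ τ) ∎
  where open ≡-Reasoning

alternating : ∀ {X} {c : Chain n m} → Ok X c → ∀ τ p q → p ≢ q → c (swapAt τ p q) ≡ - c τ
alternating o (w ∷ τ) #0 #0 ne = ⊥-elim (ne refl)
alternating {c = c} o (w ∷ τ) #0 (Fin.suc q) ne = trans (cong c (swapAt-head w τ q)) (alt-head o w τ q)
alternating {c = c} o (w ∷ τ) (Fin.suc p) #0 ne = trans
  (cong c (trans (Vecₚ.tabulate-cong λ i → cong (Vec.lookup (w ∷ τ)) (transpose-comm (Fin.suc p) #0 i)) (swapAt-head w τ p)))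
  (alt-head o w τ p)
alternating {c = c} o (w ∷ τ) (Fin.suc p) (Fin.suc q) ne = trans (cong c (swapAt-suc w τ p q))
  (alternating (ok-ι o w) τ p q λ { refl → ne refl })

supported : ∀ {X} {c : Chain n m} → Ok X c → ∀ τ → Matching X τ ⊎ c τ ≡ 0₃
supported o [] = inj₁ []
supported {X = X} {c} o (w ∷ τ) = go (good? X w)
  where
  go : Dec (Good X w) → Matching X (w ∷ τ) ⊎ c (w ∷ τ) ≡ 0₃
  go (no ng) = inj₂ (ok-bad o w ng τ)
  go (yes g) = [ (λ h → inj₁ (g ∷ h)) , inj₂ ]′ (supported (ok-ι o w) τ)

opaque
  unfolding -_

  ok⇒isChain : ∀ {c : Chain n m} → Ok [] c → IsChain c
  ok⇒isChain o = (λ τ nm → [ (λ h → ⊥-elim (nm (matching⁻ h))) , id ]′ (supported o τ)) , alternating o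

  chain⇒ok : ∀ {X} (c : Chain n m) → (∀ τ → ¬ Matching X τ → c τ ≡ 0₃) →
    (∀ τ p q → p ≢ q → c (swapAt τ p q) ≡ - c τ) → Ok X c
  chain⇒ok {m = zero} c s a = ok₀
  chain⇒ok {n = n} {m = suc m} c s a = ok₊ (alt m c a) (λ w ng τ → s (w ∷ τ) λ { (g ∷ _) → ng g })
    λ w → chain⇒ok (ι w c) (λ τ nm → s (w ∷ τ) λ { (_ ∷ h) → nm h })
      λ τ p q ne → trans (cong c (sym (swapAt-suc w τ p q))) (a (w ∷ τ) (Fin.suc p) (Fin.suc q) λ { refl → ne refl })
    where
    alt : ∀ m (c : Chain n (suc m)) → (∀ τ p q → p ≢ q → c (swapAt τ p q) ≡ - c τ) → AltHead c
    alt zero c a = tt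
    alt (suc m) c a w v τ = trans (cong c (sym (trans (swapAt-head v (w ∷ τ) #0) (cong (λ σ → w ∷ v ∷ σ) (Vecₚ.tabulate∘lookup τ)))))
      (a (v ∷ w ∷ τ) #0 #1 λ ())

  isChain⇒ok : ∀ {c : Chain n m} → IsChain c → Ok [] c
  isChain⇒ok {c = c} (s , a) = chain⇒ok c (λ τ nm → s τ λ h → nm (matching⁺ τ h λ p → (λ ()) , λ ())) a

opaque
  unfolding sumP sum

  ∂-agrees : ∀ (c : Chain n (suc m)) → Defs.∂ c ≈ ∂ c
  ∂-agrees c τ = refl

-- Deciding whether a chain is a boundary

-- Exhaustive search over a finite type up to an equivalence. Chains are functions compared
-- pointwise, so the predicate has to respect that relation.
record Search (A : Set) (_≃_ : A → A → Set) : Set₁ where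
  field
    reflexive : ∀ {a} → a ≃ a
    search : (Q : A → Set) → (∀ {a b} → a ≃ b → Q a → Q b) → (∀ a → Dec (Q a)) → Dec (∃ Q)
open Search

search-F3 : Search F3 _≡_
search-F3 .reflexive = refl
search-F3 .search Q r d = Finₚ.any? d

cons-fun : ∀ {A : Set} → A → (Fin k → A) → Fin (suc k) → A
cons-fun a f #0 = a
cons-fun a f (Fin.suc i) = f i

none : ∀ {A : Set} → Fin 0 → A
none ()

search-Π : ∀ {A : Set} {_≃_ : A → A → Set} → Search A _≃_ → ∀ k → Search (Fin k → A) (λ f g → ∀ i → f i ≃ g i)
search-Π S k .reflexive i = reflexive S
search-Π S zero .search Q r d = map′ (λ q → none , q) (λ (f , q) → r {f} {none} (λ ()) q) (d none)
search-Π {A} S (suc k) .search Q r d = map′ (λ (a , f , q) → cons-fun a f , q)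
  (λ (f , q) → f #0 , f ∘ Fin.suc , r (λ { #0 → reflexive S ; (Fin.suc i) → reflexive S }) q)
  (search S (λ a → ∃ λ f → Q (cons-fun a f))
    (λ e (f , q) → f , r (λ { #0 → e ; (Fin.suc i) → reflexive S }) q)
    λ a → search (search-Π S k) (λ f → Q (cons-fun a f))
      (λ e q → r (λ { #0 → reflexive S ; (Fin.suc i) → e i }) q) λ f → d (cons-fun a f))

search-Chain : ∀ m → Search (Chain n m) _≈_
search-Chain m .reflexive = ≈-refl
search-Chain zero .search Q r d = map′ (λ (x , q) → (λ _ → x) , q) (λ (c , q) → c [] , r (λ { [] → refl }) q)
  (search search-F3 (λ x → Q λ _ → x) (λ { refl q → q }) λ x → d _)
search-Chain {n} (suc m) .search Q r d = map′ (λ (f , q) → uncurried f , q)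
  (λ (c , q) → (λ i j τ → c ((i , j) ∷ τ)) , r (λ { ((i , j) ∷ τ) → refl }) q)
  (search (search-Π (search-Π (search-Chain m) n) n) (λ f → Q (uncurried f))
    (λ e q → r (λ { ((i , j) ∷ τ) → e i j τ }) q) λ f → d (uncurried f))
  where
  uncurried : (Fin n → Fin n → Chain n m) → Chain n (suc m)
  uncurried f ((i , j) ∷ τ) = f i j τ

all-pairs? : {P : Pair n → Set} → (∀ w → Dec (P w)) → Dec (∀ w → P w)
all-pairs? d = map′ (λ h (i , j) → h i j) (λ h i j → h (i , j)) (Finₚ.all? λ i → Finₚ.all? λ j → d (i , j))

all-vecs? : ∀ m {P : Vec (Pair n) m → Set} → (∀ τ → Dec (P τ)) → Dec (∀ τ → P τ)
all-vecs? zero d = map′ (λ { h [] → h }) (λ h → h []) (d [])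
all-vecs? (suc m) d = map′ (λ { h (w ∷ τ) → h w τ }) (λ h w τ → h (w ∷ τ)) (all-pairs? λ w → all-vecs? m λ τ → d (w ∷ τ))

≈? : ∀ (c d : Chain n m) → Dec (c ≈ d)
≈? {m = m} c d = all-vecs? m λ τ → c τ ≟₃ d τ

altHead? : ∀ m (c : Chain n (suc m)) → Dec (AltHead c)
altHead? zero c = yes tt
altHead? (suc m) c = all-pairs? λ w → all-pairs? λ v → all-vecs? m λ τ → c (w ∷ v ∷ τ) ≟₃ (- c (v ∷ w ∷ τ))

ok? : ∀ X (c : Chain n m) → Dec (Ok X c)
ok? {m = zero} X c = yes ok₀
ok? {m = suc m} X c = map′ (λ (a , b , o) → ok₊ a b o) (λ o → ok-alt o , ok-bad o , ok-ι o)
  (altHead? m c ×-dec (all-pairs? (λ w → ¬? (good? X w) →-dec ≈? (ι w c) zeroC) ×-dec all-pairs? λ w → ok? (ends w X) (ι w c)))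

bd? : ∀ X (c : Chain n m) → Dec (Bd X c)
bd? {m = m} X c = map′ (λ (b , o , e) → bd b o e) (λ { (bd b o e) → b , o , e })
  (search (search-Chain (suc m)) (λ b → Ok X b × c ≈ ∂ b)
    (λ e (o , q) → Ok-≈ e o , ≈-trans q (resp ∂-linear e)) λ b → ok? X b ×-dec ≈? c (∂ b))

-- Bases of homology

combination : (Fin k → F3) → (Fin k → Chain n m) → Chain n m
combination {k} a g = ΣC k λ i → scale (a i) (g i)

record Basis {n} (X : List (Fin n)) (m k : ℕ) : Set where
  field
    vec : Fin k → Chain n m
    cycles : ∀ i → Zc X (vec i)
    indep : ∀ a → Bd X (combination a vec) → ∀ i → a i ≡ 0₃
    spans : ∀ z → Zc X z → ∃ λ a → z ~[ X ] combination a vec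
open Basis

coefficients : ∀ {X} {g : Fin k → Chain n m} {z} → Sp X (λ c → ∃ λ i → c ≡ g i) z → ∃ λ a → z ~[ X ] combination a g
coefficients {k} {g = g} (gen (i , refl)) = unitAt , ≈⇒~ λ τ → sym (trans (sum-single k i λ j ne → cong (_· g j τ) (dec-no j ne))
    (cong (_· g i τ) dec-yes))
  where
  unitAt : Fin k → F3
  unitAt j = if does (j Finₚ.≟ i) then #1 else #0
  dec-no : ∀ j → j ≢ i → unitAt j ≡ #0
  dec-no j ne rewrite dec-false (j Finₚ.≟ i) ne = refl
  dec-yes : unitAt i ≡ #1
  dec-yes rewrite dec-true (i Finₚ.≟ i) refl = refl
coefficients {k} {g = g} {z} (bound b) = (λ _ → #0) , hom (bd-≈ (λ τ → trans (solve 1 (λ x → x := x :+ (:- :0)) refl (z τ))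
  (cong (λ x → z τ + (- x)) (sym (sum-0 k λ _ → refl)))) b)
coefficients {k} {g = g} (sp+ {c} {d} s t) with coefficients s | coefficients t
... | a , hom h | b , hom h' = (λ i → plus (a i) (b i)) , hom (bd-≈ (λ τ → trans
    (solve 4 (λ c x d y → (c :+ (:- x)) :+ (d :+ (:- y)) := (c :+ d) :+ (:- (x :+ y))) refl (c τ) (combination a g τ) (d τ) (combination b g τ))
    (cong (λ x → (c τ + d τ) + (- x)) (trans (sym (sum-+ k _ _)) (sum-cong k λ i → sym (·-plus (a i) (b i) (g i τ)))))) (bd-+ h h'))
coefficients {k} {g = g} (sp- {c} s) with coefficients s
... | a , hom h = (λ i → negate (a i)) , hom (bd-≈ (λ τ → trans
    (solve 2 (λ c x → :- (c :+ (:- x)) := (:- c) :+ (:- (:- x))) refl (c τ) (combination a g τ))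
    (cong (λ x → (- c τ) + (- x)) (trans (sym (sum-neg k _)) (sum-cong k λ i → sym (·-negate (a i) (g i τ)))))) (bd-neg h))
coefficients {g = g} (sp≈ e s) with coefficients s
... | a , hom h = a , hom (bd-≈ (λ τ → cong (_+ (- combination a g τ)) (e τ)) h)

sum-punchIn : ∀ k (i : Fin (suc k)) (f : Fin (suc k) → F3) → sum (suc k) f ≡ f i + sum k (f ∘ Fin.punchIn i)
sum-punchIn k #0 f = sum-suc k f
sum-punchIn (suc k) (Fin.suc i) f = trans (sum-suc (suc k) f) (trans (cong (f #0 +_) (sum-punchIn k i (f ∘ Fin.suc)))
  (trans (solve 3 (λ a b c → a :+ (b :+ c) := b :+ (a :+ c)) refl (f #0) _ _) (cong (f (Fin.suc i) +_) (sym (sum-suc k _)))))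

unscale : ∀ {X G} a {c : Chain n m} → a ≢ 0₃ → Sp X G (scale a c) → Sp X G c
unscale #0 ne s = ⊥-elim (ne refl)
unscale #1 ne s = s
unscale #2 ne s = sp≈ (λ τ → neg-involutive _) (sp- s)

-- All data are finite, so it is decidable whether some nontrivial combination bounds. If so, one
-- member is dropped and the search repeats; otherwise the family is a basis.
extract : ∀ {X} k (g : Fin k → Chain n m) → (∀ i → Zc X (g i)) → (∀ z → Zc X z → Sp X (λ c → ∃ λ i → c ≡ g i) z) →
  ∃ λ k' → k' ≤ k × Basis X m k'
extract {n} {m} {X} k g Z S = go k g Z S
    (search (search-Π search-F3 k) (Dependency g) (λ e ((i , ne) , b) → (i , λ q → ne (trans (e i) q)) ,
      bd-≈ (λ τ → sum-cong k λ i → cong (_· g i τ) (e i)) b)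
      λ a → Finₚ.any? (λ i → ¬? (a i ≟₃ 0₃)) ×-dec bd? X (combination a g))
  where
  Dependency : ∀ {k} → (Fin k → Chain n m) → (Fin k → F3) → Set
  Dependency g a = (∃ λ i → a i ≢ 0₃) × Bd X (combination a g)
  go : ∀ k (g : Fin k → Chain n m) → (∀ i → Zc X (g i)) → (∀ z → Zc X z → Sp X (λ c → ∃ λ i → c ≡ g i) z) →
    Dec (∃ (Dependency g)) → ∃ λ k' → k' ≤ k × Basis X m k'
  go k g Z S (no nd) = k , ℕₚ.≤-refl , record { vec = g ; cycles = Z ; spans = λ z Zz → coefficients (S z Zz)
    ; indep = λ a b i → stable (a i ≟₃ 0₃) λ ne → nd (a , (i , ne) , b) }
    where
    stable : ∀ {P : Set} → Dec P → ¬ ¬ P → P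
    stable (yes p) _ = p
    stable (no np) nnp = ⊥-elim (nnp np)
  go (suc k) g Z S (yes (a , (i , ne) , b)) = let k' , le , B = rec in k' , ℕₚ.m≤n⇒m≤1+n le , B
    where
    g' : Fin k → Chain n m
    g' = g ∘ Fin.punchIn i
    -- The dependency is solved for `g i`: its coefficient is nonzero, hence ±1.
    removed : Sp X (λ c → ∃ λ j → c ≡ g' j) (g i)
    removed = unscale (a i) ne (sp≈ (λ τ → trans
        (cong (_+ (- sum k (λ j → a (Fin.punchIn i j) · g' j τ))) (sum-punchIn k i _))
        (solve 2 (λ x y → (x :+ y) :+ (:- y) := x) refl (a i · g i τ) _))
      (sp-sub (bound b) (sp-Σ k {λ j → scale (a (Fin.punchIn i j)) (g' j)} λ j → sp-scale (a (Fin.punchIn i j)) (gen (j , refl)))))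
    S' : ∀ z → Zc X z → Sp X (λ c → ∃ λ j → c ≡ g' j) z
    S' z Zz = sp-bind id (λ { (j , refl) → each j (i Finₚ.≟ j) }) (S z Zz)
      where
      each : ∀ j → Dec (i ≡ j) → Sp X (λ c → ∃ λ j → c ≡ g' j) (g j)
      each j (yes refl) = removed
      each j (no i≢j) = gen (Fin.punchOut i≢j , cong g (sym (Finₚ.punchIn-punchOut i≢j)))
    rec : ∃ λ k' → k' ≤ k × Basis X m k'
    rec = extract k g' (Z ∘ Fin.punchIn i) S'

opaque
  unfolding _+_ -_ sum

  *₃-· : ∀ a b → a *₃ b ≡ a · b
  *₃-· #0 #0 = refl
  *₃-· #0 #1 = refl
  *₃-· #0 #2 = refl
  *₃-· #1 #0 = refl
  *₃-· #1 #1 = refl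
  *₃-· #1 #2 = refl
  *₃-· #2 #0 = refl
  *₃-· #2 #1 = refl
  *₃-· #2 #2 = refl

  lincomb-agrees : ∀ (a : Fin k → F3) (z : Fin k → Chain n m) → lincomb a z ≈ combination a z
  lincomb-agrees {k} a z τ = sum-cong k λ i → *₃-· (a i) (z i τ)

  hasBetti : ∀ {d} → Basis {n} [] (suc d) k → HasBetti n d k
  hasBetti {n} {k} {d} B = vec B , (λ i → ok⇒isChain (ok (cycles B i)) , λ τ → trans (∂-agrees (vec B i) τ) (closed (cyc (cycles B i)) τ)) ,
      (λ { a (b , cb , e) → indep B a (bd b (isChain⇒ok cb) λ τ → trans (sym (lincomb-agrees a (vec B) τ)) (trans (e τ) (∂-agrees b τ))) }) ,
      λ c cc e → finish c (spans B c (zc (isChain⇒ok cc) (cyc₊ λ τ → trans (sym (∂-agrees c τ)) (e τ))))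
    where
    closed : ∀ {c : Chain n (suc d)} → Cycle c → ∂ c ≈ zeroC
    closed (cyc₊ e) = e
    finish : ∀ c → (∃ λ a → c ~[ [] ] combination a (vec B)) → Σ (Fin k → F3) λ a → Σ (Chain n (suc (suc d))) λ b →
      IsChain b × (c ≈ (Defs._+C_ (lincomb a (vec B)) (Defs.∂ b)))
    finish c (a , hom (bd b o e)) = a , b , ok⇒isChain o , λ τ → trans
      (solve 2 (λ c l → c := l :+ (c :+ (:- l))) refl (c τ) (combination a (vec B) τ))
      (cong₂ _+_ (sym (lincomb-agrees a (vec B) τ)) (trans (e τ) (sym (∂-agrees b τ))))

fresh-all : ∀ n → Fresh [] (List.allFin n)
fresh-all n = from (Uniqueₚ.allFin⁺ n)
  where
  from : ∀ {vs : List (Fin n)} → AllPairs _≢_ vs → Fresh [] vs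
  from [] = []
  from {v ∷ vs} (v∉ ∷ u) = (λ h → All.lookup v∉ (subst (v ∈_) (Listₚ.++-identityʳ vs) h) refl) ∷ from u

extend : (Fin k → F3) → ℕ → F3
extend {zero} a i = #0
extend {suc k} a zero = a #0
extend {suc k} a (suc i) = extend (a ∘ Fin.suc) i

extend-toℕ : ∀ (a : Fin k → F3) i → extend a (toℕ i) ≡ a i
extend-toℕ a #0 = refl
extend-toℕ a (Fin.suc i) = extend-toℕ (a ∘ Fin.suc) i

-- The four exact Betti numbers

module Exact {n k} (d : Fin n) (zs : List (Poly (suc k))) (V : Poly (suc k) → Chain n (suc k))
  (V-formal : ∀ p → V p ≈ Functionals.⟦_⟧₀ d (fresh-all n) p) where

  private
    vs = List.allFin n
    full : size [] ≡ length vs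
    full = trans size-[] (sym (Listₚ.length-tabulate {n = n} id))
  open Dual d (fresh-all n) full public
  open Functionals d (fresh-all n)

  linear-combination : ∀ zs (a : Fin (length zs) → F3) a' j → (∀ i → a' (toℕ i ℕ.+ j) ≡ a i) →
    linear a' j zs ≈ combination a (λ i → V (List.lookup zs i))
  linear-combination [] a a' j h τ = sym (sum-zero _)
  linear-combination (z ∷ zs) a a' j h τ = sym (trans (sum-suc (length zs) _) (cong₂ _+_
    (cong₂ _·_ (sym (h #0)) (V-formal z τ))
    (sym (linear-combination zs (a ∘ Fin.suc) a' (suc j) (λ i → trans (cong a' (ℕₚ.+-suc (toℕ i) j)) (h (Fin.suc i))) τ))))

  basis : (∀ p → p ∈ zs → Zc [] (V p)) → (∀ z → Zc [] z → Sp [] (λ c → ∃ λ p → p ∈ zs × c ≡ V p) z) →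
    allᵇ (normP (length vs)) zs ≡ true → ∀ (D : Duals (length vs) (suc k)) → Separated zs (Duals.list D) → Basis [] (suc k) (length zs)
  basis Z S norm D chk .vec i = V (List.lookup zs i)
  basis Z S norm D chk .cycles i = Z _ (∈-lookup i)
  basis Z S norm D chk .indep a (bd b o e) i = trans (sym (extend-toℕ a i))
    (independent zs D (All.tabulate λ {p} p∈ → normP-all p (allᵇ-∈ (normP (length vs)) norm p∈)) chk
      (extend a) o (≈-trans (linear-combination zs a (extend a) 0 λ i → trans (cong (extend a) (ℕₚ.+-identityʳ (toℕ i))) (extend-toℕ a i)) e)
      (toℕ i) (Finₚ.toℕ<n i))
  basis Z S norm D chk .spans z Zz = coefficients
    (sp-bind id (λ { (p , p∈ , refl) → gen (Any.index p∈ , cong V (lookup-index p∈)) }) (S z Zz))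

evalP-cong : ∀ {I J : Mono k → F3} → (∀ w → I w ≡ J w) → ∀ p → evalP I p ≡ evalP J p
evalP-cong h [] = refl
evalP-cong h ((c , w) ∷ p) = cong₂ _+_ (cong (c ·_) (h w)) (evalP-cong h p)

-- `wedges` ending in `unit` has degree k + 0, the interpretation paired with functionals has degree
-- k. These agree by computation once k is a numeral, which is why there is one lemma per degree.
formal₁ : ∀ {n d} {X : List (Fin n)} {vs} (F : Fresh X vs) (p : Poly 1) → Interp.⟦_⟧ (nth d vs) p unit ≈ Functionals.⟦_⟧₀ d F p
formal₁ F p τ = evalP-cong (λ { (e ∷ []) → refl }) p

formal₂ : ∀ {n d} {X : List (Fin n)} {vs} (F : Fresh X vs) (p : Poly 2) → Interp.⟦_⟧ (nth d vs) p unit ≈ Functionals.⟦_⟧₀ d F p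
formal₂ F p τ = evalP-cong (λ { (e ∷ f ∷ []) → refl }) p

formal₃ : ∀ {n d} {X : List (Fin n)} {vs} (F : Fresh X vs) (p : Poly 3) → Interp.⟦_⟧ (nth d vs) p unit ≈ Functionals.⟦_⟧₀ d F p
formal₃ F p τ = evalP-cong (λ { (e ∷ f ∷ g ∷ []) → refl }) p

formal₄ : ∀ {n d} {X : List (Fin n)} {vs} (F : Fresh X vs) (p : Poly 4) → Interp.⟦_⟧ (nth d vs) p unit ≈ Functionals.⟦_⟧₀ d F p
formal₄ F p τ = evalP-cong (λ { (e ∷ f ∷ g ∷ h ∷ []) → refl }) p

closed-all : ∀ {n} (d : Fin n) {X vs} → Fresh X vs → ∀ (zs : List (Poly (suc k))) → allᵇ (closedOK (length vs) []) zs ≡ true →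
  ∀ p → p ∈ zs → Zc X (Interp.⟦_⟧ (nth d vs) p unit)
closed-all d {vs = vs} F zs chk p p∈ = Positions.zc-⟦⟧-off d F p [] refl
    (proj₁ (&&-split at)) (proj₂ (&&-split {a = validPU (length vs) [] p} at))
  where
  at : closedOK (length vs) [] p ≡ true
  at = allᵇ-∈ (closedOK (length vs) []) chk p∈

closed₃ : allᵇ (closedOK 3 []) basis₃ ≡ true
closed₃ = refl

closed₆ : allᵇ (closedOK 6 []) basis₆ ≡ true
closed₆ = refl

closed₉ : allᵇ (closedOK 9 []) allBasis₉ ≡ true
closed₉ = refl

closed₁₂ : allᵇ (closedOK 12 []) basis₁₂ ≡ true
closed₁₂ = refl

module _ where
  private
    module I₃ = Interp (nth (Fin.zero {2}) (List.allFin 3))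
    module E₃ = Exact #0 basis₃ (λ p → I₃.⟦ p ⟧ unit) (formal₁ (fresh-all 3))

  -- The two generators of `genP` are themselves independent, as are the sixteen for six vertices;
  -- elimination starts to matter with nine vertices.
  betti₃ : HasBetti 3 0 2
  betti₃ = hasBetti (E₃.basis (closed-all #0 (fresh-all 3) basis₃ closed₃)
      (λ z Zz → sp-bind id (λ { (p , p∈ , e) → sp≈ (≈-sym e) (gen (p , p∈ , refl)) }) (gens-of z Zz))
      refl duals₃ dual-check₃)
    where
    open Certified (Fin.zero {2}) (List.allFin 3) (fresh-all 3) size-[] 0 (ℕₚ.≤-reflexive (sym size-[])) (0 ∷ 1 ∷ 2 ∷ [])
      (from-yes (AllPairs.allPairs? (λ i j → ¬? (i ℕ.≟ j)) (0 ∷ 1 ∷ 2 ∷ []))) (from-yes (All.all? (ℕ._<? 3) (0 ∷ 1 ∷ 2 ∷ []))) refl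

  private
    module I₆ = Interp (nth (Fin.zero {5}) (List.allFin 6))
    module E₆ = Exact #0 basis₆ (λ p → I₆.⟦ p ⟧ unit) (formal₂ (fresh-all 6))

  betti₆ : HasBetti 6 1 16
  betti₆ = hasBetti (E₆.basis (closed-all #0 (fresh-all 6) basis₆ closed₆)
      (λ z Zz → sp-bind id (λ { (p , p∈ , e) → sp≈ (≈-sym e) (gen (p , p∈ , refl)) }) (gens-of z Zz))
      refl duals₆ dual-check₆)
    where
    open Certified (Fin.zero {5}) (List.allFin 6) (fresh-all 6) size-[] 1 (ℕₚ.≤-reflexive (sym size-[])) (0 ∷ 1 ∷ 2 ∷ 3 ∷ 4 ∷ 5 ∷ [])
      (from-yes (AllPairs.allPairs? (λ i j → ¬? (i ℕ.≟ j)) (0 ∷ 1 ∷ 2 ∷ 3 ∷ 4 ∷ 5 ∷ [])))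
      (from-yes (All.all? (ℕ._<? 6) (0 ∷ 1 ∷ 2 ∷ 3 ∷ 4 ∷ 5 ∷ []))) refl

  private
    module I₉ = Interp (nth (Fin.zero {8}) (List.allFin 9))
    module E₉ = Exact #0 allBasis₉ (λ p → I₉.⟦ p ⟧ unit) (formal₃ (fresh-all 9))

  betti₉ : HasBetti 9 2 50
  betti₉ = hasBetti (E₉.basis (closed-all #0 (fresh-all 9) allBasis₉ closed₉)
      (Nine.span₉ #0 (fresh-all 9) refl size-[])
      refl duals₉ dual-check₉)

  private
    module I₁₂ = Interp (nth (Fin.zero {11}) (List.allFin 12))
    module E₁₂ = Exact #0 basis₁₂ (λ p → I₁₂.⟦ p ⟧ unit) (formal₄ (fresh-all 12))

  betti₁₂ : HasBetti 12 3 56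
  betti₁₂ = hasBetti (E₁₂.basis (closed-all #0 (fresh-all 12) basis₁₂ closed₁₂)
      (Twelve.span₁₂ #0 (fresh-all 12) refl size-[])
      refl duals₁₂ dual-check₁₂)

-- The upper bound

SpanBy : ∀ {n} → List (Fin n) → ℕ → ℕ → Set
SpanBy {n} X m K = Σ (List (Chain n m)) λ gs → length gs ≡ K × (∀ c → c ∈ gs → Zc X c) × (∀ z → Zc X z → Sp X (_∈ gs) z)

-- Indexed by k = r - 3. For the successor, r = 4 + k, the summands are 3r + 1 triangles and 3r(3r -
-- 1) lifts.
bound-betti : ℕ → ℕ
bound-betti zero = 56
bound-betti (suc k) = (13 ℕ.+ tri k) ℕ.+ ((12 ℕ.+ tri k) ℕ.* (11 ℕ.+ tri k) ℕ.+ bound-betti k)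

length-concatMap : ∀ {A B : Set} (f : A → List B) {xs K} → (∀ x → x ∈ xs → length (f x) ≡ K) → length (List.concatMap f xs) ≡ length xs ℕ.* K
length-concatMap f {[]} h = refl
length-concatMap f {x ∷ xs} h = trans (Listₚ.length-++ (f x)) (cong₂ ℕ._+_ (h x (here refl)) (length-concatMap f (λ y y∈ → h y (there y∈))))

zc-tr : ∀ {X} {p q r : Fin n} {c : Chain n m} → Distinct3 X p q r → Zc (p ∷ q ∷ r ∷ X) c → Zc X (tr p q r c)
zc-tr {m = zero} {p = p} {q} {r} {c} D (zc o cy) = zc (Ok-tr D o) (cyc₊ λ τ → trans
  (trans (add ∂-linear (mk p q ∧ c) ((mk p r ∧ c) +C (mk q r ∧ c)) τ) (cong₂ _+_ (∂-∧-cycle (mk p q) cy τ)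
    (trans (add ∂-linear (mk p r ∧ c) (mk q r ∧ c) τ) (cong₂ _+_ (∂-∧-cycle (mk p r) cy τ) (∂-∧-cycle (mk q r) cy τ)))))
  (solve 1 (λ x → x :+ (x :+ x) := :0) refl (c τ)))
zc-tr {m = suc m} {p = p} {q} {r} {c} D (zc o (cyc₊ e)) = zc (Ok-tr D o) (cyc₊ (≈-trans (∂-tr p q r c)
  λ τ → trans (cong -_ (zero≈ (tr-linear p q r) e τ)) neg-0))

isGen-~ : ∀ {X} {g g' : Chain n m} → g ~[ X ] g' → Zc X g' → IsGen X g → IsGen X g'
isGen-~ r Z' (isGen Z S) = isGen Z' λ x Zx → sp-bind id (λ { refl → sp-~ r (gen refl) }) (S x Zx)

-- On 3m + 1 vertices the links at ac live on 3m - 1 = 2 + 3(m - 1), so `vanish` fills them and the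
-- generator can be pushed off a.
gen-off : ∀ k {Y : List (Fin n)} {a} → a ∉ Y → size Y ≡ 13 ℕ.+ tri k → Σ (Chain n (4 ℕ.+ k)) λ g → Zc (a ∷ Y) g × IsGen Y g
gen-off k {Y} {a} a∉ sz =
  let g , G = one-exists (2 ℕ.+ k) Y sz
      g' , Z' , r = push a g a∉ (gen-zc G) λ c ne c∉ →
        vanish (3 ℕ.+ k) (a ∷ c ∷ Y) (ℕₚ.≤-reflexive (sym (≡-size-∷ (∉-∷ (ne ∘ sym) a∉) (≡-size-∷ c∉ sz)))) (ι (mk a c) g) (zc-ι a c (gen-zc G))
  in g' , Z' , isGen-~ r (zc-⊆ there Z') G

-- A generator g on the vertices other than e and c bounds some w once c is restored, by `vanish`.
-- Then ec ∧ g - w is a cycle; w misses e, so the link at ec is g and all other links at e are zero.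
lift-cycle : ∀ k {Y : List (Fin n)} {e c} → e ∉ Y → c ∉ e ∷ Y → size Y ≡ 12 ℕ.+ tri k → Σ (Chain n (4 ℕ.+ k)) λ y →
  Zc Y y × IsGen (e ∷ c ∷ Y) (ι (mk e c) y) × (∀ c' → c' ≢ c → ι (mk e c') y ≈ zeroC)
lift-cycle {n} k {Y} {e} {c} e∉ c∉ sz = use (one-exists (suc k) (e ∷ c ∷ Y) (≡-size-∷ e∉c (≡-size-∷ (c∉ ∘ there) sz)))
  where
  e≢c : e ≢ c
  e≢c = c∉ ∘ here ∘ sym
  e∉c : e ∉ c ∷ Y
  e∉c = ∉-∷ e≢c e∉
  use : Σ (Chain n (3 ℕ.+ k)) (IsGen (e ∷ c ∷ Y)) → Σ (Chain n (4 ℕ.+ k)) λ y →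
    Zc Y y × IsGen (e ∷ c ∷ Y) (ι (mk e c) y) × (∀ c' → c' ≢ c → ι (mk e c') y ≈ zeroC)
  use (g , G) = combine-bd (vanish (3 ℕ.+ k) (e ∷ Y) (ℕₚ.≤-reflexive (sym (≡-size-∷ e∉ sz))) g (zc-⊆ (∷-mono there) (gen-zc G)))
    where
    combine-bd : Bd (e ∷ Y) g → Σ (Chain n (4 ℕ.+ k)) λ y →
      Zc Y y × IsGen (e ∷ c ∷ Y) (ι (mk e c) y) × (∀ c' → c' ≢ c → ι (mk e c') y ≈ zeroC)
    combine-bd (bd w ow q) = (mk e c ∧ g) -C w ,
        zc (Ok-sub (Ok-mk∧ e≢c e∉ (c∉ ∘ there) (ok (gen-zc G))) (Ok-⊆ there ow)) (cyc₊ λ τ → trans (sub ∂-linear (mk e c ∧ g) w τ)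
          (trans (cong₂ (λ x y → x + (- y)) (∂-∧-cycle (mk e c) (cyc (gen-zc G)) τ) (sym (q τ))) (neg-inverseʳ (g τ)))) ,
        isGen-≈ (λ τ → sym (trans (cong₂ (λ x y → x + (- y)) (∧-self (mk e c) (Ok-⊆ (ends-mk⁺ e c []) (Ok-⊆ (∷-mono (∷-mono λ ())) (ok (gen-zc G)))) τ) (w₀ c τ))
          (solve 1 (λ x → x :+ (:- :0) := x) refl (g τ)))) G ,
        λ c' ne τ → trans (cong₂ (λ x y → x + (- y))
          (link-∧ (mk e c) (mk e c') g (λ h → ne (sym (mk-injʳ h))) (g₀ c') τ) (w₀ c' τ)) (neg-inverseʳ 0₃)
      where
      w₀ : ∀ c' → ι (mk e c') w ≈ zeroC
      w₀ c' = ι-bad (mk e c') ow λ h → good-mk⁻ e c' h .proj₂ .proj₁ (here refl)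
      g₀ : ∀ c' → ι (mk e c') g ≈ zeroC
      g₀ c' = ι-bad (mk e c') (ok (gen-zc G)) λ h → good-mk⁻ e c' h .proj₂ .proj₁ (here refl)

spanBy-step : ∀ {n} k {X : List (Fin n)} {e u v K} → Fresh X (e ∷ u ∷ v ∷ []) → size X ≡ 15 ℕ.+ tri k →
  SpanBy (e ∷ u ∷ v ∷ X) (4 ℕ.+ k) K → SpanBy X (5 ℕ.+ k) ((13 ℕ.+ tri k) ℕ.+ ((12 ℕ.+ tri k) ℕ.* (11 ℕ.+ tri k) ℕ.+ K))
spanBy-step {n} k {X} {e} {u} {v} {K} F@(e∉ ∷ u∉ ∷ v∉ ∷ []) full (prev , len , Zprev , Sprev) =
    gs , lengths , cycles-gs , λ z Zz → sp-bind id each (recursion z Zz)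
  where
  UV : List (Fin n)
  UV = u ∷ v ∷ X
  sizeUV : size UV ≡ 13 ℕ.+ tri k
  sizeUV = ≡-size-∷ u∉ (≡-size-∷ v∉ full)
  triangle : ∀ a → Σ (Chain n (4 ℕ.+ k)) λ g → a ∉ UV → Zc (a ∷ UV) g × IsGen UV g
  triangle a = go (a ∈? UV)
    where
    go : Dec (a ∈ UV) → Σ (Chain n (4 ℕ.+ k)) λ g → a ∉ UV → Zc (a ∷ UV) g × IsGen UV g
    go (yes a∈) = zeroC , λ a∉ → ⊥-elim (a∉ a∈)
    go (no a∉) = let g , Z , G = gen-off k a∉ sizeUV in g , λ _ → Z , G
  Lift : Fin n → Fin n → Chain n (4 ℕ.+ k) → Set
  Lift a c y = Zc (a ∷ UV) y × IsGen (e ∷ c ∷ a ∷ UV) (ι (mk e c) y) × (∀ c' → c' ≢ c → ι (mk e c') y ≈ zeroC)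
  lifted : ∀ a c → Σ (Chain n (4 ℕ.+ k)) λ y → a ∉ UV → e ≢ a → c ∉ e ∷ a ∷ UV → Lift a c y
  lifted a c = go (a ∈? UV) (e Finₚ.≟ a) (c ∈? (e ∷ a ∷ UV))
    where
    go : Dec (a ∈ UV) → Dec (e ≡ a) → Dec (c ∈ e ∷ a ∷ UV) → Σ (Chain n (4 ℕ.+ k)) λ y → a ∉ UV → e ≢ a → c ∉ e ∷ a ∷ UV → Lift a c y
    go (yes a∈) _ _ = zeroC , λ a∉ → ⊥-elim (a∉ a∈)
    go (no _) (yes e≡a) _ = zeroC , λ _ e≢a → ⊥-elim (e≢a e≡a)
    go (no _) (no _) (yes c∈) = zeroC , λ _ _ c∉ → ⊥-elim (c∉ c∈)
    go (no a∉) (no e≢a) (no c∉) = let y , L = lift-cycle k (∉-∷ e≢a e∉) c∉ (≡-size-∷ a∉ sizeUV) in y , λ _ _ _ → L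
  g : Fin n → Chain n (4 ℕ.+ k)
  g a = proj₁ (triangle a)
  Y : Fin n → Fin n → Chain n (4 ℕ.+ k)
  Y a c = proj₁ (lifted a c)
  L : ∀ a c → a ∉ UV → e ≢ a → c ∉ e ∷ a ∷ UV → Lift a c (Y a c)
  L a c = proj₂ (lifted a c)
  open Recursion F (ℕₚ.≤-reflexive (sym full)) g Y
    (λ a a∉ → proj₁ (proj₂ (triangle a) a∉)) (λ a a∉ → gen-sp (proj₂ (proj₂ (triangle a) a∉)))
    (λ a c a∉ e≢a c∉ → proj₁ (L a c a∉ e≢a c∉)) (λ a c a∉ e≢a c∉ → gen-sp (proj₁ (proj₂ (L a c a∉ e≢a c∉))))
    (λ a c a∉ e≢a c∉ → proj₂ (proj₂ (L a c a∉ e≢a c∉)))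

  row-of : Fin n → List (Chain n (5 ℕ.+ k))
  row-of a = map (λ c → star u a v (Y a c)) (comp (e ∷ a ∷ UV))
  gs₁ gs₂ gs₃ gs : List (Chain n (5 ℕ.+ k))
  gs₁ = map (λ a → tr u v a (g a)) (comp UV)
  gs₂ = List.concatMap row-of (comp (e ∷ UV))
  gs₃ = map (star u e v) prev
  gs = gs₁ ++ (gs₂ ++ gs₃)

  eUV : ∀ {a} → a ∈ comp (e ∷ UV) → a ∉ UV × e ≢ a
  eUV a∈ = let a∉ = ∈-comp⁻ (e ∷ UV) a∈ in a∉ ∘ there , a∉ ∘ here ∘ sym

  lengths : length gs ≡ (13 ℕ.+ tri k) ℕ.+ ((12 ℕ.+ tri k) ℕ.* (11 ℕ.+ tri k) ℕ.+ K)
  lengths = trans (Listₚ.length-++ gs₁) (cong₂ ℕ._+_ (trans (Listₚ.length-map _ (comp UV)) (trans (length-comp UV) sizeUV))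
    (trans (Listₚ.length-++ gs₂) (cong₂ ℕ._+_ rows (trans (Listₚ.length-map _ prev) len))))
    where
    rows : length gs₂ ≡ (12 ℕ.+ tri k) ℕ.* (11 ℕ.+ tri k)
    rows = trans (length-concatMap row-of {comp (e ∷ UV)} {11 ℕ.+ tri k} λ a a∈ → let a∉ , e≢a = eUV a∈ in
        trans (Listₚ.length-map _ (comp (e ∷ a ∷ UV))) (trans (length-comp (e ∷ a ∷ UV)) (≡-size-∷ (∉-∷ e≢a e∉) (≡-size-∷ a∉ sizeUV))))
      (cong (ℕ._* (11 ℕ.+ tri k)) (trans (length-comp (e ∷ UV)) (≡-size-∷ e∉ sizeUV)))

  swap₂ : ∀ {a} → u ∷ a ∷ v ∷ X ⊆ a ∷ UV
  swap₂ = ∷⊆ (there (here refl)) (∷⊆ (here refl) (there ∘ there))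

  cycles-gs : ∀ c → c ∈ gs → Zc X c
  cycles-gs c c∈ = [ first , [ second , third ]′ ∘ ∈-++⁻ gs₂ ]′ (∈-++⁻ gs₁ c∈)
    where
    first : c ∈ gs₁ → Zc X c
    first h = from (∈-map⁻ (λ a → tr u v a (g a)) h)
      where
      from : (∃ λ a → a ∈ comp UV × c ≡ tr u v a (g a)) → Zc X c
      from (a , a∈ , refl) = zc-tr (dist-tr a∉) (zc-⊆ (∷⊆ (there (here refl)) (∷⊆ (there (there (here refl))) (∷⊆ (here refl) (there ∘ there ∘ there))))
          (proj₁ (proj₂ (triangle a) a∉)))
        where a∉ = ∈-comp⁻ UV a∈
    second : c ∈ gs₂ → Zc X c
    second h = from (Listₘ.∈-concatMap⁻ row-of {xs = comp (e ∷ UV)} h)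
      where
      from : Any.Any ((c ∈_) ∘ row-of) (comp (e ∷ UV)) → Zc X c
      from h = at (Membership.find h)
        where
        at : (∃ λ a → a ∈ comp (e ∷ UV) × c ∈ row-of a) → Zc X c
        at (a , a∈ , c∈) = fin (∈-map⁻ (λ c → star u a v (Y a c)) c∈)
          where
          fin : (∃ λ x → x ∈ comp (e ∷ a ∷ UV) × c ≡ star u a v (Y a x)) → Zc X c
          fin (x , x∈ , refl) = let a∉ , e≢a = eUV a∈ in
            zc-star (dist a∉) (zc-⊆ swap₂ (proj₁ (L a x a∉ e≢a (∈-comp⁻ (e ∷ a ∷ UV) x∈))))
    third : c ∈ gs₃ → Zc X c
    third h = from (∈-map⁻ (star u e v) h)
      where
      from : (∃ λ x → x ∈ prev × c ≡ star u e v x) → Zc X c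
      from (x , x∈ , refl) = zc-star (dist e∉) (zc-⊆ swap₂ (Zprev x x∈))

  each : ∀ {c} → TGen c → Sp X (_∈ gs) c
  each (triangles a a∉) = gen (∈-++⁺ˡ (∈-map⁺ (λ a → tr u v a (g a)) (∈-comp⁺ UV a∉)))
  each (lifts a c a∉ e≢a c∉) = gen (∈-++⁺ʳ gs₁ (∈-++⁺ˡ (Listₘ.∈-concatMap⁺ row-of
    (Membership.lose (∈-comp⁺ (e ∷ UV) (∉-∷ (e≢a ∘ sym) a∉)) (∈-map⁺ (λ c → star u a v (Y a c)) (∈-comp⁺ (e ∷ a ∷ UV) c∉))))))
  each (base x Zx) = sp-map (star-linear u e v) (λ b → bd-star (dist e∉) (bd-⊆ swap₂ b))
    (λ c∈ → gen (∈-++⁺ʳ gs₁ (∈-++⁺ʳ gs₂ (∈-map⁺ (star u e v) c∈)))) (Sprev x Zx)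

spanBy : ∀ k (X : List (Fin n)) → size X ≡ tri (4 ℕ.+ k) → SpanBy X (4 ℕ.+ k) (bound-betti k)
spanBy zero X full = from (pick-fresh X 12 (ℕₚ.≤-reflexive (sym full)))
  where
  from : (∃ λ vs → length vs ≡ 12 × Fresh X vs) → SpanBy X 4 56
  from (u ∷ v ∷ e ∷ vs , l , F) = map V basis₁₂ , Listₚ.length-map V basis₁₂ , cycles-V ,
      λ z Zz → sp-bind id (λ { (p , p∈ , refl) → gen (∈-map⁺ V p∈) }) (Twelve.span₁₂ u F (ℕₚ.+-cancelˡ-≡ 3 _ _ l) full z Zz)
    where
    V : Poly 4 → Chain _ 4
    V p = Interp.⟦_⟧ (nth u (u ∷ v ∷ e ∷ vs)) p unit
    cycles-V : ∀ c → c ∈ map V basis₁₂ → Zc X c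
    cycles-V c c∈ = go (∈-map⁻ V c∈)
      where
      go : (∃ λ p → p ∈ basis₁₂ × c ≡ V p) → Zc X c
      go (p , p∈ , refl) = closed-all u F basis₁₂ (subst (λ l → allᵇ (closedOK l []) basis₁₂ ≡ true) (sym l) closed₁₂) p p∈
spanBy (suc k) X full = from (pick-fresh X 3 (subst (3 ≤_) (sym full) (s≤s (s≤s (s≤s z≤n)))))
  where
  from : (∃ λ vs → length vs ≡ 3 × Fresh X vs) → SpanBy X (5 ℕ.+ k) (bound-betti (suc k))
  from (e ∷ u ∷ v ∷ [] , refl , F@(e∉ ∷ u∉ ∷ v∉ ∷ [])) = spanBy-step k F full
    (spanBy k (e ∷ u ∷ v ∷ X) (≡-size-∷ e∉ (≡-size-∷ u∉ (≡-size-∷ v∉ full))))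

-- The counted family only spans, so the exact dimension is whatever `extract` retains of it.
betti-bound : ∀ k → ∃ λ b → b ≤ bound-betti k × HasBetti (tri (4 ℕ.+ k)) (3 ℕ.+ k) b
betti-bound k = from (spanBy k [] size-[])
  where
  from : SpanBy [] (4 ℕ.+ k) (bound-betti k) → ∃ λ b → b ≤ bound-betti k × HasBetti (tri (4 ℕ.+ k)) (3 ℕ.+ k) b
  from (gs , l , Z , S) =
    let b , b≤ , B = extract (length gs) (List.lookup gs) (λ i → Z _ (∈-lookup i))
          λ z Zz → sp-bind id (λ c∈ → gen (Any.index c∈ , lookup-index c∈)) (S z Zz)
    in b , subst (b ≤_) l b≤ , hasBetti B

tri-3* : ∀ k → tri k ≡ 3 ℕ.* k
tri-3* zero = refl
tri-3* (suc k) = trans (cong (3 ℕ.+_) (tri-3* k)) (sym (ℕₚ.*-suc 3 k))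

-- Here k = r − 3.
bound-cubic : ∀ k → 2 ℕ.* bound-betti k ℕ.+ 146 ≡ 6 ℕ.* (3 ℕ.+ k) ℕ.^ 3 ℕ.+ 9 ℕ.* (3 ℕ.+ k) ℕ.^ 2 ℕ.+ 5 ℕ.* (3 ℕ.+ k)
bound-cubic zero = refl
bound-cubic (suc k) = begin
  2 ℕ.* ((13 ℕ.+ tri k) ℕ.+ ((12 ℕ.+ tri k) ℕ.* (11 ℕ.+ tri k) ℕ.+ bound-betti k)) ℕ.+ 146
    ≡⟨ cong (λ t → 2 ℕ.* ((13 ℕ.+ t) ℕ.+ ((12 ℕ.+ t) ℕ.* (11 ℕ.+ t) ℕ.+ bound-betti k)) ℕ.+ 146) (tri-3* k) ⟩
  2 ℕ.* ((13 ℕ.+ 3 ℕ.* k) ℕ.+ ((12 ℕ.+ 3 ℕ.* k) ℕ.* (11 ℕ.+ 3 ℕ.* k) ℕ.+ bound-betti k)) ℕ.+ 146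
    ≡⟨ left k (bound-betti k) ⟩
  2 ℕ.* ((13 ℕ.+ 3 ℕ.* k) ℕ.+ (12 ℕ.+ 3 ℕ.* k) ℕ.* (11 ℕ.+ 3 ℕ.* k)) ℕ.+ (2 ℕ.* bound-betti k ℕ.+ 146)
    ≡⟨ cong (2 ℕ.* ((13 ℕ.+ 3 ℕ.* k) ℕ.+ (12 ℕ.+ 3 ℕ.* k) ℕ.* (11 ℕ.+ 3 ℕ.* k)) ℕ.+_) (bound-cubic k) ⟩
  2 ℕ.* ((13 ℕ.+ 3 ℕ.* k) ℕ.+ (12 ℕ.+ 3 ℕ.* k) ℕ.* (11 ℕ.+ 3 ℕ.* k)) ℕ.+
    (6 ℕ.* (3 ℕ.+ k) ℕ.^ 3 ℕ.+ 9 ℕ.* (3 ℕ.+ k) ℕ.^ 2 ℕ.+ 5 ℕ.* (3 ℕ.+ k))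
    ≡⟨ right k ⟩
  6 ℕ.* (4 ℕ.+ k) ℕ.^ 3 ℕ.+ 9 ℕ.* (4 ℕ.+ k) ℕ.^ 2 ℕ.+ 5 ℕ.* (4 ℕ.+ k) ∎
  where
  open ≡-Reasoning
  left : ∀ k b → 2 ℕ.* ((13 ℕ.+ 3 ℕ.* k) ℕ.+ ((12 ℕ.+ 3 ℕ.* k) ℕ.* (11 ℕ.+ 3 ℕ.* k) ℕ.+ b)) ℕ.+ 146 ≡
    2 ℕ.* ((13 ℕ.+ 3 ℕ.* k) ℕ.+ (12 ℕ.+ 3 ℕ.* k) ℕ.* (11 ℕ.+ 3 ℕ.* k)) ℕ.+ (2 ℕ.* b ℕ.+ 146)
  left = solve-∀
  right : ∀ k → 2 ℕ.* ((13 ℕ.+ 3 ℕ.* k) ℕ.+ (12 ℕ.+ 3 ℕ.* k) ℕ.* (11 ℕ.+ 3 ℕ.* k)) ℕ.+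
    (6 ℕ.* ((3 ℕ.+ k) ℕ.* ((3 ℕ.+ k) ℕ.* ((3 ℕ.+ k) ℕ.* 1))) ℕ.+ 9 ℕ.* ((3 ℕ.+ k) ℕ.* ((3 ℕ.+ k) ℕ.* 1)) ℕ.+ 5 ℕ.* (3 ℕ.+ k)) ≡
    6 ℕ.* ((4 ℕ.+ k) ℕ.* ((4 ℕ.+ k) ℕ.* ((4 ℕ.+ k) ℕ.* 1))) ℕ.+ 9 ℕ.* ((4 ℕ.+ k) ℕ.* ((4 ℕ.+ k) ℕ.* 1)) ℕ.+ 5 ℕ.* (4 ℕ.+ k)
  right = solve-∀

theorem5p15 : HasBetti 3 0 2 × HasBetti 6 1 16 × HasBetti 9 2 50 × HasBetti 12 3 56 ×
    (∀ (r : ℕ) → 4 ≤ r →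
      Σ ℕ (λ k → HasBetti (3 ℕ.* r ℕ.+ 3) r k ×
        (2 ℕ.* k ℕ.+ 146 ≤ 6 ℕ.* r ℕ.^ 3 ℕ.+ 9 ℕ.* r ℕ.^ 2 ℕ.+ 5 ℕ.* r)))
theorem5p15 = betti₃ , betti₆ , betti₉ , betti₁₂ , upper
  where
  upper : ∀ r → 4 ≤ r → Σ ℕ λ k → HasBetti (3 ℕ.* r ℕ.+ 3) r k × (2 ℕ.* k ℕ.+ 146 ≤ 6 ℕ.* r ℕ.^ 3 ℕ.+ 9 ℕ.* r ℕ.^ 2 ℕ.+ 5 ℕ.* r)
  -- The inequality is doubled and 73 moved to the other side, giving 146, so that no fraction or
  -- truncated subtraction occurs.
  upper (suc (suc (suc k))) _ = let b , b≤ , B = betti-bound k in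
    b , subst (λ n → HasBetti n (3 ℕ.+ k) b) (trans (cong (3 ℕ.+_) (tri-3* (3 ℕ.+ k))) (ℕₚ.+-comm 3 (3 ℕ.* (3 ℕ.+ k)))) B ,
    subst (2 ℕ.* b ℕ.+ 146 ≤_) (bound-cubic k) (ℕₚ.+-monoˡ-≤ 146 (ℕₚ.*-monoʳ-≤ 2 b≤))
  upper (suc (suc zero)) (s≤s (s≤s ()))
  upper (suc zero) (s≤s ())
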